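{- For every $n\ge1$: (1) $(\mathbb{O}_f)_f$, $f$ ranging over blue-packed forests of size $n$, is a basis of $\mathbf{WQSym}_n$; (2) $(\mathbb{O}_t)_t$, $t$ ranging over blue-packed trees of size $n$, is a basis of $\mathrm{Prim}_n$; (3) $(\mathbb{O}_t)_t$, $t$ ranging over blue-packed trees of size $n$ whose root has an empty left forest, is a basis of $\mathrm{TPrim}_n$.
   Context: Words are finite words over the positive integers; $|w|$ length, $\max(w)$ largest letter ($\max(\varepsilon)=0$). A word is packed if every integer $1,\dots,\max(w)$ occurs; $\mathrm{PW}_n$ packed words of length $n$; $\mathrm{pack}(w)$ replaces the $j$-th smallest distinct letter by $j$; $u|_{\le i}$, $u|_{>i}$ are the subwords of letters $\le i$, $>i$. For $w\in\mathrm{PW}$: for $1\le i\le\max(w)+1$, $\psi_{i^\circ}(w)$ is obtained by adding $1$ to every letter $\ge i$ of $w$ and then appending the letter $i$; for $1\le i\le\max(w)$, $\psi_{i^\bullet}(w)=w\cdot i$. $\mathbf{WQSym}_n$ has basis $(\mathbb{Q}_w)_{w\in\mathrm{PW}_n}$, $(\mathbf{WQSym})_+=\bigoplus_{n\ge1}\mathbf{WQSym}_n$. For nonempty packed $u,v$: $\mathbb{Q}_u\prec\mathbb{Q}_v=\sum\mathbb{Q}_{u'v'}$ over pairs of words $u',v'$ with $\mathrm{pack}(u')=u$, $\mathrm{pack}(v')=v$, $u'v'$ packed, no letter common to $u'$ and $v'$, and $\max(u')>\max(v')$; $\mathbb{Q}_u\succ\mathbb{Q}_v$ is the same sum with $\max(u')<\max(v')$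 (bilinear extension). For $u=u_1\cdots u_n$: $\Delta_\prec(\mathbb{Q}_u)=\sum_{i=u_n}^{\max(u)-1}\mathbb{Q}_{u|_{\le i}}\otimes\mathbb{Q}_{\mathrm{pack}(u|_{>i})}$, $\Delta_\succ(\mathbb{Q}_u)=\sum_{i=1}^{u_n-1}\mathbb{Q}_{u|_{\le i}}\otimes\mathbb{Q}_{\mathrm{pack}(u|_{>i})}$. $\mathrm{Prim}_n=\mathbf{WQSym}_n\cap\ker(\Delta_\prec+\Delta_\succ)$, $\mathrm{TPrim}_n=\mathbf{WQSym}_n\cap\ker\Delta_\prec\cap\ker\Delta_\succ$. The linear map $\Psi_{i^\alpha}$ sends $\mathbb{Q}_w$ to $\mathbb{Q}_{\psi_{i^\circ}(w)}$ if $\alpha=\circ$ and $1\le i\le\max(w)+1$, to $\mathbb{Q}_{\psi_{i^\bullet}(w)}$ if $\alpha=\bullet$ and $1\le i\le\max(w)$, and to $0$ otherwise. Brace brackets: for $n\ge2$, $\langle p_1,\dots,p_{n-1};p_n\rangle=\sum_{i=0}^{n-1}(-1)^{n-1-i}(p_1\prec(p_2\prec(\cdots\prec p_i)\cdots))\succ p_n\prec((\cdots(p_{i+1}\succ p_{i+2})\succ\cdots)\succ p_{n-1})$, where for $i=0$ the left factor and "$\succ$" are omitted and for $i=n-1$ the right factor and "$\prec$" are omitted. Biplane trees: recursively $\mathrm{Node}(x,f_\ell,f_r)$, root label $x$, ordered possibly empty lists $f_\ell,f_r$ of trees; forests are ordered lists of trees. Blue-packed trees are labeled $i^\alpha$,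 $i$ a positive integer, $\alpha\in\{\circ,\bullet\}$; weight $\omega$ = number of nodes with $\alpha=\circ$; size = number of nodes. $\mathrm{Node}(i^\alpha,[\ell_1..\ell_g],[r_1..r_d])$ is blue-packed if all children are blue-packed and either ($d=0$, $i^\alpha=1^\circ$) or ($d=1$, $i^\alpha\ne1^\circ$, $1\le i\le\omega(r_1)$). Blue-packed forest: list of blue-packed trees. Definition of $\mathbb{O}$: $\mathbb{O}_{[]}=\mathbb{Q}_\varepsilon$; $\mathbb{O}_{[t_1,\dots,t_k]}=\mathbb{O}_{t_k}\prec(\mathbb{O}_{t_{k-1}}\prec(\cdots\prec\mathbb{O}_{t_1})\cdots)$ for $k\ge1$; $\mathbb{O}_{\mathrm{Node}(i^\alpha,[],f_r)}=\Psi_{i^\alpha}(\mathbb{O}_{f_r})$; and for $g\ge1$, $\mathbb{O}_{\mathrm{Node}(i^\alpha,[\ell_1,\dots,\ell_g],f_r)}=\langle\mathbb{O}_{\ell_1},\dots,\mathbb{O}_{\ell_g};\mathbb{O}_{\mathrm{Node}(i^\alpha,[],f_r)}\rangle$. -}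

module Defs where

open import Data.Nat using (ℕ; zero; suc; _+_; _∸_; _⊔_; _≤_; _≤ᵇ_; _<ᵇ_)
open import Data.Nat.Properties using () renaming (_≟_ to _≟ℕ_)
open import Data.Bool using (Bool; true; false; _∧_; _∨_; not; if_then_else_)
open import Data.List using (List; []; _∷_; _++_; length; map; concatMap; foldr; foldl;
  reverse; last; applyUpTo; upTo; filterᵇ; take; drop; cartesianProduct)
open import Data.List.Properties using (≡-dec)
open import Data.Bool.ListAction using (and)
open import Data.List.Membership.Propositional using (_∈_)
open import Data.List.Relation.Unary.All using (All)
open import Data.List.Relation.Unary.Unique.Propositional using (Unique)
open import Data.Maybe using (Maybe; just; nothing)
open import Data.Rational using (ℚ; 0ℚ; 1ℚ) renaming (_+_ to _+ℚ_; _*_ to _*ℚ_; -_ to -ℚ_)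
open import Data.Product using (Σ; ∃; _×_; _,_; proj₁; proj₂)
open import Data.Unit using (⊤)
open import Data.Empty using (⊥)
open import Relation.Nullary using (¬_; does)
open import Relation.Binary.PropositionalEquality using (_≡_; _≢_)

allᵇ : {A : Set} → (A → Bool) → List A → Bool
allᵇ p xs = and (map p xs)

Word : Set
Word = List ℕ

maxW : Word → ℕ
maxW = foldr _⊔_ 0

Packed : Word → Set
Packed w = All (λ x → 1 ≤ x) w × (∀ i → 1 ≤ i → i ≤ maxW w → i ∈ w)

occurs : ℕ → Word → Bool
occurs x []      = false
occurs x (y ∷ w) = does (x ≟ℕ y) ∨ occurs x w

isPacked : Word → Bool
isPacked w = allᵇ (λ x → 1 ≤ᵇ x) w ∧ allᵇ (λ i → occurs i w) (applyUpTo suc (maxW w))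

eqW : Word → Word → Bool
eqW u v = does (≡-dec _≟ℕ_ u v)

rank : ℕ → Word → ℕ
rank x w = length (filterᵇ (λ y → occurs y w) (upTo (suc x)))

pack : Word → Word
pack w = map (λ x → rank x w) w

restrictLE : ℕ → Word → Word
restrictLE i = filterᵇ (λ x → x ≤ᵇ i)

restrictGT : ℕ → Word → Word
restrictGT i = filterᵇ (λ x → i <ᵇ x)

-- [a .. b]  (empty if a > b)
range : ℕ → ℕ → List ℕ
range a b = applyUpTo (λ k → a + k) (suc b ∸ a)

wordsOver : ℕ → ℕ → List Word
wordsOver N zero    = [] ∷ []
wordsOver N (suc l) = concatMap (λ a → map (a ∷_) (wordsOver N l)) (range 1 N)

-- Elements of WQSym: finite formal Q-linear combinations of Q_w,
-- compared through their coefficient functions.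

LC : Set
LC = List (ℚ × Word)

coeff : LC → Word → ℚ
coeff []            w = 0ℚ
coeff ((c , u) ∷ x) w = (if eqW u w then c else 0ℚ) +ℚ coeff x w

_≈_ : LC → LC → Set
x ≈ y = ∀ w → coeff x w ≡ coeff y w

Qε : LC
Qε = (1ℚ , []) ∷ []

scale : ℚ → LC → LC
scale c = map (λ { (a , u) → (c *ℚ a , u) })

linExt : (Word → LC) → LC → LC
linExt f = concatMap (λ { (c , u) → scale c (f u) })

bilinExt : (Word → Word → LC) → LC → LC → LC
bilinExt op x y =
  concatMap (λ { (a , u) → concatMap (λ { (b , v) → scale (a *ℚ b) (op u v) }) y }) x

LC2 : Set
LC2 = List (ℚ × Word × Word)

coeff2 : LC2 → Word → Word → ℚ
coeff2 []                 p q = 0ℚ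
coeff2 ((c , u , v) ∷ x)  p q = (if eqW u p ∧ eqW v q then c else 0ℚ) +ℚ coeff2 x p q

IsZero2 : LC2 → Set
IsZero2 x = ∀ p q → coeff2 x p q ≡ 0ℚ

scale2 : ℚ → LC2 → LC2
scale2 c = map (λ { (a , u , v) → (c *ℚ a , u , v) })

linExt2 : (Word → LC2) → LC → LC2
linExt2 f = concatMap (λ { (c , u) → scale2 c (f u) })

-- Dendriform products (literal definition: sum over pairs of words u', v';
-- since u'v' is packed of length |u|+|v|, its letters lie in {1..|u|+|v|}).

disjointW : Word → Word → Bool
disjointW u v = allᵇ (λ x → not (occurs x v)) u

prodBasis : (ℕ → ℕ → Bool) → Word → Word → LC
prodBasis cmp u v =
  map (λ { (u' , v') → (1ℚ , u' ++ v') })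
      (filterᵇ cond (cartesianProduct (wordsOver N (length u)) (wordsOver N (length v))))
  where
  N = length u + length v
  cond : Word × Word → Bool
  cond (u' , v') = eqW (pack u') u ∧ eqW (pack v') v ∧ isPacked (u' ++ v')
                   ∧ disjointW u' v' ∧ cmp (maxW u') (maxW v')

_≺_ : LC → LC → LC
_≺_ = bilinExt (prodBasis (λ a b → b <ᵇ a))

_≻_ : LC → LC → LC
_≻_ = bilinExt (prodBasis (λ a b → a <ᵇ b))

ΔprecBasis : Word → LC2
ΔprecBasis u with last u
... | nothing = []
... | just un  = map (λ i → (1ℚ , restrictLE i u , pack (restrictGT i u))) (range un (maxW u ∸ 1))

ΔsuccBasis : Word → LC2
ΔsuccBasis u with last u
... | nothing = []
... | just un  = map (λ i → (1ℚ , restrictLE i u , pack (restrictGT i u))) (range 1 (un ∸ 1))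

Δprec Δsucc : LC → LC2
Δprec = linExt2 ΔprecBasis
Δsucc = linExt2 ΔsuccBasis

InWQSym : ℕ → LC → Set
InWQSym n x = ∀ w → coeff x w ≢ 0ℚ → Packed w × length w ≡ n

Prim : ℕ → LC → Set
Prim n x = InWQSym n x × IsZero2 (Δprec x ++ Δsucc x)

TPrim : ℕ → LC → Set
TPrim n x = InWQSym n x × IsZero2 (Δprec x) × IsZero2 (Δsucc x)

data Color : Set where
  white black : Color

Label : Set
Label = ℕ × Color

psiWhite : ℕ → Word → Word
psiWhite i w = map (λ x → if i ≤ᵇ x then suc x else x) w ++ (i ∷ [])

ΨBasis : Label → Word → LC
ΨBasis (i , white) w =
  if (1 ≤ᵇ i) ∧ (i ≤ᵇ suc (maxW w)) then (1ℚ , psiWhite i w) ∷ [] else []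
ΨBasis (i , black) w =
  if (1 ≤ᵇ i) ∧ (i ≤ᵇ maxW w) then (1ℚ , w ++ (i ∷ [])) ∷ [] else []

Ψ : Label → LC → LC
Ψ x = linExt (ΨBasis x)

rnest : LC → List LC → LC
rnest l []       = l
rnest l (m ∷ ms) = l ≺ rnest m ms

lnest : LC → List LC → LC
lnest r rs = foldl _≻_ r rs

braceTerm : List LC → LC → List LC → LC
braceTerm []       q []       = q
braceTerm []       q (r ∷ rs) = q ≺ lnest r rs
braceTerm (l ∷ ls) q []       = rnest l ls ≻ q
braceTerm (l ∷ ls) q (r ∷ rs) = (rnest l ls ≻ q) ≺ lnest r rs

sign : ℕ → ℚ
sign zero    = 1ℚ
sign (suc k) = -ℚ sign k

brace : List LC → LC → LC
brace ps q = concatMap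
  (λ i → scale (sign (length ps ∸ i)) (braceTerm (take i ps) q (drop i ps)))
  (upTo (suc (length ps)))

data Tree : Set where
  node : Label → List Tree → List Tree → Tree

Forest : Set
Forest = List Tree

leftForest : Tree → Forest
leftForest (node _ ls _) = ls

mutual
  size : Tree → ℕ
  size (node _ ls rs) = suc (sizeF ls + sizeF rs)

  sizeF : Forest → ℕ
  sizeF []      = 0
  sizeF (t ∷ f) = size t + sizeF f

mutual
  weight : Tree → ℕ
  weight (node (_ , white) ls rs) = suc (weightF ls + weightF rs)
  weight (node (_ , black) ls rs) = weightF ls + weightF rs

  weightF : Forest → ℕ
  weightF []      = 0
  weightF (t ∷ f) = weight t + weightF f

RootCond : Label → Forest → Set
RootCond x []            = x ≡ (1 , white)
RootCond x (r ∷ [])      = x ≢ (1 , white) × 1 ≤ proj₁ x × proj₁ x ≤ weight r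
RootCond x (_ ∷ _ ∷ _)   = ⊥

mutual
  BluePacked : Tree → Set
  BluePacked (node x ls rs) = BluePackedF ls × BluePackedF rs × RootCond x rs

  BluePackedF : Forest → Set
  BluePackedF []      = ⊤
  BluePackedF (t ∷ f) = BluePacked t × BluePackedF f

nestForest : List LC → LC
nestForest []       = Qε
nestForest (x ∷ xs) = rnest x xs

mutual
  OT : Tree → LC
  OT (node x []       rs) = Ψ x (OF rs)
  OT (node x (l ∷ ls) rs) = brace (OT l ∷ OL ls) (Ψ x (OF rs))

  OL : Forest → List LC
  OL []      = []
  OL (t ∷ f) = OT t ∷ OL f

  OF : Forest → LC
  OF []      = Qε
  OF (t ∷ f) = nestForest (reverse (OT t ∷ OL f))

lincomb : {A : Set} → (A → LC) → List (ℚ × A) → LC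
lincomb O = concatMap (λ { (c , a) → scale c (O a) })

IsBasisOf : {A : Set} → (A → Set) → (A → LC) → (LC → Set) → Set
IsBasisOf {A} Good O V =
    (∀ a → Good a → V (O a))
  × (∀ (cs : List (ℚ × A)) → All (λ p → Good (proj₂ p)) cs → Unique (map proj₂ cs)
       → lincomb O cs ≈ [] → All (λ p → proj₁ p ≡ 0ℚ) cs)
  × (∀ x → V x → Σ (List (ℚ × A)) λ cs → All (λ p → Good (proj₂ p)) cs × lincomb O cs ≈ x)

{-# OPTIONS --safe #-}
module Submission where

-- Elements of WQSym are studied through their coefficient functions V = Word → ℚ. There the half-products are sums over
-- deconcatenations w = ab into words with disjoint letters, and the coproduct of x at (p , q) is the sum of x over the
-- shuffles of p with q shifted by max p; ≺ and ≻ on the one side, Δ≺ and Δ≻ on the other, are told apart by the position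
-- of the maximum and by the origin of the last letter.
--
-- If p is primitive, then Δ(p ≺ x) = x ⊗ p + x′ ⊗ (p ≺ x″) and Δ(x ≻ p) = x ⊗ p + x′ ⊗ (x″ ≻ p). Writing
-- L(p₁…pₙ) = p₁ ≺ (p₂ ≺ …), a telescoping argument gives Σ ⟨p₁…pᵢ; q⟩ ≺ L(pᵢ₊₁…pₙ) = L(p₁…pₙ) ≻ q, from which braces of
-- primitive elements are primitive by induction. The component of lowest right degree of Δ(p ≺ x) is x ⊗ p, and that of
-- Δ≻⟨p₁…pₙ; q⟩ for totally primitive q is L(p₁…pₙ) ⊗ q.
--
-- Spanning: by coassociativity the component of lowest right degree of Δ(x) (of Δ≻(x) for primitive x) has its right
-- factors in Prim (in TPrim), so it can be cancelled by subtracting O_{f·t} (by subtracting braces), and iterating leaves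
-- a primitive (totally primitive) remainder. Finally x is totally primitive iff all its parts x ∘ ψ_{iᵅ} are primitive,
-- the parts with iᵅ = 1° or with i exceeding the maximum being zero.
--
-- Independence: applying tensor products of dual functionals of lower degree to the same lowest components gives
-- functionals that are unitriangular on the family O.


open import Defs
open import Data.Bool using (Bool; true; false; _∧_; _∨_; not; if_then_else_; T?)
open import Data.Bool.Properties using (T-≡; ∧-assoc)
open import Data.Empty using (⊥; ⊥-elim)
open import Data.List using (List; []; _∷_; _∷ʳ_; _++_; map; concatMap; foldl; length; reverse; filterᵇ; upTo; applyUpTo; last; take; drop; cartesianProduct; initLast; _∷ʳ′_)
open import Data.List.Membership.Propositional using (_∈_; _∉_)
open import Data.List.Relation.Unary.All using (All; []; _∷_)
open import Data.List.Relation.Unary.Any using (here; there)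
open import Data.List.Relation.Unary.Unique.Propositional using (Unique)
open import Data.List.Relation.Ternary.Interleaving.Propositional using (Interleaving; []; consˡ; consʳ)
open import Data.Maybe using (just)
open import Data.Nat as ℕ using (ℕ; zero; suc; _≤_; _<_; z≤n; s≤s; _⊔_; _∸_; _≤ᵇ_; _<ᵇ_)
open import Data.Nat.Induction using (<-rec)
open import Data.Product using (Σ; ∃; _×_; _,_; proj₁; proj₂)
open import Data.Rational using (ℚ; 0ℚ; 1ℚ; _+_; _*_; -_)
open import Data.Rational.Solver using (module +-*-Solver)
open import Data.Sum using (_⊎_; inj₁; inj₂)
open import Data.Unit using (⊤; tt)
open import Function using (_∘_; id; case_of_; Equivalence)
open import Relation.Binary.Definitions as Tri using (DecidableEquality)
open import Relation.Binary.PropositionalEquality using (_≡_; _≢_; refl; sym; trans; cong; cong₂; subst; subst₂; module ≡-Reasoning)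
open import Relation.Nullary using (¬_; Dec; yes; no; does)
import Data.List.Membership.Propositional.Properties as ∈
import Data.List.Properties as List
import Data.List.Relation.Unary.All as All
import Data.List.Relation.Unary.All.Properties as All
import Data.List.Relation.Unary.Any.Properties as Any
import Data.List.Relation.Unary.Unique.Propositional.Properties as Unique
import Data.Nat.Properties as ℕ
import Data.Rational.Properties as ℚ
import Data.List.Relation.Unary.AllPairs as AllPairs

open ≡-Reasoning

-- Finite sums

-- Functions on words are used because a slice `Δ c x a` of a coproduct is again such a function,
-- while no formal sum for it is at hand; this is what allows coproducts, half-products and braces
-- to be composed freely.
--
-- No dimension is computed and no bijection between trees and packed words is used, so spanning and
-- independence are two separate inductions on the degree. The second needs the first: a functional
-- that is exactly dual to the family, and not merely triangular, exists in a smaller degree only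
-- once the family is known to be a basis there.
--
-- The root condition has a simple source. All words of the element attached to a tree have the
-- weight of the tree as their maximum. A white letter 1 appended to a nonempty word can be cut off
-- as the left tensor factor, and a new maximum at the end as the right one. The condition that the
-- label differs from 1° and is at most the weight of the child excludes exactly these two letters,
-- and for every other letter the coproducts commute with stripping it.

∑ : {A : Set} → List A → (A → ℚ) → ℚ
∑ []       f = 0ℚ
∑ (x ∷ xs) f = f x + ∑ xs f

𝟙 : Bool → ℚ
𝟙 true  = 1ℚ
𝟙 false = 0ℚ

+-interchange : ∀ a b c d → (a + b) + (c + d) ≡ (a + c) + (b + d)
+-interchange = solve 4 (λ a b c d → (a :+ b) :+ (c :+ d) := (a :+ c) :+ (b :+ d)) refl
  where open +-*-Solver

*-shift : ∀ a b c → a * (b * c) ≡ b * (a * c)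
*-shift = solve 3 (λ a b c → a :* (b :* c) := b :* (a :* c)) refl
  where open +-*-Solver

*-interchange : ∀ a b c d → (a * b) * (c * d) ≡ (a * c) * (b * d)
*-interchange = solve 4 (λ a b c d → (a :* b) :* (c :* d) := (a :* c) :* (b :* d)) refl
  where open +-*-Solver

*-nonzeroˡ : ∀ a b → a * b ≢ 0ℚ → a ≢ 0ℚ
*-nonzeroˡ a b ne refl = ne (ℚ.*-zeroˡ b)

*-nonzeroʳ : ∀ a b → a * b ≢ 0ℚ → b ≢ 0ℚ
*-nonzeroʳ a b ne refl = ne (ℚ.*-zeroʳ a)

*-zeroˡ-≡ : ∀ {a} b → a ≡ 0ℚ → a * b ≡ 0ℚ
*-zeroˡ-≡ b refl = ℚ.*-zeroˡ b

*-zeroʳ-≡ : ∀ a {b} → b ≡ 0ℚ → a * b ≡ 0ℚ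
*-zeroʳ-≡ a refl = ℚ.*-zeroʳ a

-- Equality in ℚ is decidable, so a vanishing statement may be proved by refuting a nonzero value;
-- most support arguments below have this form.
stable-0 : ∀ {a} → ¬ (a ≢ 0ℚ) → a ≡ 0ℚ
stable-0 {a} h with a ℚ.≟ 0ℚ
... | yes p = p
... | no ¬p = ⊥-elim (h ¬p)

𝟙-∧ : ∀ a b → 𝟙 (a ∧ b) ≡ 𝟙 a * 𝟙 b
𝟙-∧ true  b = sym (ℚ.*-identityˡ (𝟙 b))
𝟙-∧ false b = sym (ℚ.*-zeroˡ (𝟙 b))

𝟙-nonzero : ∀ b → 𝟙 b ≢ 0ℚ → b ≡ true
𝟙-nonzero true  _  = refl
𝟙-nonzero false ne = ⊥-elim (ne refl)

𝟙-cong-* : ∀ b {x y} → (b ≡ true → x ≡ y) → 𝟙 b * x ≡ 𝟙 b * y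
𝟙-cong-* true  h = cong (1ℚ *_) (h refl)
𝟙-cong-* false {x} {y} h = trans (ℚ.*-zeroˡ x) (sym (ℚ.*-zeroˡ y))

module _ {A : Set} where

  ∑-cong-∈ : ∀ (xs : List A) {f g : A → ℚ} → (∀ x → x ∈ xs → f x ≡ g x) → ∑ xs f ≡ ∑ xs g
  ∑-cong-∈ []       h = refl
  ∑-cong-∈ (x ∷ xs) h = cong₂ _+_ (h x (here refl)) (∑-cong-∈ xs (λ y → h y ∘ there))

  ∑-cong : ∀ (xs : List A) {f g : A → ℚ} → (∀ x → f x ≡ g x) → ∑ xs f ≡ ∑ xs g
  ∑-cong xs h = ∑-cong-∈ xs (λ x _ → h x)

  ∑-zero-∈ : ∀ (xs : List A) {f : A → ℚ} → (∀ x → x ∈ xs → f x ≡ 0ℚ) → ∑ xs f ≡ 0ℚ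
  ∑-zero-∈ []       h = refl
  ∑-zero-∈ (x ∷ xs) h = trans (cong₂ _+_ (h x (here refl)) (∑-zero-∈ xs (λ y → h y ∘ there))) (ℚ.+-identityˡ 0ℚ)

  ∑-zero : ∀ (xs : List A) {f : A → ℚ} → (∀ x → f x ≡ 0ℚ) → ∑ xs f ≡ 0ℚ
  ∑-zero xs h = ∑-zero-∈ xs (λ x _ → h x)

  ∑-nonzero : ∀ (xs : List A) {f : A → ℚ} → ∑ xs f ≢ 0ℚ → ∃ λ x → x ∈ xs × f x ≢ 0ℚ
  ∑-nonzero []       ne = ⊥-elim (ne refl)
  ∑-nonzero (x ∷ xs) {f} ne with f x ℚ.≟ 0ℚ
  ... | no p  = x , here refl , p
  ... | yes p with ∑-nonzero xs {f} (λ e → ne (trans (cong₂ _+_ p e) (ℚ.+-identityˡ 0ℚ)))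
  ...   | y , y∈ , q = y , there y∈ , q

  ∑-++ : ∀ (xs ys : List A) (f : A → ℚ) → ∑ (xs ++ ys) f ≡ ∑ xs f + ∑ ys f
  ∑-++ []       ys f = sym (ℚ.+-identityˡ _)
  ∑-++ (x ∷ xs) ys f = trans (cong (f x +_) (∑-++ xs ys f)) (sym (ℚ.+-assoc (f x) (∑ xs f) (∑ ys f)))

  ∑-+ : ∀ (xs : List A) (f g : A → ℚ) → ∑ xs (λ x → f x + g x) ≡ ∑ xs f + ∑ xs g
  ∑-+ []       f g = sym (ℚ.+-identityˡ 0ℚ)
  ∑-+ (x ∷ xs) f g = trans (cong ((f x + g x) +_) (∑-+ xs f g)) (+-interchange (f x) (g x) (∑ xs f) (∑ xs g))

  ∑-*ˡ : ∀ (xs : List A) c (f : A → ℚ) → ∑ xs (λ x → c * f x) ≡ c * ∑ xs f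
  ∑-*ˡ []       c f = sym (ℚ.*-zeroʳ c)
  ∑-*ˡ (x ∷ xs) c f = trans (cong (c * f x +_) (∑-*ˡ xs c f)) (sym (ℚ.*-distribˡ-+ c (f x) (∑ xs f)))

  ∑-*ʳ : ∀ (xs : List A) c (f : A → ℚ) → ∑ xs (λ x → f x * c) ≡ ∑ xs f * c
  ∑-*ʳ xs c f = begin
    ∑ xs (λ x → f x * c)  ≡⟨ ∑-cong xs (λ x → ℚ.*-comm (f x) c) ⟩
    ∑ xs (λ x → c * f x)  ≡⟨ ∑-*ˡ xs c f ⟩
    c * ∑ xs f            ≡⟨ ℚ.*-comm c (∑ xs f) ⟩
    ∑ xs f * c            ∎

  ∑-filterᵇ : ∀ (p : A → Bool) (xs : List A) (f : A → ℚ) →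
              ∑ (filterᵇ p xs) f ≡ ∑ xs (λ x → 𝟙 (p x) * f x)
  ∑-filterᵇ p []       f = refl
  ∑-filterᵇ p (x ∷ xs) f with p x
  ... | true  = cong₂ _+_ (sym (ℚ.*-identityˡ (f x))) (∑-filterᵇ p xs f)
  ... | false = trans (∑-filterᵇ p xs f) (sym (trans (cong (_+ ∑ xs _) (ℚ.*-zeroˡ (f x))) (ℚ.+-identityˡ _)))

module _ {A B : Set} where

  ∑-map : ∀ (h : A → B) (xs : List A) (f : B → ℚ) → ∑ (map h xs) f ≡ ∑ xs (f ∘ h)
  ∑-map h []       f = refl
  ∑-map h (x ∷ xs) f = cong (f (h x) +_) (∑-map h xs f)

  ∑-concatMap : ∀ (h : A → List B) (xs : List A) (f : B → ℚ) →
                ∑ (concatMap h xs) f ≡ ∑ xs (λ x → ∑ (h x) f)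
  ∑-concatMap h []       f = refl
  ∑-concatMap h (x ∷ xs) f = trans (∑-++ (h x) (concatMap h xs) f) (cong (∑ (h x) f +_) (∑-concatMap h xs f))

  ∑-swap : ∀ (xs : List A) (ys : List B) (f : A → B → ℚ) →
           ∑ xs (λ x → ∑ ys (f x)) ≡ ∑ ys (λ y → ∑ xs (λ x → f x y))
  ∑-swap []       ys f = sym (∑-zero ys (λ _ → refl))
  ∑-swap (x ∷ xs) ys f = trans (cong (∑ ys (f x) +_) (∑-swap xs ys f)) (sym (∑-+ ys (f x) _))

  ∑-product : ∀ (xs : List A) (ys : List B) (f : A → ℚ) (g : B → ℚ) →
              ∑ xs (λ x → ∑ ys (λ y → f x * g y)) ≡ ∑ xs f * ∑ ys g
  ∑-product xs ys f g = trans (∑-cong xs (λ x → ∑-*ˡ ys (f x) g)) (∑-*ʳ xs (∑ ys g) f)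

module _ {A B : Set} where

  ∑-cartesianProduct : ∀ (xs : List A) (ys : List B) (f : A × B → ℚ) →
                       ∑ (cartesianProduct xs ys) f ≡ ∑ xs (λ x → ∑ ys (λ y → f (x , y)))
  ∑-cartesianProduct []       ys f = refl
  ∑-cartesianProduct (x ∷ xs) ys f =
    trans (∑-++ (map (x ,_) ys) (cartesianProduct xs ys) f)
          (cong₂ _+_ (∑-map (x ,_) ys f) (∑-cartesianProduct xs ys f))

-- Formal linear combinations

module FormalSum {A : Set} (_≟_ : DecidableEquality A) where

  -- A formal sum may list the same element several times; the collected coefficient is what its
  -- value depends on.
  coef : List (ℚ × A) → A → ℚ
  coef cs a = ∑ cs (λ (c , b) → 𝟙 (does (b ≟ a)) * c)

  δ-refl : ∀ a → 𝟙 (does (a ≟ a)) ≡ 1ℚ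
  δ-refl a with a ≟ a
  ... | yes _ = refl
  ... | no ¬p = ⊥-elim (¬p refl)

  δ-≢ : ∀ {a b} → a ≢ b → 𝟙 (does (a ≟ b)) ≡ 0ℚ
  δ-≢ {a} {b} ne with a ≟ b
  ... | yes p = ⊥-elim (ne p)
  ... | no _  = refl

  δ-nonzero : ∀ {a b} → 𝟙 (does (a ≟ b)) ≢ 0ℚ → a ≡ b
  δ-nonzero {a} {b} ne with a ≟ b
  ... | yes p = p
  ... | no _  = ⊥-elim (ne refl)

  δ-subst : ∀ a b (f : A → ℚ) → 𝟙 (does (a ≟ b)) * f a ≡ 𝟙 (does (a ≟ b)) * f b
  δ-subst a b f with a ≟ b
  ... | yes refl = refl
  ... | no _     = trans (ℚ.*-zeroˡ (f a)) (sym (ℚ.*-zeroˡ (f b)))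

  private
    away : A → ℚ × A → Bool
    away a (_ , b) = not (does (b ≟ a))

    coef-away : ∀ a cs b → b ≢ a → coef (filterᵇ (away a) cs) b ≡ coef cs b
    coef-away a cs b b≢a = trans (∑-filterᵇ (away a) cs _) (∑-cong cs term)
      where
      term : ∀ p → 𝟙 (away a p) * (𝟙 (does (proj₂ p ≟ b)) * proj₁ p) ≡ 𝟙 (does (proj₂ p ≟ b)) * proj₁ p
      term (c , d) with d ≟ a | d ≟ b
      ... | yes refl | yes e = ⊥-elim (b≢a (sym e))
      ... | yes _    | no _  = trans (ℚ.*-zeroˡ (0ℚ * c)) (sym (ℚ.*-zeroˡ c))
      ... | no _     | d≟b   = ℚ.*-identityˡ (𝟙 (does d≟b) * c)

    coef-away-self : ∀ a cs → coef (filterᵇ (away a) cs) a ≡ 0ℚ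
    coef-away-self a cs = trans (∑-filterᵇ (away a) cs _) (∑-zero cs term)
      where
      term : ∀ p → 𝟙 (away a p) * (𝟙 (does (proj₂ p ≟ a)) * proj₁ p) ≡ 0ℚ
      term (c , d) with d ≟ a
      ... | yes _ = ℚ.*-zeroˡ (1ℚ * c)
      ... | no _  = trans (ℚ.*-identityˡ (0ℚ * c)) (ℚ.*-zeroˡ c)

    split-away : ∀ a cs (φ : A → ℚ) → ∑ cs (λ (c , b) → c * φ b)
               ≡ coef cs a * φ a + ∑ (filterᵇ (away a) cs) (λ (c , b) → c * φ b)
    split-away a cs φ = begin
      ∑ cs (λ (c , b) → c * φ b)
        ≡⟨ ∑-cong cs term ⟩
      ∑ cs (λ p → (𝟙 (does (proj₂ p ≟ a)) * proj₁ p) * φ a + 𝟙 (away a p) * (proj₁ p * φ (proj₂ p)))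
        ≡⟨ ∑-+ cs _ _ ⟩
      ∑ cs (λ p → (𝟙 (does (proj₂ p ≟ a)) * proj₁ p) * φ a) + ∑ cs (λ p → 𝟙 (away a p) * (proj₁ p * φ (proj₂ p)))
        ≡⟨ cong₂ _+_ (∑-*ʳ cs (φ a) _) (sym (∑-filterᵇ (away a) cs _)) ⟩
      coef cs a * φ a + ∑ (filterᵇ (away a) cs) (λ (c , b) → c * φ b) ∎
      where
      open +-*-Solver
      term : ∀ (p : ℚ × A) → proj₁ p * φ (proj₂ p)
           ≡ (𝟙 (does (proj₂ p ≟ a)) * proj₁ p) * φ a + 𝟙 (away a p) * (proj₁ p * φ (proj₂ p))
      term (c , b) with b ≟ a
      ... | yes refl = solve 2 (λ c x → c :* x := (con 1ℚ :* c) :* x :+ con 0ℚ :* (c :* x)) refl c (φ b)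
      ... | no _     = solve 3 (λ c x y → c :* x := (con 0ℚ :* c) :* y :+ con 1ℚ :* (c :* x)) refl c (φ b) (φ a)

    length-away : ∀ a c cs → length (filterᵇ (away a) ((c , a) ∷ cs)) ≤ length cs
    length-away a c cs with a ≟ a
    ... | no ¬p = ⊥-elim (¬p refl)
    ... | yes _ = List.length-filter _ cs

    -- All occurrences of the head element are collected at once by `split-away`. What remains is
    -- shorter but not a tail of the list, hence the recursion on a bound for the length.
    eval-zero-≤ : ∀ n cs (φ : A → ℚ) → length cs ≤ n →
                  (∀ a → coef cs a * φ a ≡ 0ℚ) → ∑ cs (λ (c , b) → c * φ b) ≡ 0ℚ
    eval-zero-≤ n       []             φ len h = refl
    eval-zero-≤ (suc n) ((c , a) ∷ cs) φ (s≤s len) h =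
      trans (split-away a all φ)
            (cong₂ _+_ (h a) (eval-zero-≤ n (filterᵇ (away a) all) φ (ℕ.≤-trans (length-away a c cs) len) h′))
      where
      all = (c , a) ∷ cs
      h′ : ∀ b → coef (filterᵇ (away a) all) b * φ b ≡ 0ℚ
      h′ b with b ≟ a
      ... | yes refl = *-zeroˡ-≡ (φ b) (coef-away-self b all)
      ... | no b≢a   = trans (cong (_* φ b) (coef-away a all b b≢a)) (h b)

  eval-zero : ∀ cs (φ : A → ℚ) → (∀ a → coef cs a * φ a ≡ 0ℚ) → ∑ cs (λ (c , b) → c * φ b) ≡ 0ℚ
  eval-zero cs φ = eval-zero-≤ _ cs φ ℕ.≤-refl

  -- Terms that cancel inside the list impose no condition on the functions. This serves both the
  -- passage to packed words and the triangular argument for independence.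
  eval-cong : ∀ cs (φ φ′ : A → ℚ) → (∀ a → coef cs a ≢ 0ℚ → φ a ≡ φ′ a) →
              ∑ cs (λ (c , b) → c * φ b) ≡ ∑ cs (λ (c , b) → c * φ′ b)
  eval-cong cs φ φ′ h = begin
    ∑ cs (λ (c , b) → c * φ b)
      ≡⟨ ∑-cong cs (λ (c , b) → solve 3 (λ c x y → c :* x := c :* (x :- y) :+ c :* y) refl c (φ b) (φ′ b)) ⟩
    ∑ cs (λ (c , b) → c * (φ b + - φ′ b) + c * φ′ b)
      ≡⟨ ∑-+ cs _ _ ⟩
    ∑ cs (λ (c , b) → c * (φ b + - φ′ b)) + ∑ cs (λ (c , b) → c * φ′ b)
      ≡⟨ cong (_+ ∑ cs (λ (c , b) → c * φ′ b)) (eval-zero cs _ vanish) ⟩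
    0ℚ + ∑ cs (λ (c , b) → c * φ′ b)
      ≡⟨ ℚ.+-identityˡ _ ⟩
    ∑ cs (λ (c , b) → c * φ′ b) ∎
    where
    open +-*-Solver
    vanish : ∀ a → coef cs a * (φ a + - φ′ a) ≡ 0ℚ
    vanish a with coef cs a ℚ.≟ 0ℚ
    ... | yes e = *-zeroˡ-≡ (φ a + - φ′ a) e
    ... | no ne = *-zeroʳ-≡ (coef cs a) (trans (cong (_+ - φ′ a) (h a ne)) (ℚ.+-inverseʳ (φ′ a)))

  -- Without repetitions the collected coefficient at an entry is the one listed there. This
  -- translates independence into the form that `IsBasisOf` asks for.
  coef-Unique : ∀ cs → Unique (map proj₂ cs) → (∀ a → a ∈ map proj₂ cs → coef cs a ≡ 0ℚ) →
                All (λ p → proj₁ p ≡ 0ℚ) cs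
  coef-Unique [] _ h = []
  coef-Unique ((c , a) ∷ cs) (a# AllPairs.∷ u) h = c≡0 ∷ coef-Unique cs u tail
    where
    absent : coef cs a ≡ 0ℚ
    absent = ∑-zero-∈ cs λ (d , b) b∈ → *-zeroˡ-≡ d (δ-≢ (λ e → All.lookup a# (∈.∈-map⁺ proj₂ b∈) (sym e)))
    c≡0 : c ≡ 0ℚ
    c≡0 = begin
      c                                   ≡⟨ ℚ.*-identityˡ c ⟨
      1ℚ * c                              ≡⟨ cong (_* c) (δ-refl a) ⟨
      𝟙 (does (a ≟ a)) * c                ≡⟨ ℚ.+-identityʳ _ ⟨
      𝟙 (does (a ≟ a)) * c + 0ℚ           ≡⟨ cong (𝟙 (does (a ≟ a)) * c +_) absent ⟨
      𝟙 (does (a ≟ a)) * c + coef cs a    ≡⟨ h a (here refl) ⟩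
      0ℚ                                  ∎
    tail : ∀ b → b ∈ map proj₂ cs → coef cs b ≡ 0ℚ
    tail b b∈ = begin
      coef cs b                             ≡⟨ ℚ.+-identityˡ _ ⟨
      0ℚ + coef cs b                        ≡⟨ cong (_+ coef cs b) (*-zeroʳ-≡ (𝟙 (does (a ≟ b))) c≡0) ⟨
      𝟙 (does (a ≟ b)) * c + coef cs b      ≡⟨ h b (there b∈) ⟩
      0ℚ                                    ∎

-- Deconcatenations and shuffles

module _ {A : Set} where

  splits : List A → List (List A × List A)
  splits []      = ([] , []) ∷ []
  splits (x ∷ w) = ([] , x ∷ w) ∷ map (λ (a , b) → x ∷ a , b) (splits w)

  splits-++ : ∀ w {s} → s ∈ splits w → proj₁ s ++ proj₂ s ≡ w
  splits-++ []      (here refl) = refl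
  splits-++ (x ∷ w) (here refl) = refl
  splits-++ (x ∷ w) (there s∈) with ∈.∈-map⁻ _ s∈
  ... | _ , t∈ , refl = cong (x ∷_) (splits-++ w t∈)

  opaque

    -- Opaque, so that later goals keep these sums symbolic. It serves words and also lists of
    -- operands: a brace is a sum over the splittings of its list of primitives.
    ∑split : List A → (List A → List A → ℚ) → ℚ
    ∑split w F = ∑ (splits w) (λ (a , b) → F a b)

    ∑split-[] : ∀ (F : List A → List A → ℚ) → ∑split [] F ≡ F [] []
    ∑split-[] F = ℚ.+-identityʳ (F [] [])

    ∑split-∷ : ∀ x w (F : List A → List A → ℚ) →
               ∑split (x ∷ w) F ≡ F [] (x ∷ w) + ∑split w (λ a b → F (x ∷ a) b)
    ∑split-∷ x w F = cong (F [] (x ∷ w) +_) (∑-map _ (splits w) _)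

    ∑split-cong : ∀ w {F G : List A → List A → ℚ} → (∀ a b → a ++ b ≡ w → F a b ≡ G a b) →
                  ∑split w F ≡ ∑split w G
    ∑split-cong w h = ∑-cong-∈ (splits w) λ (a , b) s∈ → h a b (splits-++ w s∈)

    ∑split-zero : ∀ w {F : List A → List A → ℚ} → (∀ a b → a ++ b ≡ w → F a b ≡ 0ℚ) → ∑split w F ≡ 0ℚ
    ∑split-zero w h = ∑-zero-∈ (splits w) λ (a , b) s∈ → h a b (splits-++ w s∈)

    ∑split-nonzero : ∀ w {F : List A → List A → ℚ} → ∑split w F ≢ 0ℚ →
                     ∃ λ a → ∃ λ b → a ++ b ≡ w × F a b ≢ 0ℚ
    ∑split-nonzero w ne with ∑-nonzero (splits w) ne
    ... | (a , b) , s∈ , q = a , b , splits-++ w s∈ , q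

    ∑split-+ : ∀ w (F G : List A → List A → ℚ) →
               ∑split w (λ a b → F a b + G a b) ≡ ∑split w F + ∑split w G
    ∑split-+ w F G = ∑-+ (splits w) _ _

    ∑split-*ˡ : ∀ w c (F : List A → List A → ℚ) → ∑split w (λ a b → c * F a b) ≡ c * ∑split w F
    ∑split-*ˡ w c F = ∑-*ˡ (splits w) c _

    ∑split-∑ : ∀ {B : Set} w (ys : List B) (F : List A → List A → B → ℚ) →
               ∑split w (λ a b → ∑ ys (F a b)) ≡ ∑ ys (λ y → ∑split w (λ a b → F a b y))
    ∑split-∑ w ys F = ∑-swap (splits w) ys _

  -- Coassociativity of deconcatenation: both sides run over the factorizations of `w` into three
  -- factors.
  ∑split-assoc : ∀ w (G : List A → List A → List A → ℚ) →
                 ∑split w (λ u c → ∑split u (λ a b → G a b c)) ≡ ∑split w (λ a v → ∑split v (G a))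
  ∑split-assoc []      G =
    trans (∑split-[] _) (trans (∑split-[] _) (sym (trans (∑split-[] _) (∑split-[] _))))
  ∑split-assoc (x ∷ w) G = begin
    ∑split (x ∷ w) (λ u c → ∑split u (λ a b → G a b c))
      ≡⟨ ∑split-∷ x w _ ⟩
    ∑split [] (λ a b → G a b (x ∷ w)) + ∑split w (λ u c → ∑split (x ∷ u) (λ a b → G a b c))
      ≡⟨ cong₂ _+_ (∑split-[] _)
           (trans (∑split-cong w (λ u c _ → ∑split-∷ x u _)) (∑split-+ w _ _)) ⟩
    G [] [] (x ∷ w) + (∑split w (λ u c → G [] (x ∷ u) c) + ∑split w (λ u c → ∑split u (λ a b → G (x ∷ a) b c)))
      ≡⟨ ℚ.+-assoc (G [] [] (x ∷ w)) (∑split w (λ u c → G [] (x ∷ u) c)) _ ⟨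
    (G [] [] (x ∷ w) + ∑split w (λ u c → G [] (x ∷ u) c)) + ∑split w (λ u c → ∑split u (λ a b → G (x ∷ a) b c))
      ≡⟨ cong₂ _+_ (sym (∑split-∷ x w (G []))) (∑split-assoc w (λ a → G (x ∷ a))) ⟩
    ∑split (x ∷ w) (G []) + ∑split w (λ a v → ∑split v (G (x ∷ a)))
      ≡⟨ ∑split-∷ x w _ ⟨
    ∑split (x ∷ w) (λ a v → ∑split v (G a)) ∎

  ∑split-first : ∀ w {F : List A → List A → ℚ} → (∀ a b → a ≢ [] → F a b ≡ 0ℚ) → ∑split w F ≡ F [] w
  ∑split-first []      {F} h = ∑split-[] F
  ∑split-first (x ∷ w) {F} h = begin
    ∑split (x ∷ w) F                                  ≡⟨ ∑split-∷ x w F ⟩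
    F [] (x ∷ w) + ∑split w (λ a b → F (x ∷ a) b)     ≡⟨ cong (F [] (x ∷ w) +_) (∑split-zero w (λ a b _ → h (x ∷ a) b (λ ()))) ⟩
    F [] (x ∷ w) + 0ℚ                                 ≡⟨ ℚ.+-identityʳ _ ⟩
    F [] (x ∷ w)                                      ∎

  -- Only the splitting with empty right part can make a difference. The boundary terms stand
  -- crosswise to avoid subtraction; the one for the full list is the unknown in the proof that
  -- braces are primitive.
  ∑split-transfer : ∀ w {F G : List A → List A → ℚ} → (∀ a b → b ≢ [] → a ++ b ≡ w → F a b ≡ G a b) →
                    ∑split w F + G w [] ≡ ∑split w G + F w []
  ∑split-transfer []      {F} {G} h =
    trans (cong (_+ G [] []) (∑split-[] F)) (trans (ℚ.+-comm (F [] []) (G [] [])) (cong (_+ F [] []) (sym (∑split-[] G))))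
  ∑split-transfer (x ∷ w) {F} {G} h = begin
    ∑split (x ∷ w) F + G (x ∷ w) []
      ≡⟨ cong (_+ G (x ∷ w) []) (∑split-∷ x w F) ⟩
    (F [] (x ∷ w) + ∑split w (λ a b → F (x ∷ a) b)) + G (x ∷ w) []
      ≡⟨ ℚ.+-assoc (F [] (x ∷ w)) (∑split w (λ a b → F (x ∷ a) b)) (G (x ∷ w) []) ⟩
    F [] (x ∷ w) + (∑split w (λ a b → F (x ∷ a) b) + G (x ∷ w) [])
      ≡⟨ cong₂ _+_ (h [] (x ∷ w) (λ ()) refl) (∑split-transfer w (λ a b ne e → h (x ∷ a) b ne (cong (x ∷_) e))) ⟩
    G [] (x ∷ w) + (∑split w (λ a b → G (x ∷ a) b) + F (x ∷ w) [])
      ≡⟨ ℚ.+-assoc (G [] (x ∷ w)) (∑split w (λ a b → G (x ∷ a) b)) (F (x ∷ w) []) ⟨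
    (G [] (x ∷ w) + ∑split w (λ a b → G (x ∷ a) b)) + F (x ∷ w) []
      ≡⟨ cong (_+ F (x ∷ w) []) (∑split-∷ x w G) ⟨
    ∑split (x ∷ w) G + F (x ∷ w) [] ∎

  ∑split-last : ∀ w {F : List A → List A → ℚ} → (∀ a b → b ≢ [] → a ++ b ≡ w → F a b ≡ 0ℚ) → ∑split w F ≡ F w []
  ∑split-last w {F} h = begin
    ∑split w F                             ≡⟨ ℚ.+-identityʳ _ ⟨
    ∑split w F + 0ℚ                        ≡⟨ ∑split-transfer w h ⟩
    ∑split w (λ _ _ → 0ℚ) + F w []         ≡⟨ cong (_+ F w []) (∑split-zero w (λ _ _ _ → refl)) ⟩
    0ℚ + F w []                            ≡⟨ ℚ.+-identityˡ _ ⟩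
    F w []                                 ∎

  ∑-upTo-∷ : ∀ n (G : ℕ → ℚ) → ∑ (upTo (suc n)) G ≡ G 0 + ∑ (upTo n) (G ∘ suc)
  ∑-upTo-∷ n G = cong (G 0 +_) (trans (cong (λ l → ∑ l G) (sym (List.map-upTo suc n))) (∑-map suc (upTo n) G))

  ∑-take-drop : ∀ w (F : List A → List A → ℚ) →
                ∑ (upTo (suc (length w))) (λ i → F (take i w) (drop i w)) ≡ ∑split w F
  ∑-take-drop []      F = trans (ℚ.+-identityʳ (F [] [])) (sym (∑split-[] F))
  ∑-take-drop (x ∷ w) F = begin
    ∑ (upTo (suc (suc (length w)))) (λ i → F (take i (x ∷ w)) (drop i (x ∷ w)))
      ≡⟨ ∑-upTo-∷ (suc (length w)) (λ i → F (take i (x ∷ w)) (drop i (x ∷ w))) ⟩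
    F [] (x ∷ w) + ∑ (upTo (suc (length w))) (λ i → F (x ∷ take i w) (drop i w))
      ≡⟨ cong (F [] (x ∷ w) +_) (∑-take-drop w (λ a b → F (x ∷ a) b)) ⟩
    F [] (x ∷ w) + ∑split w (λ a b → F (x ∷ a) b)
      ≡⟨ ∑split-∷ x w F ⟨
    ∑split (x ∷ w) F ∎

  shuffles : List A → List A → List (List A)
  shuffles []      q       = q ∷ []
  shuffles (x ∷ p) []      = (x ∷ p) ∷ []
  shuffles (x ∷ p) (y ∷ q) = map (x ∷_) (shuffles p (y ∷ q)) ++ map (y ∷_) (shuffles (x ∷ p) q)

  shuffles-interleaving : ∀ p q {u} → u ∈ shuffles p q → Interleaving p q u
  shuffles-interleaving []      q       (here refl) = right q
    where
    right : ∀ q → Interleaving [] q q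
    right []      = []
    right (x ∷ q) = consʳ (right q)
  shuffles-interleaving (x ∷ p) []      (here refl) = left (x ∷ p)
    where
    left : ∀ p → Interleaving p [] p
    left []      = []
    left (x ∷ p) = consˡ (left p)
  shuffles-interleaving (x ∷ p) (y ∷ q) u∈ with ∈.∈-++⁻ (map (x ∷_) (shuffles p (y ∷ q))) u∈
  ... | inj₁ v∈ with ∈.∈-map⁻ _ v∈
  ...   | _ , w∈ , refl = consˡ (shuffles-interleaving p (y ∷ q) w∈)
  shuffles-interleaving (x ∷ p) (y ∷ q) u∈ | inj₂ v∈ with ∈.∈-map⁻ _ v∈
  ...   | _ , w∈ , refl = consʳ (shuffles-interleaving (x ∷ p) q w∈)

  opaque

    ∑sh : List A → List A → (List A → ℚ) → ℚ
    ∑sh p q = ∑ (shuffles p q)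

    ∑sh-∷ : ∀ x p y q (F : List A → ℚ) →
            ∑sh (x ∷ p) (y ∷ q) F ≡ ∑sh p (y ∷ q) (F ∘ (x ∷_)) + ∑sh (x ∷ p) q (F ∘ (y ∷_))
    ∑sh-∷ x p y q F = trans (∑-++ (map (x ∷_) (shuffles p (y ∷ q))) _ F)
      (cong₂ _+_ (∑-map (x ∷_) (shuffles p (y ∷ q)) F) (∑-map (y ∷_) (shuffles (x ∷ p) q) F))

    ∑sh-[]ˡ : ∀ q (F : List A → ℚ) → ∑sh [] q F ≡ F q
    ∑sh-[]ˡ q F = ℚ.+-identityʳ (F q)

    ∑sh-[]ʳ : ∀ p (F : List A → ℚ) → ∑sh p [] F ≡ F p
    ∑sh-[]ʳ []      F = ℚ.+-identityʳ (F [])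
    ∑sh-[]ʳ (x ∷ p) F = ℚ.+-identityʳ (F (x ∷ p))

    ∑sh-cong-≗ : ∀ p q {F G : List A → ℚ} → (∀ u → F u ≡ G u) → ∑sh p q F ≡ ∑sh p q G
    ∑sh-cong-≗ p q h = ∑-cong (shuffles p q) h

    ∑sh-cong : ∀ p q {F G : List A → ℚ} → (∀ u → Interleaving p q u → F u ≡ G u) → ∑sh p q F ≡ ∑sh p q G
    ∑sh-cong p q h = ∑-cong-∈ (shuffles p q) (λ u u∈ → h u (shuffles-interleaving p q u∈))

    ∑sh-zero : ∀ p q {F : List A → ℚ} → (∀ u → Interleaving p q u → F u ≡ 0ℚ) → ∑sh p q F ≡ 0ℚ
    ∑sh-zero p q h = ∑-zero-∈ (shuffles p q) (λ u u∈ → h u (shuffles-interleaving p q u∈))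

    ∑sh-+ : ∀ p q (F G : List A → ℚ) → ∑sh p q (λ u → F u + G u) ≡ ∑sh p q F + ∑sh p q G
    ∑sh-+ p q F G = ∑-+ (shuffles p q) F G

    ∑sh-*ˡ : ∀ p q c (F : List A → ℚ) → ∑sh p q (λ u → c * F u) ≡ c * ∑sh p q F
    ∑sh-*ˡ p q c F = ∑-*ˡ (shuffles p q) c F

    ∑sh-∑ : ∀ {B : Set} p q (ys : List B) (F : List A → B → ℚ) →
            ∑sh p q (λ u → ∑ ys (F u)) ≡ ∑ ys (λ y → ∑sh p q (λ u → F u y))
    ∑sh-∑ p q ys F = ∑-swap (shuffles p q) ys F

    ∑sh-product : ∀ p q p′ q′ (F G : List A → ℚ) →
                  ∑sh p q (λ a → ∑sh p′ q′ (λ b → F a * G b)) ≡ ∑sh p q F * ∑sh p′ q′ G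
    ∑sh-product p q p′ q′ F G = ∑-product (shuffles p q) (shuffles p′ q′) F G

  ∑sh-comm : ∀ p q (F : List A → ℚ) → ∑sh p q F ≡ ∑sh q p F
  ∑sh-comm []      q       F = trans (∑sh-[]ˡ q F) (sym (∑sh-[]ʳ q F))
  ∑sh-comm (x ∷ p) []      F = trans (∑sh-[]ʳ (x ∷ p) F) (sym (∑sh-[]ˡ (x ∷ p) F))
  ∑sh-comm (x ∷ p) (y ∷ q) F = begin
    ∑sh (x ∷ p) (y ∷ q) F
      ≡⟨ ∑sh-∷ x p y q F ⟩
    ∑sh p (y ∷ q) (F ∘ (x ∷_)) + ∑sh (x ∷ p) q (F ∘ (y ∷_))
      ≡⟨ cong₂ _+_ (∑sh-comm p (y ∷ q) _) (∑sh-comm (x ∷ p) q _) ⟩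
    ∑sh (y ∷ q) p (F ∘ (x ∷_)) + ∑sh q (x ∷ p) (F ∘ (y ∷_))
      ≡⟨ ℚ.+-comm (∑sh (y ∷ q) p (F ∘ (x ∷_))) _ ⟩
    ∑sh q (x ∷ p) (F ∘ (y ∷_)) + ∑sh (y ∷ q) p (F ∘ (x ∷_))
      ≡⟨ ∑sh-∷ y q x p F ⟨
    ∑sh (y ∷ q) (x ∷ p) F ∎

  -- For three nonempty words both sides are sorted by the word that supplies the first letter, and
  -- the induction applies to each of the three groups.
  ∑sh-assoc : ∀ a b c (F : List A → ℚ) →
              ∑sh b c (λ u → ∑sh a u F) ≡ ∑sh a b (λ v → ∑sh v c F)
  ∑sh-assoc [] b c F = begin
    ∑sh b c (λ u → ∑sh [] u F)  ≡⟨ ∑sh-cong-≗ b c (λ u → ∑sh-[]ˡ u F) ⟩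
    ∑sh b c F                   ≡⟨ ∑sh-[]ˡ b _ ⟨
    ∑sh [] b (λ v → ∑sh v c F)  ∎
  ∑sh-assoc (x ∷ a) [] c F = trans (∑sh-[]ˡ c _) (sym (∑sh-[]ʳ (x ∷ a) _))
  ∑sh-assoc (x ∷ a) (y ∷ b) [] F = begin
    ∑sh (y ∷ b) [] (λ u → ∑sh (x ∷ a) u F)         ≡⟨ ∑sh-[]ʳ (y ∷ b) _ ⟩
    ∑sh (x ∷ a) (y ∷ b) F                          ≡⟨ ∑sh-cong-≗ (x ∷ a) (y ∷ b) (λ v → sym (∑sh-[]ʳ v F)) ⟩
    ∑sh (x ∷ a) (y ∷ b) (λ v → ∑sh v [] F)         ∎
  ∑sh-assoc a′@(x ∷ a) b′@(y ∷ b) c′@(z ∷ c) F = begin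
    ∑sh b′ c′ (λ u → ∑sh a′ u F)
      ≡⟨ ∑sh-∷ y b z c _ ⟩
    ∑sh b c′ (λ u → ∑sh a′ (y ∷ u) F) + ∑sh b′ c (λ u → ∑sh a′ (z ∷ u) F)
      ≡⟨ cong₂ _+_ (trans (∑sh-cong-≗ b c′ (λ u → ∑sh-∷ x a y u F)) (∑sh-+ b c′ _ _))
                   (trans (∑sh-cong-≗ b′ c (λ u → ∑sh-∷ x a z u F)) (∑sh-+ b′ c _ _)) ⟩
    (X₁ + Y) + (X₂ + Z)
      ≡⟨ solve 4 (λ x₁ y x₂ z → (x₁ :+ y) :+ (x₂ :+ z) := (x₁ :+ x₂) :+ (y :+ z)) refl X₁ Y X₂ Z ⟩
    (X₁ + X₂) + (Y + Z)
      ≡⟨ cong₂ _+_ (trans (sym (∑sh-∷ y b z c _)) (∑sh-assoc a b′ c′ (F ∘ (x ∷_))))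
           (cong₂ _+_ (∑sh-assoc a′ b c′ (F ∘ (y ∷_))) (trans (∑sh-assoc a′ b′ c (F ∘ (z ∷_))) (∑sh-∷ x a y b _))) ⟩
    X′ + (Y′ + (Z₁ + Z₂))
      ≡⟨ solve 4 (λ x y z₁ z₂ → x :+ (y :+ (z₁ :+ z₂)) := (x :+ z₁) :+ (y :+ z₂)) refl X′ Y′ Z₁ Z₂ ⟩
    (X′ + Z₁) + (Y′ + Z₂)
      ≡⟨ cong₂ _+_ (trans (∑sh-cong-≗ a b′ (λ v → ∑sh-∷ x v z c F)) (∑sh-+ a b′ _ _))
                   (trans (∑sh-cong-≗ a′ b (λ v → ∑sh-∷ y v z c F)) (∑sh-+ a′ b _ _)) ⟨
    ∑sh a b′ (λ v → ∑sh (x ∷ v) c′ F) + ∑sh a′ b (λ v → ∑sh (y ∷ v) c′ F)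
      ≡⟨ ∑sh-∷ x a y b _ ⟨
    ∑sh a′ b′ (λ v → ∑sh v c′ F) ∎
    where
    open +-*-Solver
    X₁ = ∑sh b c′ (λ u → ∑sh a (y ∷ u) (F ∘ (x ∷_)))
    X₂ = ∑sh b′ c (λ u → ∑sh a (z ∷ u) (F ∘ (x ∷_)))
    Y  = ∑sh b c′ (λ u → ∑sh a′ u (F ∘ (y ∷_)))
    Z  = ∑sh b′ c (λ u → ∑sh a′ u (F ∘ (z ∷_)))
    X′ = ∑sh a b′ (λ v → ∑sh v c′ (F ∘ (x ∷_)))
    Y′ = ∑sh a′ b (λ v → ∑sh v c′ (F ∘ (y ∷_)))
    Z₁ = ∑sh a b′ (λ v → ∑sh (x ∷ v) c (F ∘ (z ∷_)))
    Z₂ = ∑sh a′ b (λ v → ∑sh (y ∷ v) c (F ∘ (z ∷_)))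

  private
    pairs : (List A → List A → ℚ) → List A → List A → List A → List A → ℚ
    pairs F p₁ p₂ q₁ q₂ = ∑sh p₁ q₁ (λ a → ∑sh p₂ q₂ (F a))

  -- The compatibility axiom of the shuffle bialgebra: cutting a shuffle amounts to cutting both
  -- words and shuffling the prefixes and the suffixes separately.
  ∑sh-split : ∀ p q (F : List A → List A → ℚ) →
              ∑sh p q (λ u → ∑split u F) ≡
              ∑split p (λ p₁ p₂ → ∑split q (λ q₁ q₂ → ∑sh p₁ q₁ (λ a → ∑sh p₂ q₂ (F a))))
  ∑sh-split [] q F = begin
    ∑sh [] q (λ u → ∑split u F)   ≡⟨ ∑sh-[]ˡ q _ ⟩
    ∑split q F                    ≡⟨ ∑split-cong q (λ q₁ q₂ _ → sym (trans (∑sh-[]ˡ q₁ _) (∑sh-[]ˡ q₂ _))) ⟩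
    ∑split q (pairs F [] [])      ≡⟨ ∑split-[] _ ⟨
    ∑split [] (λ p₁ p₂ → ∑split q (pairs F p₁ p₂)) ∎
  ∑sh-split p′@(x ∷ p) [] F = begin
    ∑sh p′ [] (λ u → ∑split u F)   ≡⟨ ∑sh-[]ʳ p′ _ ⟩
    ∑split p′ F                    ≡⟨ ∑split-cong p′ (λ p₁ p₂ _ →
                                      sym (trans (∑split-[] _) (trans (∑sh-[]ʳ p₁ _) (∑sh-[]ʳ p₂ _)))) ⟩
    ∑split p′ (λ p₁ p₂ → ∑split [] (pairs F p₁ p₂)) ∎
  ∑sh-split p′@(x ∷ p) q′@(y ∷ q) F = begin
    ∑sh p′ q′ (λ u → ∑split u F)
      ≡⟨ ∑sh-∷ x p y q _ ⟩
    ∑sh p q′ (λ u → ∑split (x ∷ u) F) + ∑sh p′ q (λ u → ∑split (y ∷ u) F)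
      ≡⟨ cong₂ _+_ (trans (∑sh-cong-≗ p q′ (λ u → ∑split-∷ x u F)) (∑sh-+ p q′ _ _))
                   (trans (∑sh-cong-≗ p′ q (λ u → ∑split-∷ y u F)) (∑sh-+ p′ q _ _)) ⟩
    (∑sh p q′ (λ u → F [] (x ∷ u)) + ∑sh p q′ (λ u → ∑split u Fx)) + (∑sh p′ q (λ u → F [] (y ∷ u)) + ∑sh p′ q (λ u → ∑split u Fy))
      ≡⟨ +-interchange (∑sh p q′ (λ u → F [] (x ∷ u))) _ _ _ ⟩
    (∑sh p q′ (λ u → F [] (x ∷ u)) + ∑sh p′ q (λ u → F [] (y ∷ u))) + (∑sh p q′ (λ u → ∑split u Fx) + ∑sh p′ q (λ u → ∑split u Fy))
      ≡⟨ cong₂ _+_ (trans (sym (∑sh-∷ x p y q _)) (sym (∑sh-[]ˡ [] _)))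
           (cong₂ _+_ (trans (∑sh-split p q′ Fx) (trans (∑split-cong p (λ p₁ p₂ _ → ∑split-∷ y q _)) (∑split-+ p _ _)))
                      (trans (∑sh-split p′ q Fy) (∑split-∷ x p _))) ⟩
    E + ((C + D₁) + (B + D₂))
      ≡⟨ solve 5 (λ e c d₁ b d₂ → e :+ ((c :+ d₁) :+ (b :+ d₂)) := (e :+ b) :+ (c :+ (d₁ :+ d₂))) refl E C D₁ B D₂ ⟩
    (E + B) + (C + (D₁ + D₂))
      ≡⟨ cong₂ _+_ (trans (cong (E +_) B≡) (sym (∑split-∷ y q (pairs F [] p′)))) (cong₂ _+_ C≡ D≡) ⟩
    ∑split q′ (pairs F [] p′) + (∑split p (λ p₁ p₂ → pairs F (x ∷ p₁) p₂ [] q′)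
                                + ∑split p (λ p₁ p₂ → ∑split q (λ q₁ q₂ → pairs F (x ∷ p₁) p₂ (y ∷ q₁) q₂)))
      ≡⟨ cong (∑split q′ (pairs F [] p′) +_)
           (sym (trans (∑split-cong p (λ p₁ p₂ _ → ∑split-∷ y q (pairs F (x ∷ p₁) p₂))) (∑split-+ p _ _))) ⟩
    ∑split q′ (pairs F [] p′) + ∑split p (λ p₁ p₂ → ∑split q′ (pairs F (x ∷ p₁) p₂))
      ≡⟨ ∑split-∷ x p _ ⟨
    ∑split p′ (λ p₁ p₂ → ∑split q′ (pairs F p₁ p₂)) ∎
    where
    open +-*-Solver
    Fx = λ a → F (x ∷ a)
    Fy = λ a → F (y ∷ a)
    -- `E` collects the cuts with empty prefix. In `C` and `D₁` the prefix starts with `x`, without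
    -- and with letters of `q′`; in `B` and `D₂` it starts with `y`, without and with letters of
    -- `p′`.
    E  = pairs F [] p′ [] q′
    C  = ∑split p (λ p₁ p₂ → pairs Fx p₁ p₂ [] q′)
    D₁ = ∑split p (λ p₁ p₂ → ∑split q (λ q₁ q₂ → pairs Fx p₁ p₂ (y ∷ q₁) q₂))
    B  = ∑split q (pairs Fy [] p′)
    D₂ = ∑split p (λ p₁ p₂ → ∑split q (pairs Fy (x ∷ p₁) p₂))
    B≡ : B ≡ ∑split q (λ q₁ q₂ → pairs F [] p′ (y ∷ q₁) q₂)
    B≡ = ∑split-cong q (λ q₁ q₂ _ → trans (∑sh-[]ˡ q₁ _) (sym (∑sh-[]ˡ (y ∷ q₁) _)))
    C≡ : C ≡ ∑split p (λ p₁ p₂ → pairs F (x ∷ p₁) p₂ [] q′)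
    C≡ = ∑split-cong p (λ p₁ p₂ _ → trans (∑sh-[]ʳ p₁ _) (sym (∑sh-[]ʳ (x ∷ p₁) _)))
    D≡ : D₁ + D₂ ≡ ∑split p (λ p₁ p₂ → ∑split q (λ q₁ q₂ → pairs F (x ∷ p₁) p₂ (y ∷ q₁) q₂))
    D≡ = trans (sym (∑split-+ p _ _)) (∑split-cong p (λ p₁ p₂ _ →
           trans (sym (∑split-+ q _ _)) (∑split-cong q (λ q₁ q₂ _ → sym (∑sh-∷ x p₁ y q₁ _)))))

  -- The fold forgets its accumulator at every letter, so the value is `P` at the last letter, and
  -- the default only for the empty list.
  lastᵇ : (A → Bool) → Bool → List A → Bool
  lastᵇ P = foldl (λ _ z → P z)

  lastᵇ-++ : ∀ P d d′ a b → b ≢ [] → lastᵇ P d (a ++ b) ≡ lastᵇ P d′ b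
  lastᵇ-++ P d d′ a       []      ne = ⊥-elim (ne refl)
  lastᵇ-++ P d d′ []      (y ∷ b) ne = refl
  lastᵇ-++ P d d′ (x ∷ a) (y ∷ b) ne = lastᵇ-++ P (P x) d′ a (y ∷ b) ne

  lastᵇ-∷ʳ : ∀ P d a x → lastᵇ P d (a ∷ʳ x) ≡ P x
  lastᵇ-∷ʳ P d a x = lastᵇ-++ P d d a (x ∷ []) (λ ())

  lastᵇ-All : ∀ P d b w → All (λ x → P x ≡ b) w → d ≡ b → lastᵇ P d w ≡ b
  lastᵇ-All P d b []      []       e = e
  lastᵇ-All P d b (x ∷ w) (px ∷ h) e = lastᵇ-All P (P x) b w h px

  -- A shuffle ends either with `x` or with a letter of `c`, and `P` tells the two apart. In the
  -- first case deleting `x` leaves an arbitrary shuffle of `p` and `c`; letters of `p` are never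
  -- last, so `P` is unrestricted on them.
  ∑sh-lastˡ : ∀ (P : A → Bool) d p x c (F : List A → ℚ) → P x ≡ true → All (λ z → P z ≡ false) c →
              ∑sh (p ∷ʳ x) c (λ u → 𝟙 (lastᵇ P d u) * F u) ≡ ∑sh p c (λ u → F (u ∷ʳ x))
  ∑sh-lastˡ P d [] x [] F px h = begin
    ∑sh (x ∷ []) [] (λ u → 𝟙 (lastᵇ P d u) * F u)   ≡⟨ ∑sh-[]ʳ (x ∷ []) _ ⟩
    𝟙 (P x) * F (x ∷ [])                            ≡⟨ cong (λ b → 𝟙 b * F (x ∷ [])) px ⟩
    1ℚ * F (x ∷ [])                                 ≡⟨ ℚ.*-identityˡ _ ⟩
    F (x ∷ [])                                      ≡⟨ ∑sh-[]ˡ [] (λ u → F (u ∷ʳ x)) ⟨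
    ∑sh [] [] (λ u → F (u ∷ʳ x))                    ∎
  ∑sh-lastˡ P d [] x (y ∷ c) F px (py ∷ h) = begin
    ∑sh (x ∷ []) (y ∷ c) (λ u → 𝟙 (lastᵇ P d u) * F u)
      ≡⟨ ∑sh-∷ x [] y c _ ⟩
    ∑sh [] (y ∷ c) (λ u → 𝟙 (lastᵇ P (P x) u) * F (x ∷ u)) + ∑sh (x ∷ []) c (λ u → 𝟙 (lastᵇ P (P y) u) * F (y ∷ u))
      ≡⟨ cong₂ _+_ (trans (∑sh-[]ˡ (y ∷ c) _) (*-zeroˡ-≡ (F (x ∷ y ∷ c)) (cong 𝟙 (lastᵇ-All P (P y) false c h py))))
                   (∑sh-lastˡ P (P y) [] x c (F ∘ (y ∷_)) px h) ⟩
    0ℚ + ∑sh [] c (λ u → F (y ∷ (u ∷ʳ x)))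
      ≡⟨ ℚ.+-identityˡ _ ⟩
    ∑sh [] c (λ u → F (y ∷ (u ∷ʳ x)))
      ≡⟨ trans (∑sh-[]ˡ c _) (sym (∑sh-[]ˡ (y ∷ c) (λ u → F (u ∷ʳ x)))) ⟩
    ∑sh [] (y ∷ c) (λ u → F (u ∷ʳ x)) ∎
  ∑sh-lastˡ P d (z ∷ p) x [] F px h = begin
    ∑sh ((z ∷ p) ∷ʳ x) [] (λ u → 𝟙 (lastᵇ P d u) * F u)   ≡⟨ ∑sh-[]ʳ ((z ∷ p) ∷ʳ x) _ ⟩
    𝟙 (lastᵇ P d ((z ∷ p) ∷ʳ x)) * F ((z ∷ p) ∷ʳ x)       ≡⟨ cong (λ b → 𝟙 b * F ((z ∷ p) ∷ʳ x)) (trans (lastᵇ-∷ʳ P d (z ∷ p) x) px) ⟩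
    1ℚ * F ((z ∷ p) ∷ʳ x)                                 ≡⟨ ℚ.*-identityˡ _ ⟩
    F ((z ∷ p) ∷ʳ x)                                      ≡⟨ ∑sh-[]ʳ (z ∷ p) (λ u → F (u ∷ʳ x)) ⟨
    ∑sh (z ∷ p) [] (λ u → F (u ∷ʳ x))                     ∎
  ∑sh-lastˡ P d (z ∷ p) x (y ∷ c) F px (py ∷ h) = begin
    ∑sh ((z ∷ p) ∷ʳ x) (y ∷ c) (λ u → 𝟙 (lastᵇ P d u) * F u)
      ≡⟨ ∑sh-∷ z (p ∷ʳ x) y c _ ⟩
    ∑sh (p ∷ʳ x) (y ∷ c) (λ u → 𝟙 (lastᵇ P (P z) u) * F (z ∷ u)) + ∑sh ((z ∷ p) ∷ʳ x) c (λ u → 𝟙 (lastᵇ P (P y) u) * F (y ∷ u))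
      ≡⟨ cong₂ _+_ (∑sh-lastˡ P (P z) p x (y ∷ c) (F ∘ (z ∷_)) px (py ∷ h)) (∑sh-lastˡ P (P y) (z ∷ p) x c (F ∘ (y ∷_)) px h) ⟩
    ∑sh p (y ∷ c) (λ u → F (z ∷ (u ∷ʳ x))) + ∑sh (z ∷ p) c (λ u → F (y ∷ (u ∷ʳ x)))
      ≡⟨ ∑sh-∷ z p y c (λ u → F (u ∷ʳ x)) ⟨
    ∑sh (z ∷ p) (y ∷ c) (λ u → F (u ∷ʳ x)) ∎

  ∑sh-lastʳ : ∀ (P : A → Bool) d p c x (F : List A → ℚ) → P x ≡ true → All (λ z → P z ≡ false) p →
              ∑sh p (c ∷ʳ x) (λ u → 𝟙 (lastᵇ P d u) * F u) ≡ ∑sh p c (λ u → F (u ∷ʳ x))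
  ∑sh-lastʳ P d p c x F px h =
    trans (∑sh-comm p (c ∷ʳ x) _) (trans (∑sh-lastˡ P d c x p F px h) (∑sh-comm c p _))

module _ {A B : Set} where

  ∑split-map : ∀ (h : A → B) w (F : List B → List B → ℚ) →
               ∑split (map h w) F ≡ ∑split w (λ a b → F (map h a) (map h b))
  ∑split-map h []      F = trans (∑split-[] F) (sym (∑split-[] _))
  ∑split-map h (x ∷ w) F = begin
    ∑split (map h (x ∷ w)) F
      ≡⟨ ∑split-∷ (h x) (map h w) F ⟩
    F [] (map h (x ∷ w)) + ∑split (map h w) (λ a b → F (h x ∷ a) b)
      ≡⟨ cong (F [] (map h (x ∷ w)) +_) (∑split-map h w (λ a b → F (h x ∷ a) b)) ⟩
    F [] (map h (x ∷ w)) + ∑split w (λ a b → F (map h (x ∷ a)) (map h b))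
      ≡⟨ ∑split-∷ x w _ ⟨
    ∑split (x ∷ w) (λ a b → F (map h a) (map h b)) ∎

  ∑sh-map : ∀ (h : A → B) p q (F : List B → ℚ) → ∑sh (map h p) (map h q) F ≡ ∑sh p q (F ∘ map h)
  ∑sh-map h []      q       F = trans (∑sh-[]ˡ (map h q) F) (sym (∑sh-[]ˡ q _))
  ∑sh-map h (x ∷ p) []      F = trans (∑sh-[]ʳ (map h (x ∷ p)) F) (sym (∑sh-[]ʳ (x ∷ p) _))
  ∑sh-map h (x ∷ p) (y ∷ q) F = begin
    ∑sh (map h (x ∷ p)) (map h (y ∷ q)) F
      ≡⟨ ∑sh-∷ (h x) (map h p) (h y) (map h q) F ⟩
    ∑sh (map h p) (map h (y ∷ q)) (F ∘ (h x ∷_)) + ∑sh (map h (x ∷ p)) (map h q) (F ∘ (h y ∷_))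
      ≡⟨ cong₂ _+_ (∑sh-map h p (y ∷ q) _) (∑sh-map h (x ∷ p) q _) ⟩
    ∑sh p (y ∷ q) (F ∘ map h ∘ (x ∷_)) + ∑sh (x ∷ p) q (F ∘ map h ∘ (y ∷_))
      ≡⟨ ∑sh-∷ x p y q (F ∘ map h) ⟨
    ∑sh (x ∷ p) (y ∷ q) (F ∘ map h) ∎

-- Letters, ranks and packing

bool-ext : ∀ {a b : Bool} → (a ≡ true → b ≡ true) → (b ≡ true → a ≡ true) → a ≡ b
bool-ext {true}  {b}     f g = sym (f refl)
bool-ext {false} {true}  f g = g refl
bool-ext {false} {false} f g = refl

bool-dec : ∀ b → b ≡ true ⊎ b ≡ false
bool-dec true  = inj₁ refl
bool-dec false = inj₂ refl

≢true⇒false : ∀ {b} → b ≢ true → b ≡ false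
≢true⇒false {true}  h = ⊥-elim (h refl)
≢true⇒false {false} h = refl

true≢false : ∀ {b} → b ≡ true → b ≡ false → ⊥
true≢false refl ()

∧-true⁺ : ∀ {a b} → a ≡ true → b ≡ true → a ∧ b ≡ true
∧-true⁺ refl refl = refl

∧-true⁻ˡ : ∀ {a b} → a ∧ b ≡ true → a ≡ true
∧-true⁻ˡ {true} h = refl

∧-true⁻ʳ : ∀ {a b} → a ∧ b ≡ true → b ≡ true
∧-true⁻ʳ {true} h = h

≤ᵇ-true : ∀ {m n} → m ≤ n → (m ≤ᵇ n) ≡ true
≤ᵇ-true le = Equivalence.to T-≡ (ℕ.≤⇒≤ᵇ le)

≤ᵇ-sound : ∀ {m n} → (m ≤ᵇ n) ≡ true → m ≤ n
≤ᵇ-sound {m} {n} e = ℕ.≤ᵇ⇒≤ m n (Equivalence.from T-≡ e)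

≤ᵇ-false : ∀ {m n} → n < m → (m ≤ᵇ n) ≡ false
≤ᵇ-false lt = ≢true⇒false (λ e → ℕ.<⇒≱ lt (≤ᵇ-sound e))

<ᵇ-true : ∀ {m n} → m < n → (m <ᵇ n) ≡ true
<ᵇ-true lt = Equivalence.to T-≡ (ℕ.<⇒<ᵇ lt)

<ᵇ-sound : ∀ {m n} → (m <ᵇ n) ≡ true → m < n
<ᵇ-sound {m} {n} e = ℕ.<ᵇ⇒< m n (Equivalence.from T-≡ e)

<ᵇ-false : ∀ {m n} → n ≤ m → (m <ᵇ n) ≡ false
<ᵇ-false le = ≢true⇒false (λ e → ℕ.≤⇒≯ le (<ᵇ-sound e))

allᵇ-sound : ∀ {A : Set} (p : A → Bool) xs → allᵇ p xs ≡ true → All (λ x → p x ≡ true) xs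
allᵇ-sound p []       h = []
allᵇ-sound p (x ∷ xs) h = ∧-true⁻ˡ h ∷ allᵇ-sound p xs (∧-true⁻ʳ {p x} h)

allᵇ-complete : ∀ {A : Set} (p : A → Bool) xs → All (λ x → p x ≡ true) xs → allᵇ p xs ≡ true
allᵇ-complete p []       []       = refl
allᵇ-complete p (x ∷ xs) (h ∷ hs) = ∧-true⁺ h (allᵇ-complete p xs hs)

≡ᵇ-refl : ∀ x → (x ℕ.≡ᵇ x) ≡ true
≡ᵇ-refl x = Equivalence.to T-≡ (ℕ.≡⇒≡ᵇ x x refl)

≡ᵇ-sound : ∀ x y → (x ℕ.≡ᵇ y) ≡ true → x ≡ y
≡ᵇ-sound x y e = ℕ.≡ᵇ⇒≡ x y (Equivalence.from T-≡ e)

≡ᵇ-false : ∀ {x y} → x ≢ y → (x ℕ.≡ᵇ y) ≡ false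
≡ᵇ-false {x} {y} ne = ≢true⇒false (ne ∘ ≡ᵇ-sound x y)

occurs-sound : ∀ {x} w → occurs x w ≡ true → x ∈ w
occurs-sound {x} (y ∷ w) h with x ℕ.≡ᵇ y in e
... | true  = here (≡ᵇ-sound x y e)
... | false = there (occurs-sound w h)

occurs-complete : ∀ {x} w → x ∈ w → occurs x w ≡ true
occurs-complete {x} (y ∷ w) (here refl) = cong (_∨ occurs x w) (≡ᵇ-refl x)
occurs-complete {x} (y ∷ w) (there x∈)  with x ℕ.≡ᵇ y
... | true  = refl
... | false = occurs-complete w x∈

occurs-false : ∀ {x} w → x ∉ w → occurs x w ≡ false
occurs-false w x∉ = ≢true⇒false (x∉ ∘ occurs-sound w)

disjoint-sound : ∀ u v → disjointW u v ≡ true → ∀ {x} → x ∈ u → x ∉ v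
disjoint-sound u v h {x} x∈u x∈v with occurs x v | occurs-complete v x∈v | All.lookup (allᵇ-sound _ u h) x∈u
... | .true | refl | ()

disjoint-complete : ∀ u v → (∀ {x} → x ∈ u → x ∉ v) → disjointW u v ≡ true
disjoint-complete u v h = allᵇ-complete _ u (All.tabulate (λ {x} x∈ → cong not (occurs-false v (h x∈))))

Pos : Word → Set
Pos = All (1 ≤_)

isPacked-sound : ∀ w → isPacked w ≡ true → Packed w
isPacked-sound w h = All.map (λ {x} → ≤ᵇ-sound {1} {x}) (allᵇ-sound _ w (∧-true⁻ˡ h)) , full
  where
  full : ∀ i → 1 ≤ i → i ≤ maxW w → i ∈ w
  full (suc i) _ le = occurs-sound w
    (All.lookup (allᵇ-sound _ _ (∧-true⁻ʳ {allᵇ (1 ≤ᵇ_) w} h)) (∈.∈-applyUpTo⁺ suc le))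

isPacked-complete : ∀ w → Packed w → isPacked w ≡ true
isPacked-complete w (pos , full) = ∧-true⁺ (allᵇ-complete _ w (All.map (λ {x} → ≤ᵇ-true {1} {x}) pos))
  (allᵇ-complete (λ i → occurs i w) (applyUpTo suc (maxW w)) (All.tabulate λ i∈ → case ∈.∈-applyUpTo⁻ suc i∈ of λ
    { (j , j< , refl) → occurs-complete w (full (suc j) (s≤s z≤n) j<) }))

packed? : ∀ w → Dec (Packed w)
packed? w with isPacked w in e
... | true  = yes (isPacked-sound w e)
... | false = no (λ h → true≢false (isPacked-complete w h) e)

[]-packed : Packed []
[]-packed = [] , λ { zero () _ ; (suc i) _ () }

∈⇒≤maxW : ∀ w {x} → x ∈ w → x ≤ maxW w
∈⇒≤maxW (y ∷ w) (here refl) = ℕ.m≤m⊔n y (maxW w)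
∈⇒≤maxW (y ∷ w) (there x∈)  = ℕ.≤-trans (∈⇒≤maxW w x∈) (ℕ.m≤n⊔m y (maxW w))

maxW-lub : ∀ w {m} → (∀ {x} → x ∈ w → x ≤ m) → maxW w ≤ m
maxW-lub []      h = z≤n
maxW-lub (y ∷ w) h = ℕ.⊔-lub (h (here refl)) (maxW-lub w (h ∘ there))

maxW-∷-∈ : ∀ y w → maxW (y ∷ w) ∈ y ∷ w
maxW-∷-∈ y []      = here (ℕ.⊔-identityʳ y)
maxW-∷-∈ y (z ∷ w) with ℕ.⊔-sel y (maxW (z ∷ w))
... | inj₁ e = here e
... | inj₂ e = there (subst (_∈ z ∷ w) (sym e) (maxW-∷-∈ z w))

maxW-∈ : ∀ w → w ≢ [] → maxW w ∈ w
maxW-∈ []      ne = ⊥-elim (ne refl)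
maxW-∈ (y ∷ w) ne = maxW-∷-∈ y w

maxW-++ : ∀ u v → maxW (u ++ v) ≡ maxW u ⊔ maxW v
maxW-++ []      v = refl
maxW-++ (x ∷ u) v = trans (cong (x ⊔_) (maxW-++ u v)) (sym (ℕ.⊔-assoc x (maxW u) (maxW v)))

maxW-pos : ∀ w → Pos w → w ≢ [] → 1 ≤ maxW w
maxW-pos w pos ne = All.lookup pos (maxW-∈ w ne)

[]? : ∀ {A : Set} (w : List A) → Dec (w ≡ [])
[]? []      = yes refl
[]? (x ∷ w) = no (λ ())

map-≢[] : ∀ {A B : Set} (f : A → B) w → w ≢ [] → map f w ≢ []
map-≢[] f []      ne _ = ne refl
map-≢[] f (x ∷ w) ne ()

toℕ : Bool → ℕ
toℕ true  = 1
toℕ false = 0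

toℕ≤1 : ∀ b → toℕ b ≤ 1
toℕ≤1 true  = ℕ.≤-refl
toℕ≤1 false = z≤n

length-filterᵇ-singleton : ∀ (p : ℕ → Bool) x → length (filterᵇ p (x ∷ [])) ≡ toℕ (p x)
length-filterᵇ-singleton p x with p x
... | true  = refl
... | false = refl

rank-zero : ∀ w → rank 0 w ≡ toℕ (occurs 0 w)
rank-zero w = length-filterᵇ-singleton (λ y → occurs y w) 0

rank-suc : ∀ x w → rank (suc x) w ≡ rank x w ℕ.+ toℕ (occurs (suc x) w)
rank-suc x w = trans (cong (length ∘ filterᵇ occ) (sym (List.upTo-∷ʳ (suc x))))
  (trans (cong length (List.filter-++ (T? ∘ occ) (upTo (suc x)) (suc x ∷ [])))
  (trans (List.length-++ (filterᵇ occ (upTo (suc x))))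
         (cong (rank x w ℕ.+_) (length-filterᵇ-singleton occ (suc x)))))
  where occ = λ y → occurs y w

rank-[] : ∀ x → rank x [] ≡ 0
rank-[] zero    = refl
rank-[] (suc x) = trans (rank-suc x []) (trans (ℕ.+-identityʳ _) (rank-[] x))

-- The rank counts distinct letters up to `x`. This recursion on the word, rather than on `x`,
-- counts each letter at its last occurrence.
rank-∷ : ∀ x y w → rank x (y ∷ w) ≡ toℕ ((y ≤ᵇ x) ∧ not (occurs y w)) ℕ.+ rank x w
rank-∷ zero zero w rewrite rank-zero (zero ∷ w) | rank-zero w with occurs 0 w
... | true  = refl
... | false = refl
rank-∷ zero (suc y) w rewrite rank-zero (suc y ∷ w) | rank-zero w = refl
rank-∷ (suc x) y w rewrite rank-suc x (y ∷ w) | rank-suc x w | rank-∷ x y w with suc x ℕ.≟ y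
... | yes refl rewrite ≡ᵇ-refl x | ≤ᵇ-false (ℕ.n<1+n x) | ≤ᵇ-true (ℕ.≤-refl {suc x}) with occurs (suc x) w
...   | true  = refl
...   | false = trans (ℕ.+-comm (rank x w) 1) (cong suc (sym (ℕ.+-identityʳ _)))
rank-∷ (suc x) y w | no sx≢y
  rewrite ≡ᵇ-false sx≢y | bool-ext {y ≤ᵇ suc x} {y ≤ᵇ x} (λ e → ≤ᵇ-true {y} {x} (ℕ.≤-pred (ℕ.≤∧≢⇒< (≤ᵇ-sound {y} {suc x} e) (sx≢y ∘ sym))))
                   (λ e → ≤ᵇ-true {y} {suc x} (ℕ.m≤n⇒m≤1+n (≤ᵇ-sound {y} {x} e)))
  = ℕ.+-assoc (toℕ ((y ≤ᵇ x) ∧ not (occurs y w))) (rank x w) (toℕ (occurs (suc x) w))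

rank-mono-+ : ∀ k x w → rank x w ≤ rank (k ℕ.+ x) w
rank-mono-+ zero    x w = ℕ.≤-refl
rank-mono-+ (suc k) x w = ℕ.≤-trans (rank-mono-+ k x w)
  (subst (rank (k ℕ.+ x) w ≤_) (sym (rank-suc (k ℕ.+ x) w)) (ℕ.m≤m+n _ _))

rank-mono : ∀ {x y} w → x ≤ y → rank x w ≤ rank y w
rank-mono {x} {y} w le = subst (λ z → rank x w ≤ rank z w) (ℕ.m∸n+n≡m le) (rank-mono-+ (y ∸ x) x w)

rank-strict : ∀ {x y} w → y ∈ w → x < y → rank x w < rank y w
rank-strict {x} {suc y} w y∈ (s≤s le) =
  subst (rank x w <_) (sym (trans (rank-suc y w) (trans (cong (λ b → rank y w ℕ.+ toℕ b) (occurs-complete w y∈)) (ℕ.+-comm (rank y w) 1))))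
        (s≤s (rank-mono w le))

rank-pos : ∀ {x} w → x ∈ w → 1 ≤ rank x w
rank-pos {zero}  w x∈ = subst (1 ≤_) (sym (trans (rank-zero w) (cong toℕ (occurs-complete w x∈)))) ℕ.≤-refl
rank-pos {suc x} w x∈ = ℕ.≤-trans (s≤s z≤n) (rank-strict w x∈ (ℕ.n<1+n x))

-- The rank grows by at most one when `x` does, and only at letters of `w`, so no value is skipped.
-- This is why packing produces packed words.
rank-surjective : ∀ x w i → 1 ≤ i → i ≤ rank x w → ∃ λ y → y ∈ w × rank y w ≡ i
rank-surjective zero w i 1≤i i≤ with bool-dec (occurs 0 w)
... | inj₁ e = 0 , occurs-sound w e , trans r≡1 (ℕ.≤-antisym 1≤i (subst (i ≤_) r≡1 i≤))
  where r≡1 = trans (rank-zero w) (cong toℕ e)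
... | inj₂ e = ⊥-elim (ℕ.<⇒≱ 1≤i (subst (i ≤_) (trans (rank-zero w) (cong toℕ e)) i≤))
rank-surjective (suc x) w i 1≤i i≤ with ℕ.m≤n⇒m<n∨m≡n i≤
... | inj₂ e with bool-dec (occurs (suc x) w)
...   | inj₁ o  = suc x , occurs-sound w o , sym e
...   | inj₂ o = rank-surjective x w i 1≤i (ℕ.≤-reflexive (trans e (trans (rank-suc x w) (trans (cong (λ b → rank x w ℕ.+ toℕ b) o) (ℕ.+-identityʳ _)))))
rank-surjective (suc x) w i 1≤i i≤ | inj₁ lt = rank-surjective x w i 1≤i (ℕ.≤-pred (ℕ.≤-trans lt bound))
  where
  bound : rank (suc x) w ≤ suc (rank x w)
  bound = subst₂ _≤_ (sym (rank-suc x w)) (ℕ.+-comm (rank x w) 1) (ℕ.+-monoʳ-≤ (rank x w) (toℕ≤1 (occurs (suc x) w)))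

rank-packed : ∀ {w} → Packed w → ∀ x → x ≤ maxW w → rank x w ≡ x
rank-packed {w} (pos , full) zero    le = trans (rank-zero w)
  (cong toℕ (occurs-false w (λ 0∈ → ℕ.<⇒≱ (All.lookup pos 0∈) z≤n)))
rank-packed {w} (pos , full) (suc x) le = trans (rank-suc x w)
  (trans (cong₂ (λ r b → r ℕ.+ toℕ b) (rank-packed (pos , full) x (ℕ.<⇒≤ le)) (occurs-complete w (full (suc x) (s≤s z≤n) le)))
         (ℕ.+-comm x 1))

-- Packing, disjointness and comparisons of maxima are unchanged by relabelings that are increasing
-- on the letters present. Ranks, shifts and the map `s` of `PackShuffle` are the relabelings used.
StrictOn : (ℕ → ℕ) → Word → Set
StrictOn r w = ∀ {x y} → x ∈ w → y ∈ w → x < y → r x < r y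

module _ {r : ℕ → ℕ} {w : Word} (strict : StrictOn r w) where

  strict-mono : ∀ {x y} → x ∈ w → y ∈ w → x ≤ y → r x ≤ r y
  strict-mono x∈ y∈ le with ℕ.m≤n⇒m<n∨m≡n le
  ... | inj₁ lt   = ℕ.<⇒≤ (strict x∈ y∈ lt)
  ... | inj₂ refl = ℕ.≤-refl

  strict-reflect-< : ∀ {x y} → x ∈ w → y ∈ w → r x < r y → x < y
  strict-reflect-< {x} {y} x∈ y∈ lt with x ℕ.<? y
  ... | yes p = p
  ... | no ¬p = ⊥-elim (ℕ.<⇒≱ lt (strict-mono y∈ x∈ (ℕ.≮⇒≥ ¬p)))

  strict-reflect-≤ : ∀ {x y} → x ∈ w → y ∈ w → r x ≤ r y → x ≤ y
  strict-reflect-≤ {x} {y} x∈ y∈ le with x ℕ.≤? y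
  ... | yes p = p
  ... | no ¬p = ⊥-elim (ℕ.≤⇒≯ le (strict y∈ x∈ (ℕ.≰⇒> ¬p)))

  strict-injective : ∀ {x y} → x ∈ w → y ∈ w → r x ≡ r y → x ≡ y
  strict-injective x∈ y∈ e = ℕ.≤-antisym (strict-reflect-≤ x∈ y∈ (ℕ.≤-reflexive e)) (strict-reflect-≤ y∈ x∈ (ℕ.≤-reflexive (sym e)))

  ∈-map-strict : ∀ {x v} → x ∈ w → (∀ {z} → z ∈ v → z ∈ w) → r x ∈ map r v → x ∈ v
  ∈-map-strict x∈ v⊆w rx∈ with ∈.∈-map⁻ r rx∈
  ... | y , y∈ , e = subst (_∈ _) (sym (strict-injective x∈ (v⊆w y∈) e)) y∈

  occurs-map : ∀ {x} v → x ∈ w → (∀ {z} → z ∈ v → z ∈ w) → occurs (r x) (map r v) ≡ occurs x v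
  occurs-map v x∈ v⊆w = bool-ext
    (λ h → occurs-complete v (∈-map-strict x∈ v⊆w (occurs-sound (map r v) h)))
    (λ h → occurs-complete (map r v) (∈.∈-map⁺ r (occurs-sound v h)))

  rank-map : ∀ {x} v → x ∈ w → (∀ {z} → z ∈ v → z ∈ w) → rank (r x) (map r v) ≡ rank x v
  rank-map {x} [] x∈ v⊆w = trans (rank-[] (r x)) (sym (rank-[] x))
  rank-map {x} (y ∷ v) x∈ v⊆w = trans (rank-∷ (r x) (r y) (map r v)) (trans
    (cong₂ ℕ._+_
      (cong₂ (λ a b → toℕ (a ∧ not b))
        (bool-ext (λ e → ≤ᵇ-true (strict-reflect-≤ (v⊆w (here refl)) x∈ (≤ᵇ-sound e)))
                  (λ e → ≤ᵇ-true (strict-mono (v⊆w (here refl)) x∈ (≤ᵇ-sound e))))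
        (occurs-map v (v⊆w (here refl)) (v⊆w ∘ there)))
      (rank-map v x∈ (v⊆w ∘ there)))
    (sym (rank-∷ x y v)))

  maxW-map : ∀ v → (∀ {z} → z ∈ v → z ∈ w) → v ≢ [] → maxW (map r v) ≡ r (maxW v)
  maxW-map v v⊆w ne = ℕ.≤-antisym
    (maxW-lub (map r v) (λ x∈ → case ∈.∈-map⁻ r x∈ of λ
      { (y , y∈ , refl) → strict-mono (v⊆w y∈) (v⊆w (maxW-∈ v ne)) (∈⇒≤maxW v y∈) }))
    (∈⇒≤maxW (map r v) (∈.∈-map⁺ r (maxW-∈ v ne)))

  disjointW-map : ∀ u v → (∀ {z} → z ∈ u → z ∈ w) → (∀ {z} → z ∈ v → z ∈ w) →
                  disjointW (map r u) (map r v) ≡ disjointW u v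
  disjointW-map u v u⊆w v⊆w = bool-ext
    (λ h → disjoint-complete u v (λ x∈u x∈v → disjoint-sound (map r u) (map r v) h (∈.∈-map⁺ r x∈u) (∈.∈-map⁺ r x∈v)))
    (λ h → disjoint-complete (map r u) (map r v) (λ x∈u x∈v → case ∈.∈-map⁻ r x∈u of λ
      { (y , y∈ , refl) → disjoint-sound u v h y∈ (∈-map-strict (u⊆w y∈) v⊆w x∈v) }))

  -- Positivity settles the case of an empty `u`: its maximum is 0 by convention and is not the
  -- image of a letter.
  maxW-<ᵇ-map : ∀ u v → (∀ {z} → z ∈ u → z ∈ w) → (∀ {z} → z ∈ v → z ∈ w) → Pos v → Pos (map r v) →
                (maxW (map r u) <ᵇ maxW (map r v)) ≡ (maxW u <ᵇ maxW v)
  maxW-<ᵇ-map u v u⊆w v⊆w posv posrv with []? v | []? u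
  ... | yes refl | _ = refl
  ... | no v≢[] | yes refl = trans (<ᵇ-true (maxW-pos (map r v) posrv (map-≢[] r v v≢[]))) (sym (<ᵇ-true (maxW-pos v posv v≢[])))
  ... | no v≢[] | no u≢[] rewrite maxW-map v v⊆w v≢[] | maxW-map u u⊆w u≢[] = bool-ext
    (λ e → <ᵇ-true (strict-reflect-< (u⊆w (maxW-∈ u u≢[])) (v⊆w (maxW-∈ v v≢[])) (<ᵇ-sound e)))
    (λ e → <ᵇ-true (strict (u⊆w (maxW-∈ u u≢[])) (v⊆w (maxW-∈ v v≢[])) (<ᵇ-sound e)))

  pack-map : pack (map r w) ≡ pack w
  pack-map = trans (sym (List.map-∘ w)) (List.map-cong-local (All.tabulate (λ x∈ → rank-map w x∈ id)))

StrictOn-⊆ : ∀ {r} u {w} → (∀ {z} → z ∈ u → z ∈ w) → StrictOn r w → StrictOn r u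
StrictOn-⊆ u u⊆w strict x∈ y∈ = strict (u⊆w x∈) (u⊆w y∈)

pack-strict : ∀ w → StrictOn (λ x → rank x w) w
pack-strict w _ y∈ lt = rank-strict w y∈ lt

pack-pos : ∀ w u → (∀ {z} → z ∈ u → z ∈ w) → Pos (map (λ x → rank x w) u)
pack-pos w u u⊆w = All.map⁺ (All.tabulate (λ x∈ → rank-pos w (u⊆w x∈)))

pack-packed : ∀ w → Packed (pack w)
pack-packed w = pack-pos w w id , full
  where
  full : ∀ i → 1 ≤ i → i ≤ maxW (pack w) → i ∈ pack w
  full i 1≤i i≤ with []? w
  ... | yes refl = ⊥-elim (ℕ.<⇒≱ 1≤i i≤)
  ... | no w≢[] with ∈.∈-map⁻ _ (maxW-∈ (pack w) (map-≢[] _ w w≢[]))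
  ...   | x , x∈ , e with rank-surjective x w i 1≤i (subst (i ≤_) e i≤)
  ...     | y , y∈ , refl = ∈.∈-map⁺ _ y∈

pack-id : ∀ {w} → Packed w → pack w ≡ w
pack-id {w} p = List.map-id-local (All.tabulate (λ {x} x∈ → rank-packed p x (∈⇒≤maxW w x∈)))

length-pack : ∀ w → length (pack w) ≡ length w
length-pack w = List.length-map _ w

pack-≢[] : ∀ w → w ≢ [] → pack w ≢ []
pack-≢[] w = map-≢[] _ w

rank-++ : ∀ x u v → disjointW u v ≡ true → rank x (u ++ v) ≡ rank x u ℕ.+ rank x v
rank-++ x [] v h = cong (ℕ._+ rank x v) (sym (rank-[] x))
rank-++ x (y ∷ u) v h = trans (rank-∷ x y (u ++ v)) (trans
  (cong₂ ℕ._+_ (cong (λ b → toℕ ((y ≤ᵇ x) ∧ not b)) same) (rank-++ x u v (∧-true⁻ʳ {not (occurs y v)} h)))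
  (trans (sym (ℕ.+-assoc (toℕ ((y ≤ᵇ x) ∧ not (occurs y u))) (rank x u) (rank x v)))
         (cong (ℕ._+ rank x v) (sym (rank-∷ x y u)))))
  where
  same : occurs y (u ++ v) ≡ occurs y u
  same = bool-ext
    (λ e → case ∈.∈-++⁻ u (occurs-sound (u ++ v) e) of λ
      { (inj₁ y∈u) → occurs-complete u y∈u
      ; (inj₂ y∈v) → ⊥-elim (disjoint-sound (y ∷ u) v h (here refl) y∈v) })
    (λ e → occurs-complete (u ++ v) (∈.∈-++⁺ˡ (occurs-sound u e)))

rank-saturated : ∀ x w → maxW w ≤ x → rank x w ≡ rank (maxW w) w
rank-saturated x w le = ℕ.≤-antisym (le-max x) (rank-mono w le)
  where
  le-max : ∀ x → rank x w ≤ rank (maxW w) w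
  le-max zero    = rank-mono w z≤n
  le-max (suc x) with suc x ℕ.≤? maxW w
  ... | yes p = rank-mono w p
  ... | no ¬p = subst (_≤ rank (maxW w) w) (sym (trans (rank-suc x w)
          (trans (cong (λ b → rank x w ℕ.+ toℕ b) (occurs-false w (¬p ∘ ∈⇒≤maxW w))) (ℕ.+-identityʳ _)))) (le-max x)

rank-maxW : ∀ w → rank (maxW w) w ≡ maxW (pack w)
rank-maxW w with []? w
... | yes refl = refl
... | no w≢[]  = sym (maxW-map (pack-strict w) w id w≢[])

-- The maximum of a packed word is its number of distinct letters, and these numbers add up over
-- disjoint factors. This makes the maximum a grading for the half-products.
maxW-disjoint-++ : ∀ u v → Packed (u ++ v) → disjointW u v ≡ true →
                   maxW (u ++ v) ≡ maxW (pack u) ℕ.+ maxW (pack v)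
maxW-disjoint-++ u v p h =
  trans (sym (rank-packed p M ℕ.≤-refl)) (trans (rank-++ M u v h) (cong₂ ℕ._+_
    (trans (rank-saturated M u (subst (maxW u ≤_) (sym (maxW-++ u v)) (ℕ.m≤m⊔n _ _))) (rank-maxW u))
    (trans (rank-saturated M v (subst (maxW v ≤_) (sym (maxW-++ u v)) (ℕ.m≤n⊔m (maxW u) _))) (rank-maxW v))))
  where M = maxW (u ++ v)

-- Shuffles of packed words

shift : ℕ → Word → Word
shift m = map (m ℕ.+_)

-- `left` stands for Δ≺, where the last letter falls into the left tensor factor, `right` for Δ≻,
-- and `all` for the coproduct without a condition on the last letter.
data Side : Set where
  all left right : Side

-- Does the last letter of a shuffle of a word over {1..m} with a word over {m+1..} come from the given side?
lastFrom : Side → ℕ → Word → Bool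
lastFrom all   m u = true
lastFrom left  m u = lastᵇ (_≤ᵇ m) false u
lastFrom right m u = lastᵇ (m <ᵇ_) false u

module _ {A : Set} where

  ∈-interleaving⁻ : ∀ {p q u : List A} → Interleaving p q u → ∀ {x} → x ∈ u → x ∈ p ⊎ x ∈ q
  ∈-interleaving⁻ (consˡ i) (here refl) = inj₁ (here refl)
  ∈-interleaving⁻ (consˡ i) (there x∈) with ∈-interleaving⁻ i x∈
  ... | inj₁ y = inj₁ (there y)
  ... | inj₂ y = inj₂ y
  ∈-interleaving⁻ (consʳ i) (here refl) = inj₂ (here refl)
  ∈-interleaving⁻ (consʳ i) (there x∈) with ∈-interleaving⁻ i x∈
  ... | inj₁ y = inj₁ y
  ... | inj₂ y = inj₂ (there y)

  ∈-interleavingˡ : ∀ {p q u : List A} → Interleaving p q u → ∀ {x} → x ∈ p → x ∈ u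
  ∈-interleavingˡ (consˡ i) (here refl) = here refl
  ∈-interleavingˡ (consˡ i) (there x∈)  = there (∈-interleavingˡ i x∈)
  ∈-interleavingˡ (consʳ i) x∈          = there (∈-interleavingˡ i x∈)

  ∈-interleavingʳ : ∀ {p q u : List A} → Interleaving p q u → ∀ {x} → x ∈ q → x ∈ u
  ∈-interleavingʳ (consʳ i) (here refl) = here refl
  ∈-interleavingʳ (consʳ i) (there x∈)  = there (∈-interleavingʳ i x∈)
  ∈-interleavingʳ (consˡ i) x∈          = there (∈-interleavingʳ i x∈)

  length-interleaving : ∀ {p q u : List A} → Interleaving p q u → length u ≡ length p ℕ.+ length q
  length-interleaving []        = refl
  length-interleaving (consˡ i) = cong suc (length-interleaving i)
  length-interleaving {p} {_ ∷ q} (consʳ i) = trans (cong suc (length-interleaving i)) (sym (ℕ.+-suc (length p) (length q)))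

map-interleaving : ∀ {A B : Set} (f : A → B) {p q u} → Interleaving p q u → Interleaving (map f p) (map f q) (map f u)
map-interleaving f []        = []
map-interleaving f (consˡ i) = consˡ (map-interleaving f i)
map-interleaving f (consʳ i) = consʳ (map-interleaving f i)

maxW-interleaving : ∀ {p q u} → Interleaving p q u → maxW u ≡ maxW p ⊔ maxW q
maxW-interleaving {p} {q} {u} i = ℕ.≤-antisym
  (maxW-lub u (λ x∈ → case ∈-interleaving⁻ i x∈ of λ
    { (inj₁ y) → ℕ.≤-trans (∈⇒≤maxW p y) (ℕ.m≤m⊔n _ _)
    ; (inj₂ y) → ℕ.≤-trans (∈⇒≤maxW q y) (ℕ.m≤n⊔m (maxW p) _) }))
  (ℕ.⊔-lub (maxW-lub p (∈⇒≤maxW u ∘ ∈-interleavingˡ i)) (maxW-lub q (∈⇒≤maxW u ∘ ∈-interleavingʳ i)))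

≤maxW : ∀ p → All (_≤ maxW p) p
≤maxW p = All.tabulate (∈⇒≤maxW p)

shift-strict : ∀ m w → StrictOn (m ℕ.+_) w
shift-strict m w _ _ = ℕ.+-monoʳ-< m

maxW-shift : ∀ m q → q ≢ [] → maxW (shift m q) ≡ m ℕ.+ maxW q
maxW-shift m q ne = maxW-map (shift-strict m q) q id ne

maxW-shuffle : ∀ p q {u} → Interleaving p (shift (maxW p) q) u → maxW u ≡ maxW p ℕ.+ maxW q
maxW-shuffle p q i with []? q
... | yes refl = trans (maxW-interleaving i) (trans (ℕ.⊔-identityʳ _) (sym (ℕ.+-identityʳ _)))
... | no q≢[]  = trans (maxW-interleaving i) (trans (cong (maxW p ⊔_) (maxW-shift (maxW p) q q≢[])) (ℕ.m≤n⇒m⊔n≡n (ℕ.m≤m+n _ _)))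

shift-> : ∀ m q → Pos q → All (m <_) (shift m q)
shift-> m q pos = All.map⁺ (All.map (λ {x} 1≤x → subst (_≤ m ℕ.+ x) (ℕ.+-comm m 1) (ℕ.+-monoʳ-≤ m 1≤x)) pos)

shuffle-packed : ∀ {p q u} → Packed p → Packed q → Interleaving p (shift (maxW p) q) u → Packed u
shuffle-packed {p} {q} {u} (posp , fullp) (posq , fullq) i = All.tabulate pos , full
  where
  pos : ∀ {x} → x ∈ u → 1 ≤ x
  pos x∈ with ∈-interleaving⁻ i x∈
  ... | inj₁ y = All.lookup posp y
  ... | inj₂ y = ℕ.≤-trans (s≤s z≤n) (All.lookup (shift-> (maxW p) q posq) y)
  full : ∀ j → 1 ≤ j → j ≤ maxW u → j ∈ u
  full j 1≤j j≤ with j ℕ.≤? maxW p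
  ... | yes j≤p = ∈-interleavingˡ i (fullp j 1≤j j≤p)
  ... | no j≰p  = ∈-interleavingʳ i (subst (_∈ shift (maxW p) q) e (∈.∈-map⁺ _ (fullq (j ∸ maxW p) (ℕ.m<n⇒0<n∸m (ℕ.≰⇒> j≰p)) bound)))
    where
    e : maxW p ℕ.+ (j ∸ maxW p) ≡ j
    e = ℕ.m+[n∸m]≡n (ℕ.≰⇒≥ j≰p)
    bound : j ∸ maxW p ≤ maxW q
    bound = ℕ.m≤n+o⇒m∸n≤o j (maxW p) (subst (j ≤_) (maxW-shuffle p q i) j≤)

lastᵇ-map : ∀ {A B : Set} (f : A → B) P P′ d w → (∀ {x} → x ∈ w → P (f x) ≡ P′ x) →
            lastᵇ P d (map f w) ≡ lastᵇ P′ d w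
lastᵇ-map f P P′ d []      h = refl
lastᵇ-map f P P′ d (x ∷ w) h rewrite h (here refl) = lastᵇ-map f P P′ (P′ x) w (h ∘ there)

-- Here `p` and `q` are factors of packed words and need not be packed themselves. The map `s` sends
-- low letters to their rank in `p` and stacks the ranks in `q` above them. It is increasing on the
-- letters of a shuffle and turns it into a shuffle of packed words, which is packed; hence it is
-- the packing map of the shuffle.
module PackShuffle (m : ℕ) (p q : Word) (p≤m : All (_≤ m) p) (posq : Pos q) where

  private
    M = maxW (pack p)
    s : ℕ → ℕ
    s z = if z ≤ᵇ m then rank z p else M ℕ.+ rank (z ∸ m) q

    s-≤ : ∀ {z} → z ≤ m → s z ≡ rank z p
    s-≤ le rewrite ≤ᵇ-true le = refl

    s-shift : ∀ {z} → 1 ≤ z → s (m ℕ.+ z) ≡ M ℕ.+ rank z q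
    s-shift {z} 1≤z rewrite ≤ᵇ-false (subst (_≤ m ℕ.+ z) (ℕ.+-comm m 1) (ℕ.+-monoʳ-≤ m 1≤z)) | ℕ.m+n∸m≡n m z = refl

    map-s-p : map s p ≡ pack p
    map-s-p = List.map-cong-local (All.map s-≤ p≤m)

    map-s-q : map s (shift m q) ≡ shift M (pack q)
    map-s-q = trans (sym (List.map-∘ q)) (trans (List.map-cong-local (All.map s-shift posq)) (List.map-∘ q))

    rank≤M : ∀ {z} → z ∈ p → rank z p ≤ M
    rank≤M z∈ = ∈⇒≤maxW (pack p) (∈.∈-map⁺ _ z∈)

    module _ {a : Word} (i : Interleaving p (shift m q) a) where

      data Origin (z : ℕ) : Set where
        low  : z ∈ p → z ≤ m → Origin z
        high : ∀ y → y ∈ q → 1 ≤ y → z ≡ m ℕ.+ y → Origin z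

      origin : ∀ {z} → z ∈ a → Origin z
      origin z∈ with ∈-interleaving⁻ i z∈
      ... | inj₁ z∈p = low z∈p (All.lookup p≤m z∈p)
      ... | inj₂ z∈q with ∈.∈-map⁻ _ z∈q
      ...   | y , y∈ , refl = high y y∈ (All.lookup posq y∈) refl

      s-strict : StrictOn s a
      s-strict x∈ y∈ lt with origin x∈ | origin y∈
      ... | low x∈p x≤m | low y∈p y≤m rewrite s-≤ x≤m | s-≤ y≤m = rank-strict p y∈p lt
      ... | low x∈p x≤m | high y y∈q 1≤y refl rewrite s-≤ x≤m | s-shift 1≤y =
            ℕ.≤-<-trans (rank≤M x∈p) (subst (_≤ M ℕ.+ rank y q) (ℕ.+-comm M 1) (ℕ.+-monoʳ-≤ M (rank-pos q y∈q)))
      ... | high x x∈q 1≤x refl | low y∈p y≤m = ⊥-elim (ℕ.<⇒≱ lt (ℕ.≤-trans y≤m (ℕ.m≤m+n m x)))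
      ... | high x x∈q 1≤x refl | high y y∈q 1≤y refl rewrite s-shift 1≤x | s-shift 1≤y =
            ℕ.+-monoʳ-< M (rank-strict q y∈q (ℕ.+-cancelˡ-< m x y lt))

      pack-shuffle-≡ : pack a ≡ map s a
      pack-shuffle-≡ = trans (sym (pack-map s-strict)) (pack-id
        (shuffle-packed (pack-packed p) (pack-packed q)
          (subst₂ (λ u v → Interleaving u v (map s a)) map-s-p map-s-q (map-interleaving s i))))

      s-≤ᵇ : ∀ {z} → z ∈ a → (s z ≤ᵇ M) ≡ (z ≤ᵇ m)
      s-≤ᵇ z∈ with origin z∈
      ... | low z∈p z≤m rewrite s-≤ z≤m = trans (≤ᵇ-true (rank≤M z∈p)) (sym (≤ᵇ-true z≤m))
      ... | high y y∈q 1≤y refl rewrite s-shift 1≤y = trans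
            (≤ᵇ-false (subst (_≤ M ℕ.+ rank y q) (ℕ.+-comm M 1) (ℕ.+-monoʳ-≤ M (rank-pos q y∈q))))
            (sym (≤ᵇ-false (subst (_≤ m ℕ.+ y) (ℕ.+-comm m 1) (ℕ.+-monoʳ-≤ m 1≤y))))

      s-<ᵇ : ∀ {z} → z ∈ a → (M <ᵇ s z) ≡ (m <ᵇ z)
      s-<ᵇ {z} z∈ = bool-ext
        (λ e → <ᵇ-true {m} {z} (ℕ.≰⇒> (λ le → ℕ.<⇒≱ (<ᵇ-sound {M} {s z} e) (≤ᵇ-sound {s z} {M} (trans (s-≤ᵇ z∈) (≤ᵇ-true le))))))
        (λ e → <ᵇ-true {M} {s z} (ℕ.≰⇒> (λ le → ℕ.<⇒≱ (<ᵇ-sound {m} {z} e) (≤ᵇ-sound {z} {m} (trans (sym (s-≤ᵇ z∈)) (≤ᵇ-true le))))))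

      lastFrom-pack : ∀ c → lastFrom c M (map s a) ≡ lastFrom c m a
      lastFrom-pack all   = refl
      lastFrom-pack left  = lastᵇ-map s (_≤ᵇ M) (_≤ᵇ m) false a s-≤ᵇ
      lastFrom-pack right = lastᵇ-map s (M <ᵇ_) (m <ᵇ_) false a s-<ᵇ

  ∑sh-pack : ∀ c (f : Word → ℚ) → ∑sh p (shift m q) (λ a → 𝟙 (lastFrom c m a) * f (pack a))
           ≡ ∑sh (pack p) (shift M (pack q)) (λ a → 𝟙 (lastFrom c M a) * f a)
  ∑sh-pack c f = begin
    ∑sh p (shift m q) (λ a → 𝟙 (lastFrom c m a) * f (pack a))
      ≡⟨ ∑sh-cong p (shift m q) (λ a i → cong₂ (λ b w → 𝟙 b * f w) (sym (lastFrom-pack i c)) (pack-shuffle-≡ i)) ⟩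
    ∑sh p (shift m q) (λ a → 𝟙 (lastFrom c M (map s a)) * f (map s a))
      ≡⟨ ∑sh-map s p (shift m q) _ ⟨
    ∑sh (map s p) (map s (shift m q)) (λ a → 𝟙 (lastFrom c M a) * f a)
      ≡⟨ cong₂ (λ u v → ∑sh u v (λ a → 𝟙 (lastFrom c M a) * f a)) map-s-p map-s-q ⟩
    ∑sh (pack p) (shift M (pack q)) (λ a → 𝟙 (lastFrom c M a) * f a) ∎

-- Products of functions on words

V : Set
V = Word → ℚ

data Cmp : Set where
  lt gt any : Cmp

cmpᵇ : Cmp → ℕ → ℕ → Bool
cmpᵇ lt  a b = a <ᵇ b
cmpᵇ gt  a b = b <ᵇ a
cmpᵇ any a b = true

compatible : Cmp → Word → Word → Bool
compatible c a b = disjointW a b ∧ cmpᵇ c (maxW a) (maxW b)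

opaque

  -- The leading indicator gives packed support, and the factors are evaluated only after packing,
  -- so the result depends on `f` and `g` through their values at packed words.
  conv : Cmp → V → V → V
  conv c f g w = 𝟙 (isPacked w) * ∑split w (λ a b → 𝟙 (compatible c a b) * (f (pack a) * g (pack b)))

  conv-packed : ∀ c f g {w} → Packed w →
                conv c f g w ≡ ∑split w (λ a b → 𝟙 (compatible c a b) * (f (pack a) * g (pack b)))
  conv-packed c f g {w} p rewrite isPacked-complete w p = ℚ.*-identityˡ _

  conv-unpacked : ∀ c f g {w} → ¬ Packed w → conv c f g w ≡ 0ℚ
  conv-unpacked c f g {w} np = *-zeroˡ-≡ _ (cong 𝟙 (≢true⇒false (np ∘ isPacked-sound w)))

infixl 7 _≺ᵛ_ _≻ᵛ_ _∗_

_≺ᵛ_ _≻ᵛ_ _∗_ : V → V → V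
_≺ᵛ_ = conv gt
_≻ᵛ_ = conv lt
_∗_  = conv any

conv-cong : ∀ c {f f′ g g′ : V} → (∀ {w} → Packed w → f w ≡ f′ w) → (∀ {w} → Packed w → g w ≡ g′ w) →
            ∀ w → conv c f g w ≡ conv c f′ g′ w
conv-cong c {f} {f′} {g} {g′} hf hg w with packed? w
... | no np = trans (conv-unpacked c f g np) (sym (conv-unpacked c f′ g′ np))
... | yes p = trans (conv-packed c f g p) (trans
      (∑split-cong w (λ a b _ → cong (𝟙 (compatible c a b) *_) (cong₂ _*_ (hf (pack-packed a)) (hg (pack-packed b)))))
      (sym (conv-packed c f′ g′ p)))

compatible-map : ∀ c {r u} → StrictOn r u → Pos u → Pos (map r u) → ∀ a b → a ++ b ≡ u →
                 compatible c (map r a) (map r b) ≡ compatible c a b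
compatible-map c {r} strict pos posr a b refl = cong₂ _∧_ (disjointW-map strict a b (∈.∈-++⁺ˡ) (∈.∈-++⁺ʳ a)) (cmp-map c)
  where
  posr′ = subst Pos (List.map-++ r a b) posr
  cmp-map : ∀ c → cmpᵇ c (maxW (map r a)) (maxW (map r b)) ≡ cmpᵇ c (maxW a) (maxW b)
  cmp-map lt  = maxW-<ᵇ-map strict a b (∈.∈-++⁺ˡ) (∈.∈-++⁺ʳ a) (All.++⁻ʳ a pos) (All.++⁻ʳ (map r a) posr′)
  cmp-map gt  = maxW-<ᵇ-map strict b a (∈.∈-++⁺ʳ a) (∈.∈-++⁺ˡ) (All.++⁻ˡ a pos) (All.++⁻ˡ (map r a) posr′)
  cmp-map any = refl

-- An iterated product evaluates its inner product at a packed factor. Since all conditions are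
-- invariant under packing, that factor may be cut before it is packed, and both bracketings become
-- sums over cuts of the same word.
conv-pack : ∀ c f g u → Pos u → conv c f g (pack u) ≡ ∑split u (λ a b → 𝟙 (compatible c a b) * (f (pack a) * g (pack b)))
conv-pack c f g u pos = trans (conv-packed c f g (pack-packed u)) (trans (∑split-map r u _) (∑split-cong u step))
  where
  r = λ x → rank x u
  step : ∀ a b → a ++ b ≡ u →
         𝟙 (compatible c (map r a) (map r b)) * (f (pack (map r a)) * g (pack (map r b)))
       ≡ 𝟙 (compatible c a b) * (f (pack a) * g (pack b))
  step a b refl = cong₂ (λ k x → 𝟙 k * x)
    (compatible-map c (pack-strict u) pos (pack-pos u u id) a b refl)
    (cong₂ (λ x y → f x * g y)
      (pack-map (StrictOn-⊆ a (∈.∈-++⁺ˡ) (pack-strict u)))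
      (pack-map (StrictOn-⊆ b (∈.∈-++⁺ʳ a) (pack-strict u))))

private
  ∑₃ : Word → (Word → Word → Word → Bool) → V → V → V → ℚ
  ∑₃ w k f g h = ∑split w (λ a v → ∑split v (λ b c → 𝟙 (k a b c) * (f (pack a) * (g (pack b) * h (pack c)))))

  conv-conv-left : ∀ c₁ c₂ f g h {w} → Packed w →
    conv c₁ (conv c₂ f g) h w ≡ ∑₃ w (λ a b c → compatible c₁ (a ++ b) c ∧ compatible c₂ a b) f g h
  conv-conv-left c₁ c₂ f g h {w} p = begin
    conv c₁ (conv c₂ f g) h w
      ≡⟨ conv-packed c₁ _ h p ⟩
    ∑split w (λ u c → 𝟙 (compatible c₁ u c) * (conv c₂ f g (pack u) * h (pack c)))
      ≡⟨ ∑split-cong w (λ u c e → outer u c (All.++⁻ˡ u (subst Pos (sym e) (proj₁ p)))) ⟩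
    ∑split w (λ u c → ∑split u (λ a b → 𝟙 (compatible c₁ (a ++ b) c ∧ compatible c₂ a b) * (f (pack a) * (g (pack b) * h (pack c)))))
      ≡⟨ ∑split-assoc w _ ⟩
    ∑₃ w (λ a b c → compatible c₁ (a ++ b) c ∧ compatible c₂ a b) f g h ∎
    where
    open +-*-Solver
    outer : ∀ u c → Pos u → 𝟙 (compatible c₁ u c) * (conv c₂ f g (pack u) * h (pack c))
          ≡ ∑split u (λ a b → 𝟙 (compatible c₁ (a ++ b) c ∧ compatible c₂ a b) * (f (pack a) * (g (pack b) * h (pack c))))
    outer u c pos = begin
      𝟙 (compatible c₁ u c) * (conv c₂ f g (pack u) * h (pack c))
        ≡⟨ solve 3 (λ k x y → k :* (x :* y) := (k :* y) :* x) refl (𝟙 (compatible c₁ u c)) (conv c₂ f g (pack u)) (h (pack c)) ⟩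
      (𝟙 (compatible c₁ u c) * h (pack c)) * conv c₂ f g (pack u)
        ≡⟨ cong ((𝟙 (compatible c₁ u c) * h (pack c)) *_) (conv-pack c₂ f g u pos) ⟩
      (𝟙 (compatible c₁ u c) * h (pack c)) * ∑split u (λ a b → 𝟙 (compatible c₂ a b) * (f (pack a) * g (pack b)))
        ≡⟨ ∑split-*ˡ u (𝟙 (compatible c₁ u c) * h (pack c)) _ ⟨
      ∑split u (λ a b → (𝟙 (compatible c₁ u c) * h (pack c)) * (𝟙 (compatible c₂ a b) * (f (pack a) * g (pack b))))
        ≡⟨ ∑split-cong u (λ { a b refl → trans
             (solve 5 (λ k z l x y → (k :* z) :* (l :* (x :* y)) := (k :* l) :* (x :* (y :* z))) refl
               (𝟙 (compatible c₁ u c)) (h (pack c)) (𝟙 (compatible c₂ a b)) (f (pack a)) (g (pack b)))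
             (cong (_* (f (pack a) * (g (pack b) * h (pack c)))) (sym (𝟙-∧ (compatible c₁ u c) (compatible c₂ a b)))) }) ⟩
      ∑split u (λ a b → 𝟙 (compatible c₁ (a ++ b) c ∧ compatible c₂ a b) * (f (pack a) * (g (pack b) * h (pack c)))) ∎

  conv-conv-right : ∀ c₁ c₂ f g h {w} → Packed w →
    conv c₁ f (conv c₂ g h) w ≡ ∑₃ w (λ a b c → compatible c₁ a (b ++ c) ∧ compatible c₂ b c) f g h
  conv-conv-right c₁ c₂ f g h {w} p = trans (conv-packed c₁ f _ p)
    (∑split-cong w (λ a v e → inner a v (All.++⁻ʳ a (subst Pos (sym e) (proj₁ p)))))
    where
    open +-*-Solver
    inner : ∀ a v → Pos v → 𝟙 (compatible c₁ a v) * (f (pack a) * conv c₂ g h (pack v))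
          ≡ ∑split v (λ b c → 𝟙 (compatible c₁ a (b ++ c) ∧ compatible c₂ b c) * (f (pack a) * (g (pack b) * h (pack c))))
    inner a v pos = begin
      𝟙 (compatible c₁ a v) * (f (pack a) * conv c₂ g h (pack v))
        ≡⟨ ℚ.*-assoc (𝟙 (compatible c₁ a v)) (f (pack a)) _ ⟨
      (𝟙 (compatible c₁ a v) * f (pack a)) * conv c₂ g h (pack v)
        ≡⟨ cong ((𝟙 (compatible c₁ a v) * f (pack a)) *_) (conv-pack c₂ g h v pos) ⟩
      (𝟙 (compatible c₁ a v) * f (pack a)) * ∑split v (λ b c → 𝟙 (compatible c₂ b c) * (g (pack b) * h (pack c)))
        ≡⟨ ∑split-*ˡ v (𝟙 (compatible c₁ a v) * f (pack a)) _ ⟨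
      ∑split v (λ b c → (𝟙 (compatible c₁ a v) * f (pack a)) * (𝟙 (compatible c₂ b c) * (g (pack b) * h (pack c))))
        ≡⟨ ∑split-cong v (λ { b c refl → trans
             (solve 4 (λ k x l y → (k :* x) :* (l :* y) := (k :* l) :* (x :* y)) refl
               (𝟙 (compatible c₁ a v)) (f (pack a)) (𝟙 (compatible c₂ b c)) (g (pack b) * h (pack c)))
             (cong (_* (f (pack a) * (g (pack b) * h (pack c)))) (sym (𝟙-∧ (compatible c₁ a v) (compatible c₂ b c)))) }) ⟩
      ∑split v (λ b c → 𝟙 (compatible c₁ a (b ++ c) ∧ compatible c₂ b c) * (f (pack a) * (g (pack b) * h (pack c)))) ∎

  compatible-reassoc : ∀ c₁ c₂ c₃ c₄ →
    (∀ {x y z} → cmpᵇ c₁ (x ⊔ y) z ≡ true → cmpᵇ c₂ x y ≡ true → cmpᵇ c₃ x (y ⊔ z) ≡ true × cmpᵇ c₄ y z ≡ true) →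
    (∀ {x y z} → cmpᵇ c₃ x (y ⊔ z) ≡ true → cmpᵇ c₄ y z ≡ true → cmpᵇ c₁ (x ⊔ y) z ≡ true × cmpᵇ c₂ x y ≡ true) →
    ∀ a b c → compatible c₁ (a ++ b) c ∧ compatible c₂ a b ≡ compatible c₃ a (b ++ c) ∧ compatible c₄ b c
  compatible-reassoc c₁ c₂ c₃ c₄ to from a b c = bool-ext fwd bwd
    where
    fwd : compatible c₁ (a ++ b) c ∧ compatible c₂ a b ≡ true → compatible c₃ a (b ++ c) ∧ compatible c₄ b c ≡ true
    fwd h = ∧-true⁺ (∧-true⁺ (disjoint-complete a (b ++ c) abc) (subst (λ m → cmpᵇ c₃ (maxW a) m ≡ true) (sym (maxW-++ b c)) (proj₁ cmps)))
                    (∧-true⁺ (disjoint-complete b c (λ x∈b → ab-c (∈.∈-++⁺ʳ a x∈b))) (proj₂ cmps))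
      where
      h₁ = ∧-true⁻ˡ h
      h₂ = ∧-true⁻ʳ {compatible c₁ (a ++ b) c} h
      ab-c = disjoint-sound (a ++ b) c (∧-true⁻ˡ h₁)
      abc : ∀ {x} → x ∈ a → x ∉ b ++ c
      abc x∈a x∈bc with ∈.∈-++⁻ b x∈bc
      ... | inj₁ x∈b = disjoint-sound a b (∧-true⁻ˡ h₂) x∈a x∈b
      ... | inj₂ x∈c = ab-c (∈.∈-++⁺ˡ x∈a) x∈c
      cmps = to (subst (λ m → cmpᵇ c₁ m (maxW c) ≡ true) (maxW-++ a b) (∧-true⁻ʳ {disjointW (a ++ b) c} h₁))
                (∧-true⁻ʳ {disjointW a b} h₂)
    bwd : compatible c₃ a (b ++ c) ∧ compatible c₄ b c ≡ true → compatible c₁ (a ++ b) c ∧ compatible c₂ a b ≡ true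
    bwd h = ∧-true⁺ (∧-true⁺ (disjoint-complete (a ++ b) c abc) (subst (λ m → cmpᵇ c₁ m (maxW c) ≡ true) (sym (maxW-++ a b)) (proj₁ cmps)))
                    (∧-true⁺ (disjoint-complete a b (λ x∈a x∈b → a-bc x∈a (∈.∈-++⁺ˡ x∈b))) (proj₂ cmps))
      where
      h₁ = ∧-true⁻ˡ h
      h₂ = ∧-true⁻ʳ {compatible c₃ a (b ++ c)} h
      a-bc = disjoint-sound a (b ++ c) (∧-true⁻ˡ h₁)
      abc : ∀ {x} → x ∈ a ++ b → x ∉ c
      abc x∈ab x∈c with ∈.∈-++⁻ a x∈ab
      ... | inj₁ x∈a = a-bc x∈a (∈.∈-++⁺ʳ b x∈c)
      ... | inj₂ x∈b = disjoint-sound b c (∧-true⁻ˡ h₂) x∈b x∈c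
      cmps = from (subst (λ m → cmpᵇ c₃ (maxW a) m ≡ true) (maxW-++ b c) (∧-true⁻ʳ {disjointW a (b ++ c)} h₁))
                  (∧-true⁻ʳ {disjointW b c} h₂)

  -- Disjointness of three factors does not depend on the bracketing, so each dendriform axiom
  -- reduces to an equivalence between inequalities of three maxima, which the two hypotheses
  -- express.
  conv-assoc : ∀ c₁ c₂ c₃ c₄ →
    (∀ {x y z} → cmpᵇ c₁ (x ⊔ y) z ≡ true → cmpᵇ c₂ x y ≡ true → cmpᵇ c₃ x (y ⊔ z) ≡ true × cmpᵇ c₄ y z ≡ true) →
    (∀ {x y z} → cmpᵇ c₃ x (y ⊔ z) ≡ true → cmpᵇ c₄ y z ≡ true → cmpᵇ c₁ (x ⊔ y) z ≡ true × cmpᵇ c₂ x y ≡ true) →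
    ∀ f g h w → conv c₁ (conv c₂ f g) h w ≡ conv c₃ f (conv c₄ g h) w
  conv-assoc c₁ c₂ c₃ c₄ to from f g h w with packed? w
  ... | no np = trans (conv-unpacked c₁ _ h np) (sym (conv-unpacked c₃ f _ np))
  ... | yes p = trans (conv-conv-left c₁ c₂ f g h p) (trans
        (∑split-cong w (λ a v _ → ∑split-cong v (λ b c _ →
          cong (λ k → 𝟙 k * (f (pack a) * (g (pack b) * h (pack c)))) (compatible-reassoc c₁ c₂ c₃ c₄ to from a b c))))
        (sym (conv-conv-right c₃ c₄ f g h p)))

≺-assoc : ∀ f g h w → ((f ≺ᵛ g) ≺ᵛ h) w ≡ (f ≺ᵛ (g ∗ h)) w
≺-assoc = conv-assoc gt gt gt any
  (λ {x} {y} {z} z<xy y<x → let y<x′ = <ᵇ-sound {y} {x} y<x in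
     <ᵇ-true {y ⊔ z} {x} (ℕ.⊔-pres-<m y<x′ (subst (z <_) (ℕ.m≥n⇒m⊔n≡m (ℕ.<⇒≤ y<x′)) (<ᵇ-sound {z} {x ⊔ y} z<xy))) , refl)
  (λ {x} {y} {z} yz<x _ → let lt = <ᵇ-sound {y ⊔ z} {x} yz<x in
     <ᵇ-true {z} {x ⊔ y} (ℕ.<-≤-trans (ℕ.≤-<-trans (ℕ.m≤n⊔m y z) lt) (ℕ.m≤m⊔n x y)) ,
     <ᵇ-true {y} {x} (ℕ.≤-<-trans (ℕ.m≤m⊔n y z) lt))

≻-≺-assoc : ∀ f g h w → ((f ≻ᵛ g) ≺ᵛ h) w ≡ (f ≻ᵛ (g ≺ᵛ h)) w
≻-≺-assoc = conv-assoc gt lt lt gt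
  (λ {x} {y} {z} z<xy x<y → let lt = <ᵇ-sound {x} {y} x<y in
     <ᵇ-true {x} {y ⊔ z} (ℕ.<-≤-trans lt (ℕ.m≤m⊔n y z)) ,
     <ᵇ-true {z} {y} (subst (z <_) (ℕ.m≤n⇒m⊔n≡n (ℕ.<⇒≤ lt)) (<ᵇ-sound {z} {x ⊔ y} z<xy)))
  (λ {x} {y} {z} x<yz z<y → let lt = <ᵇ-sound {z} {y} z<y in
     <ᵇ-true {z} {x ⊔ y} (ℕ.<-≤-trans lt (ℕ.m≤n⊔m x y)) ,
     <ᵇ-true {x} {y} (subst (x <_) (ℕ.m≥n⇒m⊔n≡m (ℕ.<⇒≤ lt)) (<ᵇ-sound {x} {y ⊔ z} x<yz)))

-- Units and linearity

𝟏 : V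
𝟏 []      = 1ℚ
𝟏 (_ ∷ _) = 0ℚ

𝟏-≢[] : ∀ {w} → w ≢ [] → 𝟏 w ≡ 0ℚ
𝟏-≢[] {[]}    ne = ⊥-elim (ne refl)
𝟏-≢[] {_ ∷ _} ne = refl

PackedSupport : V → Set
PackedSupport f = ∀ {w} → ¬ Packed w → f w ≡ 0ℚ

-- The unit laws `f ≺ 𝟏 = f` and `𝟏 ≻ f = f` hold only on the augmentation ideal: at the empty word
-- both maxima are 0, and both half-products vanish.
Augmentation : V → Set
Augmentation f = PackedSupport f × f [] ≡ 0ℚ

disjointW-[]ʳ : ∀ w → disjointW w [] ≡ true
disjointW-[]ʳ w = disjoint-complete w [] (λ _ ())

compatible-[]ʳ : ∀ w → Pos w → w ≢ [] → compatible gt w [] ≡ true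
compatible-[]ʳ w pos ne = ∧-true⁺ (disjointW-[]ʳ w) (<ᵇ-true (maxW-pos w pos ne))

compatible-[]ˡ : ∀ w → Pos w → w ≢ [] → compatible lt [] w ≡ true
compatible-[]ˡ w pos ne = <ᵇ-true (maxW-pos w pos ne)

𝟙-true : ∀ {b} x → b ≡ true → 𝟙 b * x ≡ x
𝟙-true x refl = ℚ.*-identityˡ x

𝟙-false : ∀ {b} x → b ≡ false → 𝟙 b * x ≡ 0ℚ
𝟙-false x refl = ℚ.*-zeroˡ x

conv-𝟏ʳ : ∀ c f {w} → Packed w → conv c f 𝟏 w ≡ 𝟙 (compatible c w []) * f w
conv-𝟏ʳ c f {w} p = begin
  conv c f 𝟏 w
    ≡⟨ conv-packed c f 𝟏 p ⟩
  ∑split w (λ a b → 𝟙 (compatible c a b) * (f (pack a) * 𝟏 (pack b)))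
    ≡⟨ ∑split-last w (λ a b ne _ → *-zeroʳ-≡ (𝟙 (compatible c a b)) (*-zeroʳ-≡ (f (pack a)) (𝟏-≢[] (pack-≢[] b ne)))) ⟩
  𝟙 (compatible c w []) * (f (pack w) * 1ℚ)
    ≡⟨ cong (𝟙 (compatible c w []) *_) (trans (ℚ.*-identityʳ _) (cong f (pack-id p))) ⟩
  𝟙 (compatible c w []) * f w ∎

conv-𝟏ˡ : ∀ c f {w} → Packed w → conv c 𝟏 f w ≡ 𝟙 (compatible c [] w) * f w
conv-𝟏ˡ c f {w} p = begin
  conv c 𝟏 f w
    ≡⟨ conv-packed c 𝟏 f p ⟩
  ∑split w (λ a b → 𝟙 (compatible c a b) * (𝟏 (pack a) * f (pack b)))
    ≡⟨ ∑split-first w (λ a b ne → *-zeroʳ-≡ (𝟙 (compatible c a b)) (*-zeroˡ-≡ (f (pack b)) (𝟏-≢[] (pack-≢[] a ne)))) ⟩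
  𝟙 (compatible c [] w) * (1ℚ * f (pack w))
    ≡⟨ cong (𝟙 (compatible c [] w) *_) (trans (ℚ.*-identityˡ _) (cong f (pack-id p))) ⟩
  𝟙 (compatible c [] w) * f w ∎

≺-identityʳ : ∀ {f} → Augmentation f → ∀ w → (f ≺ᵛ 𝟏) w ≡ f w
≺-identityʳ {f} (supp , f[]) w with packed? w
... | no np = trans (conv-unpacked gt f 𝟏 np) (sym (supp np))
... | yes p with []? w
...   | yes refl = trans (conv-𝟏ʳ gt f p) (trans (ℚ.*-zeroˡ (f [])) (sym f[]))
...   | no ne    = trans (conv-𝟏ʳ gt f p) (𝟙-true (f w) (compatible-[]ʳ w (proj₁ p) ne))

≻-identityˡ : ∀ {f} → Augmentation f → ∀ w → (𝟏 ≻ᵛ f) w ≡ f w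
≻-identityˡ {f} (supp , f[]) w with packed? w
... | no np = trans (conv-unpacked lt 𝟏 f np) (sym (supp np))
... | yes p with []? w
...   | yes refl = trans (conv-𝟏ˡ lt f p) (trans (ℚ.*-zeroˡ (f [])) (sym f[]))
...   | no ne    = trans (conv-𝟏ˡ lt f p) (𝟙-true (f w) (compatible-[]ˡ w (proj₁ p) ne))

∗-identityʳ : ∀ {f} → PackedSupport f → ∀ w → (f ∗ 𝟏) w ≡ f w
∗-identityʳ {f} supp w with packed? w
... | no np = trans (conv-unpacked any f 𝟏 np) (sym (supp np))
... | yes p = trans (conv-𝟏ʳ any f p) (𝟙-true (f w) (∧-true⁺ (disjointW-[]ʳ w) refl))

∗-identityˡ : ∀ {f} → PackedSupport f → ∀ w → (𝟏 ∗ f) w ≡ f w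
∗-identityˡ {f} supp w with packed? w
... | no np = trans (conv-unpacked any 𝟏 f np) (sym (supp np))
... | yes p = trans (conv-𝟏ˡ any f p) (ℚ.*-identityˡ (f w))

conv-[] : ∀ c f g → conv c f g [] ≡ 𝟙 (cmpᵇ c 0 0) * (f [] * g [])
conv-[] c f g = trans (conv-packed c f g []-packed) (∑split-[] _)

≺-augmentation : ∀ f g → Augmentation (f ≺ᵛ g)
≺-augmentation f g = conv-unpacked gt f g , trans (conv-[] gt f g) (ℚ.*-zeroˡ (f [] * g []))

≻-augmentation : ∀ f g → Augmentation (f ≻ᵛ g)
≻-augmentation f g = conv-unpacked lt f g , trans (conv-[] lt f g) (ℚ.*-zeroˡ (f [] * g []))

𝟏-packedSupport : PackedSupport 𝟏
𝟏-packedSupport {[]}    np = ⊥-elim (np []-packed)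
𝟏-packedSupport {_ ∷ _} np = refl

maxW-disjoint-≢ : ∀ a b → Pos a → Pos b → disjointW a b ≡ true → ¬ (a ≡ [] × b ≡ []) → maxW a ≢ maxW b
maxW-disjoint-≢ a b posa posb d ne e with []? a | []? b
... | yes refl | yes refl = ne (refl , refl)
... | yes refl | no b≢[]  = ℕ.<⇒≢ (maxW-pos b posb b≢[]) e
... | no a≢[]  | yes refl = ℕ.<⇒≢ (maxW-pos a posa a≢[]) (sym e)
... | no a≢[]  | no b≢[]  = disjoint-sound a b d (maxW-∈ a a≢[]) (subst (_∈ b) (sym e) (maxW-∈ b b≢[]))

-- Disjoint factors that are not both empty have different maxima, so exactly one half-product
-- counts the cut. The condition at the empty word removes the cuts with empty left factor, among
-- them the trivial one that neither side would count.
∗-≺-≻ : ∀ f g → f [] ≡ 0ℚ → ∀ w → (f ∗ g) w ≡ (f ≺ᵛ g) w + (f ≻ᵛ g) w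
∗-≺-≻ f g f[] w with packed? w
... | no np = trans (conv-unpacked any f g np) (sym (trans (cong₂ _+_ (conv-unpacked gt f g np) (conv-unpacked lt f g np)) (ℚ.+-identityˡ 0ℚ)))
... | yes p = trans (conv-packed any f g p) (trans
      (trans (∑split-cong w (λ a b e → term a b (subst Pos (sym e) (proj₁ p)))) (∑split-+ w _ _))
      (sym (cong₂ _+_ (conv-packed gt f g p) (conv-packed lt f g p))))
  where
  term : ∀ a b → Pos (a ++ b) → 𝟙 (compatible any a b) * (f (pack a) * g (pack b))
       ≡ 𝟙 (compatible gt a b) * (f (pack a) * g (pack b)) + 𝟙 (compatible lt a b) * (f (pack a) * g (pack b))
  term a b pos with []? a
  ... | yes refl rewrite f[] = trans (*-zeroʳ-≡ (𝟙 (compatible any [] b)) z)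
        (sym (trans (cong₂ _+_ (*-zeroʳ-≡ (𝟙 (compatible gt [] b)) z) (*-zeroʳ-≡ (𝟙 (compatible lt [] b)) z)) (ℚ.+-identityˡ 0ℚ)))
    where z = ℚ.*-zeroˡ (g (pack b))
  ... | no a≢[] with bool-dec (disjointW a b)
  ...   | inj₂ d rewrite d = trans (ℚ.*-zeroˡ X) (sym (trans (cong₂ _+_ (ℚ.*-zeroˡ X) (ℚ.*-zeroˡ X)) (ℚ.+-identityˡ 0ℚ)))
    where X = f (pack a) * g (pack b)
  ...   | inj₁ d with ℕ.<-cmp (maxW a) (maxW b)
  ...     | Tri.tri≈ _ e _ = ⊥-elim (maxW-disjoint-≢ a b (All.++⁻ˡ a pos) (All.++⁻ʳ a pos) d (a≢[] ∘ proj₁) e)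
  ...     | Tri.tri< l _ _ rewrite d | <ᵇ-true l | <ᵇ-false (ℕ.<⇒≤ l) = sym (trans (cong (_+ 1ℚ * X) (ℚ.*-zeroˡ X)) (ℚ.+-identityˡ _))
    where X = f (pack a) * g (pack b)
  ...     | Tri.tri> _ _ l rewrite d | <ᵇ-true l | <ᵇ-false (ℕ.<⇒≤ l) = sym (trans (cong (1ℚ * X +_) (ℚ.*-zeroˡ X)) (ℚ.+-identityʳ _))
    where X = f (pack a) * g (pack b)

-- φ is linear and depends only on the values at words satisfying P.
Linear : (Word → Set) → (V → ℚ) → Set₁
Linear P φ = ∀ {A : Set} (xs : List A) (k : A → ℚ) (F : A → V) (x : V) →
             (∀ {w} → P w → x w ≡ ∑ xs (λ i → k i * F i w)) → φ x ≡ ∑ xs (λ i → k i * φ (F i))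

module _ {P : Word → Set} {φ : V → ℚ} (lin : Linear P φ) where

  linear-zero : ∀ x → (∀ {w} → P w → x w ≡ 0ℚ) → φ x ≡ 0ℚ
  linear-zero x h = lin {⊤} [] (λ _ → 0ℚ) (λ _ → x) x h

  linear-scale : ∀ k x y → (∀ {w} → P w → x w ≡ k * y w) → φ x ≡ k * φ y
  linear-scale k x y h = trans
    (lin (tt ∷ []) (λ _ → k) (λ _ → y) x (λ p → trans (h p) (sym (ℚ.+-identityʳ _))))
    (ℚ.+-identityʳ _)

  linear-cong : ∀ x y → (∀ {w} → P w → x w ≡ y w) → φ x ≡ φ y
  linear-cong x y h = trans (linear-scale 1ℚ x y (λ p → trans (h p) (sym (ℚ.*-identityˡ _)))) (ℚ.*-identityˡ _)

  linear-+ : ∀ k x y z → (∀ {w} → P w → x w ≡ y w + k * z w) → φ x ≡ φ y + k * φ z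
  linear-+ k x y z h = trans
    (lin (true ∷ false ∷ []) (λ b → if b then 1ℚ else k) (λ b → if b then y else z) x
      (λ {w} p → trans (h p) (cong₂ _+_ (sym (ℚ.*-identityˡ (y w))) (sym (ℚ.+-identityʳ (k * z w))))))
    (cong₂ _+_ (ℚ.*-identityˡ (φ y)) (ℚ.+-identityʳ (k * φ z)))

  opaque
    unfolding ∑split

    linear-∑split : ∀ {A : Set} (ps : List A) (k : List A → List A → ℚ) (F : List A → List A → V) (x : V) →
                    (∀ {w} → P w → x w ≡ ∑split ps (λ u v → k u v * F u v w)) →
                    φ x ≡ ∑split ps (λ u v → k u v * φ (F u v))
    linear-∑split ps k F x h = lin (splits ps) (λ (u , v) → k u v) (λ (u , v) → F u v) x h

conv-linearˡ : ∀ c g w → Linear Packed (λ f → conv c f g w)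
conv-linearˡ c g w xs k F x h with packed? w
... | no np = trans (conv-unpacked c x g np) (sym (∑-zero xs (λ i → *-zeroʳ-≡ (k i) (conv-unpacked c (F i) g np))))
... | yes p = begin
  conv c x g w
    ≡⟨ conv-packed c x g p ⟩
  ∑split w (λ a b → 𝟙 (compatible c a b) * (x (pack a) * g (pack b)))
    ≡⟨ ∑split-cong w (λ a b _ → trans (term a b) (sym (∑-*ˡ xs (𝟙 (compatible c a b) * g (pack b)) _))) ⟩
  ∑split w (λ a b → ∑ xs (λ i → (𝟙 (compatible c a b) * g (pack b)) * (k i * F i (pack a))))
    ≡⟨ ∑split-∑ w xs _ ⟩
  ∑ xs (λ i → ∑split w (λ a b → (𝟙 (compatible c a b) * g (pack b)) * (k i * F i (pack a))))
    ≡⟨ ∑-cong xs (λ i → trans (∑split-cong w (λ a b _ → shuffle (𝟙 (compatible c a b)) (g (pack b)) (k i) (F i (pack a)))) (∑split-*ˡ w (k i) _)) ⟩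
  ∑ xs (λ i → k i * ∑split w (λ a b → 𝟙 (compatible c a b) * (F i (pack a) * g (pack b))))
    ≡⟨ ∑-cong xs (λ i → cong (k i *_) (conv-packed c (F i) g p)) ⟨
  ∑ xs (λ i → k i * conv c (F i) g w) ∎
  where
  open +-*-Solver
  shuffle : ∀ κ y k z → (κ * y) * (k * z) ≡ k * (κ * (z * y))
  shuffle = solve 4 (λ κ y k z → (κ :* y) :* (k :* z) := k :* (κ :* (z :* y))) refl
  term : ∀ a b → 𝟙 (compatible c a b) * (x (pack a) * g (pack b))
       ≡ (𝟙 (compatible c a b) * g (pack b)) * ∑ xs (λ i → k i * F i (pack a))
  term a b = trans (cong (λ y → 𝟙 (compatible c a b) * (y * g (pack b))) (h (pack-packed a)))
    (solve 3 (λ κ s y → κ :* (s :* y) := (κ :* y) :* s) refl (𝟙 (compatible c a b)) _ (g (pack b)))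

conv-linearʳ : ∀ c f w → Linear Packed (λ g → conv c f g w)
conv-linearʳ c f w xs k F x h with packed? w
... | no np = trans (conv-unpacked c f x np) (sym (∑-zero xs (λ i → *-zeroʳ-≡ (k i) (conv-unpacked c f (F i) np))))
... | yes p = begin
  conv c f x w
    ≡⟨ conv-packed c f x p ⟩
  ∑split w (λ a b → 𝟙 (compatible c a b) * (f (pack a) * x (pack b)))
    ≡⟨ ∑split-cong w (λ a b _ → trans (term a b) (sym (∑-*ˡ xs (𝟙 (compatible c a b) * f (pack a)) _))) ⟩
  ∑split w (λ a b → ∑ xs (λ i → (𝟙 (compatible c a b) * f (pack a)) * (k i * F i (pack b))))
    ≡⟨ ∑split-∑ w xs _ ⟩
  ∑ xs (λ i → ∑split w (λ a b → (𝟙 (compatible c a b) * f (pack a)) * (k i * F i (pack b))))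
    ≡⟨ ∑-cong xs (λ i → trans (∑split-cong w (λ a b _ → shuffle (𝟙 (compatible c a b)) (f (pack a)) (k i) (F i (pack b)))) (∑split-*ˡ w (k i) _)) ⟩
  ∑ xs (λ i → k i * ∑split w (λ a b → 𝟙 (compatible c a b) * (f (pack a) * F i (pack b))))
    ≡⟨ ∑-cong xs (λ i → cong (k i *_) (conv-packed c f (F i) p)) ⟨
  ∑ xs (λ i → k i * conv c f (F i) w) ∎
  where
  open +-*-Solver
  shuffle : ∀ κ y k z → (κ * y) * (k * z) ≡ k * (κ * (y * z))
  shuffle = solve 4 (λ κ y k z → (κ :* y) :* (k :* z) := k :* (κ :* (y :* z))) refl
  term : ∀ a b → 𝟙 (compatible c a b) * (f (pack a) * x (pack b))
       ≡ (𝟙 (compatible c a b) * f (pack a)) * ∑ xs (λ i → k i * F i (pack b))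
  term a b = trans (cong (λ y → 𝟙 (compatible c a b) * (f (pack a) * y)) (h (pack-packed b)))
    (sym (ℚ.*-assoc (𝟙 (compatible c a b)) (f (pack a)) _))

-- Coproducts of functions on words

opaque

  -- Cuts with an empty factor are included, unlike in `Δprec` and `Δsucc`: `Δ all x p []` is `x p`.
  -- The product formulas then need no separate boundary terms, and `Vanishes` restricts to nonempty
  -- factors.
  Δ : Side → V → Word → Word → ℚ
  Δ c x p q = 𝟙 (isPacked p ∧ isPacked q) * ∑sh p (shift (maxW p) q) (λ u → 𝟙 (lastFrom c (maxW p) u) * x u)

  Δ-packed : ∀ c x {p q} → Packed p → Packed q →
             Δ c x p q ≡ ∑sh p (shift (maxW p) q) (λ u → 𝟙 (lastFrom c (maxW p) u) * x u)
  Δ-packed c x {p} {q} pp pq = 𝟙-true _ (∧-true⁺ (isPacked-complete p pp) (isPacked-complete q pq))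

  Δ-unpackedˡ : ∀ c x {p q} → ¬ Packed p → Δ c x p q ≡ 0ℚ
  Δ-unpackedˡ c x {p} np = 𝟙-false _ (cong (_∧ _) (≢true⇒false (np ∘ isPacked-sound p)))

  Δ-unpackedʳ : ∀ c x {p q} → ¬ Packed q → Δ c x p q ≡ 0ℚ
  Δ-unpackedʳ c x {p} {q} np = 𝟙-false _ (≢true⇒false (np ∘ isPacked-sound q ∘ ∧-true⁻ʳ {isPacked p}))

Δ-linear : ∀ c p q → Linear Packed (λ x → Δ c x p q)
Δ-linear c p q xs k F x h with packed? p | packed? q
... | no np | _      = trans (Δ-unpackedˡ c x np) (sym (∑-zero xs (λ i → *-zeroʳ-≡ (k i) (Δ-unpackedˡ c (F i) np))))
... | yes pp | no np = trans (Δ-unpackedʳ c x np) (sym (∑-zero xs (λ i → *-zeroʳ-≡ (k i) (Δ-unpackedʳ c (F i) np))))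
... | yes pp | yes pq = begin
  Δ c x p q
    ≡⟨ Δ-packed c x pp pq ⟩
  ∑sh p q′ (λ u → 𝟙 (lastFrom c m u) * x u)
    ≡⟨ ∑sh-cong p q′ (λ u i → trans (cong (𝟙 (lastFrom c m u) *_) (h (shuffle-packed pp pq i))) (sym (∑-*ˡ xs (𝟙 (lastFrom c m u)) _))) ⟩
  ∑sh p q′ (λ u → ∑ xs (λ i → 𝟙 (lastFrom c m u) * (k i * F i u)))
    ≡⟨ ∑sh-∑ p q′ xs _ ⟩
  ∑ xs (λ i → ∑sh p q′ (λ u → 𝟙 (lastFrom c m u) * (k i * F i u)))
    ≡⟨ ∑-cong xs (λ i → trans (∑sh-cong-≗ p q′ (λ u → *-shift (𝟙 (lastFrom c m u)) (k i) (F i u))) (∑sh-*ˡ p q′ (k i) _)) ⟩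
  ∑ xs (λ i → k i * ∑sh p q′ (λ u → 𝟙 (lastFrom c m u) * F i u))
    ≡⟨ ∑-cong xs (λ i → cong (k i *_) (Δ-packed c (F i) pp pq)) ⟨
  ∑ xs (λ i → k i * Δ c (F i) p q) ∎
  where
  m  = maxW p
  q′ = shift m q

Δ-all : ∀ x {p q} → Packed p → Packed q → Δ all x p q ≡ ∑sh p (shift (maxW p) q) x
Δ-all x {p} {q} pp pq = trans (Δ-packed all x pp pq) (∑sh-cong-≗ p _ (λ u → ℚ.*-identityˡ (x u)))

Δ-[]ʳ : ∀ x {p} → Packed p → Δ all x p [] ≡ x p
Δ-[]ʳ x {p} pp = trans (Δ-all x pp []-packed) (∑sh-[]ʳ p x)

Δ-right-[]ʳ : ∀ x {p} → Packed p → Δ right x p [] ≡ 0ℚ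
Δ-right-[]ʳ x {p} pp = trans (Δ-packed right x pp []-packed) (trans (∑sh-[]ʳ p _)
  (𝟙-false (x p) (lastᵇ-All (maxW p <ᵇ_) false false p (All.map <ᵇ-false (≤maxW p)) refl)))

Δ-[]ˡ : ∀ c → c ≢ left → ∀ x {q} → Packed q → q ≢ [] → Δ c x [] q ≡ x q
Δ-[]ˡ left  ne x pq q≢[] = ⊥-elim (ne refl)
Δ-[]ˡ all   ne x {q} pq q≢[] = trans (Δ-all x []-packed pq) (trans (∑sh-[]ˡ (shift 0 q) x) (cong x (List.map-id q)))
Δ-[]ˡ right ne x {q} pq q≢[] = trans (Δ-packed right x []-packed pq) (trans (∑sh-[]ˡ (shift 0 q) _)
  (trans (cong (λ w → 𝟙 (lastFrom right 0 w) * x w) (List.map-id q)) (𝟙-true (x q) (last-true q (proj₁ pq) q≢[]))))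
  where
  last-true : ∀ q → Pos q → q ≢ [] → lastᵇ (0 <ᵇ_) false q ≡ true
  last-true []      _         ne = ⊥-elim (ne refl)
  last-true (y ∷ q) (1≤y ∷ h) _  = lastᵇ-All (0 <ᵇ_) (0 <ᵇ y) true q (All.map <ᵇ-true h) (<ᵇ-true 1≤y)

module _ {m p₁ p₂ q₁ q₂ a b} (p₁≤m : All (_≤ m) p₁) (p₂≤m : All (_≤ m) p₂) (pos₁ : Pos q₁) (pos₂ : Pos q₂)
         (i : Interleaving p₁ (shift m q₁) a) (j : Interleaving p₂ (shift m q₂) b) where

  disjointW-shuffle : disjointW a b ≡ disjointW p₁ p₂ ∧ disjointW q₁ q₂
  disjointW-shuffle = bool-ext
    (λ h → let d = disjoint-sound a b h in
       ∧-true⁺ (disjoint-complete p₁ p₂ (λ x∈ y∈ → d (∈-interleavingˡ i x∈) (∈-interleavingˡ j y∈)))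
               (disjoint-complete q₁ q₂ (λ x∈ y∈ → d (∈-interleavingʳ i (∈.∈-map⁺ _ x∈)) (∈-interleavingʳ j (∈.∈-map⁺ _ y∈)))))
    (λ h → disjoint-complete a b (sound (∧-true⁻ˡ h) (∧-true⁻ʳ {disjointW p₁ p₂} h)))
    where
    sound : disjointW p₁ p₂ ≡ true → disjointW q₁ q₂ ≡ true → ∀ {x} → x ∈ a → x ∉ b
    sound dp dq x∈a x∈b with ∈-interleaving⁻ i x∈a | ∈-interleaving⁻ j x∈b
    ... | inj₁ x∈ | inj₁ y∈ = disjoint-sound p₁ p₂ dp x∈ y∈
    ... | inj₁ x∈ | inj₂ y∈ = ℕ.<⇒≱ (All.lookup (shift-> m q₂ pos₂) y∈) (All.lookup p₁≤m x∈)
    ... | inj₂ x∈ | inj₁ y∈ = ℕ.<⇒≱ (All.lookup (shift-> m q₁ pos₁) x∈) (All.lookup p₂≤m y∈)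
    ... | inj₂ x∈ | inj₂ y∈ with ∈.∈-map⁻ _ x∈ | ∈.∈-map⁻ _ y∈
    ...   | z , z∈ , refl | z′ , z′∈ , e = disjoint-sound q₁ q₂ dq z∈ (subst (_∈ q₂) (sym (ℕ.+-cancelˡ-≡ m z z′ e)) z′∈)

maxW-high : ∀ {m p q a} → All (_≤ m) p → Interleaving p (shift m q) a → q ≢ [] → maxW a ≡ m ℕ.+ maxW q
maxW-high {m} {p} {q} p≤m i q≢[] = trans (maxW-interleaving i) (trans
  (cong (maxW p ⊔_) (maxW-shift m q q≢[]))
  (ℕ.m≤n⇒m⊔n≡n (ℕ.≤-trans (maxW-lub p (All.lookup p≤m)) (ℕ.m≤m+n m _))))

-- As soon as letters above `m` occur, they alone decide which factor contains the maximum. Hence a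
-- half-product is visible in the right tensor factor of its coproduct.
maxW-<ᵇ-shuffle : ∀ {m p₁ p₂ q₁ q₂ a b} → All (_≤ m) p₁ → All (_≤ m) p₂ → Pos q₁ → Pos q₂ →
                  Interleaving p₁ (shift m q₁) a → Interleaving p₂ (shift m q₂) b → q₁ ++ q₂ ≢ [] →
                  (maxW a <ᵇ maxW b) ≡ (maxW q₁ <ᵇ maxW q₂)
maxW-<ᵇ-shuffle {m} {p₁} {p₂} {q₁} {q₂} {a} {b} p₁≤m p₂≤m pos₁ pos₂ i j ne with []? q₁ | []? q₂
... | yes refl | yes refl = ⊥-elim (ne refl)
... | no q₁≢[] | yes refl = trans (<ᵇ-false {maxW a} {maxW b} (ℕ.≤-trans
        (subst (_≤ m) (sym (trans (maxW-interleaving j) (ℕ.⊔-identityʳ (maxW p₂)))) (maxW-lub p₂ (All.lookup p₂≤m)))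
        (subst (m ≤_) (sym (maxW-high p₁≤m i q₁≢[])) (ℕ.m≤m+n m _)))) (sym (<ᵇ-false {maxW q₁} {0} z≤n))
... | yes refl | no q₂≢[] = trans (<ᵇ-true {maxW a} {maxW b} (ℕ.≤-<-trans
        (subst (_≤ m) (sym (trans (maxW-interleaving i) (ℕ.⊔-identityʳ (maxW p₁)))) (maxW-lub p₁ (All.lookup p₁≤m)))
        (subst (m <_) (sym (maxW-high p₂≤m j q₂≢[])) (subst (_≤ m ℕ.+ maxW q₂) (ℕ.+-comm m 1) (ℕ.+-monoʳ-≤ m (maxW-pos q₂ pos₂ q₂≢[])))))) (sym (<ᵇ-true (maxW-pos q₂ pos₂ q₂≢[])))
... | no q₁≢[] | no q₂≢[] rewrite maxW-high p₁≤m i q₁≢[] | maxW-high p₂≤m j q₂≢[] = bool-ext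
        (λ e → <ᵇ-true {maxW q₁} {maxW q₂} (ℕ.+-cancelˡ-< m _ _ (<ᵇ-sound {m ℕ.+ maxW q₁} {m ℕ.+ maxW q₂} e)))
        (λ e → <ᵇ-true {m ℕ.+ maxW q₁} {m ℕ.+ maxW q₂} (ℕ.+-monoʳ-< m (<ᵇ-sound {maxW q₁} {maxW q₂} e)))

compatible-shuffle : ∀ k → k ≢ any → ∀ {m p₁ p₂ q₁ q₂ a b} → All (_≤ m) p₁ → All (_≤ m) p₂ → Pos q₁ → Pos q₂ →
                     Interleaving p₁ (shift m q₁) a → Interleaving p₂ (shift m q₂) b → q₁ ++ q₂ ≢ [] →
                     𝟙 (compatible k a b) ≡ 𝟙 (disjointW p₁ p₂) * 𝟙 (compatible k q₁ q₂)
compatible-shuffle k k≢any {m} {p₁} {p₂} {q₁} {q₂} {a} {b} p₁≤m p₂≤m pos₁ pos₂ i j ne =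
  trans (cong 𝟙 (trans (cong₂ _∧_ (disjointW-shuffle p₁≤m p₂≤m pos₁ pos₂ i j) (cmps k k≢any))
                       (∧-assoc (disjointW p₁ p₂) (disjointW q₁ q₂) (cmpᵇ k (maxW q₁) (maxW q₂)))))
        (𝟙-∧ (disjointW p₁ p₂) (compatible k q₁ q₂))
  where
  cmps : ∀ k → k ≢ any → cmpᵇ k (maxW a) (maxW b) ≡ cmpᵇ k (maxW q₁) (maxW q₂)
  cmps lt  _  = maxW-<ᵇ-shuffle p₁≤m p₂≤m pos₁ pos₂ i j ne
  cmps gt  _  = maxW-<ᵇ-shuffle p₂≤m p₁≤m pos₂ pos₁ j i (λ e → ne (cong₂ _++_ (List.++-conicalʳ q₂ q₁ e) (List.++-conicalˡ q₂ q₁ e)))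
  cmps any ne′ = ⊥-elim (ne′ refl)

lastFrom-++ : ∀ c m a b → b ≢ [] → lastFrom c m (a ++ b) ≡ lastFrom c m b
lastFrom-++ all   m a b ne = refl
lastFrom-++ left  m a b ne = lastᵇ-++ (_≤ᵇ m) false false a b ne
lastFrom-++ right m a b ne = lastᵇ-++ (m <ᵇ_) false false a b ne

-- By `∑sh-split` a cut of a shuffle is a pair of shuffles. The comparison of maxima passes to the
-- parts of the nonempty `q`, and the condition on the last letter to the second factor. An empty
-- second factor would pass it to the first one; this is prevented by `c` being `all` or by `y`
-- vanishing at the empty word.
Δ-conv : ∀ c k → k ≢ any → ∀ x y → c ≡ all ⊎ y [] ≡ 0ℚ → ∀ {p q} → Packed p → Packed q → q ≢ [] →
         Δ c (conv k x y) p q ≡ ∑split p (λ p₁ p₂ → ∑split q (λ q₁ q₂ →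
           (𝟙 (disjointW p₁ p₂) * 𝟙 (compatible k q₁ q₂)) * (Δ all x (pack p₁) (pack q₁) * Δ c y (pack p₂) (pack q₂))))
Δ-conv c k k≢any x y hy {p} {q} pp pq q≢[] = begin
  Δ c (conv k x y) p q
    ≡⟨ Δ-packed c _ pp pq ⟩
  ∑sh p (shift m q) (λ u → 𝟙 (lastFrom c m u) * conv k x y u)
    ≡⟨ ∑sh-cong p (shift m q) (λ u i → trans (cong (𝟙 (lastFrom c m u) *_) (conv-packed k x y (shuffle-packed pp pq i)))
         (sym (∑split-*ˡ u (𝟙 (lastFrom c m u)) _))) ⟩
  ∑sh p (shift m q) (λ u → ∑split u (λ a b → 𝟙 (lastFrom c m u) * (𝟙 (compatible k a b) * (x (pack a) * y (pack b)))))
    ≡⟨ ∑sh-cong-≗ p (shift m q) (λ u → ∑split-cong u (λ { a b refl → rearrange a b })) ⟩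
  ∑sh p (shift m q) (λ u → ∑split u G)
    ≡⟨ ∑sh-split p (shift m q) G ⟩
  ∑split p (λ p₁ p₂ → ∑split (shift m q) (λ q₁ q₂ → ∑sh p₁ q₁ (λ a → ∑sh p₂ q₂ (G a))))
    ≡⟨ ∑split-cong p (λ p₁ p₂ _ → ∑split-map (m ℕ.+_) q _) ⟩
  ∑split p (λ p₁ p₂ → ∑split q (λ q₁ q₂ → ∑sh p₁ (shift m q₁) (λ a → ∑sh p₂ (shift m q₂) (G a))))
    ≡⟨ ∑split-cong p (λ p₁ p₂ e → ∑split-cong q (λ q₁ q₂ e′ → piece p₁ p₂ q₁ q₂ e e′)) ⟩
  ∑split p (λ p₁ p₂ → ∑split q (λ q₁ q₂ →
    (𝟙 (disjointW p₁ p₂) * 𝟙 (compatible k q₁ q₂)) * (Δ all x (pack p₁) (pack q₁) * Δ c y (pack p₂) (pack q₂)))) ∎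
  where
  open +-*-Solver
  m = maxW p
  G : Word → Word → ℚ
  G a b = 𝟙 (compatible k a b) * (x (pack a) * (𝟙 (lastFrom c m b) * y (pack b)))

  last-[] : ∀ a → c ≡ all ⊎ y [] ≡ 0ℚ → 𝟙 (lastFrom c m (a ++ [])) * y [] ≡ 𝟙 (lastFrom c m []) * y []
  last-[] a (inj₁ e)   = cong (_* y []) (trans (cong (λ c → 𝟙 (lastFrom c m (a ++ []))) e) (cong (λ c → 𝟙 (lastFrom c m [])) (sym e)))
  last-[] a (inj₂ y[]) = trans (*-zeroʳ-≡ (𝟙 (lastFrom c m (a ++ []))) y[]) (sym (*-zeroʳ-≡ (𝟙 (lastFrom c m [])) y[]))

  last-step : ∀ a b → 𝟙 (lastFrom c m (a ++ b)) * y (pack b) ≡ 𝟙 (lastFrom c m b) * y (pack b)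
  last-step a []      = last-[] a hy
  last-step a (z ∷ b) = cong (λ l → 𝟙 l * y (pack (z ∷ b))) (lastFrom-++ c m a (z ∷ b) (λ ()))

  rearrange : ∀ a b → 𝟙 (lastFrom c m (a ++ b)) * (𝟙 (compatible k a b) * (x (pack a) * y (pack b))) ≡ G a b
  rearrange a b = trans
    (solve 4 (λ l κ x y → l :* (κ :* (x :* y)) := κ :* (x :* (l :* y))) refl
      (𝟙 (lastFrom c m (a ++ b))) (𝟙 (compatible k a b)) (x (pack a)) (y (pack b)))
    (cong (λ z → 𝟙 (compatible k a b) * (x (pack a) * z)) (last-step a b))

  piece : ∀ p₁ p₂ q₁ q₂ → p₁ ++ p₂ ≡ p → q₁ ++ q₂ ≡ q →
          ∑sh p₁ (shift m q₁) (λ a → ∑sh p₂ (shift m q₂) (G a))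
        ≡ (𝟙 (disjointW p₁ p₂) * 𝟙 (compatible k q₁ q₂)) * (Δ all x (pack p₁) (pack q₁) * Δ c y (pack p₂) (pack q₂))
  piece p₁ p₂ q₁ q₂ e e′ = begin
    ∑sh p₁ (shift m q₁) (λ a → ∑sh p₂ (shift m q₂) (G a))
      ≡⟨ ∑sh-cong p₁ _ (λ a i → trans (∑sh-cong p₂ _ (λ b j → cong (_* (x (pack a) * (𝟙 (lastFrom c m b) * y (pack b))))
           (compatible-shuffle k k≢any p₁≤m p₂≤m pos₁ pos₂ i j (λ e″ → q≢[] (trans (sym e′) e″)))))
           (∑sh-*ˡ p₂ _ K _)) ⟩
    ∑sh p₁ (shift m q₁) (λ a → K * ∑sh p₂ (shift m q₂) (λ b → x (pack a) * (𝟙 (lastFrom c m b) * y (pack b))))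
      ≡⟨ ∑sh-*ˡ p₁ _ K _ ⟩
    K * ∑sh p₁ (shift m q₁) (λ a → ∑sh p₂ (shift m q₂) (λ b → x (pack a) * (𝟙 (lastFrom c m b) * y (pack b))))
      ≡⟨ cong (K *_) (∑sh-product p₁ _ p₂ _ _ _) ⟩
    K * (∑sh p₁ (shift m q₁) (x ∘ pack) * ∑sh p₂ (shift m q₂) (λ b → 𝟙 (lastFrom c m b) * y (pack b)))
      ≡⟨ cong (λ z → K * (z * ∑sh p₂ (shift m q₂) (λ b → 𝟙 (lastFrom c m b) * y (pack b))))
           (∑sh-cong-≗ p₁ _ (λ a → sym (ℚ.*-identityˡ (x (pack a))))) ⟩
    K * (∑sh p₁ (shift m q₁) (λ a → 1ℚ * x (pack a)) * ∑sh p₂ (shift m q₂) (λ b → 𝟙 (lastFrom c m b) * y (pack b)))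
      ≡⟨ cong (K *_) (cong₂ _*_
           (trans (PackShuffle.∑sh-pack m p₁ q₁ p₁≤m pos₁ all x) (sym (Δ-packed all x (pack-packed p₁) (pack-packed q₁))))
           (trans (PackShuffle.∑sh-pack m p₂ q₂ p₂≤m pos₂ c y) (sym (Δ-packed c y (pack-packed p₂) (pack-packed q₂))))) ⟩
    K * (Δ all x (pack p₁) (pack q₁) * Δ c y (pack p₂) (pack q₂)) ∎
    where
    K = 𝟙 (disjointW p₁ p₂) * 𝟙 (compatible k q₁ q₂)
    p₁≤m = All.++⁻ˡ p₁ (subst (All (_≤ m)) (sym e) (≤maxW p))
    p₂≤m = All.++⁻ʳ p₁ (subst (All (_≤ m)) (sym e) (≤maxW p))
    pos₁ = All.++⁻ˡ q₁ (subst Pos (sym e′) (proj₁ pq))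
    pos₂ = All.++⁻ʳ q₁ (subst Pos (sym e′) (proj₁ pq))

-- Primitive elements and braces

Vanishes : Side → V → Set
Vanishes c x = ∀ {a b} → Packed a → Packed b → a ≢ [] → b ≢ [] → Δ c x a b ≡ 0ℚ

Degree : ℕ → V → Set
Degree n x = ∀ {w} → length w ≢ n → x w ≡ 0ℚ

compatible-gt-[] : ∀ b → compatible gt [] b ≡ false
compatible-gt-[] b = <ᵇ-false {maxW b} {0} z≤n

compatible-lt-[] : ∀ b → compatible lt b [] ≡ false
compatible-lt-[] b = ≢true⇒false (λ h → case <ᵇ-sound {maxW b} {0} (∧-true⁻ʳ {disjointW b []} h) of λ ())

zero-*-* : ∀ x y z → y ≡ 0ℚ → (x * y) * z ≡ 0ℚ
zero-*-* x y z e = *-zeroˡ-≡ z (*-zeroʳ-≡ x e)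

-- In `Δ-conv` only an empty `a₁` survives: otherwise primitivity of `p` forces an empty `b₁`, which
-- loses the comparison of maxima. The term `x ⊗ p` of the coproduct is contained in the right side,
-- because the slice `Δ all x a` takes the value `x a` at the empty word.
Δ-≺-primitive : ∀ {p} → Vanishes all p → ∀ x {a b} → Packed a → Packed b → b ≢ [] →
                Δ all (p ≺ᵛ x) a b ≡ (p ≺ᵛ Δ all x a) b
Δ-≺-primitive {p} prim x {a} {b} pa pb b≢[] = begin
  Δ all (p ≺ᵛ x) a b
    ≡⟨ Δ-conv all gt (λ ()) p x (inj₁ refl) pa pb b≢[] ⟩
  ∑split a (λ a₁ a₂ → ∑split b (λ b₁ b₂ →
    (𝟙 (disjointW a₁ a₂) * 𝟙 (compatible gt b₁ b₂)) * (Δ all p (pack a₁) (pack b₁) * Δ all x (pack a₂) (pack b₂))))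
    ≡⟨ ∑split-first a (λ a₁ a₂ ne → ∑split-zero b (λ b₁ b₂ _ → vanish a₁ a₂ b₁ b₂ ne)) ⟩
  ∑split b (λ b₁ b₂ → (1ℚ * 𝟙 (compatible gt b₁ b₂)) * (Δ all p [] (pack b₁) * Δ all x (pack a) (pack b₂)))
    ≡⟨ ∑split-cong b (λ b₁ b₂ _ → collapse b₁ b₂) ⟩
  ∑split b (λ b₁ b₂ → 𝟙 (compatible gt b₁ b₂) * (p (pack b₁) * Δ all x a (pack b₂)))
    ≡⟨ conv-packed gt p _ pb ⟨
  (p ≺ᵛ Δ all x a) b ∎
  where
  vanish : ∀ a₁ a₂ b₁ b₂ → a₁ ≢ [] →
    (𝟙 (disjointW a₁ a₂) * 𝟙 (compatible gt b₁ b₂)) * (Δ all p (pack a₁) (pack b₁) * Δ all x (pack a₂) (pack b₂)) ≡ 0ℚ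
  vanish a₁ a₂ [] b₂ ne = zero-*-* (𝟙 (disjointW a₁ a₂)) _ _ (cong 𝟙 (compatible-gt-[] b₂))
  vanish a₁ a₂ b₁@(_ ∷ _) b₂ ne = *-zeroʳ-≡ (𝟙 (disjointW a₁ a₂) * 𝟙 (compatible gt b₁ b₂))
    (*-zeroˡ-≡ _ (prim (pack-packed a₁) (pack-packed b₁) (pack-≢[] a₁ ne) (pack-≢[] b₁ (λ ()))))
  collapse : ∀ b₁ b₂ → (1ℚ * 𝟙 (compatible gt b₁ b₂)) * (Δ all p [] (pack b₁) * Δ all x (pack a) (pack b₂))
           ≡ 𝟙 (compatible gt b₁ b₂) * (p (pack b₁) * Δ all x a (pack b₂))
  collapse [] b₂ = trans
    (zero-*-* 1ℚ (𝟙 (compatible gt [] b₂)) (Δ all p [] [] * Δ all x (pack a) (pack b₂)) (cong 𝟙 (compatible-gt-[] b₂)))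
    (sym (𝟙-false (p [] * Δ all x a (pack b₂)) (compatible-gt-[] b₂)))
  collapse b₁@(_ ∷ _) b₂ = cong₂ _*_ (ℚ.*-identityˡ (𝟙 (compatible gt b₁ b₂)))
    (cong₂ _*_ (Δ-[]ˡ all (λ ()) p (pack-packed b₁) (pack-≢[] b₁ (λ ()))) (cong (λ w → Δ all x w (pack b₂)) (pack-id pa)))

-- The mirror image, where only an empty `a₂` survives. The second factor inherits the condition
-- `c`, so vanishing of `Δ c q` is enough to confine `q` to the right tensor factor. For `left` the
-- value `Δ left q [] b` would not give back `q b`.
Δ-≻-primitive : ∀ c → c ≢ left → ∀ {q} → q [] ≡ 0ℚ → Vanishes c q → ∀ x {a b} → Packed a → Packed b → b ≢ [] →
                Δ c (x ≻ᵛ q) a b ≡ (Δ all x a ≻ᵛ q) b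
Δ-≻-primitive c c≢left {q} q[] prim x {a} {b} pa pb b≢[] = begin
  Δ c (x ≻ᵛ q) a b
    ≡⟨ Δ-conv c lt (λ ()) x q (inj₂ q[]) pa pb b≢[] ⟩
  ∑split a (λ a₁ a₂ → ∑split b (λ b₁ b₂ →
    (𝟙 (disjointW a₁ a₂) * 𝟙 (compatible lt b₁ b₂)) * (Δ all x (pack a₁) (pack b₁) * Δ c q (pack a₂) (pack b₂))))
    ≡⟨ ∑split-last a (λ a₁ a₂ ne _ → ∑split-zero b (λ b₁ b₂ _ → vanish a₁ a₂ b₁ b₂ ne)) ⟩
  ∑split b (λ b₁ b₂ → (𝟙 (disjointW a []) * 𝟙 (compatible lt b₁ b₂)) * (Δ all x (pack a) (pack b₁) * Δ c q [] (pack b₂)))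
    ≡⟨ ∑split-cong b (λ b₁ b₂ _ → collapse b₁ b₂) ⟩
  ∑split b (λ b₁ b₂ → 𝟙 (compatible lt b₁ b₂) * (Δ all x a (pack b₁) * q (pack b₂)))
    ≡⟨ conv-packed lt _ q pb ⟨
  (Δ all x a ≻ᵛ q) b ∎
  where
  vanish : ∀ a₁ a₂ b₁ b₂ → a₂ ≢ [] →
    (𝟙 (disjointW a₁ a₂) * 𝟙 (compatible lt b₁ b₂)) * (Δ all x (pack a₁) (pack b₁) * Δ c q (pack a₂) (pack b₂)) ≡ 0ℚ
  vanish a₁ a₂ b₁ [] ne = zero-*-* (𝟙 (disjointW a₁ a₂)) _ _ (cong 𝟙 (compatible-lt-[] b₁))
  vanish a₁ a₂ b₁ b₂@(_ ∷ _) ne = *-zeroʳ-≡ (𝟙 (disjointW a₁ a₂) * 𝟙 (compatible lt b₁ b₂))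
    (*-zeroʳ-≡ (Δ all x (pack a₁) (pack b₁)) (prim (pack-packed a₂) (pack-packed b₂) (pack-≢[] a₂ ne) (pack-≢[] b₂ (λ ()))))
  collapse : ∀ b₁ b₂ → (𝟙 (disjointW a []) * 𝟙 (compatible lt b₁ b₂)) * (Δ all x (pack a) (pack b₁) * Δ c q [] (pack b₂))
           ≡ 𝟙 (compatible lt b₁ b₂) * (Δ all x a (pack b₁) * q (pack b₂))
  collapse b₁ [] = trans (zero-*-* (𝟙 (disjointW a [])) _ _ (cong 𝟙 (compatible-lt-[] b₁))) (sym (𝟙-false _ (compatible-lt-[] b₁)))
  collapse b₁ b₂@(_ ∷ _) = cong₂ _*_ (𝟙-true _ (disjointW-[]ʳ a))
    (cong₂ _*_ (cong (λ w → Δ all x w (pack b₁)) (pack-id pa)) (Δ-[]ˡ c c≢left q (pack-packed b₂) (pack-≢[] b₂ (λ ()))))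

length-<-++ˡ : ∀ {A : Set} (a b : List A) → b ≢ [] → length a < length (a ++ b)
length-<-++ˡ a []      ne = ⊥-elim (ne refl)
length-<-++ˡ a (x ∷ b) ne = subst (length a <_) (sym (List.length-++ a))
  (subst (length a <_) (sym (ℕ.+-suc (length a) (length b))) (s≤s (ℕ.m≤m+n _ _)))

length-≤-++ˡ : ∀ {A : Set} (a b : List A) → length a ≤ length (a ++ b)
length-≤-++ˡ a b = subst (length a ≤_) (sym (List.length-++ a)) (ℕ.m≤m+n _ _)

length-≤-++ʳ : ∀ {A : Set} (a b : List A) → length b ≤ length (a ++ b)
length-≤-++ʳ a b = subst (length b ≤_) (sym (List.length-++ a)) (ℕ.m≤n+m _ _)

length-<-++ʳ : ∀ {A : Set} (a b : List A) → a ≢ [] → length b < length (a ++ b)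
length-<-++ʳ []      b ne = ⊥-elim (ne refl)
length-<-++ʳ (x ∷ a) b ne = s≤s (length-≤-++ʳ a b)

module _ {k p} (deg : Degree k p) where

  private
    p-short : ∀ a → length a < k → p (pack a) ≡ 0ℚ
    p-short a l = deg (λ e → ℕ.<⇒≢ l (trans (sym (length-pack a)) e))

  -- The factor that goes to `p` must have exactly `k` letters. So `b` needs at least `k` of them,
  -- and with exactly `k` the other factor is empty; the lemmas of this group record both facts for
  -- `p` on either side.
  ≺-short : ∀ g {b} → length b < k → (p ≺ᵛ g) b ≡ 0ℚ
  ≺-short g {b} l with packed? b
  ... | no np = conv-unpacked gt p g np
  ... | yes pb = trans (conv-packed gt p g pb) (∑split-zero b (λ { b₁ b₂ refl →
        *-zeroʳ-≡ (𝟙 (compatible gt b₁ b₂)) (*-zeroˡ-≡ (g (pack b₂)) (p-short b₁ (ℕ.≤-<-trans (length-≤-++ˡ b₁ b₂) l))) }))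

  ≺-leading : ∀ g {b} → Packed b → b ≢ [] → length b ≡ k → (p ≺ᵛ g) b ≡ g [] * p b
  ≺-leading g {b} pb b≢[] l = begin
    (p ≺ᵛ g) b
      ≡⟨ conv-packed gt p g pb ⟩
    ∑split b (λ b₁ b₂ → 𝟙 (compatible gt b₁ b₂) * (p (pack b₁) * g (pack b₂)))
      ≡⟨ ∑split-last b (λ { b₁ b₂ ne refl → *-zeroʳ-≡ (𝟙 (compatible gt b₁ b₂)) (*-zeroˡ-≡ (g (pack b₂))
           (p-short b₁ (subst (length b₁ <_) l (length-<-++ˡ b₁ b₂ ne)))) }) ⟩
    𝟙 (compatible gt b []) * (p (pack b) * g [])
      ≡⟨ 𝟙-true _ (compatible-[]ʳ b (proj₁ pb) b≢[]) ⟩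
    p (pack b) * g []
      ≡⟨ trans (ℚ.*-comm (p (pack b)) (g [])) (cong (λ w → g [] * p w) (pack-id pb)) ⟩
    g [] * p b ∎

  ≻-short : ∀ g {b} → length b < k → (g ≻ᵛ p) b ≡ 0ℚ
  ≻-short g {b} l with packed? b
  ... | no np = conv-unpacked lt g p np
  ... | yes pb = trans (conv-packed lt g p pb) (∑split-zero b (λ { b₁ b₂ refl →
        *-zeroʳ-≡ (𝟙 (compatible lt b₁ b₂)) (*-zeroʳ-≡ (g (pack b₁)) (p-short b₂ (ℕ.≤-<-trans (length-≤-++ʳ b₁ b₂) l))) }))

  ≻-leading : ∀ g {b} → Packed b → b ≢ [] → length b ≡ k → (g ≻ᵛ p) b ≡ g [] * p b
  ≻-leading g {b} pb b≢[] l = begin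
    (g ≻ᵛ p) b
      ≡⟨ conv-packed lt g p pb ⟩
    ∑split b (λ b₁ b₂ → 𝟙 (compatible lt b₁ b₂) * (g (pack b₁) * p (pack b₂)))
      ≡⟨ ∑split-cong b (λ b₁ b₂ e → kill b₁ b₂ e) ⟩
    ∑split b (λ b₁ b₂ → 𝟏 b₁ * (g [] * p b₂))
      ≡⟨ ∑split-first b (λ b₁ b₂ ne → *-zeroˡ-≡ (g [] * p b₂) (𝟏-≢[] ne)) ⟩
    1ℚ * (g [] * p b)
      ≡⟨ ℚ.*-identityˡ _ ⟩
    g [] * p b ∎
    where
    kill : ∀ b₁ b₂ → b₁ ++ b₂ ≡ b → 𝟙 (compatible lt b₁ b₂) * (g (pack b₁) * p (pack b₂)) ≡ 𝟏 b₁ * (g [] * p b₂)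
    kill []          b₂ refl = cong₂ (λ κ w → κ * (g [] * p w)) (cong 𝟙 (compatible-[]ˡ b₂ (proj₁ pb) b≢[])) (pack-id pb)
    kill b₁@(_ ∷ _) b₂ refl = trans
      (*-zeroʳ-≡ (𝟙 (compatible lt b₁ b₂)) (*-zeroʳ-≡ (g (pack b₁)) (p-short b₂ (subst (length b₂ <_) l (length-<-++ʳ b₁ b₂ (λ ()))))))
      (sym (ℚ.*-zeroˡ (g [] * p b₂)))

nestˡ : List V → V
nestˡ []       = 𝟏
nestˡ (p ∷ ps) = p ≺ᵛ nestˡ ps

nestʳ : V → List V → V
nestʳ a []       = a
nestʳ a (r ∷ rs) = nestʳ (a ≻ᵛ r) rs

braceᵛ : List V → V → V
braceᵛ ps q w = ∑split ps (λ us vs → sign (length vs) * ((nestˡ us ≻ᵛ q) ≺ᵛ nestʳ 𝟏 vs) w)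

nestˡ-packedSupport : ∀ ps → PackedSupport (nestˡ ps)
nestˡ-packedSupport []       = 𝟏-packedSupport
nestˡ-packedSupport (p ∷ ps) = proj₁ (≺-augmentation p (nestˡ ps))

nestʳ-augmentation : ∀ a rs → Augmentation a → Augmentation (nestʳ a rs)
nestʳ-augmentation a []       h = h
nestʳ-augmentation a (r ∷ rs) h = nestʳ-augmentation (a ≻ᵛ r) rs (≻-augmentation a r)

braceᵛ-augmentation : ∀ ps q → Augmentation (braceᵛ ps q)
braceᵛ-augmentation ps q =
    (λ np → ∑split-zero ps (λ us vs _ → *-zeroʳ-≡ (sign (length vs)) (proj₁ (≺-augmentation _ _) np)))
  , ∑split-zero ps (λ us vs _ → *-zeroʳ-≡ (sign (length vs)) (proj₂ (≺-augmentation _ _)))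

neg-* : ∀ s x → - s * x ≡ - 1ℚ * (s * x)
neg-* = solve 2 (λ s x → :- s :* x := :- con 1ℚ :* (s :* x)) refl
  where open +-*-Solver

-- The alternating sum telescopes: x ∗ (p ≺ y) = x ≺ (p ≺ y) + (x ≻ p) ≺ y.
nest-telescope : ∀ a → Augmentation a → ∀ ps w →
                 ∑split ps (λ us vs → sign (length us) * (nestʳ a us ∗ nestˡ vs) w) ≡ (a ≺ᵛ nestˡ ps) w
-- Kept separate because `nest-inverse` applies it to `𝟏`, which is not in the augmentation ideal.
nest-telescope-∷ : ∀ a p ps w →
                   ∑split (p ∷ ps) (λ us vs → sign (length us) * (nestʳ a us ∗ nestˡ vs) w)
                 ≡ (a ∗ (p ≺ᵛ nestˡ ps)) w + - 1ℚ * ((a ≻ᵛ p) ≺ᵛ nestˡ ps) w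
nest-telescope a aug [] w = begin
  ∑split [] (λ us vs → sign (length us) * (nestʳ a us ∗ nestˡ vs) w)   ≡⟨ ∑split-[] _ ⟩
  1ℚ * (a ∗ 𝟏) w                                                       ≡⟨ ℚ.*-identityˡ _ ⟩
  (a ∗ 𝟏) w                                                            ≡⟨ ∗-identityʳ (proj₁ aug) w ⟩
  a w                                                                  ≡⟨ ≺-identityʳ aug w ⟨
  (a ≺ᵛ 𝟏) w                                                           ∎
nest-telescope a aug (p ∷ ps) w = begin
  ∑split (p ∷ ps) (λ us vs → sign (length us) * (nestʳ a us ∗ nestˡ vs) w)
    ≡⟨ nest-telescope-∷ a p ps w ⟩
  (a ∗ (p ≺ᵛ nestˡ ps)) w + - 1ℚ * ((a ≻ᵛ p) ≺ᵛ nestˡ ps) w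
    ≡⟨ cong₂ (λ x y → x + - 1ℚ * y) (∗-≺-≻ a _ (proj₂ aug) w) (≻-≺-assoc a p (nestˡ ps) w) ⟩
  ((a ≺ᵛ (p ≺ᵛ nestˡ ps)) w + (a ≻ᵛ (p ≺ᵛ nestˡ ps)) w) + - 1ℚ * (a ≻ᵛ (p ≺ᵛ nestˡ ps)) w
    ≡⟨ solve 2 (λ x y → (x :+ y) :+ :- con 1ℚ :* y := x) refl ((a ≺ᵛ (p ≺ᵛ nestˡ ps)) w) ((a ≻ᵛ (p ≺ᵛ nestˡ ps)) w) ⟩
  (a ≺ᵛ (p ≺ᵛ nestˡ ps)) w ∎
  where open +-*-Solver
nest-telescope-∷ a p ps w = begin
  ∑split (p ∷ ps) (λ us vs → sign (length us) * (nestʳ a us ∗ nestˡ vs) w)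
    ≡⟨ ∑split-∷ p ps _ ⟩
  1ℚ * (a ∗ (p ≺ᵛ nestˡ ps)) w + ∑split ps (λ us vs → - sign (length us) * (nestʳ (a ≻ᵛ p) us ∗ nestˡ vs) w)
    ≡⟨ cong₂ _+_ (ℚ.*-identityˡ ((a ∗ (p ≺ᵛ nestˡ ps)) w))
         (trans (∑split-cong ps (λ us vs _ → neg-* (sign (length us)) ((nestʳ (a ≻ᵛ p) us ∗ nestˡ vs) w))) (∑split-*ˡ ps (- 1ℚ) _)) ⟩
  (a ∗ (p ≺ᵛ nestˡ ps)) w + - 1ℚ * ∑split ps (λ us vs → sign (length us) * (nestʳ (a ≻ᵛ p) us ∗ nestˡ vs) w)
    ≡⟨ cong (λ z → (a ∗ (p ≺ᵛ nestˡ ps)) w + - 1ℚ * z) (nest-telescope (a ≻ᵛ p) (≻-augmentation a p) ps w) ⟩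
  (a ∗ (p ≺ᵛ nestˡ ps)) w + - 1ℚ * ((a ≻ᵛ p) ≺ᵛ nestˡ ps) w ∎

-- The signed nests `nestʳ 𝟏` are inverse to `nestˡ` for convolution over splittings. After one step
-- of telescoping the two remaining terms are both `p ≺ nestˡ ps` by the unit laws, with opposite
-- signs.
nest-inverse : ∀ ps → ps ≢ [] → All Augmentation ps → ∀ w →
               ∑split ps (λ us vs → sign (length us) * (nestʳ 𝟏 us ∗ nestˡ vs) w) ≡ 0ℚ
nest-inverse []       ne _         w = ⊥-elim (ne refl)
nest-inverse (p ∷ ps) ne (aug ∷ _) w = begin
  ∑split (p ∷ ps) (λ us vs → sign (length us) * (nestʳ 𝟏 us ∗ nestˡ vs) w)
    ≡⟨ nest-telescope-∷ 𝟏 p ps w ⟩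
  (𝟏 ∗ (p ≺ᵛ nestˡ ps)) w + - 1ℚ * ((𝟏 ≻ᵛ p) ≺ᵛ nestˡ ps) w
    ≡⟨ cong₂ (λ x y → x + - 1ℚ * y) (∗-identityˡ (nestˡ-packedSupport (p ∷ ps)) w)
         (conv-cong gt (λ {w} _ → ≻-identityˡ aug w) (λ _ → refl) w) ⟩
  (p ≺ᵛ nestˡ ps) w + - 1ℚ * (p ≺ᵛ nestˡ ps) w
    ≡⟨ solve 1 (λ x → x :+ :- con 1ℚ :* x := con 0ℚ) refl ((p ≺ᵛ nestˡ ps) w) ⟩
  0ℚ ∎
  where open +-*-Solver

-- By `≺-assoc` the right nest of a brace and the following `nestˡ vs` are joined by `∗`. After
-- regrouping, the inner alternating sum is that of `nest-inverse`, so only the term with nothing to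
-- the right of `q` remains.
brace-nest : ∀ ps q → All Augmentation ps → ∀ w →
             ∑split ps (λ us vs → (braceᵛ us q ≺ᵛ nestˡ vs) w) ≡ (nestˡ ps ≻ᵛ q) w
brace-nest ps q augs w = begin
  ∑split ps (λ us vs → (braceᵛ us q ≺ᵛ nestˡ vs) w)
    ≡⟨ ∑split-cong ps (λ us vs _ → linear-∑split (conv-linearˡ gt (nestˡ vs) w) us (λ _ u₂ → sign (length u₂)) _ _ (λ _ → refl)) ⟩
  ∑split ps (λ us vs → ∑split us (λ u₁ u₂ → sign (length u₂) * ((X u₁ ≺ᵛ nestʳ 𝟏 u₂) ≺ᵛ nestˡ vs) w))
    ≡⟨ ∑split-assoc ps _ ⟩
  ∑split ps (λ u v → ∑split v (λ u₂ vs → sign (length u₂) * ((X u ≺ᵛ nestʳ 𝟏 u₂) ≺ᵛ nestˡ vs) w))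
    ≡⟨ ∑split-cong ps (λ u v _ → trans
         (∑split-cong v (λ u₂ vs _ → cong (sign (length u₂) *_) (≺-assoc (X u) (nestʳ 𝟏 u₂) (nestˡ vs) w)))
         (sym (linear-∑split (conv-linearʳ gt (X u) w) v (λ u₂ _ → sign (length u₂)) _ _ (λ _ → refl)))) ⟩
  ∑split ps (λ u v → (X u ≺ᵛ (λ w → ∑split v (λ u₂ vs → sign (length u₂) * (nestʳ 𝟏 u₂ ∗ nestˡ vs) w))) w)
    ≡⟨ ∑split-last ps (λ { u v ne refl → linear-zero (conv-linearʳ gt (X u) w) _
         (λ {w} _ → nest-inverse v ne (All.++⁻ʳ u augs) w) }) ⟩
  (X ps ≺ᵛ (λ w → ∑split [] (λ u₂ vs → sign (length u₂) * (nestʳ 𝟏 u₂ ∗ nestˡ vs) w))) w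
    ≡⟨ conv-cong gt (λ _ → refl) (λ {w} _ → trans (∑split-[] _) (trans (ℚ.*-identityˡ _) (∗-identityʳ 𝟏-packedSupport w))) w ⟩
  (X ps ≺ᵛ 𝟏) w
    ≡⟨ ≺-identityʳ (≻-augmentation (nestˡ ps) q) w ⟩
  (nestˡ ps ≻ᵛ q) w ∎
  where
  X : List V → V
  X us = nestˡ us ≻ᵛ q

Δ-𝟏 : ∀ {a b} → Packed a → Packed b → a ≢ [] → Δ all 𝟏 a b ≡ 0ℚ
Δ-𝟏 {a} {b} pa pb a≢[] = trans (Δ-all 𝟏 pa pb) (∑sh-zero a _ (λ u i → 𝟏-≢[] (nonempty i)))
  where
  nonempty : ∀ {u} → Interleaving a (shift (maxW a) b) u → u ≢ []
  nonempty i refl with ∈-interleavingˡ i (maxW-∈ a a≢[])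
  ... | ()

-- Each use of `Δ-≺-primitive` puts the outermost operand in front of the right tensor factor; hence
-- prefixes of the list go right and suffixes left.
Δ-nestˡ : ∀ ps → All (Vanishes all) ps → ∀ {a b} → Packed a → Packed b → a ≢ [] →
          Δ all (nestˡ ps) a b ≡ ∑split ps (λ us vs → nestˡ vs a * nestˡ us b)
Δ-nestˡ [] prims {a} {b} pa pb a≢[] = trans (Δ-𝟏 pa pb a≢[]) (sym (trans (∑split-[] _) (*-zeroˡ-≡ (𝟏 b) (𝟏-≢[] a≢[]))))
Δ-nestˡ (p ∷ ps) (prim ∷ prims) {a} {b} pa pb a≢[] with []? b
... | yes refl = begin
  Δ all (nestˡ (p ∷ ps)) a []
    ≡⟨ Δ-[]ʳ _ pa ⟩
  nestˡ (p ∷ ps) a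
    ≡⟨ ℚ.*-identityʳ _ ⟨
  nestˡ (p ∷ ps) a * 1ℚ
    ≡⟨ ∑split-first (p ∷ ps) (λ { [] vs ne → ⊥-elim (ne refl)
                                ; (u ∷ us) vs ne → *-zeroʳ-≡ (nestˡ vs a) (proj₂ (≺-augmentation u (nestˡ us))) }) ⟨
  ∑split (p ∷ ps) (λ us vs → nestˡ vs a * nestˡ us []) ∎
... | no b≢[] = begin
  Δ all (nestˡ (p ∷ ps)) a b
    ≡⟨ Δ-≺-primitive prim (nestˡ ps) pa pb b≢[] ⟩
  (p ≺ᵛ Δ all (nestˡ ps) a) b
    ≡⟨ linear-∑split (conv-linearʳ gt p b) ps (λ _ vs → nestˡ vs a) _ _ (λ pw → Δ-nestˡ ps prims pa pw a≢[]) ⟩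
  ∑split ps (λ us vs → nestˡ vs a * nestˡ (p ∷ us) b)
    ≡⟨ trans (cong (_+ ∑split ps (λ us vs → nestˡ vs a * nestˡ (p ∷ us) b)) (*-zeroʳ-≡ (nestˡ (p ∷ ps) a) (𝟏-≢[] b≢[]))) (ℚ.+-identityˡ _) ⟨
  nestˡ (p ∷ ps) a * 𝟏 b + ∑split ps (λ us vs → nestˡ vs a * nestˡ (p ∷ us) b)
    ≡⟨ ∑split-∷ p ps _ ⟨
  ∑split (p ∷ ps) (λ us vs → nestˡ vs a * nestˡ us b) ∎

linear-∑split₁ : ∀ {P φ} → Linear P φ → ∀ {A : Set} (ps : List A) (F : List A → List A → V) (x : V) →
                 (∀ {w} → P w → x w ≡ ∑split ps (λ u v → F u v w)) → φ x ≡ ∑split ps (λ u v → φ (F u v))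
linear-∑split₁ lin ps F x h = trans
  (linear-∑split lin ps (λ _ _ → 1ℚ) F x (λ p → trans (h p) (∑split-cong ps (λ _ _ _ → sym (ℚ.*-identityˡ _)))))
  (∑split-cong ps (λ _ _ _ → ℚ.*-identityˡ _))

-- `G` is the coproduct of a summand of `brace-nest`, and `H` is what `Δ-≺-primitive` predicts for
-- it if the brace is primitive. They agree on proper prefixes by induction, and both sum to the
-- coproduct of `nestˡ ps ≻ᵛ q`. So they also agree for the full list, where `H` vanishes.
braceᵛ-primitive-≤ : ∀ n ps q → length ps ≤ n → All Augmentation ps → All (Vanishes all) ps →
                     q [] ≡ 0ℚ → Vanishes all q → Vanishes all (braceᵛ ps q)
braceᵛ-primitive-≤ n ps q len augs prims q[] primq {a} {b} pa pb a≢[] b≢[] = begin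
  Δ all (braceᵛ ps q) a b
    ≡⟨ linear-cong (Δ-linear all a b) _ _ (λ {w} _ → sym (≺-identityʳ (braceᵛ-augmentation ps q) w)) ⟩
  G ps []
    ≡⟨ cancel (sym (trans transfer (trans (cong (∑split ps G +_) H-ps) (ℚ.+-identityʳ _)))) ⟩
  0ℚ ∎
  where
  open +-*-Solver
  G H : List V → List V → ℚ
  G us vs = Δ all (braceᵛ us q ≺ᵛ nestˡ vs) a b
  H us vs = (braceᵛ us q ≺ᵛ Δ all (nestˡ vs) a) b
  total = ∑split ps H

  prefix : ∀ m us vs → length ps ≤ m → vs ≢ [] → us ++ vs ≡ ps → Vanishes all (braceᵛ us q)
  prefix zero us vs l ne refl = ⊥-elim (ℕ.<⇒≱ (length-<-++ˡ us vs ne) (ℕ.≤-trans l z≤n))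
  prefix (suc m) us vs l ne refl = braceᵛ-primitive-≤ m us q
    (ℕ.≤-pred (ℕ.≤-trans (length-<-++ˡ us vs ne) l)) (All.++⁻ˡ us augs) (All.++⁻ˡ us prims) q[] primq

  transfer : ∑split ps H + G ps [] ≡ ∑split ps G + H ps []
  transfer = ∑split-transfer ps (λ us vs ne e → sym (Δ-≺-primitive (prefix n us vs len ne e) (nestˡ vs) pa pb b≢[]))

  H-ps : H ps [] ≡ 0ℚ
  H-ps = linear-zero (conv-linearʳ gt (braceᵛ ps q) b) _ (λ pw → Δ-𝟏 pa pw a≢[])

  total-G : ∑split ps G ≡ Δ all (nestˡ ps ≻ᵛ q) a b
  total-G = sym (linear-∑split₁ (Δ-linear all a b) ps (λ us vs → braceᵛ us q ≺ᵛ nestˡ vs) _ (λ {w} _ → sym (brace-nest ps q augs w)))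

  -- Expanding the slices by `Δ-nestˡ` gives a sum over three consecutive pieces of `ps`;
  -- `brace-nest`, now applied in the right tensor factor, sums over the first cut.
  total-H : total ≡ ∑split ps G
  total-H = begin
    ∑split ps (λ us vs → (braceᵛ us q ≺ᵛ Δ all (nestˡ vs) a) b)
      ≡⟨ ∑split-cong ps (λ { us vs refl → linear-∑split (conv-linearʳ gt (braceᵛ us q) b) vs (λ _ v₂ → nestˡ v₂ a) _ _
           (λ pw → Δ-nestˡ vs (All.++⁻ʳ us prims) pa pw a≢[]) }) ⟩
    ∑split ps (λ us vs → ∑split vs (λ v₁ v₂ → nestˡ v₂ a * (braceᵛ us q ≺ᵛ nestˡ v₁) b))
      ≡⟨ ∑split-assoc ps _ ⟨
    ∑split ps (λ u v₂ → ∑split u (λ us v₁ → nestˡ v₂ a * (braceᵛ us q ≺ᵛ nestˡ v₁) b))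
      ≡⟨ ∑split-cong ps (λ { u v₂ refl → trans (∑split-*ˡ u (nestˡ v₂ a) _) (cong (nestˡ v₂ a *_) (brace-nest u q (All.++⁻ˡ u augs) b)) }) ⟩
    ∑split ps (λ u v₂ → nestˡ v₂ a * (nestˡ u ≻ᵛ q) b)
      ≡⟨ linear-∑split (conv-linearˡ lt q b) ps (λ _ vs → nestˡ vs a) _ _ (λ pw → Δ-nestˡ ps prims pa pw a≢[]) ⟨
    (Δ all (nestˡ ps) a ≻ᵛ q) b
      ≡⟨ Δ-≻-primitive all (λ ()) q[] primq (nestˡ ps) pa pb b≢[] ⟨
    Δ all (nestˡ ps ≻ᵛ q) a b
      ≡⟨ total-G ⟨
    ∑split ps G ∎

  cancel : ∀ {g} → ∑split ps G ≡ total + g → g ≡ 0ℚ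
  cancel {g} e = begin
    g                          ≡⟨ solve 2 (λ g t → g := (t :+ g) :+ :- t) refl g total ⟩
    (total + g) + - total      ≡⟨ cong₂ (λ x y → x + - y) (sym e) total-H ⟩
    ∑split ps G + - ∑split ps G ≡⟨ ℚ.+-inverseʳ (∑split ps G) ⟩
    0ℚ                         ∎

braceᵛ-primitive : ∀ ps q → All Augmentation ps → All (Vanishes all) ps →
                   q [] ≡ 0ℚ → Vanishes all q → Vanishes all (braceᵛ ps q)
braceᵛ-primitive ps q = braceᵛ-primitive-≤ _ ps q ℕ.≤-refl

-- In the component whose right factor has the degree of q, only the term (p₁ ≺ … ≺ pₙ) ≻ q of the brace contributes.
module _ {k} {ps : List V} {q} (aug : Augmentation q) (primq : Vanishes all q) (primq′ : Vanishes right q) (deg : Degree k q)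
         {a b} (pa : Packed a) (pb : Packed b) (b≢[] : b ≢ []) (len : length b ≤ k) where

  private
    -- The last letter lies in the factor of the right nest. If it is to come from `b`, that factor
    -- takes at least one letter of `b`, and fewer than `k` remain for `q`.
    other-terms : ∀ us vs → vs ≢ [] → Δ right ((nestˡ us ≻ᵛ q) ≺ᵛ nestʳ 𝟏 vs) a b ≡ 0ℚ
    other-terms us []       ne = ⊥-elim (ne refl)
    other-terms us (v ∷ vs) ne = trans
      (Δ-conv right gt (λ ()) (nestˡ us ≻ᵛ q) y (inj₂ (proj₂ (nestʳ-augmentation (𝟏 ≻ᵛ v) vs (≻-augmentation 𝟏 v)))) pa pb b≢[])
      (∑split-zero a (λ a₁ a₂ _ → ∑split-zero b (λ b₁ b₂ e → term a₁ a₂ b₁ b₂ e)))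
      where
      y = nestʳ 𝟏 (v ∷ vs)
      term : ∀ a₁ a₂ b₁ b₂ → b₁ ++ b₂ ≡ b → (𝟙 (disjointW a₁ a₂) * 𝟙 (compatible gt b₁ b₂)) *
             (Δ all (nestˡ us ≻ᵛ q) (pack a₁) (pack b₁) * Δ right y (pack a₂) (pack b₂)) ≡ 0ℚ
      term a₁ a₂ b₁ [] _ = *-zeroʳ-≡ (𝟙 (disjointW a₁ a₂) * 𝟙 (compatible gt b₁ []))
        (*-zeroʳ-≡ (Δ all (nestˡ us ≻ᵛ q) (pack a₁) (pack b₁)) (Δ-right-[]ʳ y (pack-packed a₂)))
      term a₁ a₂ [] b₂@(_ ∷ _) _ = zero-*-* (𝟙 (disjointW a₁ a₂)) _ _ (cong 𝟙 (compatible-gt-[] b₂))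
      term a₁ a₂ b₁@(_ ∷ _) b₂@(_ ∷ _) refl = *-zeroʳ-≡ (𝟙 (disjointW a₁ a₂) * 𝟙 (compatible gt b₁ b₂))
        (*-zeroˡ-≡ _ (trans (Δ-≻-primitive all (λ ()) (proj₂ aug) primq (nestˡ us) (pack-packed a₁) (pack-packed b₁) (pack-≢[] b₁ (λ ())))
          (≻-short deg _ (subst (_< k) (sym (length-pack b₁)) (ℕ.<-≤-trans (length-<-++ˡ b₁ b₂ (λ ())) len)))))

    reduce : Δ right (braceᵛ ps q) a b ≡ (Δ all (nestˡ ps) a ≻ᵛ q) b
    reduce = begin
      Δ right (braceᵛ ps q) a b
        ≡⟨ linear-∑split (Δ-linear right a b) ps (λ _ vs → sign (length vs)) _ _ (λ _ → refl) ⟩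
      ∑split ps (λ us vs → sign (length vs) * Δ right ((nestˡ us ≻ᵛ q) ≺ᵛ nestʳ 𝟏 vs) a b)
        ≡⟨ ∑split-last ps (λ us vs ne _ → *-zeroʳ-≡ (sign (length vs)) (other-terms us vs ne)) ⟩
      1ℚ * Δ right ((nestˡ ps ≻ᵛ q) ≺ᵛ 𝟏) a b
        ≡⟨ ℚ.*-identityˡ _ ⟩
      Δ right ((nestˡ ps ≻ᵛ q) ≺ᵛ 𝟏) a b
        ≡⟨ linear-cong (Δ-linear right a b) _ _ (λ {w} _ → ≺-identityʳ (≻-augmentation (nestˡ ps) q) w) ⟩
      Δ right (nestˡ ps ≻ᵛ q) a b
        ≡⟨ Δ-≻-primitive right (λ ()) (proj₂ aug) primq′ (nestˡ ps) pa pb b≢[] ⟩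
      (Δ all (nestˡ ps) a ≻ᵛ q) b ∎

  brace-short : length b < k → Δ right (braceᵛ ps q) a b ≡ 0ℚ
  brace-short l = trans reduce (≻-short deg (Δ all (nestˡ ps) a) l)

  brace-leading : length b ≡ k → Δ right (braceᵛ ps q) a b ≡ nestˡ ps a * q b
  brace-leading l = trans reduce (trans (≻-leading deg (Δ all (nestˡ ps) a) pb b≢[] l) (cong (_* q b) (Δ-[]ʳ (nestˡ ps) pa)))

-- Coassociativity

-- Quantifying over the predicate says, without naming a letter, that the last letter of a shuffle
-- is the last letter of one of its two words.
interleaving-last : ∀ {A : Set} {p q u : List A} → Interleaving p q u →
  (p ≢ [] × (∀ P d → lastᵇ P d u ≡ lastᵇ P d p)) ⊎ (q ≢ [] × (∀ P d → lastᵇ P d u ≡ lastᵇ P d q)) ⊎ u ≡ []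
interleaving-last [] = inj₂ (inj₂ refl)
interleaving-last {p = x ∷ p} {q} (consˡ i) with interleaving-last i
... | inj₁ (ne , h)        = inj₁ ((λ ()) , λ P d → h P (P x))
... | inj₂ (inj₁ (ne , h)) = inj₂ (inj₁ (ne , λ P d → trans (h P (P x)) (lastᵇ-++ P (P x) d [] q ne)))
interleaving-last {p = _ ∷ []} {[]} (consˡ [])       | inj₂ (inj₂ refl) = inj₁ ((λ ()) , λ P d → refl)
interleaving-last {p = p} {x ∷ q} (consʳ i) with interleaving-last i
... | inj₁ (ne , h)        = inj₁ (ne , λ P d → trans (h P (P x)) (lastᵇ-++ P (P x) d [] p ne))
... | inj₂ (inj₁ (ne , h)) = inj₂ (inj₁ ((λ ()) , λ P d → h P (P x)))
interleaving-last {p = []} {_ ∷ []} (consʳ [])       | inj₂ (inj₂ refl) = inj₂ (inj₁ ((λ ()) , λ P d → refl))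

lastᵇ-All-≢[] : ∀ {A : Set} (P : A → Bool) d b w → w ≢ [] → All (λ x → P x ≡ b) w → lastᵇ P d w ≡ b
lastᵇ-All-≢[] P d b []      ne h        = ⊥-elim (ne refl)
lastᵇ-All-≢[] P d b (x ∷ w) ne (px ∷ h) = lastᵇ-All P (P x) b w h px

lastFrom-right-low : ∀ {m} a → All (_≤ m) a → lastFrom right m a ≡ false
lastFrom-right-low a h = lastᵇ-All _ false false a (All.map <ᵇ-false h) refl

lastFrom-right-high : ∀ {m} s → s ≢ [] → All (m <_) s → lastFrom right m s ≡ true
lastFrom-right-high s ne h = lastᵇ-All-≢[] _ false true s ne (All.map <ᵇ-true h)

lastFrom-left-high : ∀ {m} s → All (m <_) s → lastFrom left m s ≡ false
lastFrom-left-high s h = lastᵇ-All _ false false s (All.map ≤ᵇ-false h) refl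

<ᵇ-+ : ∀ m x y → (m ℕ.+ x <ᵇ m ℕ.+ y) ≡ (x <ᵇ y)
<ᵇ-+ zero    x y = refl
<ᵇ-+ (suc m) x y = <ᵇ-+ m x y

≤ᵇ-+ : ∀ m x y → (m ℕ.+ x ≤ᵇ m ℕ.+ y) ≡ (x ≤ᵇ y)
≤ᵇ-+ m x y = bool-ext
  (λ e → ≤ᵇ-true {x} {y} (ℕ.+-cancelˡ-≤ m x y (≤ᵇ-sound {m ℕ.+ x} {m ℕ.+ y} e)))
  (λ e → ≤ᵇ-true {m ℕ.+ x} {m ℕ.+ y} (ℕ.+-monoʳ-≤ m (≤ᵇ-sound {x} {y} e)))

module _ (x : V) {a b c : Word} (pa : Packed a) (pb : Packed b) (pc : Packed c) where

  private
    ma = maxW a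
    mb = maxW b

    -- The common skeleton of the coassociativity laws: shuffling is associative, and the two
    -- conditions on last letters merge into one condition `I` on the complete shuffle.
    Δ-Δ : ∀ c₁ c₂ (I : V) →
      (∀ u v → Pos u → Interleaving a (shift ma u) v → 𝟙 (lastFrom c₂ mb u) * 𝟙 (lastFrom c₁ ma v) ≡ I v) →
      Δ c₂ (Δ c₁ x a) b c ≡ ∑sh a (shift ma b) (λ v′ → ∑sh v′ (shift (ma ℕ.+ mb) c) (λ v → I v * x v))
    Δ-Δ c₁ c₂ I h = begin
      Δ c₂ (Δ c₁ x a) b c
        ≡⟨ Δ-packed c₂ _ pb pc ⟩
      ∑sh b (shift mb c) (λ u → 𝟙 (lastFrom c₂ mb u) * Δ c₁ x a u)
        ≡⟨ ∑sh-cong b (shift mb c) (λ u i → inner u (shuffle-packed pb pc i)) ⟩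
      ∑sh b (shift mb c) (λ u → ∑sh a (shift ma u) (λ v → I v * x v))
        ≡⟨ ∑sh-map (ma ℕ.+_) b (shift mb c) (λ u → ∑sh a u (λ v → I v * x v)) ⟨
      ∑sh (shift ma b) (shift ma (shift mb c)) (λ u → ∑sh a u (λ v → I v * x v))
        ≡⟨ ∑sh-assoc a (shift ma b) (shift ma (shift mb c)) _ ⟩
      ∑sh a (shift ma b) (λ v′ → ∑sh v′ (shift ma (shift mb c)) (λ v → I v * x v))
        ≡⟨ cong (λ z → ∑sh a (shift ma b) (λ v′ → ∑sh v′ z (λ v → I v * x v)))
             (trans (sym (List.map-∘ c)) (List.map-cong (λ y → sym (ℕ.+-assoc ma mb y)) c)) ⟩
      ∑sh a (shift ma b) (λ v′ → ∑sh v′ (shift (ma ℕ.+ mb) c) (λ v → I v * x v)) ∎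
      where
      inner : ∀ u → Packed u → 𝟙 (lastFrom c₂ mb u) * Δ c₁ x a u ≡ ∑sh a (shift ma u) (λ v → I v * x v)
      inner u pu = trans (cong (𝟙 (lastFrom c₂ mb u) *_) (Δ-packed c₁ x pa pu))
        (trans (sym (∑sh-*ˡ a (shift ma u) (𝟙 (lastFrom c₂ mb u)) _))
               (∑sh-cong a (shift ma u) (λ v i → trans (sym (ℚ.*-assoc (𝟙 (lastFrom c₂ mb u)) (𝟙 (lastFrom c₁ ma v)) (x v))) (cong (_* x v) (h u v (proj₁ pu) i)))))

    fold : ∀ c₃ {v′} → Interleaving a (shift ma b) v′ →
           ∑sh v′ (shift (ma ℕ.+ mb) c) (λ v → 𝟙 (lastFrom c₃ (ma ℕ.+ mb) v) * x v) ≡ Δ c₃ x v′ c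
    fold c₃ {v′} i = trans
      (cong (λ m → ∑sh v′ (shift m c) (λ v → 𝟙 (lastFrom c₃ m v) * x v)) (sym (maxW-shuffle a b i)))
      (sym (Δ-packed c₃ x (shuffle-packed pa pb i) pc))

  Δ-coassoc : Δ all (Δ all x a) b c ≡ ∑sh a (shift ma b) (λ v → Δ all x v c)
  Δ-coassoc = trans (Δ-Δ all all (λ _ → 1ℚ) (λ _ _ _ _ → refl)) (∑sh-cong a (shift ma b) (λ v i → fold all i))

  -- Both sides say that the last letter of the complete shuffle comes from the third factor.
  Δ-coassoc-right-right : Δ right (Δ right x a) b c ≡ ∑sh a (shift ma b) (λ v → Δ right x v c)
  Δ-coassoc-right-right = trans
    (Δ-Δ right right (λ v → 𝟙 (lastFrom right (ma ℕ.+ mb) v)) indicator)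
    (∑sh-cong a (shift ma b) (λ v i → fold right i))
    where
    indicator : ∀ u v → Pos u → Interleaving a (shift ma u) v →
                𝟙 (lastFrom right mb u) * 𝟙 (lastFrom right ma v) ≡ 𝟙 (lastFrom right (ma ℕ.+ mb) v)
    indicator u v pos i with interleaving-last i
    ... | inj₁ (ne , h) = trans (*-zeroʳ-≡ (𝟙 (lastFrom right mb u)) (cong 𝟙 (trans (h _ _) (lastFrom-right-low a (≤maxW a)))))
          (sym (cong 𝟙 (trans (h _ _) (lastFrom-right-low a (All.map (λ l → ℕ.≤-trans l (ℕ.m≤m+n ma mb)) (≤maxW a))))))
    ... | inj₂ (inj₁ (ne , h)) = trans (cong (λ t → 𝟙 (lastFrom right mb u) * 𝟙 t) (trans (h _ _) (lastFrom-right-high (shift ma u) ne (shift-> ma u pos))))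
          (trans (ℚ.*-identityʳ _) (cong 𝟙 (sym (trans (h _ _) (lastᵇ-map (ma ℕ.+_) _ _ false u (λ {y} _ → <ᵇ-+ ma mb y))))))
    ... | inj₂ (inj₂ refl) = ℚ.*-zeroʳ (𝟙 (lastFrom right mb u))

  -- Both sides say that the last letter of the complete shuffle comes from the middle factor.
  Δ-coassoc-right-left : Δ left (Δ right x a) b c ≡ ∑sh a (shift ma b) (λ v → 𝟙 (lastFrom right ma v) * Δ left x v c)
  Δ-coassoc-right-left = trans
    (Δ-Δ right left (λ v → 𝟙 (lastFrom right ma v) * 𝟙 (lastFrom left (ma ℕ.+ mb) v)) indicator)
    (∑sh-cong a (shift ma b) (λ v′ i → trans (∑sh-cong v′ (shift (ma ℕ.+ mb) c) (λ v j → pull v′ v j))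
       (trans (∑sh-*ˡ v′ (shift (ma ℕ.+ mb) c) (𝟙 (lastFrom right ma v′)) _) (cong (𝟙 (lastFrom right ma v′) *_) (fold left i)))))
    where
    indicator : ∀ u v → Pos u → Interleaving a (shift ma u) v →
                𝟙 (lastFrom left mb u) * 𝟙 (lastFrom right ma v) ≡ 𝟙 (lastFrom right ma v) * 𝟙 (lastFrom left (ma ℕ.+ mb) v)
    indicator u v pos i with interleaving-last i
    ... | inj₁ (ne , h) = trans (*-zeroʳ-≡ (𝟙 (lastFrom left mb u)) z) (sym (*-zeroˡ-≡ (𝟙 (lastFrom left (ma ℕ.+ mb) v)) z))
      where z = cong 𝟙 (trans (h _ _) (lastFrom-right-low a (≤maxW a)))
    ... | inj₂ (inj₁ (ne , h)) = trans (ℚ.*-comm (𝟙 (lastFrom left mb u)) (𝟙 (lastFrom right ma v)))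
          (cong (λ t → 𝟙 (lastFrom right ma v) * 𝟙 t) (sym (trans (h _ _) (lastᵇ-map (ma ℕ.+_) _ _ false u (λ {y} _ → ≤ᵇ-+ ma y mb)))))
    ... | inj₂ (inj₂ refl) = trans (ℚ.*-zeroʳ (𝟙 (lastFrom left mb u))) (sym (ℚ.*-zeroˡ 0ℚ))

    pull : ∀ v′ v → Interleaving v′ (shift (ma ℕ.+ mb) c) v →
           (𝟙 (lastFrom right ma v) * 𝟙 (lastFrom left (ma ℕ.+ mb) v)) * x v
         ≡ 𝟙 (lastFrom right ma v′) * (𝟙 (lastFrom left (ma ℕ.+ mb) v) * x v)
    pull v′ v j with interleaving-last j
    ... | inj₁ (ne , h) = trans (ℚ.*-assoc (𝟙 (lastFrom right ma v)) (𝟙 (lastFrom left (ma ℕ.+ mb) v)) (x v))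
          (cong (λ t → 𝟙 t * (𝟙 (lastFrom left (ma ℕ.+ mb) v) * x v)) (h _ _))
    ... | inj₂ (inj₁ (ne , h)) = trans (zero-*-* (𝟙 (lastFrom right ma v)) (𝟙 (lastFrom left (ma ℕ.+ mb) v)) (x v) z)
          (sym (*-zeroʳ-≡ (𝟙 (lastFrom right ma v′)) (*-zeroˡ-≡ (x v) z)))
      where z = cong 𝟙 (trans (h _ _) (lastFrom-left-high (shift (ma ℕ.+ mb) c) (shift-> (ma ℕ.+ mb) c (proj₁ pc))))
    pull [] [] j | inj₂ (inj₂ refl) = ℚ.*-assoc 0ℚ 0ℚ (x [])

Δ-left+right : ∀ x {a b} → Packed a → Packed b → b ≢ [] → Δ left x a b + Δ right x a b ≡ Δ all x a b
Δ-left+right x {a} {b} pa pb b≢[] = begin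
  Δ left x a b + Δ right x a b
    ≡⟨ cong₂ _+_ (Δ-packed left x pa pb) (Δ-packed right x pa pb) ⟩
  ∑sh a b′ (λ u → 𝟙 (lastFrom left ma u) * x u) + ∑sh a b′ (λ u → 𝟙 (lastFrom right ma u) * x u)
    ≡⟨ ∑sh-+ a b′ _ _ ⟨
  ∑sh a b′ (λ u → 𝟙 (lastFrom left ma u) * x u + 𝟙 (lastFrom right ma u) * x u)
    ≡⟨ ∑sh-cong a b′ (λ u i → term u (λ { refl → case ∈-interleavingʳ i (maxW-∈ b′ (map-≢[] _ b b≢[])) of λ () })) ⟩
  ∑sh a b′ x
    ≡⟨ Δ-all x pa pb ⟨
  Δ all x a b ∎
  where
  ma = maxW a
  b′ = shift ma b
  dichotomy : ∀ d d′ u → u ≢ [] ⊎ 𝟙 d + 𝟙 d′ ≡ 1ℚ → 𝟙 (lastᵇ (_≤ᵇ ma) d u) + 𝟙 (lastᵇ (ma <ᵇ_) d′ u) ≡ 1ℚ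
  dichotomy d d′ []      (inj₁ ne) = ⊥-elim (ne refl)
  dichotomy d d′ []      (inj₂ h)  = h
  dichotomy d d′ (z ∷ u) _ = dichotomy _ _ u (inj₂ letter)
    where
    letter : 𝟙 (z ≤ᵇ ma) + 𝟙 (ma <ᵇ z) ≡ 1ℚ
    letter with z ℕ.≤? ma
    ... | yes le = cong₂ (λ s t → 𝟙 s + 𝟙 t) (≤ᵇ-true le) (<ᵇ-false le)
    ... | no ¬le = cong₂ (λ s t → 𝟙 s + 𝟙 t) (≤ᵇ-false (ℕ.≰⇒> ¬le)) (<ᵇ-true (ℕ.≰⇒> ¬le))
  term : ∀ u → u ≢ [] → 𝟙 (lastFrom left ma u) * x u + 𝟙 (lastFrom right ma u) * x u ≡ x u
  term u ne = trans (sym (ℚ.*-distribʳ-+ (x u) (𝟙 (lastFrom left ma u)) (𝟙 (lastFrom right ma u))))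
    (trans (cong (_* x u) (dichotomy false false u (inj₁ ne))) (ℚ.*-identityˡ (x u)))

Δ-degree : ∀ c {n x} → Degree n x → ∀ {a b} → length a ℕ.+ length b ≢ n → Δ c x a b ≡ 0ℚ
Δ-degree c {n} {x} deg {a} {b} ne with packed? a | packed? b
... | no np | _      = Δ-unpackedˡ c x np
... | yes _ | no np  = Δ-unpackedʳ c x np
... | yes pa | yes pb = trans (Δ-packed c x pa pb) (∑sh-zero a _ (λ u i → *-zeroʳ-≡ (𝟙 (lastFrom c (maxW a) u))
      (deg (λ e → ne (trans (cong (length a ℕ.+_) (sym (List.length-map _ b))) (trans (sym (length-interleaving i)) e))))))

-- Appending a last letter

ψ : Label → Word → Word
ψ (i , white) w = psiWhite i w
ψ (i , black) w = w ∷ʳ i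

Valid : Label → ℕ → Set
Valid (i , white) m = 1 ≤ i × i ≤ suc m
Valid (i , black) m = 1 ≤ i × i ≤ m

bump : ℕ → ℕ → ℕ
bump i x = if i ≤ᵇ x then suc x else x

bump-≥ : ∀ {i x} → i ≤ x → bump i x ≡ suc x
bump-≥ le rewrite ≤ᵇ-true le = refl

bump-< : ∀ {i x} → x < i → bump i x ≡ x
bump-< l rewrite ≤ᵇ-false l = refl

bump-≢ : ∀ i x → bump i x ≢ i
bump-≢ i x e with i ℕ.≤? x
... | yes le = ℕ.<⇒≢ (s≤s le) (trans (sym e) (bump-≥ le))
... | no ¬le = ℕ.<⇒≢ (ℕ.≰⇒> ¬le) (trans (sym (bump-< (ℕ.≰⇒> ¬le))) e)

bump-mono-< : ∀ i {x y} → x < y → bump i x < bump i y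
bump-mono-< i {x} {y} l with i ℕ.≤? x | i ℕ.≤? y
... | yes p | yes q rewrite bump-≥ p | bump-≥ q = s≤s l
... | yes p | no q  = ⊥-elim (q (ℕ.≤-trans p (ℕ.<⇒≤ l)))
... | no p  | yes q rewrite bump-< (ℕ.≰⇒> p) | bump-≥ q = ℕ.m≤n⇒m≤1+n l
... | no p  | no q  rewrite bump-< (ℕ.≰⇒> p) | bump-< (ℕ.≰⇒> q) = l

bump-injective : ∀ i {x y} → bump i x ≡ bump i y → x ≡ y
bump-injective i {x} {y} e with ℕ.<-cmp x y
... | Tri.tri< l _ _ = ⊥-elim (ℕ.<⇒≢ (bump-mono-< i l) e)
... | Tri.tri≈ _ p _ = p
... | Tri.tri> _ _ l = ⊥-elim (ℕ.<⇒≢ (bump-mono-< i l) (sym e))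

bump-≤ : ∀ i x → bump i x ≤ suc x
bump-≤ i x with i ℕ.≤? x
... | yes p = ℕ.≤-reflexive (bump-≥ p)
... | no p  = ℕ.≤-trans (ℕ.≤-reflexive (bump-< (ℕ.≰⇒> p))) (ℕ.n≤1+n x)

x≤bump : ∀ i x → x ≤ bump i x
x≤bump i x with i ℕ.≤? x
... | yes p = subst (x ≤_) (sym (bump-≥ p)) (ℕ.n≤1+n x)
... | no p  = ℕ.≤-reflexive (sym (bump-< (ℕ.≰⇒> p)))

∈-∷ʳ⁻ : ∀ {A : Set} {x y : A} w → x ∈ w ∷ʳ y → x ∈ w ⊎ x ≡ y
∈-∷ʳ⁻ w x∈ with ∈.∈-++⁻ w x∈
... | inj₁ h        = inj₁ h
... | inj₂ (here e) = inj₂ e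

∈-∷ʳ-last : ∀ {A : Set} (w : List A) {y} → y ∈ w ∷ʳ y
∈-∷ʳ-last w = ∈.∈-++⁺ʳ w (here refl)

∷ʳ-≢[] : ∀ {A : Set} (w : List A) {y} → w ∷ʳ y ≢ []
∷ʳ-≢[] [] ()
∷ʳ-≢[] (x ∷ w) ()

maxW-ψ-white : ∀ i w → i ≤ suc (maxW w) → 1 ≤ i → maxW (psiWhite i w) ≡ suc (maxW w)
maxW-ψ-white i w i≤ 1≤i = ℕ.≤-antisym
  (maxW-lub (psiWhite i w) (λ x∈ → case ∈-∷ʳ⁻ (map (bump i) w) x∈ of λ
    { (inj₁ y∈) → case ∈.∈-map⁻ (bump i) y∈ of λ { (y , y∈w , refl) → ℕ.≤-trans (bump-≤ i y) (s≤s (∈⇒≤maxW w y∈w)) }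
    ; (inj₂ refl) → i≤ }))
  (∈⇒≤maxW (psiWhite i w) top)
  where
  top : suc (maxW w) ∈ psiWhite i w
  top with ℕ.m≤n⇒m<n∨m≡n i≤
  ... | inj₂ refl    = ∈-∷ʳ-last (map (bump i) w)
  ... | inj₁ (s≤s l) = ∈.∈-++⁺ˡ (subst (_∈ map (bump i) w) (bump-≥ l)
          (∈.∈-map⁺ (bump i) (maxW-∈ w (λ { refl → ℕ.<⇒≱ 1≤i l }))))

maxW-ψ-black : ∀ i w → i ≤ maxW w → maxW (w ∷ʳ i) ≡ maxW w
maxW-ψ-black i w le = trans (maxW-++ w (i ∷ [])) (trans (cong (maxW w ⊔_) (ℕ.⊔-identityʳ i)) (ℕ.m≥n⇒m⊔n≡m le))

ψ-packed : ∀ l {w} → Packed w → Valid l (maxW w) → Packed (ψ l w)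
ψ-packed (i , black) {w} (pos , full) (1≤i , i≤) = All.++⁺ pos (1≤i ∷ []) ,
  λ j 1≤j j≤ → ∈.∈-++⁺ˡ (full j 1≤j (subst (j ≤_) (maxW-ψ-black i w i≤) j≤))
ψ-packed (i , white) {w} (pos , full) (1≤i , i≤) =
  All.++⁺ (All.map⁺ (All.map (λ {x} 1≤x → ℕ.≤-trans 1≤x (x≤bump i x)) pos)) (1≤i ∷ []) , full′
  where
  full′ : ∀ j → 1 ≤ j → j ≤ maxW (psiWhite i w) → j ∈ psiWhite i w
  full′ (suc j) 1≤j j≤ with ℕ.<-cmp (suc j) i | subst (suc j ≤_) (maxW-ψ-white i w i≤ 1≤i) j≤
  ... | Tri.tri< l _ _ | _ = ∈.∈-++⁺ˡ (subst (_∈ map (bump i) w) (bump-< l)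
          (∈.∈-map⁺ (bump i) (full (suc j) 1≤j (ℕ.≤-pred (ℕ.≤-trans l i≤)))))
  ... | Tri.tri≈ _ refl _ | _ = ∈-∷ʳ-last (map (bump i) w)
  ... | Tri.tri> _ _ (s≤s i≤j) | s≤s j≤max = ∈.∈-++⁺ˡ (subst (_∈ map (bump i) w) (bump-≥ i≤j)
          (∈.∈-map⁺ (bump i) (full j (ℕ.≤-trans 1≤i i≤j) j≤max)))

ψ-≢[] : ∀ l w → ψ l w ≢ []
ψ-≢[] (i , white) w = ∷ʳ-≢[] (map (bump i) w)
ψ-≢[] (i , black) w = ∷ʳ-≢[] w

length-ψ : ∀ l w → length (ψ l w) ≡ suc (length w)
length-ψ (i , white) w = trans (List.length-++ (map (bump i) w)) (trans (ℕ.+-comm _ 1) (cong suc (List.length-map (bump i) w)))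
length-ψ (i , black) w = trans (List.length-++ w) (ℕ.+-comm _ 1)

-- The colour is visible in the word: a white last letter occurs nowhere else, since `bump i` avoids
-- `i`, and a black one occurs earlier, since it is bounded by the maximum of a packed word.
ψ-injective : ∀ l l′ {v v′} → Packed v → Packed v′ → Valid l (maxW v) → Valid l′ (maxW v′) →
              ψ l v ≡ ψ l′ v′ → l ≡ l′ × v ≡ v′
ψ-injective (i , white) (j , white) {v} {v′} pv pv′ val val′ e
  with List.∷ʳ-injective (map (bump i) v) (map (bump j) v′) e
... | e′ , refl = refl , List.map-injective (bump-injective i) e′
ψ-injective (i , black) (j , black) {v} {v′} pv pv′ val val′ e with List.∷ʳ-injective v v′ e
... | e′ , refl = refl , e′
ψ-injective (i , white) (j , black) {v} {v′} pv pv′ val (1≤j , j≤) e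
  with List.∷ʳ-injective (map (bump i) v) v′ e
... | refl , refl = case ∈.∈-map⁻ (bump i) (proj₂ pv′ i 1≤j j≤) of λ { (y , _ , e) → ⊥-elim (bump-≢ i y (sym e)) }
ψ-injective (i , black) (j , white) {v} {v′} pv pv′ (1≤i , i≤) val′ e
  with List.∷ʳ-injective v (map (bump j) v′) e
... | refl , refl = case ∈.∈-map⁻ (bump i) (proj₂ pv i 1≤i i≤) of λ { (y , _ , e) → ⊥-elim (bump-≢ i y (sym e)) }

record LastLetter (w : Word) : Set where
  constructor mkLast
  field
    label  : Label
    rest   : Word
    valid  : Valid label (maxW rest)
    packed : Packed rest
    eq     : w ≡ ψ label rest

-- The last letter is black if it occurs earlier and white otherwise; in the white case the larger
-- letters are lowered by one to close the gap.
lastLetter : ∀ {w} → Packed w → w ≢ [] → LastLetter w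
lastLetter {w} pw w≢[] with initLast w
... | []          = ⊥-elim (w≢[] refl)
... | v ∷ʳ′ i with bool-dec (occurs i v)
...   | inj₁ occ = mkLast (i , black) v (1≤i , i≤) (All.++⁻ˡ v (proj₁ pw) , full) refl
  where
  i∈v = occurs-sound v occ
  1≤i = All.lookup (proj₁ pw) (∈-∷ʳ-last v)
  i≤  = ∈⇒≤maxW v i∈v
  full : ∀ j → 1 ≤ j → j ≤ maxW v → j ∈ v
  full j 1≤j j≤ with ∈-∷ʳ⁻ v (proj₂ pw j 1≤j (subst (j ≤_) (sym (maxW-ψ-black i v i≤)) j≤))
  ... | inj₁ h    = h
  ... | inj₂ refl = i∈v
...   | inj₂ occ = mkLast (i , white) v₀ (1≤i , i≤) (pos , full) (cong (_∷ʳ i) (sym map-v₀))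
  where
  i∉v : i ∉ v
  i∉v i∈v = true≢false (occurs-complete v i∈v) occ
  1≤i = All.lookup (proj₁ pw) (∈-∷ʳ-last v)
  lower : ℕ → ℕ
  lower x = if i <ᵇ x then x ∸ 1 else x
  bump-lower : ∀ {x} → x ≢ i → bump i (lower x) ≡ x
  bump-lower {x} ne with ℕ.<-cmp x i
  ... | Tri.tri< l _ _ rewrite <ᵇ-false (ℕ.<⇒≤ l) = bump-< l
  ... | Tri.tri≈ _ e _ = ⊥-elim (ne e)
  bump-lower {suc x} ne | Tri.tri> _ _ (s≤s l) rewrite <ᵇ-true (s≤s l) = bump-≥ l
  v₀ = map lower v
  map-v₀ : map (bump i) v₀ ≡ v
  map-v₀ = trans (sym (List.map-∘ v)) (List.map-id-local (All.tabulate (λ x∈ → bump-lower (λ { refl → i∉v x∈ }))))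
  bump∈w : ∀ {y} → y ∈ v₀ → bump i y ∈ v
  bump∈w y∈ = subst (_ ∈_) map-v₀ (∈.∈-map⁺ (bump i) y∈)
  pos : Pos v₀
  pos = All.tabulate (λ {y} y∈ → positive y (All.lookup (proj₁ pw) (∈.∈-++⁺ˡ (bump∈w y∈))))
    where
    positive : ∀ y → 1 ≤ bump i y → 1 ≤ y
    positive (suc y) _ = s≤s z≤n
    positive zero    h = ⊥-elim (ℕ.<⇒≱ h (ℕ.≤-reflexive (bump-< 1≤i)))
  unbump : ∀ {j} → bump i j ∈ v ∷ʳ i → j ∈ v₀
  unbump {j} h with ∈-∷ʳ⁻ v h
  ... | inj₂ e  = ⊥-elim (bump-≢ i j e)
  ... | inj₁ h′ with ∈.∈-map⁻ (bump i) (subst (_ ∈_) (sym map-v₀) h′)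
  ...   | y , y∈ , e = subst (_∈ v₀) (sym (bump-injective i e)) y∈
  bump-mono-≤ : ∀ {x y} → x ≤ y → bump i x ≤ bump i y
  bump-mono-≤ le with ℕ.m≤n⇒m<n∨m≡n le
  ... | inj₁ l    = ℕ.<⇒≤ (bump-mono-< i l)
  ... | inj₂ refl = ℕ.≤-refl
  full : ∀ j → 1 ≤ j → j ≤ maxW v₀ → j ∈ v₀
  full j 1≤j j≤ = unbump (proj₂ pw (bump i j) (ℕ.≤-trans 1≤j (x≤bump i j))
    (ℕ.≤-trans (bump-mono-≤ j≤) (∈⇒≤maxW (v ∷ʳ i) (∈.∈-++⁺ˡ (bump∈w (maxW-∈ v₀ (λ e → ℕ.<⇒≱ 1≤j (subst (λ z → j ≤ maxW z) e j≤))))))))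
  i≤ : i ≤ suc (maxW v₀)
  i≤ with i ℕ.≤? suc (maxW v₀)
  ... | yes p = p
  ... | no ¬p = ⊥-elim (ℕ.<⇒≱ (ℕ.n<1+n (maxW v₀)) (∈⇒≤maxW v₀ (unbump (subst (_∈ v ∷ʳ i) (sym (bump-< (ℕ.≰⇒> ¬p)))
          (proj₂ pw (suc (maxW v₀)) (s≤s z≤n) (ℕ.≤-trans (ℕ.<⇒≤ (ℕ.≰⇒> ¬p)) (∈⇒≤maxW (v ∷ʳ i) (∈-∷ʳ-last v))))))))

-- The condition `left` makes the last letter of `ψ l a` the last letter of the shuffle, and it can
-- be stripped. For a white label all shifted letters of `b` are at least `i`, so `bump i` is on
-- them the extra shift caused by the larger maximum.
Δ-left-ψ : ∀ l f {a b} → Packed a → Packed b → Valid l (maxW a) →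
           Δ left f (ψ l a) b ≡ ∑sh a (shift (maxW a) b) (f ∘ ψ l)
Δ-left-ψ (i , white) f {a} {b} pa pb val@(1≤i , i≤) = begin
  Δ left f (psiWhite i a) b
    ≡⟨ Δ-packed left f (ψ-packed (i , white) pa val) pb ⟩
  ∑sh (psiWhite i a) (shift (maxW (psiWhite i a)) b) (λ u → 𝟙 (lastFrom left (maxW (psiWhite i a)) u) * f u)
    ≡⟨ cong (λ m → ∑sh (psiWhite i a) (shift m b) (λ u → 𝟙 (lastFrom left m u) * f u)) (maxW-ψ-white i a i≤ 1≤i) ⟩
  ∑sh (map (bump i) a ∷ʳ i) (shift (suc ma) b) (λ u → 𝟙 (lastFrom left (suc ma) u) * f u)
    ≡⟨ ∑sh-lastˡ (_≤ᵇ suc ma) false (map (bump i) a) i (shift (suc ma) b) f (≤ᵇ-true i≤) (All.map ≤ᵇ-false (shift-> (suc ma) b (proj₁ pb))) ⟩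
  ∑sh (map (bump i) a) (shift (suc ma) b) (λ u → f (u ∷ʳ i))
    ≡⟨ cong (λ z → ∑sh (map (bump i) a) z (λ u → f (u ∷ʳ i))) shift-bump ⟩
  ∑sh (map (bump i) a) (map (bump i) (shift ma b)) (λ u → f (u ∷ʳ i))
    ≡⟨ ∑sh-map (bump i) a (shift ma b) (λ u → f (u ∷ʳ i)) ⟩
  ∑sh a (shift ma b) (λ u → f (psiWhite i u)) ∎
  where
  ma = maxW a
  shift-bump : shift (suc ma) b ≡ map (bump i) (shift ma b)
  shift-bump = trans (List.map-cong-local (All.map (λ {y} 1≤y → sym (bump-≥
    (ℕ.≤-trans i≤ (subst (_≤ ma ℕ.+ y) (ℕ.+-comm ma 1) (ℕ.+-monoʳ-≤ ma 1≤y))))) (proj₁ pb))) (List.map-∘ b)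
Δ-left-ψ (i , black) f {a} {b} pa pb val@(1≤i , i≤) = begin
  Δ left f (a ∷ʳ i) b
    ≡⟨ Δ-packed left f (ψ-packed (i , black) pa val) pb ⟩
  ∑sh (a ∷ʳ i) (shift (maxW (a ∷ʳ i)) b) (λ u → 𝟙 (lastFrom left (maxW (a ∷ʳ i)) u) * f u)
    ≡⟨ cong (λ m → ∑sh (a ∷ʳ i) (shift m b) (λ u → 𝟙 (lastFrom left m u) * f u)) (maxW-ψ-black i a i≤) ⟩
  ∑sh (a ∷ʳ i) (shift (maxW a) b) (λ u → 𝟙 (lastFrom left (maxW a) u) * f u)
    ≡⟨ ∑sh-lastˡ (_≤ᵇ maxW a) false a i (shift (maxW a) b) f (≤ᵇ-true i≤) (All.map ≤ᵇ-false (shift-> (maxW a) b (proj₁ pb))) ⟩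
  ∑sh a (shift (maxW a) b) (λ u → f (u ∷ʳ i)) ∎

raise : ℕ → Label → Label
raise m (i , α) = m ℕ.+ i , α

-- Here the stripped letter belongs to the right factor and is shifted along with it, hence the
-- raised label. The letters of `a` lie below it and are not bumped.
Δ-right-ψ : ∀ l f {a b} → Packed a → Packed b → Valid l (maxW b) →
            Δ right f a (ψ l b) ≡ ∑sh a (shift (maxW a) b) (f ∘ ψ (raise (maxW a) l))
Δ-right-ψ (i , white) f {a} {b} pa pb val@(1≤i , i≤) = begin
  Δ right f a (psiWhite i b)
    ≡⟨ Δ-packed right f pa (ψ-packed (i , white) pb val) ⟩
  ∑sh a (shift ma (psiWhite i b)) (λ u → 𝟙 (lastFrom right ma u) * f u)
    ≡⟨ cong (λ z → ∑sh a z (λ u → 𝟙 (lastFrom right ma u) * f u)) shift-ψ ⟩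
  ∑sh a (map (bump j) (shift ma b) ∷ʳ j) (λ u → 𝟙 (lastFrom right ma u) * f u)
    ≡⟨ ∑sh-lastʳ (ma <ᵇ_) false a (map (bump j) (shift ma b)) j f (<ᵇ-true ma<j) (All.map <ᵇ-false (≤maxW a)) ⟩
  ∑sh a (map (bump j) (shift ma b)) (λ u → f (u ∷ʳ j))
    ≡⟨ cong (λ z → ∑sh z (map (bump j) (shift ma b)) (λ u → f (u ∷ʳ j)))
         (sym (List.map-id-local (All.map (λ l → bump-< (ℕ.≤-<-trans l ma<j)) (≤maxW a)))) ⟩
  ∑sh (map (bump j) a) (map (bump j) (shift ma b)) (λ u → f (u ∷ʳ j))
    ≡⟨ ∑sh-map (bump j) a (shift ma b) (λ u → f (u ∷ʳ j)) ⟩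
  ∑sh a (shift ma b) (λ u → f (psiWhite j u)) ∎
  where
  ma = maxW a
  j  = ma ℕ.+ i
  ma<j : ma < j
  ma<j = subst (_≤ j) (ℕ.+-comm ma 1) (ℕ.+-monoʳ-≤ ma 1≤i)
  bump-+ : ∀ y → ma ℕ.+ bump i y ≡ bump j (ma ℕ.+ y)
  bump-+ y with i ℕ.≤? y
  ... | yes p = trans (cong (ma ℕ.+_) (bump-≥ p)) (trans (ℕ.+-suc ma y) (sym (bump-≥ (ℕ.+-monoʳ-≤ ma p))))
  ... | no p  = trans (cong (ma ℕ.+_) (bump-< (ℕ.≰⇒> p))) (sym (bump-< (ℕ.+-monoʳ-< ma (ℕ.≰⇒> p))))
  shift-ψ : shift ma (psiWhite i b) ≡ map (bump j) (shift ma b) ∷ʳ j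
  shift-ψ = trans (List.map-++ (ma ℕ.+_) (map (bump i) b) (i ∷ []))
    (cong (_∷ʳ j) (trans (sym (List.map-∘ b)) (trans (List.map-cong bump-+ b) (List.map-∘ b))))
Δ-right-ψ (i , black) f {a} {b} pa pb val@(1≤i , i≤) = begin
  Δ right f a (b ∷ʳ i)
    ≡⟨ Δ-packed right f pa (ψ-packed (i , black) pb val) ⟩
  ∑sh a (shift ma (b ∷ʳ i)) (λ u → 𝟙 (lastFrom right ma u) * f u)
    ≡⟨ cong (λ z → ∑sh a z (λ u → 𝟙 (lastFrom right ma u) * f u)) (List.map-++ (ma ℕ.+_) b (i ∷ [])) ⟩
  ∑sh a (shift ma b ∷ʳ (ma ℕ.+ i)) (λ u → 𝟙 (lastFrom right ma u) * f u)
    ≡⟨ ∑sh-lastʳ (ma <ᵇ_) false a (shift ma b) (ma ℕ.+ i) f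
         (<ᵇ-true (subst (_≤ ma ℕ.+ i) (ℕ.+-comm ma 1) (ℕ.+-monoʳ-≤ ma 1≤i))) (All.map <ᵇ-false (≤maxW a)) ⟩
  ∑sh a (shift ma b) (λ u → f (u ∷ʳ (ma ℕ.+ i))) ∎
  where ma = maxW a

-- Coefficients of the operations on linear combinations

module Words = FormalSum (List.≡-dec ℕ._≟_)

eqW-sound : ∀ u v → eqW u v ≡ true → u ≡ v
eqW-sound u v e with List.≡-dec ℕ._≟_ u v
... | yes p = p

eqW-refl : ∀ u → eqW u u ≡ true
eqW-refl u with List.≡-dec ℕ._≟_ u u
... | yes _ = refl
... | no ¬p = ⊥-elim (¬p refl)

eqW-false : ∀ {u v} → u ≢ v → eqW u v ≡ false
eqW-false {u} {v} ne = ≢true⇒false (ne ∘ eqW-sound u v)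

eqW-sym : ∀ u v → eqW u v ≡ eqW v u
eqW-sym u v = bool-ext (λ e → subst (λ z → eqW v z ≡ true) (sym (eqW-sound u v e)) (eqW-refl v))
                       (λ e → subst (λ z → eqW u z ≡ true) (sym (eqW-sound v u e)) (eqW-refl u))

if-𝟙 : ∀ b c → (if b then c else 0ℚ) ≡ 𝟙 b * c
if-𝟙 true  c = sym (ℚ.*-identityˡ c)
if-𝟙 false c = sym (ℚ.*-zeroˡ c)

coeff-∑ : ∀ x w → coeff x w ≡ ∑ x (λ (c , u) → 𝟙 (eqW u w) * c)
coeff-∑ []            w = refl
coeff-∑ ((c , u) ∷ x) w = cong₂ _+_ (if-𝟙 (eqW u w) c) (coeff-∑ x w)

coeff-++ : ∀ x y w → coeff (x ++ y) w ≡ coeff x w + coeff y w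
coeff-++ x y w = trans (coeff-∑ (x ++ y) w) (trans (∑-++ x y _) (sym (cong₂ _+_ (coeff-∑ x w) (coeff-∑ y w))))

coeff-scale : ∀ c x w → coeff (scale c x) w ≡ c * coeff x w
coeff-scale c x w = begin
  coeff (scale c x) w                        ≡⟨ coeff-∑ (scale c x) w ⟩
  ∑ (scale c x) (λ (d , u) → 𝟙 (eqW u w) * d) ≡⟨ ∑-map _ x _ ⟩
  ∑ x (λ (d , u) → 𝟙 (eqW u w) * (c * d))    ≡⟨ ∑-cong x (λ (d , u) → *-shift (𝟙 (eqW u w)) c d) ⟩
  ∑ x (λ (d , u) → c * (𝟙 (eqW u w) * d))    ≡⟨ ∑-*ˡ x c _ ⟩
  c * ∑ x (λ (d , u) → 𝟙 (eqW u w) * d)      ≡⟨ cong (c *_) (coeff-∑ x w) ⟨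
  c * coeff x w                              ∎

coeff-concatMap : ∀ {A : Set} (h : A → LC) xs w → coeff (concatMap h xs) w ≡ ∑ xs (λ x → coeff (h x) w)
coeff-concatMap h []       w = refl
coeff-concatMap h (x ∷ xs) w = trans (coeff-++ (h x) (concatMap h xs) w) (cong (coeff (h x) w +_) (coeff-concatMap h xs w))

coeff-lincomb : ∀ {A : Set} (O : A → LC) cs w → coeff (lincomb O cs) w ≡ ∑ cs (λ (c , a) → c * coeff (O a) w)
coeff-lincomb O cs w = trans (coeff-concatMap _ cs w) (∑-cong cs (λ (c , a) → coeff-scale c (O a) w))

coeff-linExt : ∀ f x w → coeff (linExt f x) w ≡ ∑ x (λ (c , u) → c * coeff (f u) w)
coeff-linExt f x w = trans (coeff-concatMap _ x w) (∑-cong x (λ (c , a) → coeff-scale c (f a) w))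

coeff-bilinExt : ∀ op x y w →
  coeff (bilinExt op x y) w ≡ ∑ x (λ (a , u) → ∑ y (λ (b , v) → (a * b) * coeff (op u v) w))
coeff-bilinExt op x y w = trans (coeff-concatMap _ x w)
  (∑-cong x (λ (a , u) → trans (coeff-concatMap _ y w) (∑-cong y (λ (b , v) → coeff-scale (a * b) (op u v) w))))

∑-applyUpTo-δ : ∀ a n j (G : ℕ → ℚ) → ∑ (applyUpTo (a ℕ.+_) n) (λ i → 𝟙 (i ℕ.≡ᵇ j) * G i) ≡ 𝟙 ((a ≤ᵇ j) ∧ (j <ᵇ a ℕ.+ n)) * G j
∑-applyUpTo-δ a zero j G = sym (𝟙-false (G j) (≢true⇒false (λ h →
  ℕ.<⇒≱ (<ᵇ-sound (∧-true⁻ʳ {a ≤ᵇ j} h)) (subst (_≤ j) (sym (ℕ.+-identityʳ a)) (≤ᵇ-sound (∧-true⁻ˡ {a ≤ᵇ j} h))))))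
∑-applyUpTo-δ a (suc n) j G = begin
  ∑ (applyUpTo (a ℕ.+_) (suc n)) (λ i → 𝟙 (i ℕ.≡ᵇ j) * G i)
    ≡⟨ cong (λ l → ∑ l (λ i → 𝟙 (i ℕ.≡ᵇ j) * G i)) (sym (List.applyUpTo-∷ʳ (a ℕ.+_) n)) ⟩
  ∑ (applyUpTo (a ℕ.+_) n ∷ʳ (a ℕ.+ n)) (λ i → 𝟙 (i ℕ.≡ᵇ j) * G i)
    ≡⟨ ∑-++ (applyUpTo (a ℕ.+_) n) _ _ ⟩
  ∑ (applyUpTo (a ℕ.+_) n) (λ i → 𝟙 (i ℕ.≡ᵇ j) * G i) + (𝟙 (a ℕ.+ n ℕ.≡ᵇ j) * G (a ℕ.+ n) + 0ℚ)
    ≡⟨ cong₂ _+_ (∑-applyUpTo-δ a n j G) (ℚ.+-identityʳ _) ⟩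
  𝟙 ((a ≤ᵇ j) ∧ (j <ᵇ a ℕ.+ n)) * G j + 𝟙 (a ℕ.+ n ℕ.≡ᵇ j) * G (a ℕ.+ n)
    ≡⟨ last-term ⟩
  𝟙 ((a ≤ᵇ j) ∧ (j <ᵇ a ℕ.+ suc n)) * G j ∎
  where
  last-term : 𝟙 ((a ≤ᵇ j) ∧ (j <ᵇ a ℕ.+ n)) * G j + 𝟙 (a ℕ.+ n ℕ.≡ᵇ j) * G (a ℕ.+ n) ≡ 𝟙 ((a ≤ᵇ j) ∧ (j <ᵇ a ℕ.+ suc n)) * G j
  last-term with a ℕ.+ n ℕ.≟ j
  ... | yes refl = trans (cong₂ _+_ (𝟙-false (G (a ℕ.+ n)) (≢true⇒false (λ h → ℕ.<-irrefl refl (<ᵇ-sound {a ℕ.+ n} (∧-true⁻ʳ {a ≤ᵇ a ℕ.+ n} h)))))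
                                    (𝟙-true (G (a ℕ.+ n)) (≡ᵇ-refl (a ℕ.+ n))))
          (trans (ℚ.+-identityˡ _) (sym (𝟙-true (G (a ℕ.+ n)) (∧-true⁺ (≤ᵇ-true (ℕ.m≤m+n a n)) (<ᵇ-true (ℕ.+-monoʳ-< a (ℕ.n<1+n n)))))))
  ... | no ne = trans (cong (𝟙 ((a ≤ᵇ j) ∧ (j <ᵇ a ℕ.+ n)) * G j +_) (𝟙-false (G (a ℕ.+ n)) (≡ᵇ-false ne)))
          (trans (ℚ.+-identityʳ _) (cong (λ b → 𝟙 ((a ≤ᵇ j) ∧ b) * G j) (bool-ext
            (λ e → <ᵇ-true {j} {a ℕ.+ suc n} (ℕ.<-trans (<ᵇ-sound {j} {a ℕ.+ n} e) (ℕ.+-monoʳ-< a (ℕ.n<1+n n))))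
            (λ e → <ᵇ-true {j} {a ℕ.+ n} (ℕ.≤∧≢⇒< (ℕ.≤-pred (subst (j <_) (ℕ.+-suc a n) (<ᵇ-sound {j} {a ℕ.+ suc n} e))) (ne ∘ sym))))))

∑-wordsOver-δ : ∀ N l w (F : Word → ℚ) → length w ≡ l → Pos w → All (_≤ N) w →
                ∑ (wordsOver N l) (λ a → 𝟙 (eqW a w) * F a) ≡ F w
∑-wordsOver-δ N zero    []      F _ _ _ = trans (ℚ.+-identityʳ _) (ℚ.*-identityˡ (F []))
∑-wordsOver-δ N (suc l) (y ∷ w) F len (1≤y ∷ pos) (y≤ ∷ h) = begin
  ∑ (wordsOver N (suc l)) (λ a → 𝟙 (eqW a (y ∷ w)) * F a)
    ≡⟨ ∑-concatMap _ (range 1 N) _ ⟩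
  ∑ (range 1 N) (λ x → ∑ (map (x ∷_) (wordsOver N l)) (λ a → 𝟙 (eqW a (y ∷ w)) * F a))
    ≡⟨ ∑-cong (range 1 N) inner ⟩
  ∑ (range 1 N) (λ x → 𝟙 (x ℕ.≡ᵇ y) * F (x ∷ w))
    ≡⟨ ∑-applyUpTo-δ 1 N y (λ x → F (x ∷ w)) ⟩
  𝟙 ((1 ≤ᵇ y) ∧ (y <ᵇ 1 ℕ.+ N)) * F (y ∷ w)
    ≡⟨ 𝟙-true (F (y ∷ w)) (∧-true⁺ (≤ᵇ-true 1≤y) (<ᵇ-true (s≤s y≤))) ⟩
  F (y ∷ w) ∎
  where
  inner : ∀ x → ∑ (map (x ∷_) (wordsOver N l)) (λ a → 𝟙 (eqW a (y ∷ w)) * F a) ≡ 𝟙 (x ℕ.≡ᵇ y) * F (x ∷ w)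
  inner x = begin
    ∑ (map (x ∷_) (wordsOver N l)) (λ a → 𝟙 (eqW a (y ∷ w)) * F a)
      ≡⟨ ∑-map (x ∷_) (wordsOver N l) _ ⟩
    ∑ (wordsOver N l) (λ a → 𝟙 ((x ℕ.≡ᵇ y) ∧ eqW a w) * F (x ∷ a))
      ≡⟨ ∑-cong (wordsOver N l) (λ a → trans (cong (_* F (x ∷ a)) (𝟙-∧ (x ℕ.≡ᵇ y) (eqW a w))) (ℚ.*-assoc (𝟙 (x ℕ.≡ᵇ y)) _ _)) ⟩
    ∑ (wordsOver N l) (λ a → 𝟙 (x ℕ.≡ᵇ y) * (𝟙 (eqW a w) * F (x ∷ a)))
      ≡⟨ ∑-*ˡ (wordsOver N l) (𝟙 (x ℕ.≡ᵇ y)) _ ⟩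
    𝟙 (x ℕ.≡ᵇ y) * ∑ (wordsOver N l) (λ a → 𝟙 (eqW a w) * F (x ∷ a))
      ≡⟨ cong (𝟙 (x ℕ.≡ᵇ y) *_) (∑-wordsOver-δ N l w (F ∘ (x ∷_)) (ℕ.suc-injective len) pos h) ⟩
    𝟙 (x ℕ.≡ᵇ y) * F (x ∷ w) ∎

rank-≤-length : ∀ x w → rank x w ≤ length w
rank-≤-length x []      = ℕ.≤-reflexive (rank-[] x)
rank-≤-length x (y ∷ w) = subst (_≤ suc (length w)) (sym (rank-∷ x y w)) (ℕ.+-mono-≤ (toℕ≤1 _) (rank-≤-length x w))

maxW-≤-length : ∀ {w} → Packed w → maxW w ≤ length w
maxW-≤-length {w} p = subst (_≤ length w) (rank-packed p (maxW w) ℕ.≤-refl) (rank-≤-length (maxW w) w)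

-- Letters of a packed word do not exceed its length, so the alphabet of size `n` suffices in length
-- `n`.
packedWords : ℕ → List Word
packedWords n = filterᵇ isPacked (wordsOver n n)

∑-packedWords-δ : ∀ n {w} → Packed w → length w ≡ n → ∀ (F : Word → ℚ) → ∑ (packedWords n) (λ a → 𝟙 (eqW a w) * F a) ≡ F w
∑-packedWords-δ n {w} p refl F = begin
  ∑ (packedWords n) (λ a → 𝟙 (eqW a w) * F a)
    ≡⟨ ∑-filterᵇ isPacked (wordsOver n n) _ ⟩
  ∑ (wordsOver n n) (λ a → 𝟙 (isPacked a) * (𝟙 (eqW a w) * F a))
    ≡⟨ ∑-cong (wordsOver n n) (λ a → trans (*-shift (𝟙 (isPacked a)) (𝟙 (eqW a w)) (F a))
         (𝟙-cong-* (eqW a w) (λ e → 𝟙-true (F a) (trans (cong isPacked (eqW-sound a w e)) (isPacked-complete w p))))) ⟩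
  ∑ (wordsOver n n) (λ a → 𝟙 (eqW a w) * F a)
    ≡⟨ ∑-wordsOver-δ n n w F refl (proj₁ p) (All.map (λ l → ℕ.≤-trans l (maxW-≤-length p)) (≤maxW w)) ⟩
  F w ∎

∑split-δ : ∀ u v w → ∑split w (λ a b → 𝟙 (eqW u a) * 𝟙 (eqW v b)) ≡ 𝟙 (eqW (u ++ v) w)
∑split-δ []      v []      = trans (∑split-[] _) (ℚ.*-identityˡ _)
∑split-δ (x ∷ u) v []      = trans (∑split-[] _) (ℚ.*-zeroˡ (𝟙 (eqW v [])))
∑split-δ []      v (z ∷ w) = begin
  ∑split (z ∷ w) (λ a b → 𝟙 (eqW [] a) * 𝟙 (eqW v b))  ≡⟨ ∑split-first (z ∷ w) (λ a b ne → *-zeroˡ-≡ (𝟙 (eqW v b)) (cong 𝟙 (eqW-false (ne ∘ sym)))) ⟩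
  1ℚ * 𝟙 (eqW v (z ∷ w))                              ≡⟨ ℚ.*-identityˡ _ ⟩
  𝟙 (eqW v (z ∷ w))                                   ∎
∑split-δ (x ∷ u) v (z ∷ w) = begin
  ∑split (z ∷ w) (λ a b → 𝟙 (eqW (x ∷ u) a) * 𝟙 (eqW v b))
    ≡⟨ ∑split-∷ z w _ ⟩
  0ℚ * 𝟙 (eqW v (z ∷ w)) + ∑split w (λ a b → 𝟙 ((x ℕ.≡ᵇ z) ∧ eqW u a) * 𝟙 (eqW v b))
    ≡⟨ cong₂ _+_ (ℚ.*-zeroˡ (𝟙 (eqW v (z ∷ w))))
         (trans (∑split-cong w (λ a b _ → trans (cong (_* 𝟙 (eqW v b)) (𝟙-∧ (x ℕ.≡ᵇ z) (eqW u a))) (ℚ.*-assoc (𝟙 (x ℕ.≡ᵇ z)) _ _)))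
                (∑split-*ˡ w (𝟙 (x ℕ.≡ᵇ z)) _)) ⟩
  0ℚ + 𝟙 (x ℕ.≡ᵇ z) * ∑split w (λ a b → 𝟙 (eqW u a) * 𝟙 (eqW v b))
    ≡⟨ trans (ℚ.+-identityˡ _) (cong (𝟙 (x ℕ.≡ᵇ z) *_) (∑split-δ u v w)) ⟩
  𝟙 (x ℕ.≡ᵇ z) * 𝟙 (eqW (u ++ v) w)
    ≡⟨ 𝟙-∧ (x ℕ.≡ᵇ z) (eqW (u ++ v) w) ⟨
  𝟙 (eqW (x ∷ u ++ v) (z ∷ w)) ∎

module ProdBasis (c : Cmp) (u v w : Word) where

  private
    N = length u ℕ.+ length v
    U = wordsOver N (length u)
    U′ = wordsOver N (length v)

    G : Word → Word → ℚ
    G a b = 𝟙 (compatible c a b) * (𝟙 (eqW u (pack a)) * 𝟙 (eqW v (pack b)))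

    condition : Word → Word → Bool
    condition a b = eqW (pack a) u ∧ eqW (pack b) v ∧ isPacked (a ++ b) ∧ disjointW a b ∧ cmpᵇ c (maxW a) (maxW b)

    𝟙-condition : ∀ a b → 𝟙 (condition a b) ≡ 𝟙 (isPacked (a ++ b)) * G a b
    𝟙-condition a b rewrite eqW-sym (pack a) u | eqW-sym (pack b) v = trans
      (trans (𝟙-∧ (eqW u (pack a)) _) (cong (𝟙 (eqW u (pack a)) *_) (trans (𝟙-∧ (eqW v (pack b)) _)
        (cong (𝟙 (eqW v (pack b)) *_) (𝟙-∧ (isPacked (a ++ b)) (compatible c a b))))))
      (solve 4 (λ x y p k → x :* (y :* (p :* k)) := p :* (k :* (x :* y))) refl
        (𝟙 (eqW u (pack a))) (𝟙 (eqW v (pack b))) (𝟙 (isPacked (a ++ b))) (𝟙 (compatible c a b)))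
      where open +-*-Solver

    expand : coeff (prodBasis (cmpᵇ c) u v) w ≡ ∑ U (λ a → ∑ U′ (λ b → 𝟙 (eqW (a ++ b) w) * (𝟙 (isPacked w) * G a b)))
    expand = begin
      coeff (prodBasis (cmpᵇ c) u v) w
        ≡⟨ coeff-∑ (prodBasis (cmpᵇ c) u v) w ⟩
      ∑ (prodBasis (cmpᵇ c) u v) (λ (d , s) → 𝟙 (eqW s w) * d)
        ≡⟨ ∑-map _ (filterᵇ _ (cartesianProduct U U′)) _ ⟩
      ∑ (filterᵇ _ (cartesianProduct U U′)) _
        ≡⟨ ∑-filterᵇ _ (cartesianProduct U U′) _ ⟩
      ∑ (cartesianProduct U U′) _
        ≡⟨ ∑-cartesianProduct U U′ _ ⟩
      ∑ U (λ a → ∑ U′ (λ b → 𝟙 (condition a b) * (𝟙 (eqW (a ++ b) w) * 1ℚ)))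
        ≡⟨ ∑-cong U (λ a → ∑-cong U′ (λ b → term a b)) ⟩
      ∑ U (λ a → ∑ U′ (λ b → 𝟙 (eqW (a ++ b) w) * (𝟙 (isPacked w) * G a b))) ∎
      where
      term : ∀ a b → 𝟙 (condition a b) * (𝟙 (eqW (a ++ b) w) * 1ℚ) ≡ 𝟙 (eqW (a ++ b) w) * (𝟙 (isPacked w) * G a b)
      term a b = trans (*-shift (𝟙 (condition a b)) (𝟙 (eqW (a ++ b) w)) 1ℚ)
        (𝟙-cong-* (eqW (a ++ b) w) (λ e → trans (ℚ.*-identityʳ _)
          (trans (𝟙-condition a b) (cong (λ z → 𝟙 (isPacked z) * G a b) (eqW-sound (a ++ b) w e)))))

    G-length : ∀ a b → G a b ≢ 0ℚ → length a ≡ length u × length b ≡ length v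
    G-length a b ne = trans (sym (length-pack a)) (cong length (sym (eqW-sound u (pack a) (𝟙-nonzero _ (*-nonzeroˡ _ _ ne′))))) ,
                      trans (sym (length-pack b)) (cong length (sym (eqW-sound v (pack b) (𝟙-nonzero _ (*-nonzeroʳ (𝟙 (eqW u (pack a))) _ ne′)))))
      where ne′ = *-nonzeroʳ (𝟙 (compatible c a b)) _ ne

    -- If `G a b` is nonzero, the lengths are those of `u` and `v`, and letters of the packed word
    -- `a ++ b` are at most `N`; so the enumeration meets this pair exactly once. If `G a b` is
    -- zero, every term is zero.
    locate : Packed w → ∀ a b → a ++ b ≡ w → ∑ U (λ a′ → ∑ U′ (λ b′ → (𝟙 (eqW a′ a) * 𝟙 (eqW b′ b)) * G a′ b′)) ≡ G a b
    locate pw a b refl = trans (∑-cong U (λ a′ → trans (∑-cong U′ (λ b′ → ℚ.*-assoc (𝟙 (eqW a′ a)) _ _)) (∑-*ˡ U′ (𝟙 (eqW a′ a)) _))) found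
      where
      found : ∑ U (λ a′ → 𝟙 (eqW a′ a) * ∑ U′ (λ b′ → 𝟙 (eqW b′ b) * G a′ b′)) ≡ G a b
      found with G a b ℚ.≟ 0ℚ
      ... | yes z = trans (∑-zero U (λ a′ → trans (Words.δ-subst a′ a (λ y → ∑ U′ (λ b′ → 𝟙 (eqW b′ b) * G y b′)))
              (*-zeroʳ-≡ (𝟙 (eqW a′ a)) (∑-zero U′ (λ b′ → trans (Words.δ-subst b′ b (G a)) (*-zeroʳ-≡ (𝟙 (eqW b′ b)) z)))))) (sym z)
      ... | no nz = trans (∑-wordsOver-δ N (length u) a _ (proj₁ lens) (All.++⁻ˡ a (proj₁ pw)) (All.++⁻ˡ a ≤N))
                          (∑-wordsOver-δ N (length v) b _ (proj₂ lens) (All.++⁻ʳ a (proj₁ pw)) (All.++⁻ʳ a ≤N))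
        where
        lens = G-length a b nz
        ≤N : All (_≤ N) (a ++ b)
        ≤N = All.map (λ l → ℕ.≤-trans l (subst (maxW (a ++ b) ≤_)
               (trans (List.length-++ a) (cong₂ ℕ._+_ (proj₁ lens) (proj₂ lens))) (maxW-≤-length pw))) (≤maxW (a ++ b))

  coeff-prodBasis : coeff (prodBasis (cmpᵇ c) u v) w ≡ conv c (λ z → 𝟙 (eqW u z)) (λ z → 𝟙 (eqW v z)) w
  coeff-prodBasis with packed? w
  ... | no np = trans expand (trans (∑-zero U (λ a → ∑-zero U′ (λ b → *-zeroʳ-≡ (𝟙 (eqW (a ++ b) w))
          (𝟙-false (G a b) (≢true⇒false (np ∘ isPacked-sound w)))))) (sym (conv-unpacked c _ _ np)))
  ... | yes pw = begin
    coeff (prodBasis (cmpᵇ c) u v) w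
      ≡⟨ expand ⟩
    ∑ U (λ a → ∑ U′ (λ b → 𝟙 (eqW (a ++ b) w) * (𝟙 (isPacked w) * G a b)))
      ≡⟨ ∑-cong U (λ a → ∑-cong U′ (λ b → trans (cong₂ _*_ (sym (∑split-δ a b w)) (𝟙-true (G a b) (isPacked-complete w pw)))
           (trans (ℚ.*-comm _ (G a b)) (trans (sym (∑split-*ˡ w (G a b) _)) (∑split-cong w (λ a′ b′ _ → ℚ.*-comm (G a b) _)))))) ⟩
    ∑ U (λ a → ∑ U′ (λ b → ∑split w (λ a′ b′ → (𝟙 (eqW a a′) * 𝟙 (eqW b b′)) * G a b)))
      ≡⟨ ∑-cong U (λ a → sym (∑split-∑ w U′ _)) ⟩
    ∑ U (λ a → ∑split w (λ a′ b′ → ∑ U′ (λ b → (𝟙 (eqW a a′) * 𝟙 (eqW b b′)) * G a b)))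
      ≡⟨ ∑split-∑ w U _ ⟨
    ∑split w (λ a′ b′ → ∑ U (λ a → ∑ U′ (λ b → (𝟙 (eqW a a′) * 𝟙 (eqW b b′)) * G a b)))
      ≡⟨ ∑split-cong w (locate pw) ⟩
    ∑split w G
      ≡⟨ conv-packed c _ _ pw ⟨
    conv c (λ z → 𝟙 (eqW u z)) (λ z → 𝟙 (eqW v z)) w ∎

coeff-conv : ∀ c x y w → coeff (bilinExt (prodBasis (cmpᵇ c)) x y) w ≡ conv c (coeff x) (coeff y) w
coeff-conv c x y w = sym (begin
  conv c (coeff x) (coeff y) w
    ≡⟨ conv-linearˡ c (coeff y) w x proj₁ (λ (_ , u) z → 𝟙 (eqW u z)) (coeff x) (λ {z} _ → expand x z) ⟩
  ∑ x (λ (a , u) → a * conv c (λ z → 𝟙 (eqW u z)) (coeff y) w)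
    ≡⟨ ∑-cong x (λ (a , u) → trans (cong (a *_)
         (conv-linearʳ c (λ z → 𝟙 (eqW u z)) w y proj₁ (λ (_ , v) z → 𝟙 (eqW v z)) (coeff y) (λ {z} _ → expand y z)))
         (sym (∑-*ˡ y a _))) ⟩
  ∑ x (λ (a , u) → ∑ y (λ (b , v) → a * (b * conv c (λ z → 𝟙 (eqW u z)) (λ z → 𝟙 (eqW v z)) w)))
    ≡⟨ ∑-cong x (λ (a , u) → ∑-cong y (λ (b , v) → trans (sym (ℚ.*-assoc a b _)) (cong ((a * b) *_) (sym (ProdBasis.coeff-prodBasis c u v w))))) ⟩
  ∑ x (λ (a , u) → ∑ y (λ (b , v) → (a * b) * coeff (prodBasis (cmpᵇ c) u v) w))
    ≡⟨ coeff-bilinExt (prodBasis (cmpᵇ c)) x y w ⟨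
  coeff (bilinExt (prodBasis (cmpᵇ c)) x y) w ∎)
  where
  expand : ∀ x z → coeff x z ≡ ∑ x (λ (c , u) → c * 𝟙 (eqW u z))
  expand x z = trans (coeff-∑ x z) (∑-cong x (λ (c , u) → ℚ.*-comm (𝟙 (eqW u z)) c))

coeff-≺ : ∀ x y w → coeff (x ≺ y) w ≡ (coeff x ≺ᵛ coeff y) w
coeff-≺ = coeff-conv gt

coeff-≻ : ∀ x y w → coeff (x ≻ y) w ≡ (coeff x ≻ᵛ coeff y) w
coeff-≻ = coeff-conv lt

coeff-rnest : ∀ l ls → All Augmentation (map coeff (l ∷ ls)) → ∀ w → coeff (rnest l ls) w ≡ nestˡ (map coeff (l ∷ ls)) w
coeff-rnest l []       (h ∷ _)  w = sym (≺-identityʳ h w)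
coeff-rnest l (m ∷ ms) (_ ∷ hs) w = trans (coeff-≺ l (rnest m ms) w) (conv-cong gt (λ _ → refl) (λ {v} _ → coeff-rnest m ms hs v) w)

coeff-lnest : ∀ r rs a → (∀ w → coeff r w ≡ a w) → ∀ w → coeff (lnest r rs) w ≡ nestʳ a (map coeff rs) w
coeff-lnest r []       a h w = h w
coeff-lnest r (s ∷ rs) a h w = coeff-lnest (r ≻ s) rs (a ≻ᵛ coeff s)
  (λ w → trans (coeff-≻ r s w) (conv-cong lt (λ {v} _ → h v) (λ _ → refl) w)) w

coeff-braceTerm : ∀ ls q rs → All Augmentation (map coeff ls) → Augmentation (coeff q) → All Augmentation (map coeff rs) → ∀ w →
                  coeff (braceTerm ls q rs) w ≡ ((nestˡ (map coeff ls) ≻ᵛ coeff q) ≺ᵛ nestʳ 𝟏 (map coeff rs)) w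
coeff-braceTerm ls q rs hls hq hrs w = trans (outer rs hrs) (conv-cong gt (λ {v} _ → left-part ls hls v) (λ _ → refl) w)
  where
  L : List LC → LC
  L []       = q
  L (l ∷ ls) = rnest l ls ≻ q
  left-part : ∀ ls → All Augmentation (map coeff ls) → ∀ w → coeff (L ls) w ≡ (nestˡ (map coeff ls) ≻ᵛ coeff q) w
  left-part []       h w = sym (≻-identityˡ hq w)
  left-part (l ∷ ls) h w = trans (coeff-≻ (rnest l ls) q w) (conv-cong lt (λ {v} _ → coeff-rnest l ls h v) (λ _ → refl) w)
  aug-L : ∀ ls → All Augmentation (map coeff ls) → Augmentation (coeff (L ls))
  aug-L ls h = (λ {v} np → trans (left-part ls h v) (proj₁ (≻-augmentation _ (coeff q)) np)) , trans (left-part ls h []) (proj₂ (≻-augmentation _ (coeff q)))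
  term-[] : ∀ ls → braceTerm ls q [] ≡ L ls
  term-[] []       = refl
  term-[] (l ∷ ls) = refl
  term-∷ : ∀ ls r rs → braceTerm ls q (r ∷ rs) ≡ L ls ≺ lnest r rs
  term-∷ []       r rs = refl
  term-∷ (l ∷ ls) r rs = refl
  outer : ∀ rs → All Augmentation (map coeff rs) → coeff (braceTerm ls q rs) w ≡ (coeff (L ls) ≺ᵛ nestʳ 𝟏 (map coeff rs)) w
  outer []       _       = trans (cong (λ z → coeff z w) (term-[] ls)) (sym (≺-identityʳ (aug-L ls hls) w))
  outer (r ∷ rs) (h ∷ _) = trans (cong (λ z → coeff z w) (term-∷ ls r rs)) (trans (coeff-≺ (L ls) (lnest r rs) w)
    (conv-cong gt (λ _ → refl) (λ {v} _ → coeff-lnest r rs (𝟏 ≻ᵛ coeff r) (λ v → sym (≻-identityˡ h v)) v) w))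

coeff-brace : ∀ ps q → All Augmentation (map coeff ps) → Augmentation (coeff q) → ∀ w →
              coeff (brace ps q) w ≡ braceᵛ (map coeff ps) (coeff q) w
coeff-brace ps q hps hq w = begin
  coeff (brace ps q) w
    ≡⟨ coeff-concatMap (λ i → scale (sign (length ps ∸ i)) (braceTerm (take i ps) q (drop i ps))) (upTo (suc (length ps))) w ⟩
  ∑ (upTo (suc (length ps))) (λ i → coeff (scale (sign (length ps ∸ i)) (braceTerm (take i ps) q (drop i ps))) w)
    ≡⟨ ∑-cong (upTo (suc (length ps))) (λ i → trans (coeff-scale (sign (length ps ∸ i)) (braceTerm (take i ps) q (drop i ps)) w)
         (cong (λ n → sign n * coeff (braceTerm (take i ps) q (drop i ps)) w) (sym (List.length-drop i ps)))) ⟩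
  ∑ (upTo (suc (length ps))) (λ i → sign (length (drop i ps)) * coeff (braceTerm (take i ps) q (drop i ps)) w)
    ≡⟨ ∑-take-drop ps (λ us vs → sign (length vs) * coeff (braceTerm us q vs) w) ⟩
  ∑split ps (λ us vs → sign (length vs) * coeff (braceTerm us q vs) w)
    ≡⟨ ∑split-cong ps (λ { us vs refl → let hs = subst (All Augmentation) (List.map-++ coeff us vs) hps in cong₂ _*_
         (cong sign (sym (List.length-map coeff vs)))
         (coeff-braceTerm us q vs (All.++⁻ˡ (map coeff us) hs) hq (All.++⁻ʳ (map coeff us) hs) w) }) ⟩
  ∑split ps (λ us vs → sign (length (map coeff vs)) * ((nestˡ (map coeff us) ≻ᵛ coeff q) ≺ᵛ nestʳ 𝟏 (map coeff vs)) w)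
    ≡⟨ ∑split-map coeff ps _ ⟨
  braceᵛ (map coeff ps) (coeff q) w ∎

-- The coproducts in terms of coefficients

∈-filterᵇ⁺ : ∀ (P : ℕ → Bool) {x} w → x ∈ w → P x ≡ true → x ∈ filterᵇ P w
∈-filterᵇ⁺ P w x∈ e = ∈.∈-filter⁺ (T? ∘ P) x∈ (Equivalence.from T-≡ e)

∈-filterᵇ⁻ : ∀ (P : ℕ → Bool) {x} w → x ∈ filterᵇ P w → x ∈ w × P x ≡ true
∈-filterᵇ⁻ P w x∈ with ∈.∈-filter⁻ (T? ∘ P) {xs = w} x∈
... | x∈w , t = x∈w , Equivalence.to T-≡ t

restrictLE-∈⁺ : ∀ {i x} u → x ∈ u → x ≤ i → x ∈ restrictLE i u
restrictLE-∈⁺ {i} u x∈ le = ∈-filterᵇ⁺ (_≤ᵇ i) u x∈ (≤ᵇ-true le)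

restrictLE-∈⁻ : ∀ {i x} u → x ∈ restrictLE i u → x ∈ u × x ≤ i
restrictLE-∈⁻ {i} {x} u x∈ with ∈-filterᵇ⁻ (_≤ᵇ i) u x∈
... | x∈u , e = x∈u , ≤ᵇ-sound {x} {i} e

restrictGT-∈⁺ : ∀ {i x} u → x ∈ u → i < x → x ∈ restrictGT i u
restrictGT-∈⁺ {i} u x∈ l = ∈-filterᵇ⁺ (i <ᵇ_) u x∈ (<ᵇ-true l)

restrictGT-∈⁻ : ∀ {i x} u → x ∈ restrictGT i u → x ∈ u × i < x
restrictGT-∈⁻ {i} {x} u x∈ with ∈-filterᵇ⁻ (i <ᵇ_) u x∈
... | x∈u , e = x∈u , <ᵇ-sound {i} {x} e

∈⇒≢[] : ∀ {A : Set} {x : A} {w} → x ∈ w → w ≢ []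
∈⇒≢[] () refl

module _ {u : Word} (pu : Packed u) {i : ℕ} (1≤i : 1 ≤ i) (i≤ : i ≤ maxW u) where

  maxW-restrictLE : maxW (restrictLE i u) ≡ i
  maxW-restrictLE = ℕ.≤-antisym (maxW-lub (restrictLE i u) (λ x∈ → proj₂ (restrictLE-∈⁻ u x∈)))
    (∈⇒≤maxW (restrictLE i u) (restrictLE-∈⁺ u (proj₂ pu i 1≤i i≤) ℕ.≤-refl))

  restrictLE-packed : Packed (restrictLE i u)
  restrictLE-packed = All.tabulate (λ x∈ → All.lookup (proj₁ pu) (proj₁ (restrictLE-∈⁻ u x∈))) ,
    λ j 1≤j j≤ → let j≤i = subst (j ≤_) maxW-restrictLE j≤ in restrictLE-∈⁺ u (proj₂ pu j 1≤j (ℕ.≤-trans j≤i i≤)) j≤i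

  restrictLE-≢[] : restrictLE i u ≢ []
  restrictLE-≢[] = ∈⇒≢[] (restrictLE-∈⁺ u (proj₂ pu i 1≤i i≤) ℕ.≤-refl)

module _ {u : Word} (pu : Packed u) (i : ℕ) where

  private
    q = map (_∸ i) (restrictGT i u)

    shift-q : shift i q ≡ restrictGT i u
    shift-q = trans (sym (List.map-∘ (restrictGT i u)))
      (List.map-id-local (All.tabulate (λ x∈ → ℕ.m+[n∸m]≡n (ℕ.<⇒≤ (proj₂ (restrictGT-∈⁻ u x∈))))))

    q-packed : Packed q
    q-packed = All.map⁺ (All.tabulate (λ x∈ → ℕ.m<n⇒0<n∸m (proj₂ (restrictGT-∈⁻ u x∈)))) , full
      where
      full : ∀ j → 1 ≤ j → j ≤ maxW q → j ∈ q
      full j 1≤j j≤ = subst (_∈ q) (ℕ.m+n∸m≡n i j) (∈.∈-map⁺ (_∸ i) (restrictGT-∈⁺ u i+j∈u i<i+j))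
        where
        i<i+j : i < i ℕ.+ j
        i<i+j = subst (_≤ i ℕ.+ j) (ℕ.+-comm i 1) (ℕ.+-monoʳ-≤ i 1≤j)
        top : i ℕ.+ maxW q ∈ restrictGT i u
        top = subst (i ℕ.+ maxW q ∈_) shift-q (∈.∈-map⁺ (i ℕ.+_) (maxW-∈ q (λ e → ℕ.<⇒≱ 1≤j (subst (λ z → j ≤ maxW z) e j≤))))
        i+j∈u : i ℕ.+ j ∈ u
        i+j∈u = proj₂ pu (i ℕ.+ j) (ℕ.≤-trans (s≤s z≤n) i<i+j)
          (ℕ.≤-trans (ℕ.+-monoʳ-≤ i j≤) (∈⇒≤maxW u (proj₁ (restrictGT-∈⁻ u top))))

    pack-GT : pack (restrictGT i u) ≡ q
    pack-GT = trans (cong pack (sym shift-q)) (trans (pack-map (shift-strict i q)) (pack-id q-packed))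

  -- The letters above `i` of a packed word form an interval starting at `i + 1`, or there are none,
  -- so packing them is subtraction of `i`.
  pack-restrictGT : ∀ {r} → pack (restrictGT i u) ≡ r → restrictGT i u ≡ shift i r
  pack-restrictGT e = trans (sym shift-q) (cong (shift i) (trans (sym pack-GT) e))

pack-shift : ∀ m {q} → Packed q → pack (shift m q) ≡ q
pack-shift m {q} pq = trans (pack-map (shift-strict m q)) (pack-id pq)

-- The size of a letter tells from which word it comes, so `u` is a shuffle of `p` and `c` in at
-- most one way, namely when these are its restrictions. This is the duality between shuffling and
-- cutting by value.
∑sh-δ : ∀ i p c u → All (_≤ i) p → All (i <_) c →
        ∑sh p c (λ s → 𝟙 (eqW u s)) ≡ 𝟙 (eqW (restrictLE i u) p) * 𝟙 (eqW (restrictGT i u) c)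
∑sh-δ i []      []      []      _ _ = ∑sh-[]ˡ [] _
∑sh-δ i []      (y ∷ c) []      _ _ = trans (∑sh-[]ˡ (y ∷ c) _) (sym (ℚ.*-zeroʳ 1ℚ))
∑sh-δ i (x ∷ p) c       []      _ _ = trans (∑sh-zero (x ∷ p) c (λ s j → cong 𝟙 (eqW-false {[]} {s} (λ { refl → case ∈-interleavingˡ j (here refl) of λ () }))))
  (sym (ℚ.*-zeroˡ (𝟙 (eqW [] c))))
∑sh-δ i p c (z ∷ u) hp hc with z ℕ.≤? i
... | yes z≤i rewrite ≤ᵇ-true z≤i | <ᵇ-false z≤i = low p c hp hc
  where
  high-letter : ∀ {y} → i < y → (z ℕ.≡ᵇ y) ≡ false
  high-letter {y} l = ≡ᵇ-false {z} {y} (λ { refl → ℕ.<⇒≱ l z≤i })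
  low : ∀ p c → All (_≤ i) p → All (i <_) c → ∑sh p c (λ s → 𝟙 (eqW (z ∷ u) s)) ≡ 𝟙 (eqW (z ∷ restrictLE i u) p) * 𝟙 (eqW (restrictGT i u) c)
  low [] []      _ _ = trans (∑sh-[]ˡ [] _) (sym (ℚ.*-zeroˡ (𝟙 (eqW (restrictGT i u) []))))
  low [] (y ∷ c) _ (l ∷ _) = trans (∑sh-[]ˡ (y ∷ c) _) (trans (cong (λ b → 𝟙 (b ∧ eqW u c)) (high-letter l)) (sym (ℚ.*-zeroˡ (𝟙 (eqW (restrictGT i u) (y ∷ c))))))
  low (x ∷ p) [] (_ ∷ hp) hc = begin
    ∑sh (x ∷ p) [] (λ s → 𝟙 (eqW (z ∷ u) s))
      ≡⟨ ∑sh-[]ʳ (x ∷ p) _ ⟩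
    𝟙 ((z ℕ.≡ᵇ x) ∧ eqW u p)
      ≡⟨ 𝟙-∧ (z ℕ.≡ᵇ x) (eqW u p) ⟩
    𝟙 (z ℕ.≡ᵇ x) * 𝟙 (eqW u p)
      ≡⟨ cong (𝟙 (z ℕ.≡ᵇ x) *_) (trans (sym (∑sh-[]ʳ p _)) (∑sh-δ i p [] u hp [])) ⟩
    𝟙 (z ℕ.≡ᵇ x) * (𝟙 (eqW (restrictLE i u) p) * 𝟙 (eqW (restrictGT i u) []))
      ≡⟨ ℚ.*-assoc (𝟙 (z ℕ.≡ᵇ x)) _ _ ⟨
    (𝟙 (z ℕ.≡ᵇ x) * 𝟙 (eqW (restrictLE i u) p)) * 𝟙 (eqW (restrictGT i u) [])
      ≡⟨ cong (_* 𝟙 (eqW (restrictGT i u) [])) (𝟙-∧ (z ℕ.≡ᵇ x) (eqW (restrictLE i u) p)) ⟨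
    𝟙 (eqW (z ∷ restrictLE i u) (x ∷ p)) * 𝟙 (eqW (restrictGT i u) []) ∎
  low (x ∷ p) (y ∷ c) (_ ∷ hp) (l ∷ hc) = begin
    ∑sh (x ∷ p) (y ∷ c) (λ s → 𝟙 (eqW (z ∷ u) s))
      ≡⟨ ∑sh-∷ x p y c _ ⟩
    ∑sh p (y ∷ c) (λ s → 𝟙 ((z ℕ.≡ᵇ x) ∧ eqW u s)) + ∑sh (x ∷ p) c (λ s → 𝟙 ((z ℕ.≡ᵇ y) ∧ eqW u s))
      ≡⟨ cong₂ _+_ (trans (∑sh-cong-≗ p (y ∷ c) (λ s → 𝟙-∧ (z ℕ.≡ᵇ x) (eqW u s))) (∑sh-*ˡ p (y ∷ c) (𝟙 (z ℕ.≡ᵇ x)) _))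
                   (∑sh-zero (x ∷ p) c (λ s _ → cong (λ b → 𝟙 (b ∧ eqW u s)) (high-letter l))) ⟩
    𝟙 (z ℕ.≡ᵇ x) * ∑sh p (y ∷ c) (λ s → 𝟙 (eqW u s)) + 0ℚ
      ≡⟨ trans (ℚ.+-identityʳ _) (cong (𝟙 (z ℕ.≡ᵇ x) *_) (∑sh-δ i p (y ∷ c) u hp (l ∷ hc))) ⟩
    𝟙 (z ℕ.≡ᵇ x) * (𝟙 (eqW (restrictLE i u) p) * 𝟙 (eqW (restrictGT i u) (y ∷ c)))
      ≡⟨ ℚ.*-assoc (𝟙 (z ℕ.≡ᵇ x)) _ _ ⟨
    (𝟙 (z ℕ.≡ᵇ x) * 𝟙 (eqW (restrictLE i u) p)) * 𝟙 (eqW (restrictGT i u) (y ∷ c))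
      ≡⟨ cong (_* 𝟙 (eqW (restrictGT i u) (y ∷ c))) (𝟙-∧ (z ℕ.≡ᵇ x) (eqW (restrictLE i u) p)) ⟨
    𝟙 (eqW (z ∷ restrictLE i u) (x ∷ p)) * 𝟙 (eqW (restrictGT i u) (y ∷ c)) ∎
... | no z≰i rewrite ≤ᵇ-false (ℕ.≰⇒> z≰i) | <ᵇ-true (ℕ.≰⇒> z≰i) = high p c hp hc
  where
  low-letter : ∀ {x} → x ≤ i → (z ℕ.≡ᵇ x) ≡ false
  low-letter {x} l = ≡ᵇ-false {z} {x} (λ { refl → z≰i l })
  high : ∀ p c → All (_≤ i) p → All (i <_) c → ∑sh p c (λ s → 𝟙 (eqW (z ∷ u) s)) ≡ 𝟙 (eqW (restrictLE i u) p) * 𝟙 (eqW (z ∷ restrictGT i u) c)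
  high [] [] _ _ = trans (∑sh-[]ˡ [] _) (sym (ℚ.*-zeroʳ (𝟙 (eqW (restrictLE i u) []))))
  high (x ∷ p) [] (l ∷ _) _ = trans (∑sh-[]ʳ (x ∷ p) _) (trans (cong (λ b → 𝟙 (b ∧ eqW u p)) (low-letter l)) (sym (ℚ.*-zeroʳ (𝟙 (eqW (restrictLE i u) (x ∷ p))))))
  high [] (y ∷ c) hp (_ ∷ hc) = begin
    ∑sh [] (y ∷ c) (λ s → 𝟙 (eqW (z ∷ u) s))
      ≡⟨ ∑sh-[]ˡ (y ∷ c) _ ⟩
    𝟙 ((z ℕ.≡ᵇ y) ∧ eqW u c)
      ≡⟨ 𝟙-∧ (z ℕ.≡ᵇ y) (eqW u c) ⟩
    𝟙 (z ℕ.≡ᵇ y) * 𝟙 (eqW u c)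
      ≡⟨ cong (𝟙 (z ℕ.≡ᵇ y) *_) (trans (sym (∑sh-[]ˡ c _)) (∑sh-δ i [] c u [] hc)) ⟩
    𝟙 (z ℕ.≡ᵇ y) * (𝟙 (eqW (restrictLE i u) []) * 𝟙 (eqW (restrictGT i u) c))
      ≡⟨ *-shift (𝟙 (z ℕ.≡ᵇ y)) (𝟙 (eqW (restrictLE i u) [])) (𝟙 (eqW (restrictGT i u) c)) ⟩
    𝟙 (eqW (restrictLE i u) []) * (𝟙 (z ℕ.≡ᵇ y) * 𝟙 (eqW (restrictGT i u) c))
      ≡⟨ cong (𝟙 (eqW (restrictLE i u) []) *_) (𝟙-∧ (z ℕ.≡ᵇ y) (eqW (restrictGT i u) c)) ⟨
    𝟙 (eqW (restrictLE i u) []) * 𝟙 (eqW (z ∷ restrictGT i u) (y ∷ c)) ∎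
  high (x ∷ p) (y ∷ c) (l ∷ hp) (_ ∷ hc) = begin
    ∑sh (x ∷ p) (y ∷ c) (λ s → 𝟙 (eqW (z ∷ u) s))
      ≡⟨ ∑sh-∷ x p y c _ ⟩
    ∑sh p (y ∷ c) (λ s → 𝟙 ((z ℕ.≡ᵇ x) ∧ eqW u s)) + ∑sh (x ∷ p) c (λ s → 𝟙 ((z ℕ.≡ᵇ y) ∧ eqW u s))
      ≡⟨ cong₂ _+_ (∑sh-zero p (y ∷ c) (λ s _ → cong (λ b → 𝟙 (b ∧ eqW u s)) (low-letter l)))
                   (trans (∑sh-cong-≗ (x ∷ p) c (λ s → 𝟙-∧ (z ℕ.≡ᵇ y) (eqW u s))) (∑sh-*ˡ (x ∷ p) c (𝟙 (z ℕ.≡ᵇ y)) _)) ⟩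
    0ℚ + 𝟙 (z ℕ.≡ᵇ y) * ∑sh (x ∷ p) c (λ s → 𝟙 (eqW u s))
      ≡⟨ trans (ℚ.+-identityˡ _) (cong (𝟙 (z ℕ.≡ᵇ y) *_) (∑sh-δ i (x ∷ p) c u (l ∷ hp) hc)) ⟩
    𝟙 (z ℕ.≡ᵇ y) * (𝟙 (eqW (restrictLE i u) (x ∷ p)) * 𝟙 (eqW (restrictGT i u) c))
      ≡⟨ *-shift (𝟙 (z ℕ.≡ᵇ y)) (𝟙 (eqW (restrictLE i u) (x ∷ p))) (𝟙 (eqW (restrictGT i u) c)) ⟩
    𝟙 (eqW (restrictLE i u) (x ∷ p)) * (𝟙 (z ℕ.≡ᵇ y) * 𝟙 (eqW (restrictGT i u) c))
      ≡⟨ cong (𝟙 (eqW (restrictLE i u) (x ∷ p)) *_) (𝟙-∧ (z ℕ.≡ᵇ y) (eqW (restrictGT i u) c)) ⟨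
    𝟙 (eqW (restrictLE i u) (x ∷ p)) * 𝟙 (eqW (z ∷ restrictGT i u) (y ∷ c)) ∎

coeff2-∑ : ∀ x p q → coeff2 x p q ≡ ∑ x (λ (c , u , v) → 𝟙 (eqW u p ∧ eqW v q) * c)
coeff2-∑ []                p q = refl
coeff2-∑ ((c , u , v) ∷ x) p q = cong₂ _+_ (if-𝟙 (eqW u p ∧ eqW v q) c) (coeff2-∑ x p q)

coeff2-++ : ∀ x y p q → coeff2 (x ++ y) p q ≡ coeff2 x p q + coeff2 y p q
coeff2-++ x y p q = trans (coeff2-∑ (x ++ y) p q) (trans (∑-++ x y _) (sym (cong₂ _+_ (coeff2-∑ x p q) (coeff2-∑ y p q))))

coeff2-linExt2 : ∀ f x p q → coeff2 (linExt2 f x) p q ≡ ∑ x (λ (c , u) → c * coeff2 (f u) p q)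
coeff2-linExt2 f []            p q = refl
coeff2-linExt2 f ((c , u) ∷ x) p q = trans (coeff2-++ (scale2 c (f u)) (linExt2 f x) p q) (cong₂ _+_ scaled (coeff2-linExt2 f x p q))
  where
  scaled : coeff2 (scale2 c (f u)) p q ≡ c * coeff2 (f u) p q
  scaled = begin
    coeff2 (scale2 c (f u)) p q
      ≡⟨ coeff2-∑ (scale2 c (f u)) p q ⟩
    ∑ (scale2 c (f u)) (λ (d , a , b) → 𝟙 (eqW a p ∧ eqW b q) * d)
      ≡⟨ ∑-map _ (f u) _ ⟩
    ∑ (f u) (λ (d , a , b) → 𝟙 (eqW a p ∧ eqW b q) * (c * d))
      ≡⟨ ∑-cong (f u) (λ (d , a , b) → *-shift (𝟙 (eqW a p ∧ eqW b q)) c d) ⟩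
    ∑ (f u) (λ (d , a , b) → c * (𝟙 (eqW a p ∧ eqW b q) * d))
      ≡⟨ ∑-*ˡ (f u) c _ ⟩
    c * ∑ (f u) (λ (d , a , b) → 𝟙 (eqW a p ∧ eqW b q) * d)
      ≡⟨ cong (c *_) (coeff2-∑ (f u) p q) ⟨
    c * coeff2 (f u) p q ∎

cuts : Word → List ℕ → LC2
cuts u is = map (λ i → (1ℚ , restrictLE i u , pack (restrictGT i u))) is

levels : Side → Word → ℕ → List ℕ
levels left  u z = range z (maxW u ∸ 1)
levels right u z = range 1 (z ∸ 1)
levels all   u z = []

ΔBasis : Side → Word → LC2
ΔBasis left  = ΔprecBasis
ΔBasis right = ΔsuccBasis
ΔBasis all   = λ _ → []

ΔBasis-last : ∀ c u z → last u ≡ just z → ΔBasis c u ≡ cuts u (levels c u z)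
ΔBasis-last left  u z e rewrite e = refl
ΔBasis-last right u z e rewrite e = refl
ΔBasis-last all   u z e = refl

ΔBasis-[] : ∀ c → ΔBasis c [] ≡ []
ΔBasis-[] left  = refl
ΔBasis-[] right = refl
ΔBasis-[] all   = refl

last-∷ʳ : ∀ {A : Set} (w : List A) z → last (w ∷ʳ z) ≡ just z
last-∷ʳ []          z = refl
last-∷ʳ (x ∷ [])    z = refl
last-∷ʳ (x ∷ y ∷ w) z = last-∷ʳ (y ∷ w) z

coeff2-cuts : ∀ u is p q → coeff2 (cuts u is) p q ≡ ∑ is (λ i → 𝟙 (eqW (restrictLE i u) p ∧ eqW (pack (restrictGT i u)) q))
coeff2-cuts u is p q = trans (coeff2-∑ (cuts u is) p q) (trans (∑-map _ is _) (∑-cong is (λ i → ℚ.*-identityʳ _)))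

range-bound : ∀ a b j → j < a ℕ.+ (suc b ∸ a) → a ≤ j → j ≤ b
range-bound a b j l a≤j with a ℕ.≤? suc b
... | yes p = ℕ.≤-pred (subst (j <_) (ℕ.m+[n∸m]≡n p) l)
... | no p  = ⊥-elim (ℕ.<⇒≱ l (subst (_≤ j) (sym (trans (cong (a ℕ.+_) (ℕ.m≤n⇒m∸n≡0 (ℕ.<⇒≤ (ℕ.≰⇒> p)))) (ℕ.+-identityʳ a))) a≤j))

range-∈ : ∀ a b {i} → i ∈ range a b → a ≤ i × i ≤ b
range-∈ a b i∈ with ∈.∈-applyUpTo⁻ (a ℕ.+_) i∈
... | k , k< , refl = ℕ.m≤m+n a k , range-bound a b (a ℕ.+ k) (ℕ.+-monoʳ-< a k<) (ℕ.m≤m+n a k)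

∑-range-δ : ∀ a b j (G : ℕ → ℚ) → ∑ (range a b) (λ i → 𝟙 (i ℕ.≡ᵇ j) * G i) ≡ 𝟙 ((a ≤ᵇ j) ∧ (j ≤ᵇ b)) * G j
∑-range-δ a b j G = trans (∑-applyUpTo-δ a (suc b ∸ a) j G) (cong (λ t → 𝟙 t * G j) (bool-ext
  (λ h → let a≤j = ≤ᵇ-sound {a} {j} (∧-true⁻ˡ h) in ∧-true⁺ (≤ᵇ-true a≤j)
     (≤ᵇ-true {j} {b} (range-bound a b j (<ᵇ-sound {j} {a ℕ.+ (suc b ∸ a)} (∧-true⁻ʳ {a ≤ᵇ j} h)) a≤j)))
  (λ h → let a≤j = ≤ᵇ-sound {a} {j} (∧-true⁻ˡ h)
             j≤b = ≤ᵇ-sound {j} {b} (∧-true⁻ʳ {a ≤ᵇ j} h) in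
     ∧-true⁺ (≤ᵇ-true a≤j) (<ᵇ-true (subst (j <_) (sym (ℕ.m+[n∸m]≡n (ℕ.≤-trans a≤j (ℕ.m≤n⇒m≤1+n j≤b)))) (s≤s j≤b))))))

≤∸1⇒< : ∀ {i m} → 1 ≤ m → i ≤ m ∸ 1 → i < m
≤∸1⇒< {i} {suc m} _ le = s≤s le

<⇒≤∸1 : ∀ {i m} → i < m → i ≤ m ∸ 1
<⇒≤∸1 {i} {suc m} (s≤s le) = le

module _ {v : Word} {z : ℕ} (pu : Packed (v ∷ʳ z)) where

  private
    u = v ∷ʳ z
    1≤z = All.lookup (proj₁ pu) (∈-∷ʳ-last v)
    z≤max = ∈⇒≤maxW u (∈-∷ʳ-last v)

  levels-∈ : ∀ c {i} → i ∈ levels c u z → 1 ≤ i × i < maxW u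
  levels-∈ left  i∈ with range-∈ z (maxW u ∸ 1) i∈
  ... | z≤i , i≤ = ℕ.≤-trans 1≤z z≤i , ≤∸1⇒< (ℕ.≤-trans 1≤z z≤max) i≤
  levels-∈ right i∈ with range-∈ 1 (z ∸ 1) i∈
  ... | 1≤i , i≤ = 1≤i , ℕ.<-≤-trans (≤∸1⇒< 1≤z i≤) z≤max

  module _ {p q} (pp : Packed p) (pq : Packed q) (p≢[] : p ≢ []) (q≢[] : q ≢ []) where

    private
      m = maxW p
      1≤m = maxW-pos p (proj₁ pp) p≢[]

      K : ℕ → Bool
      K i = eqW (restrictLE i u) p ∧ eqW (pack (restrictGT i u)) q

      within : Side → Bool
      within left  = (z ≤ᵇ m) ∧ (m ≤ᵇ maxW u ∸ 1)
      within right = (1 ≤ᵇ m) ∧ (m ≤ᵇ z ∸ 1)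
      within all   = false

      ∑-levels-δ : ∀ c (G : ℕ → ℚ) → ∑ (levels c u z) (λ i → 𝟙 (i ℕ.≡ᵇ m) * G i) ≡ 𝟙 (within c) * G m
      ∑-levels-δ left  G = ∑-range-δ z (maxW u ∸ 1) m G
      ∑-levels-δ right G = ∑-range-δ 1 (z ∸ 1) m G
      ∑-levels-δ all   G = sym (ℚ.*-zeroˡ (G m))

      only-m : ∀ c i → i ∈ levels c u z → 𝟙 (K i) ≡ 𝟙 (i ℕ.≡ᵇ m) * 𝟙 (K i)
      only-m c i i∈ with bool-dec (K i)
      ... | inj₂ f = trans (cong 𝟙 f) (sym (*-zeroʳ-≡ (𝟙 (i ℕ.≡ᵇ m)) (cong 𝟙 f)))
      ... | inj₁ t = sym (𝟙-true (𝟙 (K i)) (trans (cong (i ℕ.≡ᵇ_) m≡i) (≡ᵇ-refl i)))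
        where
        m≡i : m ≡ i
        m≡i = trans (cong maxW (sym (eqW-sound (restrictLE i u) p (∧-true⁻ˡ t))))
          (maxW-restrictLE pu (proj₁ (levels-∈ c i∈)) (ℕ.<⇒≤ (proj₂ (levels-∈ c i∈))))

      m<max : restrictGT m u ≡ shift m q → m < maxW u
      m<max e = ℕ.<-≤-trans (proj₂ top) (∈⇒≤maxW u (proj₁ top))
        where
        top : maxW (shift m q) ∈ u × m < maxW (shift m q)
        top = restrictGT-∈⁻ u (subst (maxW (shift m q) ∈_) (sym e) (maxW-∈ (shift m q) (map-≢[] _ q q≢[])))

      within-last : ∀ c → m < maxW u → within c ≡ true → lastFrom c m u ≡ true
      within-last left  _ h = trans (lastᵇ-∷ʳ (_≤ᵇ m) false v z) (∧-true⁻ˡ h)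
      within-last right _ h = trans (lastᵇ-∷ʳ (m <ᵇ_) false v z) (<ᵇ-true (≤∸1⇒< 1≤z (≤ᵇ-sound {m} {z ∸ 1} (∧-true⁻ʳ {1 ≤ᵇ m} h))))

      last-within : ∀ c → c ≢ all → m < maxW u → lastFrom c m u ≡ true → within c ≡ true
      last-within left  _ l h = ∧-true⁺ (trans (sym (lastᵇ-∷ʳ (_≤ᵇ m) false v z)) h) (≤ᵇ-true (<⇒≤∸1 l))
      last-within right _ l h = ∧-true⁺ (≤ᵇ-true 1≤m) (≤ᵇ-true (<⇒≤∸1 (<ᵇ-sound {m} {z} (trans (sym (lastᵇ-∷ʳ (m <ᵇ_) false v z)) h))))
      last-within all  ne _ _ = ⊥-elim (ne refl)

      K-≡ : ∀ c → c ≢ all → within c ∧ K m ≡ lastFrom c m u ∧ (eqW (restrictLE m u) p ∧ eqW (restrictGT m u) (shift m q))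
      K-≡ c c≢all = bool-ext
        (λ h → let k = ∧-true⁻ʳ {within c} h
                   gt≡ = pack-restrictGT pu m (eqW-sound (pack (restrictGT m u)) q (∧-true⁻ʳ {eqW (restrictLE m u) p} k)) in
           ∧-true⁺ (within-last c (m<max gt≡) (∧-true⁻ˡ h))
             (∧-true⁺ (∧-true⁻ˡ k) (subst (λ t → eqW t (shift m q) ≡ true) (sym gt≡) (eqW-refl (shift m q)))))
        (λ h → let k = ∧-true⁻ʳ {lastFrom c m u} h
                   gt≡ = eqW-sound (restrictGT m u) (shift m q) (∧-true⁻ʳ {eqW (restrictLE m u) p} k) in
           ∧-true⁺ (last-within c c≢all (m<max gt≡) (∧-true⁻ˡ h))
             (∧-true⁺ (∧-true⁻ˡ k) (subst (λ t → eqW t q ≡ true) (sym (trans (cong pack gt≡) (pack-shift m pq))) (eqW-refl q))))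

    -- The lower part of a packed word cut at level `i` has maximum `i`, so a given `p` can only
    -- come from the level `maxW p`. That this level lies in the range of the chosen coproduct says
    -- on which side the last letter `z` falls.
    coeff2-ΔBasis-∷ʳ : ∀ c → c ≢ all →
      coeff2 (ΔBasis c u) p q ≡ ∑sh p (shift m q) (λ s → 𝟙 (lastFrom c m s) * 𝟙 (eqW u s))
    coeff2-ΔBasis-∷ʳ c c≢all = begin
      coeff2 (ΔBasis c u) p q
        ≡⟨ cong (λ x → coeff2 x p q) (ΔBasis-last c u z (last-∷ʳ v z)) ⟩
      coeff2 (cuts u (levels c u z)) p q
        ≡⟨ coeff2-cuts u (levels c u z) p q ⟩
      ∑ (levels c u z) (λ i → 𝟙 (K i))
        ≡⟨ ∑-cong-∈ (levels c u z) (only-m c) ⟩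
      ∑ (levels c u z) (λ i → 𝟙 (i ℕ.≡ᵇ m) * 𝟙 (K i))
        ≡⟨ ∑-levels-δ c (λ i → 𝟙 (K i)) ⟩
      𝟙 (within c) * 𝟙 (K m)
        ≡⟨ 𝟙-∧ (within c) (K m) ⟨
      𝟙 (within c ∧ K m)
        ≡⟨ cong 𝟙 (K-≡ c c≢all) ⟩
      𝟙 (lastFrom c m u ∧ (eqW (restrictLE m u) p ∧ eqW (restrictGT m u) (shift m q)))
        ≡⟨ trans (𝟙-∧ (lastFrom c m u) _) (cong (𝟙 (lastFrom c m u) *_) (𝟙-∧ (eqW (restrictLE m u) p) _)) ⟩
      𝟙 (lastFrom c m u) * (𝟙 (eqW (restrictLE m u) p) * 𝟙 (eqW (restrictGT m u) (shift m q)))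
        ≡⟨ cong (𝟙 (lastFrom c m u) *_) (sym (∑sh-δ m p (shift m q) u (≤maxW p) (shift-> m q (proj₁ pq)))) ⟩
      𝟙 (lastFrom c m u) * ∑sh p (shift m q) (λ s → 𝟙 (eqW u s))
        ≡⟨ ∑sh-*ˡ p (shift m q) (𝟙 (lastFrom c m u)) _ ⟨
      ∑sh p (shift m q) (λ s → 𝟙 (lastFrom c m u) * 𝟙 (eqW u s))
        ≡⟨ ∑sh-cong-≗ p (shift m q) (λ s → trans (ℚ.*-comm (𝟙 (lastFrom c m u)) (𝟙 (eqW u s)))
             (trans (Words.δ-subst u s (λ t → 𝟙 (lastFrom c m t))) (ℚ.*-comm (𝟙 (eqW u s)) (𝟙 (lastFrom c m s))))) ⟩
      ∑sh p (shift m q) (λ s → 𝟙 (lastFrom c m s) * 𝟙 (eqW u s)) ∎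

  coeff2-ΔBasis-support-∷ʳ : ∀ c p q → coeff2 (ΔBasis c u) p q ≢ 0ℚ → (Packed p × p ≢ []) × (Packed q × q ≢ [])
  coeff2-ΔBasis-support-∷ʳ c p q ne
    with ∑-nonzero (levels c u z) (λ e → ne (trans (cong (λ x → coeff2 x p q) (ΔBasis-last c u z (last-∷ʳ v z))) (trans (coeff2-cuts u (levels c u z) p q) e)))
  ... | i , i∈ , k with levels-∈ c i∈
  ...   | 1≤i , i< with eqW-sound (restrictLE i u) p (∧-true⁻ˡ (𝟙-nonzero _ k))
                      | eqW-sound (pack (restrictGT i u)) q (∧-true⁻ʳ {eqW (restrictLE i u) p} (𝟙-nonzero _ k))
  ...     | refl | refl = (restrictLE-packed pu 1≤i (ℕ.<⇒≤ i<) , restrictLE-≢[] pu 1≤i (ℕ.<⇒≤ i<)) ,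
                          (pack-packed _ , pack-≢[] _ (∈⇒≢[] (restrictGT-∈⁺ u (maxW-∈ u (∷ʳ-≢[] v)) i<)))

coeff2-ΔBasis : ∀ c → c ≢ all → ∀ {u p q} → Packed u → Packed p → Packed q → p ≢ [] → q ≢ [] →
                coeff2 (ΔBasis c u) p q ≡ ∑sh p (shift (maxW p) q) (λ s → 𝟙 (lastFrom c (maxW p) s) * 𝟙 (eqW u s))
coeff2-ΔBasis c c≢all {u} {p} {q} pu pp pq p≢[] q≢[] with initLast u
... | v ∷ʳ′ z = coeff2-ΔBasis-∷ʳ pu pp pq p≢[] q≢[] c c≢all
... | [] = trans (cong (λ x → coeff2 x p q) (ΔBasis-[] c)) (sym (∑sh-zero p _ (λ s i →
        *-zeroʳ-≡ (𝟙 (lastFrom c (maxW p) s)) (cong 𝟙 (eqW-false {[]} {s} (λ { refl → ∈⇒≢[] (∈-interleavingˡ i (maxW-∈ p p≢[])) refl }))))))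

coeff2-ΔBasis-support : ∀ c {u} → Packed u → ∀ p q → coeff2 (ΔBasis c u) p q ≢ 0ℚ → (Packed p × p ≢ []) × (Packed q × q ≢ [])
coeff2-ΔBasis-support c {u} pu p q ne with initLast u
... | v ∷ʳ′ z = coeff2-ΔBasis-support-∷ʳ pu c p q ne
... | [] = ⊥-elim (ne (cong (λ x → coeff2 x p q) (ΔBasis-[] c)))

module _ (x : LC) (supp : PackedSupport (coeff x)) where

  private
    coef-packed : ∀ u → Words.coef x u ≢ 0ℚ → Packed u
    coef-packed u ne with packed? u
    ... | yes p = p
    ... | no np = ⊥-elim (ne (trans (sym (coeff-∑ x u)) (supp np)))

  -- The list may contain unpacked words, but only with collected coefficient zero; so formulas on
  -- basis elements have to be checked at packed words only.
  eval-packed : ∀ (φ φ′ : Word → ℚ) → (∀ {u} → Packed u → φ u ≡ φ′ u) →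
                ∑ x (λ (c , u) → c * φ u) ≡ ∑ x (λ (c , u) → c * φ′ u)
  eval-packed φ φ′ h = Words.eval-cong x φ φ′ (λ u ne → h (coef-packed u ne))

  coeff2-Δ : ∀ c → c ≢ all → ∀ {p q} → Packed p → Packed q → p ≢ [] → q ≢ [] →
             coeff2 (linExt2 (ΔBasis c) x) p q ≡ Δ c (coeff x) p q
  coeff2-Δ c c≢all {p} {q} pp pq p≢[] q≢[] = begin
    coeff2 (linExt2 (ΔBasis c) x) p q
      ≡⟨ coeff2-linExt2 (ΔBasis c) x p q ⟩
    ∑ x (λ (d , u) → d * coeff2 (ΔBasis c u) p q)
      ≡⟨ eval-packed _ _ (λ pu → coeff2-ΔBasis c c≢all pu pp pq p≢[] q≢[]) ⟩
    ∑ x (λ (d , u) → d * ∑sh p q′ (λ s → 𝟙 (lastFrom c m s) * 𝟙 (eqW u s)))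
      ≡⟨ ∑-cong x (λ (d , u) → trans (sym (∑sh-*ˡ p q′ d _)) (∑sh-cong-≗ p q′ (λ s →
           solve 3 (λ d l e → d :* (l :* e) := l :* (e :* d)) refl d (𝟙 (lastFrom c m s)) (𝟙 (eqW u s))))) ⟩
    ∑ x (λ (d , u) → ∑sh p q′ (λ s → 𝟙 (lastFrom c m s) * (𝟙 (eqW u s) * d)))
      ≡⟨ ∑sh-∑ p q′ x _ ⟨
    ∑sh p q′ (λ s → ∑ x (λ (d , u) → 𝟙 (lastFrom c m s) * (𝟙 (eqW u s) * d)))
      ≡⟨ ∑sh-cong-≗ p q′ (λ s → trans (∑-*ˡ x (𝟙 (lastFrom c m s)) _) (cong (𝟙 (lastFrom c m s) *_) (sym (coeff-∑ x s)))) ⟩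
    ∑sh p q′ (λ s → 𝟙 (lastFrom c m s) * coeff x s)
      ≡⟨ Δ-packed c (coeff x) pp pq ⟨
    Δ c (coeff x) p q ∎
    where
    open +-*-Solver
    m  = maxW p
    q′ = shift m q

  coeff2-Δ-zero : ∀ c p q → ¬ ((Packed p × p ≢ []) × (Packed q × q ≢ [])) → coeff2 (linExt2 (ΔBasis c) x) p q ≡ 0ℚ
  coeff2-Δ-zero c p q np = begin
    coeff2 (linExt2 (ΔBasis c) x) p q
      ≡⟨ coeff2-linExt2 (ΔBasis c) x p q ⟩
    ∑ x (λ (d , u) → d * coeff2 (ΔBasis c u) p q)
      ≡⟨ eval-packed _ (λ _ → 0ℚ) (λ pu → stable-0 (λ ne → np (coeff2-ΔBasis-support c pu p q ne))) ⟩
    ∑ x (λ (d , u) → d * 0ℚ)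
      ≡⟨ ∑-zero x (λ (d , u) → ℚ.*-zeroʳ d) ⟩
    0ℚ ∎

  private
    cut? : ∀ p q → Dec ((Packed p × p ≢ []) × (Packed q × q ≢ []))
    cut? p q with packed? p | packed? q | []? p | []? q
    ... | no np | _ | _ | _ = no (np ∘ proj₁ ∘ proj₁)
    ... | yes _ | no nq | _ | _ = no (nq ∘ proj₁ ∘ proj₂)
    ... | yes _ | yes _ | yes e | _ = no (λ h → proj₂ (proj₁ h) e)
    ... | yes _ | yes _ | no _ | yes e = no (λ h → proj₂ (proj₂ h) e)
    ... | yes pp | yes pq | no np | no nq = yes ((pp , np) , (pq , nq))

  IsZero2⇒Vanishes : ∀ c → c ≢ all → IsZero2 (linExt2 (ΔBasis c) x) → Vanishes c (coeff x)
  IsZero2⇒Vanishes c c≢all h {a} {b} pa pb a≢[] b≢[] = trans (sym (coeff2-Δ c c≢all pa pb a≢[] b≢[])) (h a b)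

  Vanishes⇒IsZero2 : ∀ c → c ≢ all → Vanishes c (coeff x) → IsZero2 (linExt2 (ΔBasis c) x)
  Vanishes⇒IsZero2 c c≢all h p q with cut? p q
  ... | no np = coeff2-Δ-zero c p q np
  ... | yes ((pp , p≢[]) , (pq , q≢[])) = trans (coeff2-Δ c c≢all pp pq p≢[] q≢[]) (h pp pq p≢[] q≢[])

  coeff2-Δ-sum : ∀ {a b} → Packed a → Packed b → a ≢ [] → b ≢ [] →
                 coeff2 (Δprec x ++ Δsucc x) a b ≡ Δ all (coeff x) a b
  coeff2-Δ-sum {a} {b} pa pb a≢[] b≢[] = trans (coeff2-++ (Δprec x) (Δsucc x) a b)
    (trans (cong₂ _+_ (coeff2-Δ left (λ ()) pa pb a≢[] b≢[]) (coeff2-Δ right (λ ()) pa pb a≢[] b≢[]))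
           (Δ-left+right (coeff x) pa pb b≢[]))

  IsZero2⇒primitive : IsZero2 (Δprec x ++ Δsucc x) → Vanishes all (coeff x)
  IsZero2⇒primitive h {a} {b} pa pb a≢[] b≢[] = trans (sym (coeff2-Δ-sum pa pb a≢[] b≢[])) (h a b)

  primitive⇒IsZero2 : Vanishes all (coeff x) → IsZero2 (Δprec x ++ Δsucc x)
  primitive⇒IsZero2 h p q with cut? p q
  ... | no np = trans (coeff2-++ (Δprec x) (Δsucc x) p q) (trans (cong₂ _+_ (coeff2-Δ-zero left p q np) (coeff2-Δ-zero right p q np)) (ℚ.+-identityˡ 0ℚ))
  ... | yes ((pp , p≢[]) , (pq , q≢[])) = trans (coeff2-Δ-sum pp pq p≢[] q≢[]) (h pp pq p≢[] q≢[])

-- Coefficients of the operators Ψ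

_≟ᶜ_ : DecidableEquality Color
white ≟ᶜ white = yes refl
white ≟ᶜ black = no (λ ())
black ≟ᶜ white = no (λ ())
black ≟ᶜ black = yes refl

_≟ˡ_ : DecidableEquality Label
(i , α) ≟ˡ (j , β) with i ℕ.≟ j | α ≟ᶜ β
... | yes refl | yes refl = yes refl
... | no ne    | _        = no (λ { refl → ne refl })
... | yes _    | no ne    = no (λ { refl → ne refl })

module Labels = FormalSum _≟ˡ_

ΨBasis-coeff : ∀ l u w → (Valid l (maxW u) × coeff (ΨBasis l u) w ≡ 𝟙 (eqW (ψ l u) w)) ⊎
                         (¬ Valid l (maxW u) × coeff (ΨBasis l u) w ≡ 0ℚ)
ΨBasis-coeff (i , white) u w with bool-dec ((1 ≤ᵇ i) ∧ (i ≤ᵇ suc (maxW u)))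
... | inj₁ e rewrite e = inj₁ ((≤ᵇ-sound {1} {i} (∧-true⁻ˡ e) , ≤ᵇ-sound {i} {suc (maxW u)} (∧-true⁻ʳ {1 ≤ᵇ i} e)) ,
    trans (coeff-∑ ((1ℚ , psiWhite i u) ∷ []) w) (trans (ℚ.+-identityʳ _) (ℚ.*-identityʳ _)))
... | inj₂ e rewrite e = inj₂ ((λ (a , b) → true≢false (∧-true⁺ (≤ᵇ-true {1} {i} a) (≤ᵇ-true {i} {suc (maxW u)} b)) e) , refl)
ΨBasis-coeff (i , black) u w with bool-dec ((1 ≤ᵇ i) ∧ (i ≤ᵇ maxW u))
... | inj₁ e rewrite e = inj₁ ((≤ᵇ-sound {1} {i} (∧-true⁻ˡ e) , ≤ᵇ-sound {i} {maxW u} (∧-true⁻ʳ {1 ≤ᵇ i} e)) ,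
    trans (coeff-∑ ((1ℚ , u ∷ʳ i) ∷ []) w) (trans (ℚ.+-identityʳ _) (ℚ.*-identityʳ _)))
... | inj₂ e rewrite e = inj₂ ((λ (a , b) → true≢false (∧-true⁺ (≤ᵇ-true {1} {i} a) (≤ᵇ-true {i} {maxW u} b)) e) , refl)

module _ (y : LC) (supp : PackedSupport (coeff y)) (l : Label) where

  -- By `ψ-injective` a word determines its last label and its rest, so only the term of `v` with
  -- the same label contributes. Together with `lastLetter` this describes every value of `Ψ l y`.
  coeff-Ψ : ∀ l′ {v} → Packed v → Valid l′ (maxW v) → coeff (Ψ l y) (ψ l′ v) ≡ 𝟙 (does (l ≟ˡ l′)) * coeff y v
  coeff-Ψ l′ {v} pv val = begin
    coeff (Ψ l y) (ψ l′ v)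
      ≡⟨ coeff-linExt (ΨBasis l) y (ψ l′ v) ⟩
    ∑ y (λ (c , u) → c * coeff (ΨBasis l u) (ψ l′ v))
      ≡⟨ eval-packed y supp _ _ basis ⟩
    ∑ y (λ (c , u) → c * (𝟙 (does (l ≟ˡ l′)) * 𝟙 (eqW u v)))
      ≡⟨ ∑-cong y (λ (c , u) → solve 3 (λ c k e → c :* (k :* e) := k :* (e :* c)) refl c (𝟙 (does (l ≟ˡ l′))) (𝟙 (eqW u v))) ⟩
    ∑ y (λ (c , u) → 𝟙 (does (l ≟ˡ l′)) * (𝟙 (eqW u v) * c))
      ≡⟨ ∑-*ˡ y (𝟙 (does (l ≟ˡ l′))) _ ⟩
    𝟙 (does (l ≟ˡ l′)) * ∑ y (λ (c , u) → 𝟙 (eqW u v) * c)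
      ≡⟨ cong (𝟙 (does (l ≟ˡ l′)) *_) (coeff-∑ y v) ⟨
    𝟙 (does (l ≟ˡ l′)) * coeff y v ∎
    where
    open +-*-Solver
    basis : ∀ {u} → Packed u → coeff (ΨBasis l u) (ψ l′ v) ≡ 𝟙 (does (l ≟ˡ l′)) * 𝟙 (eqW u v)
    basis {u} pu with ΨBasis-coeff l u (ψ l′ v) | l ≟ˡ l′
    ... | inj₁ (valu , e) | no ne = trans e (trans (cong 𝟙 (eqW-false (λ e → ne (proj₁ (ψ-injective l l′ pu pv valu val e))))) (sym (ℚ.*-zeroˡ (𝟙 (eqW u v)))))
    ... | inj₁ (valu , e) | yes refl = trans e (trans (cong 𝟙 (bool-ext
            (λ h → subst (λ t → eqW u t ≡ true) (proj₂ (ψ-injective l l pu pv valu val (eqW-sound (ψ l u) (ψ l v) h))) (eqW-refl u))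
            (λ h → subst (λ t → eqW (ψ l u) (ψ l t) ≡ true) (eqW-sound u v h) (eqW-refl (ψ l u))))) (sym (ℚ.*-identityˡ (𝟙 (eqW u v)))))
    ... | inj₂ (_ , e)  | no ne = trans e (sym (ℚ.*-zeroˡ (𝟙 (eqW u v))))
    ... | inj₂ (nv , e) | yes refl = trans e (sym (*-zeroʳ-≡ 1ℚ (cong 𝟙 (eqW-false {u} {v} (λ { refl → nv val })))))

  Ψ-augmentation : Augmentation (coeff (Ψ l y))
  Ψ-augmentation = (λ {w} np → zero-at w (λ pu val → λ { refl → np (ψ-packed l pu val) })) , zero-at [] (λ {u} pu val e → ψ-≢[] l u e)
    where
    zero-at : ∀ w → (∀ {u} → Packed u → Valid l (maxW u) → ψ l u ≢ w) → coeff (Ψ l y) w ≡ 0ℚ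
    zero-at w h = trans (coeff-linExt (ΨBasis l) y w) (trans (eval-packed y supp _ (λ _ → 0ℚ) vanish) (∑-zero y (λ (c , u) → ℚ.*-zeroʳ c)))
      where
      vanish : ∀ {u} → Packed u → coeff (ΨBasis l u) w ≡ 0ℚ
      vanish {u} pu with ΨBasis-coeff l u w
      ... | inj₁ (val , e) = trans e (cong 𝟙 (eqW-false (h pu val)))
      ... | inj₂ (_ , e)   = e

-- The family O is homogeneous and consists of primitive elements

-- Besides the length also the maximum is fixed on the support. For trees the second degree is the
-- weight, so the root condition becomes a bound by the maximum of the words involved.
Hom : ℕ → ℕ → V → Set
Hom n m f = ∀ {w} → f w ≢ 0ℚ → Packed w × length w ≡ n × maxW w ≡ m

Hom-cong : ∀ {n m f g} → (∀ w → f w ≡ g w) → Hom n m f → Hom n m g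
Hom-cong e h ne = h (λ z → ne (trans (sym (e _)) z))

Hom-degree : ∀ {n m f} → Hom n m f → Degree n f
Hom-degree h ne = stable-0 (λ nz → ne (proj₁ (proj₂ (h nz))))

Hom-packedSupport : ∀ {n m f} → Hom n m f → PackedSupport f
Hom-packedSupport h np = stable-0 (λ nz → np (proj₁ (h nz)))

Hom-maxW : ∀ {n m f} → Hom n m f → ∀ {w} → maxW w ≢ m → f w ≡ 0ℚ
Hom-maxW h ne = stable-0 (λ nz → ne (proj₂ (proj₂ (h nz))))

Hom-augmentation : ∀ {n m f} → Hom (suc n) m f → Augmentation f
Hom-augmentation h = Hom-packedSupport h , Hom-degree h (λ ())

Vanishes-cong : ∀ {c f g} → (∀ w → f w ≡ g w) → Vanishes c f → Vanishes c g
Vanishes-cong {c} {f} {g} e h {a} {b} pa pb na nb = trans (linear-cong (Δ-linear c a b) g f (λ {w} _ → sym (e w))) (h pa pb na nb)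

𝟏-Hom : Hom 0 0 𝟏
𝟏-Hom {[]}    ne = []-packed , refl , refl
𝟏-Hom {_ ∷ _} ne = ⊥-elim (ne refl)

conv-Hom : ∀ c {n m n′ m′ f g} → Hom n m f → Hom n′ m′ g → Hom (n ℕ.+ n′) (m ℕ.+ m′) (conv c f g)
conv-Hom c {f = f} {g} hf hg {w} ne with packed? w
... | no np = ⊥-elim (ne (conv-unpacked c f g np))
... | yes p with ∑split-nonzero w (λ e → ne (trans (conv-packed c f g p) e))
...   | a , b , refl , ne′ with hf (*-nonzeroˡ (f (pack a)) _ (*-nonzeroʳ (𝟙 (compatible c a b)) _ ne′))
                              | hg (*-nonzeroʳ (f (pack a)) _ (*-nonzeroʳ (𝟙 (compatible c a b)) _ ne′))
                              | ∧-true⁻ˡ {disjointW a b} (𝟙-nonzero (compatible c a b) (*-nonzeroˡ _ _ ne′))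
...     | _ , la , ma | _ , lb , mb | d = p ,
  trans (List.length-++ a) (cong₂ ℕ._+_ (trans (sym (length-pack a)) la) (trans (sym (length-pack b)) lb)) ,
  trans (maxW-disjoint-++ a b p d) (cong₂ ℕ._+_ ma mb)

Oᵗ : Tree → V
Oᵗ t = coeff (OT t)

Oᶠ : Forest → V
Oᶠ f = coeff (OF f)

TreeHom : Tree → Set
TreeHom t = Hom (size t) (weight t) (Oᵗ t)

nestˡ-Hom : ∀ {ts} → All TreeHom ts → Hom (sizeF ts) (weightF ts) (nestˡ (map Oᵗ ts))
nestˡ-Hom []       = 𝟏-Hom
nestˡ-Hom (h ∷ hs) = conv-Hom gt h (nestˡ-Hom hs)

nestʳ-Hom : ∀ {n m a ts} → Hom n m a → All TreeHom ts → Hom (n ℕ.+ sizeF ts) (m ℕ.+ weightF ts) (nestʳ a (map Oᵗ ts))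
nestʳ-Hom {n} {m} {a} ha [] = subst₂ (λ n m → Hom n m a) (sym (ℕ.+-identityʳ n)) (sym (ℕ.+-identityʳ m)) ha
nestʳ-Hom {n} {m} {a} {t ∷ ts} ha (h ∷ hs) = subst₂ (λ n m → Hom n m (nestʳ (a ≻ᵛ Oᵗ t) (map Oᵗ ts)))
  (ℕ.+-assoc n (size t) (sizeF ts)) (ℕ.+-assoc m (weight t) (weightF ts)) (nestʳ-Hom (conv-Hom lt ha h) hs)

sizeF-++ : ∀ f g → sizeF (f ++ g) ≡ sizeF f ℕ.+ sizeF g
sizeF-++ []      g = refl
sizeF-++ (t ∷ f) g = trans (cong (size t ℕ.+_) (sizeF-++ f g)) (sym (ℕ.+-assoc (size t) (sizeF f) (sizeF g)))

weightF-++ : ∀ f g → weightF (f ++ g) ≡ weightF f ℕ.+ weightF g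
weightF-++ []      g = refl
weightF-++ (t ∷ f) g = trans (cong (weight t ℕ.+_) (weightF-++ f g)) (sym (ℕ.+-assoc (weight t) (weightF f) (weightF g)))

sizeF-∷ʳ : ∀ f t → sizeF (f ∷ʳ t) ≡ sizeF f ℕ.+ size t
sizeF-∷ʳ f t = trans (sizeF-++ f (t ∷ [])) (cong (sizeF f ℕ.+_) (ℕ.+-identityʳ (size t)))

sizeF-reverse : ∀ f → sizeF (reverse f) ≡ sizeF f
sizeF-reverse []      = refl
sizeF-reverse (t ∷ f) = trans (cong sizeF (List.unfold-reverse t f)) (trans (sizeF-∷ʳ (reverse f) t)
  (trans (cong (ℕ._+ size t) (sizeF-reverse f)) (ℕ.+-comm (sizeF f) (size t))))

braceᵛ-Hom : ∀ {n m q ts} → All TreeHom ts → Hom n m q → Hom (sizeF ts ℕ.+ n) (weightF ts ℕ.+ m) (braceᵛ (map Oᵗ ts) q)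
braceᵛ-Hom {n} {m} {q} {ts} hs hq {w} ne
  with ∑split-nonzero ts (λ e → ne (trans (∑split-map Oᵗ ts _) e))
... | us , vs , refl , ne′ = subst₂ (λ n m → Packed w × length w ≡ n × maxW w ≡ m)
        (trans (ℕ.+-assoc (sizeF us) n (sizeF vs)) (trans (cong (sizeF us ℕ.+_) (ℕ.+-comm n (sizeF vs)))
          (trans (sym (ℕ.+-assoc (sizeF us) (sizeF vs) n)) (cong (ℕ._+ n) (sym (sizeF-++ us vs))))))
        (trans (ℕ.+-assoc (weightF us) m (weightF vs)) (trans (cong (weightF us ℕ.+_) (ℕ.+-comm m (weightF vs)))
          (trans (sym (ℕ.+-assoc (weightF us) (weightF vs) m)) (cong (ℕ._+ m) (sym (weightF-++ us vs))))))
        (conv-Hom gt (conv-Hom lt (nestˡ-Hom (All.++⁻ˡ us hs)) hq) (nestʳ-Hom 𝟏-Hom (All.++⁻ʳ us hs))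
          (*-nonzeroʳ (sign (length (map Oᵗ vs))) _ ne′))

ψ-max : Label → ℕ → ℕ
ψ-max (_ , white) m = suc m
ψ-max (_ , black) m = m

maxW-ψ : ∀ l w → Valid l (maxW w) → maxW (ψ l w) ≡ ψ-max l (maxW w)
maxW-ψ (i , white) w (1≤i , i≤) = maxW-ψ-white i w i≤ 1≤i
maxW-ψ (i , black) w (1≤i , i≤) = maxW-ψ-black i w i≤

Ψ-Hom : ∀ l y {n m} → Hom n m (coeff y) → Hom (suc n) (ψ-max l m) (coeff (Ψ l y))
Ψ-Hom l y {n} {m} hy {w} ne = found (lastLetter pw w≢[])
  where
  supp = Hom-packedSupport hy
  aug  = Ψ-augmentation y supp l
  pw : Packed w
  pw with packed? w
  ... | yes p = p
  ... | no np = ⊥-elim (ne (proj₁ aug np))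
  w≢[] : w ≢ []
  w≢[] refl = ne (proj₂ aug)
  found : LastLetter w → Packed w × length w ≡ suc n × maxW w ≡ ψ-max l m
  found (mkLast l′ v val pv e) = pw ,
    trans (cong length e) (trans (length-ψ l′ v) (cong suc (proj₁ (proj₂ hv)))) ,
    trans (cong maxW e) (trans (maxW-ψ l′ v val) (cong₂ ψ-max (sym l≡l′) (proj₂ (proj₂ hv))))
    where
    ne′ : 𝟙 (does (l ≟ˡ l′)) * coeff y v ≢ 0ℚ
    ne′ z = ne (trans (cong (coeff (Ψ l y)) e) (trans (coeff-Ψ y supp l l′ pv val) z))
    hv = hy (*-nonzeroʳ (𝟙 (does (l ≟ˡ l′))) (coeff y v) ne′)
    l≡l′ = Labels.δ-nonzero {l} {l′} (*-nonzeroˡ (𝟙 (does (l ≟ˡ l′))) (coeff y v) ne′)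

Valid-mono : ∀ l {m m′} → m ≤ m′ → Valid l m → Valid l m′
Valid-mono (i , white) le (1≤i , i≤) = 1≤i , ℕ.≤-trans i≤ (s≤s le)
Valid-mono (i , black) le (1≤i , i≤) = 1≤i , ℕ.≤-trans i≤ le

Valid-≤ : ∀ l {m} → 1 ≤ proj₁ l → proj₁ l ≤ m → Valid l m
Valid-≤ (i , white) 1≤i le = 1≤i , ℕ.m≤n⇒m≤1+n le
Valid-≤ (i , black) 1≤i le = 1≤i , le

Valid-raise : ∀ k l {m} → Valid l m → Valid (raise k l) (k ℕ.+ m)
Valid-raise k (i , white) {m} (1≤i , i≤) = ℕ.≤-trans 1≤i (ℕ.m≤n+m i k) , subst (k ℕ.+ i ≤_) (ℕ.+-suc k m) (ℕ.+-monoʳ-≤ k i≤)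
Valid-raise k (i , black) (1≤i , i≤) = ℕ.≤-trans 1≤i (ℕ.m≤n+m i k) , ℕ.+-monoʳ-≤ k i≤

Valid-[] : ∀ l → Valid l 0 → l ≡ (1 , white)
Valid-[] (suc zero , white) _ = refl
Valid-[] (suc (suc _) , white) (_ , s≤s ())
Valid-[] (suc _ , black) (_ , ())

module _ (y : LC) {n m} (hy : Hom n m (coeff y)) (prim : Vanishes all (coeff y))
         {l : Label} (l≢ : l ≢ (1 , white)) (l≤ : proj₁ l ≤ m) where

  private
    supp = Hom-packedSupport hy

    ∑sh-Ψ : ∀ l′ {a b} → Packed a → Packed b → Valid l′ (maxW a ℕ.+ maxW b) →
            ∑sh a (shift (maxW a) b) (coeff (Ψ l y) ∘ ψ l′) ≡ 𝟙 (does (l ≟ˡ l′)) * Δ all (coeff y) a b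
    ∑sh-Ψ l′ {a} {b} pa pb val = begin
      ∑sh a (shift (maxW a) b) (coeff (Ψ l y) ∘ ψ l′)
        ≡⟨ ∑sh-cong a _ (λ u i → coeff-Ψ y supp l l′ (shuffle-packed pa pb i) (subst (Valid l′) (sym (maxW-shuffle a b i)) val)) ⟩
      ∑sh a (shift (maxW a) b) (λ u → 𝟙 (does (l ≟ˡ l′)) * coeff y u)
        ≡⟨ ∑sh-*ˡ a _ (𝟙 (does (l ≟ˡ l′))) _ ⟩
      𝟙 (does (l ≟ˡ l′)) * ∑sh a (shift (maxW a) b) (coeff y)
        ≡⟨ cong (𝟙 (does (l ≟ˡ l′)) *_) (Δ-all (coeff y) pa pb) ⟨
      𝟙 (does (l ≟ˡ l′)) * Δ all (coeff y) a b ∎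

    -- Primitivity of `y` leaves the case of an empty `a`. There the only valid label is 1°, which
    -- `l` is not.
    left-term : ∀ l′ {a b} → Packed a → Packed b → b ≢ [] → Valid l′ (maxW a) → 𝟙 (does (l ≟ˡ l′)) * Δ all (coeff y) a b ≡ 0ℚ
    left-term l′ {a} {b} pa pb b≢[] val = stable-0 λ ne →
      let l≡l′ = Labels.δ-nonzero {l} {l′} (*-nonzeroˡ (𝟙 (does (l ≟ˡ l′))) (Δ all (coeff y) a b) ne) in
      *-nonzeroʳ (𝟙 (does (l ≟ˡ l′))) (Δ all (coeff y) a b) ne
        (prim pa pb (λ { refl → l≢ (trans l≡l′ (Valid-[] l′ val)) }) b≢[])

    -- Primitivity of `y` leaves the case of an empty `b`. Then `l` would carry the letter
    -- `maxW a + 1`; since this is at most `m`, the maximum of `a` is not `m`, and `y` vanishes at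
    -- `a`.
    right-term : ∀ l′ {a b} → Packed a → Packed b → a ≢ [] → Valid l′ (maxW b) →
                 𝟙 (does (l ≟ˡ raise (maxW a) l′)) * Δ all (coeff y) a b ≡ 0ℚ
    right-term l′ {a} {b} pa pb a≢[] val = stable-0 λ ne →
      *-nonzeroʳ (𝟙 (does (l ≟ˡ raise (maxW a) l′))) (Δ all (coeff y) a b) ne
        (vanish (Labels.δ-nonzero {l} {raise (maxW a) l′} (*-nonzeroˡ (𝟙 (does (l ≟ˡ raise (maxW a) l′))) (Δ all (coeff y) a b) ne)) ([]? b))
      where
      too-big : l ≡ raise (maxW a) l′ → b ≡ [] → maxW a < proj₁ l
      too-big e refl = subst (maxW a <_) (sym (trans (cong proj₁ e) (cong (λ z → maxW a ℕ.+ proj₁ z) (Valid-[] l′ val))))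
        (subst (maxW a <_) (ℕ.+-comm 1 (maxW a)) (ℕ.n<1+n (maxW a)))
      vanish : l ≡ raise (maxW a) l′ → Dec (b ≡ []) → Δ all (coeff y) a b ≡ 0ℚ
      vanish e (no ne)    = prim pa pb a≢[] ne
      vanish e (yes b≡[]) = trans (trans (cong (Δ all (coeff y) a) b≡[]) (Δ-[]ʳ (coeff y) pa))
        (Hom-maxW hy (λ m≡ → ℕ.<⇒≱ (too-big e b≡[]) (subst (proj₁ l ≤_) (sym m≡) l≤)))

  Ψ-vanishes-left : Vanishes left (coeff (Ψ l y))
  Ψ-vanishes-left {a} {b} pa pb a≢[] b≢[] = step (lastLetter pa a≢[])
    where
    step : LastLetter a → Δ left (coeff (Ψ l y)) a b ≡ 0ℚ
    step (mkLast l′ a₀ val pa₀ e) = trans (cong (λ z → Δ left (coeff (Ψ l y)) z b) e) (trans (Δ-left-ψ l′ (coeff (Ψ l y)) pa₀ pb val)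
      (trans (∑sh-Ψ l′ pa₀ pb (Valid-mono l′ (ℕ.m≤m+n _ _) val)) (left-term l′ pa₀ pb b≢[] val)))

  Ψ-vanishes-right : Vanishes right (coeff (Ψ l y))
  Ψ-vanishes-right {a} {b} pa pb a≢[] b≢[] = step (lastLetter pb b≢[])
    where
    step : LastLetter b → Δ right (coeff (Ψ l y)) a b ≡ 0ℚ
    step (mkLast l′ b₀ val pb₀ e) = trans (cong (Δ right (coeff (Ψ l y)) a) e) (trans (Δ-right-ψ l′ (coeff (Ψ l y)) pa pb₀ val)
      (trans (∑sh-Ψ (raise (maxW a) l′) pa pb₀ (Valid-raise (maxW a) l′ val)) (right-term l′ pa pb₀ a≢[] val)))

  Ψ-primitive : Vanishes all (coeff (Ψ l y))
  Ψ-primitive pa pb a≢[] b≢[] = trans (sym (Δ-left+right (coeff (Ψ l y)) pa pb b≢[]))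
    (cong₂ _+_ (Ψ-vanishes-left pa pb a≢[] b≢[]) (Ψ-vanishes-right pa pb a≢[] b≢[]))

degree-one-vanishes : ∀ c {f} → Degree 1 f → Vanishes c f
degree-one-vanishes c deg {[]}                    pa pb a≢[] b≢[] = ⊥-elim (a≢[] refl)
degree-one-vanishes c deg {_ ∷ _} {[]}            pa pb a≢[] b≢[] = ⊥-elim (b≢[] refl)
degree-one-vanishes c deg {x ∷ a} {y ∷ b} pa pb a≢[] b≢[] =
  Δ-degree c deg (λ e → case trans (sym (ℕ.+-suc (length a) (length b))) (ℕ.suc-injective e) of λ ())

coeff-Qε : ∀ w → coeff Qε w ≡ 𝟏 w
coeff-Qε []      = refl
coeff-Qε (_ ∷ _) = refl

map-OT : ∀ f → OL f ≡ map OT f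
map-OT []      = refl
map-OT (t ∷ f) = cong (OT t ∷_) (map-OT f)

map-coeff-OL : ∀ f → map coeff (OL f) ≡ map Oᵗ f
map-coeff-OL f = trans (cong (map coeff) (map-OT f)) (sym (List.map-∘ f))

coeff-nestForest : ∀ xs → All Augmentation (map coeff xs) → ∀ w → coeff (nestForest xs) w ≡ nestˡ (map coeff xs) w
coeff-nestForest []       h w = coeff-Qε w
coeff-nestForest (x ∷ xs) h w = coeff-rnest x xs h w

OF-nestForest : ∀ f → OF f ≡ nestForest (reverse (OL f))
OF-nestForest []      = refl
OF-nestForest (t ∷ f) = refl

Oᵗ-augmentation : ∀ {t} → TreeHom t → Augmentation (Oᵗ t)
Oᵗ-augmentation {node _ _ _} h = Hom-augmentation h

All-Oᵗ-augmentation : ∀ {ts} → All TreeHom ts → All Augmentation (map Oᵗ ts)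
All-Oᵗ-augmentation h = All.map⁺ (All.map (λ {t} → Oᵗ-augmentation {t}) h)

All-reverse : ∀ {A : Set} {P : A → Set} {xs} → All P xs → All P (reverse xs)
All-reverse {xs = xs} h = All.tabulate (λ x∈ → All.lookup h (Any.reverse⁻ x∈))

coeff-OF : ∀ f → All TreeHom f → ∀ w → Oᶠ f w ≡ nestˡ (map Oᵗ (reverse f)) w
coeff-OF f h w = begin
  coeff (OF f) w                              ≡⟨ cong (λ x → coeff x w) (OF-nestForest f) ⟩
  coeff (nestForest (reverse (OL f))) w       ≡⟨ coeff-nestForest (reverse (OL f)) (subst (All Augmentation) (sym functions) (All-Oᵗ-augmentation (All-reverse h))) w ⟩
  nestˡ (map coeff (reverse (OL f))) w        ≡⟨ cong (λ z → nestˡ z w) functions ⟩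
  nestˡ (map Oᵗ (reverse f)) w                ∎
  where
  functions : map coeff (reverse (OL f)) ≡ map Oᵗ (reverse f)
  functions = trans (List.reverse-map coeff (OL f)) (trans (cong reverse (map-coeff-OL f)) (sym (List.reverse-map Oᵗ f)))

-- A brace with empty list is its last argument by the unit laws, so one formula covers both clauses
-- for trees.
coeff-OT : ∀ l ls rs → All TreeHom ls → Augmentation (coeff (Ψ l (OF rs))) → ∀ w →
           Oᵗ (node l ls rs) w ≡ braceᵛ (map Oᵗ ls) (Oᵗ (node l [] rs)) w
coeff-OT l [] rs _ aug w = sym (begin
  braceᵛ [] q w                       ≡⟨ ∑split-[] _ ⟩
  1ℚ * ((𝟏 ≻ᵛ q) ≺ᵛ 𝟏) w              ≡⟨ ℚ.*-identityˡ _ ⟩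
  ((𝟏 ≻ᵛ q) ≺ᵛ 𝟏) w                   ≡⟨ ≺-identityʳ (≻-augmentation 𝟏 q) w ⟩
  (𝟏 ≻ᵛ q) w                          ≡⟨ ≻-identityˡ aug w ⟩
  q w                                 ∎)
  where q = coeff (Ψ l (OF rs))
coeff-OT l (t ∷ ls) rs h aug w = trans
  (coeff-brace (OT t ∷ OL ls) (Ψ l (OF rs)) (subst (All Augmentation) (sym (map-coeff-OL (t ∷ ls))) (All-Oᵗ-augmentation h)) aug w)
  (cong (λ z → braceᵛ z (coeff (Ψ l (OF rs))) w) (map-coeff-OL (t ∷ ls)))

record TreeFacts (t : Tree) : Set where
  field
    hom       : TreeHom t
    isPrimitive : Vanishes all (Oᵗ t)

record CoreFacts (l : Label) (rs : Forest) : Set where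
  field
    hom             : TreeHom (node l [] rs)
    vanishes-left   : Vanishes left (Oᵗ (node l [] rs))
    vanishes-right  : Vanishes right (Oᵗ (node l [] rs))
    isPrimitive       : Vanishes all (Oᵗ (node l [] rs))

coreFacts : ∀ l rs → RootCond l rs → All TreeFacts rs → CoreFacts l rs
coreFacts l [] refl [] = record
  { hom = hom ; vanishes-left = degree-one-vanishes left {q} (λ {w} → deg {w})
  ; vanishes-right = degree-one-vanishes right {q} (λ {w} → deg {w}) ; isPrimitive = degree-one-vanishes all {q} (λ {w} → deg {w}) }
  where
  q = coeff (Ψ (1 , white) Qε)
  hom : Hom 1 1 q
  hom = Ψ-Hom (1 , white) Qε (Hom-cong (λ w → sym (coeff-Qε w)) 𝟏-Hom)
  deg : Degree 1 q
  deg {w} = Hom-degree {1} {1} {q} (λ {v} → hom {v}) {w}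
coreFacts l (r ∷ []) (l≢ , 1≤ , l≤) (facts ∷ []) = record
  { hom = core-hom l (Ψ-Hom l (OT r) hom)
  ; vanishes-left = Ψ-vanishes-left (OT r) hom isPrimitive l≢ l≤
  ; vanishes-right = Ψ-vanishes-right (OT r) hom isPrimitive l≢ l≤
  ; isPrimitive = Ψ-primitive (OT r) hom isPrimitive l≢ l≤ }
  where
  open TreeFacts facts
  core-hom : ∀ l → Hom (suc (size r)) (ψ-max l (weight r)) (Oᵗ (node l [] (r ∷ []))) → TreeHom (node l [] (r ∷ []))
  core-hom (i , white) h = subst₂ (λ n m → Hom (suc n) (suc m) (Oᵗ (node (i , white) [] (r ∷ [])))) (sym (ℕ.+-identityʳ (size r))) (sym (ℕ.+-identityʳ (weight r))) h
  core-hom (i , black) h = subst₂ (λ n m → Hom (suc n) m (Oᵗ (node (i , black) [] (r ∷ [])))) (sym (ℕ.+-identityʳ (size r))) (sym (ℕ.+-identityʳ (weight r))) h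

mutual
  treeFacts : ∀ t → BluePacked t → TreeFacts t
  treeFacts (node l ls rs) (bls , brs , rc) = record
    { hom = Hom-cong (λ w → sym (agree w)) (node-hom l rs ls (braceᵛ-Hom homs (CoreFacts.hom core)))
    ; isPrimitive = Vanishes-cong (λ w → sym (agree w)) (braceᵛ-primitive (map Oᵗ ls) (Oᵗ (node l [] rs)) (All-Oᵗ-augmentation homs)
        (All.map⁺ (All.map TreeFacts.isPrimitive facts)) (proj₂ aug) (CoreFacts.isPrimitive core)) }
    where
    facts = forestFacts ls bls
    homs  = All.map TreeFacts.hom facts
    core  = coreFacts l rs rc (forestFacts rs brs)
    aug   = Oᵗ-augmentation {node l [] rs} (CoreFacts.hom core)
    agree = coeff-OT l ls rs homs aug
    node-hom : ∀ l rs ls {f} → Hom (sizeF ls ℕ.+ size (node l [] rs)) (weightF ls ℕ.+ weight (node l [] rs)) f →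
               Hom (size (node l ls rs)) (weight (node l ls rs)) f
    node-hom (i , white) rs ls {f} h = subst₂ (λ n m → Hom n m f) (ℕ.+-suc (sizeF ls) (sizeF rs)) (ℕ.+-suc (weightF ls) (weightF rs)) h
    node-hom (i , black) rs ls {f} h = subst (λ n → Hom n (weightF ls ℕ.+ weightF rs) f) (ℕ.+-suc (sizeF ls) (sizeF rs)) h

  forestFacts : ∀ f → BluePackedF f → All TreeFacts f
  forestFacts []      _         = []
  forestFacts (t ∷ f) (bt , bf) = treeFacts t bt ∷ forestFacts f bf

treeHoms : ∀ f → BluePackedF f → All TreeHom f
treeHoms f bf = All.map TreeFacts.hom (forestFacts f bf)

coreFacts-node : ∀ l ls rs → BluePacked (node l ls rs) → CoreFacts l rs
coreFacts-node l ls rs (_ , brs , rc) = coreFacts l rs rc (forestFacts rs brs)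

node-brace : ∀ l ls rs → BluePacked (node l ls rs) → ∀ w → Oᵗ (node l ls rs) w ≡ braceᵛ (map Oᵗ ls) (Oᵗ (node l [] rs)) w
node-brace l ls rs b@(bls , _ , _) = coeff-OT l ls rs (treeHoms ls bls) (Oᵗ-augmentation {node l [] rs} (CoreFacts.hom (coreFacts-node l ls rs b)))

-- The nest is built from the reversed list, so the last tree of a forest is the outermost factor.
forest-∷ʳ : ∀ f t → BluePackedF (f ∷ʳ t) → BluePackedF f → ∀ w → Oᶠ (f ∷ʳ t) w ≡ (Oᵗ t ≺ᵛ Oᶠ f) w
forest-∷ʳ f t bft bf w = begin
  Oᶠ (f ∷ʳ t) w                              ≡⟨ coeff-OF (f ∷ʳ t) (treeHoms (f ∷ʳ t) bft) w ⟩
  nestˡ (map Oᵗ (reverse (f ∷ʳ t))) w        ≡⟨ cong (λ z → nestˡ (map Oᵗ z) w) (List.reverse-++ f (t ∷ [])) ⟩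
  (Oᵗ t ≺ᵛ nestˡ (map Oᵗ (reverse f))) w     ≡⟨ conv-cong gt (λ _ → refl) (λ {v} _ → sym (coeff-OF f (treeHoms f bf) v)) w ⟩
  (Oᵗ t ≺ᵛ Oᶠ f) w                           ∎

forest-degree : ∀ f → BluePackedF f → Degree (sizeF f) (Oᶠ f)
forest-degree f bf {w} ne = trans (coeff-OF f (treeHoms f bf) w)
  (Hom-degree (nestˡ-Hom (All-reverse (treeHoms f bf))) (λ e → ne (trans e (sizeF-reverse f))))

forest-packedSupport : ∀ f → BluePackedF f → PackedSupport (Oᶠ f)
forest-packedSupport f bf {w} np = trans (coeff-OF f (treeHoms f bf) w) (nestˡ-packedSupport (map Oᵗ (reverse f)) np)

-- Spanning by filtration on the degree of the right tensor factor

Supp : ℕ → V → Set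
Supp n f = PackedSupport f × Degree n f

lc : {A : Set} → (A → V) → List (ℚ × A) → V
lc O cs w = ∑ cs (λ (c , a) → c * O a w)

Span : {A : Set} → (A → Set) → (A → V) → V → Set
Span {A} Good O f = Σ (List (ℚ × A)) λ cs → All (Good ∘ proj₂) cs × (∀ w → lc O cs w ≡ f w)

lc-linear : ∀ {P φ} → Linear P φ → {A : Set} (O : A → V) (cs : List (ℚ × A)) → φ (lc O cs) ≡ ∑ cs (λ (c , a) → c * φ (O a))
lc-linear lin O cs = lin cs proj₁ (λ (_ , a) → O a) (lc O cs) (λ _ → refl)

∑-zero-All : ∀ {A : Set} {P : A → Set} {xs} (F : A → ℚ) → All P xs → (∀ {x} → P x → F x ≡ 0ℚ) → ∑ xs F ≡ 0ℚ
∑-zero-All F h z = ∑-zero-∈ _ (λ x x∈ → z (All.lookup h x∈))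

_⊖_ : V → V → V
(x ⊖ y) w = x w + - 1ℚ * y w

linear-⊖ : ∀ {P φ} → Linear P φ → ∀ x y → φ (x ⊖ y) ≡ φ x + - 1ℚ * φ y
linear-⊖ lin x y = linear-+ lin (- 1ℚ) (x ⊖ y) x y (λ _ → refl)

⊖-zero : ∀ {a b} → a ≡ 0ℚ → b ≡ 0ℚ → a + - 1ℚ * b ≡ 0ℚ
⊖-zero refl refl = refl

⊖-cancel : ∀ {a b} → a ≡ b → a + - 1ℚ * b ≡ 0ℚ
⊖-cancel {a} refl = solve 1 (λ x → x :+ :- con 1ℚ :* x := con 0ℚ) refl a
  where open +-*-Solver

⊖-+ : ∀ a b → b + (a + - 1ℚ * b) ≡ a
⊖-+ = solve 2 (λ a b → b :+ (a :+ :- con 1ℚ :* b) := a) refl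
  where open +-*-Solver

Vanishes-⊖ : ∀ {c x y} → Vanishes c x → Vanishes c y → Vanishes c (x ⊖ y)
Vanishes-⊖ {c} {x} {y} hx hy {a} {b} pa pb na nb = trans (linear-⊖ (Δ-linear c a b) x y) (⊖-zero (hx pa pb na nb) (hy pa pb na nb))

Supp-⊖ : ∀ {n x y} → Supp n x → Supp n y → Supp n (x ⊖ y)
Supp-⊖ (px , dx) (py , dy) = (λ np → ⊖-zero (px np) (py np)) , (λ ne → ⊖-zero (dx ne) (dy ne))

Supp-lc : ∀ {n} {A : Set} (O : A → V) {cs : List (ℚ × A)} → All (Supp n ∘ O ∘ proj₂) cs → Supp n (lc O cs)
Supp-lc O h = (λ np → ∑-zero-All _ h (λ {p} s → *-zeroʳ-≡ (proj₁ p) (proj₁ s np))) ,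
              (λ ne → ∑-zero-All _ h (λ {p} s → *-zeroʳ-≡ (proj₁ p) (proj₂ s ne)))

Vanishes-lc : ∀ {c} {A : Set} (O : A → V) {cs : List (ℚ × A)} → All (Vanishes c ∘ O ∘ proj₂) cs → Vanishes c (lc O cs)
Vanishes-lc {c} O {cs} h {a} {b} pa pb na nb = trans (lc-linear (Δ-linear c a b) O cs)
  (∑-zero-All _ h (λ {p} s → *-zeroʳ-≡ (proj₁ p) (s pa pb na nb)))

≢[]⇒length≥1 : ∀ {A : Set} (w : List A) → w ≢ [] → 1 ≤ length w
≢[]⇒length≥1 []      ne = ⊥-elim (ne refl)
≢[]⇒length≥1 (_ ∷ _) _  = s≤s z≤n

δ-Supp : ∀ {a n} → Packed a → length a ≡ n → Supp n (λ w → 𝟙 (eqW a w))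
δ-Supp {a} pa la = (λ {w} np → cong 𝟙 (eqW-false {a} {w} (λ e → np (subst Packed e pa)))) ,
                   (λ {w} ne → cong 𝟙 (eqW-false {a} {w} (λ e → ne (trans (cong length (sym e)) la))))

-- In left degree `j` the function `D` is the sum of `δ_a ⊗ D a` over the packed words `a` of length
-- `j`. Each indicator `δ_a` is expanded in the family `O` and each slice `D a` in the family `O′`.
module Tensor {F T : Set} {GoodF : F → Set} {GoodT : T → Set} {O : F → V} {O′ : T → V} (j : ℕ) (D : Word → V)
  (spanˡ : ∀ f → Supp j f → Span GoodF O f) (spanʳ : ∀ a → Packed a → length a ≡ j → Span GoodT O′ (D a)) where

  private
    pairs : List (ℚ × F) → List (ℚ × T) → List (ℚ × F × T)
    pairs ds cs = concatMap (λ (d , f) → map (λ (c , t) → (d * c , f , t)) cs) ds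

    All-pairs : ∀ {ds cs} → All (GoodF ∘ proj₂) ds → All (GoodT ∘ proj₂) cs →
                All (λ p → GoodF (proj₁ (proj₂ p)) × GoodT (proj₂ (proj₂ p))) (pairs ds cs)
    All-pairs []       hs = []
    All-pairs (g ∷ gs) hs = All.++⁺ (All.map⁺ (All.map (g ,_) hs)) (All-pairs gs hs)

    ∑-pairs : ∀ ds cs w b → ∑ (pairs ds cs) (λ (c , f , t) → c * (O f w * O′ t b)) ≡ lc O ds w * lc O′ cs b
    ∑-pairs ds cs w b = begin
      ∑ (pairs ds cs) (λ (c , f , t) → c * (O f w * O′ t b))
        ≡⟨ ∑-concatMap (λ (d , f) → map (λ (c , t) → (d * c , f , t)) cs) ds _ ⟩
      ∑ ds (λ (d , f) → ∑ (map (λ (c , t) → (d * c , f , t)) cs) (λ (c , f , t) → c * (O f w * O′ t b)))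
        ≡⟨ ∑-cong ds (λ (d , f) → trans (∑-map _ cs _) (∑-cong cs (λ (c , t) → *-interchange d c (O f w) (O′ t b)))) ⟩
      ∑ ds (λ (d , f) → ∑ cs (λ (c , t) → (d * O f w) * (c * O′ t b)))
        ≡⟨ ∑-product ds cs _ _ ⟩
      lc O ds w * lc O′ cs b ∎

    piece : ∀ a → Dec (Packed a) → Dec (length a ≡ j) → List (ℚ × F × T)
    piece a (yes pa) (yes la) = pairs (proj₁ (spanˡ _ (δ-Supp pa la))) (proj₁ (spanʳ a pa la))
    piece a _        _        = []

    All-piece : ∀ a pa? la? → All (λ p → GoodF (proj₁ (proj₂ p)) × GoodT (proj₂ (proj₂ p))) (piece a pa? la?)
    All-piece a (yes pa) (yes la) = All-pairs (proj₁ (proj₂ (spanˡ _ (δ-Supp pa la)))) (proj₁ (proj₂ (spanʳ a pa la)))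
    All-piece a (yes pa) (no _)   = []
    All-piece a (no _)   _        = []

    ∑-piece : ∀ a pa? la? {w} b → Packed w → length w ≡ j →
              ∑ (piece a pa? la?) (λ (c , f , t) → c * (O f w * O′ t b)) ≡ 𝟙 (eqW a w) * D a b
    ∑-piece a (yes pa) (yes la) {w} b pw lw =
      trans (∑-pairs (proj₁ (spanˡ _ (δ-Supp pa la))) (proj₁ (spanʳ a pa la)) w b)
            (cong₂ _*_ (proj₂ (proj₂ (spanˡ _ (δ-Supp pa la))) w) (proj₂ (proj₂ (spanʳ a pa la)) b))
    ∑-piece a (yes pa) (no nl) {w} b pw lw = sym (*-zeroˡ-≡ (D a b) (cong 𝟙 (eqW-false {a} {w} (λ { refl → nl lw }))))
    ∑-piece a (no np)  _       {w} b pw lw = sym (*-zeroˡ-≡ (D a b) (cong 𝟙 (eqW-false {a} {w} (λ { refl → np pw }))))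

  tensor : List (ℚ × F × T)
  tensor = concatMap (λ a → piece a (packed? a) (length a ℕ.≟ j)) (packedWords j)

  tensor-good : All (λ p → GoodF (proj₁ (proj₂ p)) × GoodT (proj₂ (proj₂ p))) tensor
  tensor-good = All.concat⁺ (All.map⁺ (All.tabulate {xs = packedWords j} (λ {a} _ → All-piece a (packed? a) (length a ℕ.≟ j))))

  tensor-≡ : ∀ {w} b → Packed w → length w ≡ j → ∑ tensor (λ (c , f , t) → c * (O f w * O′ t b)) ≡ D w b
  tensor-≡ {w} b pw lw = trans (∑-concatMap _ (packedWords j) _)
    (trans (∑-cong (packedWords j) (λ a → ∑-piece a (packed? a) (length a ℕ.≟ j) b pw lw)) (∑-packedWords-δ j pw lw (λ a → D a b)))

Below : Side → ℕ → V → Set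
Below c k x = ∀ {a b} → Packed a → Packed b → a ≢ [] → b ≢ [] → length b < k → Δ c x a b ≡ 0ℚ

-- The component of lowest right degree k of the coproduct of x is a combination of tensors O f ⊗ O′ t;
-- subtracting the corresponding elements comb f t raises k.
module Filtration (n : ℕ) (c : Side) {F T I : Set} (GoodF : ℕ → F → Set) (GoodT : ℕ → T → Set) (GoodI : I → Set)
  (O : F → V) (O′ : T → V) (Oᴵ : I → V) (comb : F → T → I) (X : V → Set)
  (X-Supp : ∀ {x} → X x → Supp n x)
  (X-sub : ∀ {x cs} → X x → All (GoodI ∘ proj₂) cs → X (x ⊖ lc Oᴵ cs))
  (comb-good : ∀ {j k f t} → 1 ≤ j → j ℕ.+ k ≡ n → GoodF j f → GoodT k t → GoodI (comb f t))
  (comb-short : ∀ {j k f t} → 1 ≤ j → j ℕ.+ k ≡ n → GoodF j f → GoodT k t → Below c k (Oᴵ (comb f t)))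
  (comb-leading : ∀ {j k f t} → 1 ≤ j → j ℕ.+ k ≡ n → GoodF j f → GoodT k t →
                  ∀ {a b} → Packed a → Packed b → b ≢ [] → length b ≡ k → Δ c (Oᴵ (comb f t)) a b ≡ O f a * O′ t b)
  (spanˡ : ∀ {j k} → 1 ≤ j → 1 ≤ k → j ℕ.+ k ≡ n → ∀ f → Supp j f → Span (GoodF j) O f)
  (slice : ∀ {j k} → 1 ≤ j → 1 ≤ k → j ℕ.+ k ≡ n → ∀ {x} → X x → Below c k x →
           ∀ a → Packed a → length a ≡ j → Span (GoodT k) O′ (Δ c x a))
  where

  Result : V → Set
  Result x = Σ (List (ℚ × I)) λ cs → Σ V λ y → All (GoodI ∘ proj₂) cs × X y × Vanishes c y × (∀ w → lc Oᴵ cs w + y w ≡ x w)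

  private
    module Step {j k} (1≤j : 1 ≤ j) (1≤k : 1 ≤ k) (j+k : j ℕ.+ k ≡ n) {x} (xX : X x) (below : Below c k x) where
      open Tensor {O = O} {O′ = O′} j (Δ c x) (spanˡ 1≤j 1≤k j+k) (slice 1≤j 1≤k j+k xX below)

      cs : List (ℚ × I)
      cs = map (λ (d , f , t) → (d , comb f t)) tensor

      good : All (GoodI ∘ proj₂) cs
      good = All.map⁺ (All.map (λ (gf , gq) → comb-good 1≤j j+k gf gq) tensor-good)

      y : V
      y = x ⊖ lc Oᴵ cs

      yX : X y
      yX = X-sub xX good

      Δ-lc : ∀ a b → Δ c (lc Oᴵ cs) a b ≡ ∑ tensor (λ (d , f , t) → d * Δ c (Oᴵ (comb f t)) a b)
      Δ-lc a b = trans (lc-linear (Δ-linear c a b) Oᴵ cs) (∑-map _ tensor _)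

      lower : Below c k y
      lower {a} {b} pa pb na nb l = trans (linear-⊖ (Δ-linear c a b) x (lc Oᴵ cs)) (⊖-zero (below pa pb na nb l)
        (trans (Δ-lc a b) (∑-zero-All _ tensor-good (λ {p} (gf , gq) → *-zeroʳ-≡ (proj₁ p) (comb-short 1≤j j+k gf gq pa pb na nb l)))))

      level : ∀ {a b} → Packed a → Packed b → b ≢ [] → length b ≡ k → length a ≡ j → Δ c y a b ≡ 0ℚ
      level {a} {b} pa pb nb lb la = trans (linear-⊖ (Δ-linear c a b) x (lc Oᴵ cs)) (⊖-cancel (sym (trans (Δ-lc a b)
        (trans (∑-cong-∈ tensor (λ p p∈ → let (gf , gq) = All.lookup tensor-good p∈ in
                 cong (proj₁ p *_) (comb-leading 1≤j j+k gf gq pa pb nb lb)))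
               (tensor-≡ b pa la)))))

      below′ : Below c (suc k) y
      below′ {a} {b} pa pb na nb l with ℕ.m≤n⇒m<n∨m≡n (ℕ.≤-pred l)
      ... | inj₁ l′ = lower pa pb na nb l′
      ... | inj₂ lb with length a ℕ.≟ j
      ...   | yes la = level pa pb nb lb la
      ...   | no nla = Δ-degree c (proj₂ (X-Supp yX)) (λ e → nla (ℕ.+-cancelʳ-≡ k (length a) j (trans (cong (length a ℕ.+_) (sym lb)) (trans e (sym j+k)))))

    reduce-from : ∀ j k → 1 ≤ k → j ℕ.+ k ≡ n → ∀ {x} → X x → Below c k x → Result x
    reduce-from zero k 1≤k refl {x} xX below = [] , x , [] , xX , vanish , (λ w → ℚ.+-identityˡ (x w))
      where
      vanish : Vanishes c x
      vanish {a} {b} pa pb na nb with length b ℕ.<? k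
      ... | yes l = below pa pb na nb l
      ... | no nl = Δ-degree c (proj₂ (X-Supp xX)) (λ e → nl (subst (length b <_) e (ℕ.m<n+m (length b) (≢[]⇒length≥1 a na))))
    reduce-from (suc j) k 1≤k j+k {x} xX below = combine (reduce-from j (suc k) (s≤s z≤n) (trans (ℕ.+-suc j k) j+k) yX below′)
      where
      open Step (s≤s z≤n) 1≤k j+k xX below
      combine : Result y → Result x
      combine (cs′ , z , good′ , zX , vz , e) = cs ++ cs′ , z , All.++⁺ good good′ , zX , vz , λ w → begin
        lc Oᴵ (cs ++ cs′) w + z w              ≡⟨ cong (_+ z w) (∑-++ cs cs′ _) ⟩
        (lc Oᴵ cs w + lc Oᴵ cs′ w) + z w       ≡⟨ ℚ.+-assoc (lc Oᴵ cs w) (lc Oᴵ cs′ w) (z w) ⟩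
        lc Oᴵ cs w + (lc Oᴵ cs′ w + z w)       ≡⟨ cong (lc Oᴵ cs w +_) (e w) ⟩
        lc Oᴵ cs w + y w                       ≡⟨ ⊖-+ (x w) (lc Oᴵ cs w) ⟩
        x w                                    ∎

  reduce : 1 ≤ n → ∀ {x} → X x → Result x
  -- Right factors are nonempty, so nothing lies below right degree 1. The left degree counts down
  -- from `n ∸ 1`, and when it reaches 0 no proper cut is left.
  reduce 1≤n {x} xX = reduce-from (n ∸ 1) 1 ℕ.≤-refl (ℕ.m∸n+n≡m 1≤n) xX
    (λ {a} {b} _ _ _ nb l → ⊥-elim (ℕ.<⇒≱ l (≢[]⇒length≥1 b nb)))

-- By coassociativity a proper cut of the slice is a sum of cuts of `x` whose left factor has more
-- than `j` letters. By homogeneity its right factor then has fewer than `k`, where the coproduct of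
-- `x` vanishes.
slice-primitive : ∀ {n j k x} → j ℕ.+ k ≡ n → Supp n x → Below all k x →
                  ∀ a → Packed a → length a ≡ j → 1 ≤ j → Supp k (Δ all x a) × Vanishes all (Δ all x a)
slice-primitive {n} {j} {k} {x} j+k (supp , deg) below a pa la 1≤j =
  (Δ-unpackedʳ all x , λ ne → Δ-degree all deg (λ e → ne (ℕ.+-cancelˡ-≡ j _ _ (trans (cong (ℕ._+ _) (sym la)) (trans e (sym j+k)))))) ,
  λ {b} {c} pb pc nb nc → trans (Δ-coassoc x pa pb pc) (∑sh-zero a (shift (maxW a) b) (λ v i → term pb pc nb nc v i))
  where
  term : ∀ {b c} → Packed b → Packed c → b ≢ [] → c ≢ [] → ∀ v → Interleaving a (shift (maxW a) b) v → Δ all x v c ≡ 0ℚ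
  term {b} {c} pb pc nb nc v i with length c ℕ.<? k
  ... | yes l = below (shuffle-packed pa pb i) pc (λ { refl → ∈⇒≢[] (∈-interleavingʳ i (maxW-∈ _ (map-≢[] _ b nb))) refl }) nc l
  ... | no nl = Δ-degree all deg (λ e → ℕ.<⇒≢ (too-long e) refl)
    where
    too-long : length v ℕ.+ length c ≡ n → n < n
    too-long e = subst₂ _<_ j+k e (ℕ.+-mono-<-≤ (subst (j <_) (sym (trans (length-interleaving i) (cong₂ ℕ._+_ la (List.length-map _ b))))
      (ℕ.m<m+n j (≢[]⇒length≥1 b nb))) (ℕ.≮⇒≥ nl))

-- For Δ≻ the argument is that of `slice-primitive`. For Δ≺ coassociativity leads to values of
-- `Δ left x`, which are the negatives of those of `Δ right x` because `x` is primitive.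
slice-totally-primitive : ∀ {n j k x} → j ℕ.+ k ≡ n → Supp n x → Vanishes all x → Below right k x →
  ∀ a → Packed a → length a ≡ j → 1 ≤ j →
  Supp k (Δ right x a) × Vanishes left (Δ right x a) × Vanishes right (Δ right x a)
slice-totally-primitive {n} {j} {k} {x} j+k (supp , deg) prim below a pa la 1≤j =
  (Δ-unpackedʳ right x , λ ne → Δ-degree right deg (λ e → ne (ℕ.+-cancelˡ-≡ j _ _ (trans (cong (ℕ._+ _) (sym la)) (trans e (sym j+k)))))) ,
  (λ {b} {c} pb pc nb nc → trans (Δ-coassoc-right-left x pa pb pc) (∑sh-zero a (shift (maxW a) b) (λ v i →
     *-zeroʳ-≡ (𝟙 (lastFrom right (maxW a) v)) (left-term pb pc nb nc v i)))) ,
  (λ {b} {c} pb pc nb nc → trans (Δ-coassoc-right-right x pa pb pc) (∑sh-zero a (shift (maxW a) b) (λ v i → term pb pc nb nc v i)))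
  where
  nonempty : ∀ {b} → b ≢ [] → ∀ {v} → Interleaving a (shift (maxW a) b) v → v ≢ []
  nonempty {b} nb i refl = ∈⇒≢[] (∈-interleavingʳ i (maxW-∈ _ (map-≢[] _ b nb))) refl
  term : ∀ {b c} → Packed b → Packed c → b ≢ [] → c ≢ [] → ∀ v → Interleaving a (shift (maxW a) b) v → Δ right x v c ≡ 0ℚ
  term {b} {c} pb pc nb nc v i with length c ℕ.<? k
  ... | yes l = below (shuffle-packed pa pb i) pc (nonempty nb i) nc l
  ... | no nl = Δ-degree right deg (λ e → ℕ.<⇒≢ (too-long e) refl)
    where
    too-long : length v ℕ.+ length c ≡ n → n < n
    too-long e = subst₂ _<_ j+k e (ℕ.+-mono-<-≤ (subst (j <_) (sym (trans (length-interleaving i) (cong₂ ℕ._+_ la (List.length-map _ b))))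
      (ℕ.m<m+n j (≢[]⇒length≥1 b nb))) (ℕ.≮⇒≥ nl))
  left-term : ∀ {b c} → Packed b → Packed c → b ≢ [] → c ≢ [] → ∀ v → Interleaving a (shift (maxW a) b) v → Δ left x v c ≡ 0ℚ
  left-term {b} {c} pb pc nb nc v i = begin
    Δ left x v c                   ≡⟨ ℚ.+-identityʳ _ ⟨
    Δ left x v c + 0ℚ              ≡⟨ cong (Δ left x v c +_) (term pb pc nb nc v i) ⟨
    Δ left x v c + Δ right x v c   ≡⟨ Δ-left+right x (shuffle-packed pa pb i) pc nc ⟩
    Δ all x v c                    ≡⟨ prim (shuffle-packed pa pb i) pc (nonempty nb i) nc ⟩
    0ℚ                             ∎

-- Spanning for forests, for trees and for trees with empty left forest

ForestOf : ℕ → Forest → Set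
ForestOf n f = BluePackedF f × sizeF f ≡ n

TreeOf CoreOf : ℕ → Tree → Set
TreeOf n t = BluePacked t × size t ≡ n
CoreOf n t = BluePacked t × size t ≡ n × leftForest t ≡ []

-- The spanning halves of the three claims in degree `n`. They are stated for functions because they
-- are applied to slices of coproducts.
Span₁ Span₂ Span₃ : ℕ → Set
Span₁ n = ∀ f → Supp n f → Span (ForestOf n) Oᶠ f
Span₂ n = ∀ f → Supp n f → Vanishes all f → Span (TreeOf n) Oᵗ f
Span₃ n = ∀ f → Supp n f → Vanishes left f → Vanishes right f → Span (CoreOf n) Oᵗ f

Supp-nonzero : ∀ {n f w} → Supp n f → f w ≢ 0ℚ → Packed w × length w ≡ n
Supp-nonzero {n} {f} {w} (supp , deg) nz with packed? w | length w ℕ.≟ n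
... | no np | _     = ⊥-elim (nz (supp np))
... | yes _ | no nl = ⊥-elim (nz (deg nl))
... | yes p | yes l = p , l

tree-Supp : ∀ {n t} → TreeOf n t → Supp n (Oᵗ t)
tree-Supp {t = t} (b , refl) = Hom-packedSupport h , Hom-degree h
  where h = TreeFacts.hom (treeFacts t b)

tree-primitive : ∀ {n t} → TreeOf n t → Vanishes all (Oᵗ t)
tree-primitive {t = t} (b , _) = TreeFacts.isPrimitive (treeFacts t b)

forest-Supp : ∀ {n f} → ForestOf n f → Supp n (Oᶠ f)
forest-Supp {f = f} (b , refl) = forest-packedSupport f b , forest-degree f b

BluePackedF-++⁺ : ∀ f g → BluePackedF f → BluePackedF g → BluePackedF (f ++ g)
BluePackedF-++⁺ []      g _         bg = bg
BluePackedF-++⁺ (t ∷ f) g (bt , bf) bg = bt , BluePackedF-++⁺ f g bf bg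

BluePackedF-++⁻ : ∀ f g → BluePackedF (f ++ g) → BluePackedF f × BluePackedF g
BluePackedF-++⁻ []      g b         = tt , b
BluePackedF-++⁻ (t ∷ f) g (bt , b) = (bt , proj₁ (BluePackedF-++⁻ f g b)) , proj₂ (BluePackedF-++⁻ f g b)

BluePackedF-reverse : ∀ f → BluePackedF f → BluePackedF (reverse f)
BluePackedF-reverse []      b         = tt
BluePackedF-reverse (t ∷ f) (bt , bf) = subst BluePackedF (sym (List.unfold-reverse t f))
  (BluePackedF-++⁺ (reverse f) (t ∷ []) (BluePackedF-reverse f bf) (bt , tt))

size≥1 : ∀ t → 1 ≤ size t
size≥1 (node _ _ _) = s≤s z≤n

module ForestLeading {k f t} (bf : BluePackedF f) (gt′ : TreeOf k t) where

  private
    deg : Degree k (Oᵗ t)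
    deg = proj₂ (tree-Supp gt′)
    agree : ∀ w → Oᶠ (f ∷ʳ t) w ≡ (Oᵗ t ≺ᵛ Oᶠ f) w
    agree = forest-∷ʳ f t (BluePackedF-++⁺ f (t ∷ []) bf (proj₁ gt′ , tt)) bf

    slice : ∀ {a b} → Packed a → Packed b → b ≢ [] → Δ all (Oᶠ (f ∷ʳ t)) a b ≡ (Oᵗ t ≺ᵛ Δ all (Oᶠ f) a) b
    slice {a} {b} pa pb nb = trans (linear-cong (Δ-linear all a b) (Oᶠ (f ∷ʳ t)) (Oᵗ t ≺ᵛ Oᶠ f) (λ {w} _ → agree w))
      (Δ-≺-primitive (tree-primitive gt′) (Oᶠ f) pa pb nb)

  forest-short : Below all k (Oᶠ (f ∷ʳ t))
  forest-short {a} {b} pa pb na nb l = trans (slice pa pb nb) (≺-short deg (Δ all (Oᶠ f) a) l)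

  forest-leading : ∀ {a b} → Packed a → Packed b → b ≢ [] → length b ≡ k → Δ all (Oᶠ (f ∷ʳ t)) a b ≡ Oᶠ f a * Oᵗ t b
  forest-leading {a} {b} pa pb nb l = trans (slice pa pb nb)
    (trans (≺-leading deg (Δ all (Oᶠ f) a) pb nb l) (cong (_* Oᵗ t b) (Δ-[]ʳ (Oᶠ f) pa)))

module TreeLeading {k l ls rs} (b : BluePacked (node l ls rs)) (sz : size (node l [] rs) ≡ k) where

  private
    core = coreFacts-node l ls rs b
    q = Oᵗ (node l [] rs)
    aug : Augmentation q
    aug = Oᵗ-augmentation {node l [] rs} (CoreFacts.hom core)
    deg : Degree k q
    deg {w} ne = Hom-degree {size (node l [] rs)} {weight (node l [] rs)} {q} (CoreFacts.hom core) {w} (λ e → ne (trans e sz))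

    agree : ∀ a b′ → Δ right (Oᵗ (node l ls rs)) a b′ ≡ Δ right (braceᵛ (map Oᵗ ls) q) a b′
    agree a b′ = linear-cong (Δ-linear right a b′) (Oᵗ (node l ls rs)) (braceᵛ (map Oᵗ ls) q) (λ {w} _ → node-brace l ls rs b w)

    nest : ∀ a → nestˡ (map Oᵗ ls) a ≡ Oᶠ (reverse ls) a
    nest a = sym (trans (coeff-OF (reverse ls) (treeHoms (reverse ls) (BluePackedF-reverse ls (proj₁ b))) a)
      (cong (λ z → nestˡ (map Oᵗ z) a) (List.reverse-involutive ls)))

  tree-short : Below right k (Oᵗ (node l ls rs))
  tree-short {a} {b′} pa pb na nb len = trans (agree a b′)
    (brace-short {k} {map Oᵗ ls} {q} aug (CoreFacts.isPrimitive core) (CoreFacts.vanishes-right core) deg pa pb nb (ℕ.<⇒≤ len) len)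

  tree-leading : ∀ {a b′} → Packed a → Packed b′ → b′ ≢ [] → length b′ ≡ k →
                 Δ right (Oᵗ (node l ls rs)) a b′ ≡ Oᶠ (reverse ls) a * q b′
  tree-leading {a} {b′} pa pb nb len = trans (agree a b′)
    (trans (brace-leading {k} {map Oᵗ ls} {q} aug (CoreFacts.isPrimitive core) (CoreFacts.vanishes-right core) deg pa pb nb (ℕ.≤-reflexive len) len)
           (cong (_* q b′) (nest a)))

-- The reversal reconciles two conventions: a forest is nested with its last tree outermost, the
-- list of a brace with its first. It makes `Oᶠ f ⊗ Oᵗ t` the leading tensor of the grafted tree
-- when `t` has no left forest.
graft : Forest → Tree → Tree
graft f (node l _ rs) = node l (reverse f) rs

-- Left tensor factors are arbitrary and expanded by `Span₁`, right ones are totally primitive and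
-- expanded by `Span₃`, both in smaller degree. The remainder is primitive with vanishing Δ≻, so its
-- Δ≺ vanishes as well and `Span₃ n` applies.
span₂-step : ∀ n → 1 ≤ n → (∀ m → 1 ≤ m → m < n → Span₁ m × Span₃ m) → Span₃ n → Span₂ n
span₂-step n 1≤n smaller span₃ f suppf primf = finish (reduce 1≤n (suppf , primf))
  where
  X : V → Set
  X x = Supp n x × Vanishes all x

  graft-BluePacked : ∀ {j k f t} → ForestOf j f → CoreOf k t → BluePacked (graft f t)
  graft-BluePacked {f = f} {node l [] rs} (bf , _) ((_ , brs , rc) , _ , refl) = BluePackedF-reverse f bf , brs , rc

  graft-good : ∀ {j k f t} → 1 ≤ j → j ℕ.+ k ≡ n → ForestOf j f → CoreOf k t → TreeOf n (graft f t)
  graft-good {f = f} {node l [] rs} 1≤j e gf@(_ , refl) gq@(_ , refl , refl) = graft-BluePacked gf gq ,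
    trans (cong (λ z → suc (z ℕ.+ sizeF rs)) (sizeF-reverse f)) (trans (sym (ℕ.+-suc (sizeF f) (sizeF rs))) e)

  graft-short : ∀ {j k f t} → 1 ≤ j → j ℕ.+ k ≡ n → ForestOf j f → CoreOf k t → Below right k (Oᵗ (graft f t))
  graft-short {f = f} {node l [] rs} 1≤j e gf gq@(_ , sz , refl) = TreeLeading.tree-short {ls = reverse f} (graft-BluePacked gf gq) sz

  graft-leading : ∀ {j k f t} → 1 ≤ j → j ℕ.+ k ≡ n → ForestOf j f → CoreOf k t →
                  ∀ {a b} → Packed a → Packed b → b ≢ [] → length b ≡ k → Δ right (Oᵗ (graft f t)) a b ≡ Oᶠ f a * Oᵗ t b
  graft-leading {f = f} {node l [] rs} 1≤j e gf gq@(_ , sz , refl) {a} {b} pa pb nb len = trans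
    (TreeLeading.tree-leading {ls = reverse f} (graft-BluePacked gf gq) sz pa pb nb len)
    (cong (λ z → Oᶠ z a * Oᵗ (node l [] rs) b) (List.reverse-involutive f))

  X-sub : ∀ {x cs} → X x → All (TreeOf n ∘ proj₂) cs → X (x ⊖ lc Oᵗ cs)
  X-sub (s , v) good = Supp-⊖ s (Supp-lc Oᵗ (All.map tree-Supp good)) , Vanishes-⊖ v (Vanishes-lc Oᵗ (All.map tree-primitive good))

  spanˡ : ∀ {j k} → 1 ≤ j → 1 ≤ k → j ℕ.+ k ≡ n → Span₁ j
  spanˡ {j} 1≤j 1≤k e = proj₁ (smaller j 1≤j (subst (j <_) e (ℕ.m<m+n j 1≤k)))

  slice : ∀ {j k} → 1 ≤ j → 1 ≤ k → j ℕ.+ k ≡ n → ∀ {x} → X x → Below right k x →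
          ∀ a → Packed a → length a ≡ j → Span (CoreOf k) Oᵗ (Δ right x a)
  slice {j} {k} 1≤j 1≤k e {x} (s , v) below a pa la with slice-totally-primitive e s v below a pa la 1≤j
  ... | sk , vl , vr = proj₂ (smaller k 1≤k (subst (k <_) e (ℕ.m<n+m k 1≤j))) (Δ right x a) sk vl vr

  open Filtration n right ForestOf CoreOf (TreeOf n) Oᶠ Oᵗ Oᵗ graft X proj₁ X-sub graft-good graft-short graft-leading spanˡ slice

  finish : Result f → Span (TreeOf n) Oᵗ f
  finish (cs , y , good , (sy , vy) , vry , e) = combine (span₃ y sy vly vry)
    where
    vly : Vanishes left y
    vly {a} {b} pa pb na nb = begin
      Δ left y a b                  ≡⟨ ℚ.+-identityʳ _ ⟨
      Δ left y a b + 0ℚ             ≡⟨ cong (Δ left y a b +_) (vry pa pb na nb) ⟨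
      Δ left y a b + Δ right y a b  ≡⟨ Δ-left+right y pa pb nb ⟩
      Δ all y a b                   ≡⟨ vy pa pb na nb ⟩
      0ℚ                            ∎
    combine : Span (CoreOf n) Oᵗ y → Span (TreeOf n) Oᵗ f
    combine (ds , good′ , e′) = cs ++ ds , All.++⁺ good (All.map (λ (b , s , _) → b , s) good′) ,
      λ w → trans (∑-++ cs ds _) (trans (cong (lc Oᵗ cs w +_) (e′ w)) (e w))

-- The same scheme with the full coproduct, whose leading right factors are primitive. The trees
-- that express the primitive remainder enter as forests with one tree.
span₁-step : ∀ n → 1 ≤ n → (∀ m → 1 ≤ m → m < n → Span₁ m × Span₂ m) → Span₂ n → Span₁ n
span₁-step n 1≤n smaller span₂ f suppf = finish (reduce 1≤n suppf)
  where
  ∷ʳ-good : ∀ {j k f t} → 1 ≤ j → j ℕ.+ k ≡ n → ForestOf j f → TreeOf k t → ForestOf n (f ∷ʳ t)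
  ∷ʳ-good {f = f} {t} 1≤j e (bf , refl) (bt , refl) = BluePackedF-++⁺ f (t ∷ []) bf (bt , tt) , trans (sizeF-∷ʳ f t) e

  Supp-sub : ∀ {x cs} → Supp n x → All (ForestOf n ∘ proj₂) cs → Supp n (x ⊖ lc Oᶠ cs)
  Supp-sub s good = Supp-⊖ s (Supp-lc Oᶠ (All.map forest-Supp good))

  ∷ʳ-short : ∀ {j k f t} → 1 ≤ j → j ℕ.+ k ≡ n → ForestOf j f → TreeOf k t → Below all k (Oᶠ (f ∷ʳ t))
  ∷ʳ-short 1≤j e gf gq = ForestLeading.forest-short (proj₁ gf) gq

  ∷ʳ-leading : ∀ {j k f t} → 1 ≤ j → j ℕ.+ k ≡ n → ForestOf j f → TreeOf k t →
               ∀ {a b} → Packed a → Packed b → b ≢ [] → length b ≡ k → Δ all (Oᶠ (f ∷ʳ t)) a b ≡ Oᶠ f a * Oᵗ t b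
  ∷ʳ-leading 1≤j e gf gq = ForestLeading.forest-leading (proj₁ gf) gq

  spanˡ : ∀ {j k} → 1 ≤ j → 1 ≤ k → j ℕ.+ k ≡ n → Span₁ j
  spanˡ {j} 1≤j 1≤k e = proj₁ (smaller j 1≤j (subst (j <_) e (ℕ.m<m+n j 1≤k)))

  slice : ∀ {j k} → 1 ≤ j → 1 ≤ k → j ℕ.+ k ≡ n → ∀ {x} → Supp n x → Below all k x →
          ∀ a → Packed a → length a ≡ j → Span (TreeOf k) Oᵗ (Δ all x a)
  slice {j} {k} 1≤j 1≤k e {x} s below a pa la with slice-primitive e s below a pa la 1≤j
  ... | sk , v = proj₂ (smaller k 1≤k (subst (k <_) e (ℕ.m<n+m k 1≤j))) (Δ all x a) sk v

  open Filtration n all ForestOf TreeOf (ForestOf n) Oᶠ Oᵗ Oᶠ _∷ʳ_ (Supp n) id Supp-sub ∷ʳ-good ∷ʳ-short ∷ʳ-leading spanˡ slice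

  finish : Result f → Span (ForestOf n) Oᶠ f
  finish (cs , y , good , sy , vy , e) = combine (span₂ y sy vy)
    where
    combine : Span (TreeOf n) Oᵗ y → Span (ForestOf n) Oᶠ f
    combine (ds , good′ , e′) = cs ++ map (λ (c , t) → c , t ∷ []) ds ,
      All.++⁺ good (All.map⁺ (All.map (λ {(_ , t)} (b , s) → (b , tt) , trans (ℕ.+-identityʳ (size t)) s) good′)) ,
      λ w → trans (∑-++ cs _ _) (trans (cong (lc Oᶠ cs w +_) (trans (∑-map _ ds _) (e′ w))) (e w))

-- Totally primitive elements are determined by the primitive elements x ∘ ψ l.

leaf : Tree
leaf = node (1 , white) [] []

Oᵗ-leaf : ∀ w → Oᵗ leaf w ≡ 𝟙 (eqW (1 ∷ []) w)
Oᵗ-leaf w with eqW (1 ∷ []) w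
... | true  = refl
... | false = refl

span₃-one : Span₃ 1
span₃-one f (supp , deg) _ _ = (f (1 ∷ []) , leaf) ∷ [] , ((tt , tt , refl) , refl , refl) ∷ [] , value
  where
  value : ∀ w → f (1 ∷ []) * Oᵗ leaf w + 0ℚ ≡ f w
  value w = trans (ℚ.+-identityʳ _) (trans (cong (f (1 ∷ []) *_) (Oᵗ-leaf w)) (cases (List.≡-dec ℕ._≟_ (1 ∷ []) w)))
    where
    one-letter : ∀ w → Packed w → length w ≡ 1 → w ≡ 1 ∷ []
    one-letter (x ∷ []) (1≤x ∷ [] , full) _ with full 1 ℕ.≤-refl (ℕ.≤-trans 1≤x (ℕ.m≤m⊔n x 0))
    ... | here refl = refl
    cases : Dec (1 ∷ [] ≡ w) → f (1 ∷ []) * 𝟙 (eqW (1 ∷ []) w) ≡ f w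
    cases (yes e) = trans (cong (λ z → f (1 ∷ []) * 𝟙 (eqW (1 ∷ []) z)) (sym e)) (trans (ℚ.*-identityʳ _) (cong f e))
    cases (no ne) = trans (*-zeroʳ-≡ (f (1 ∷ [])) (cong 𝟙 (eqW-false ne)))
      (sym (stable-0 (λ nz → let (p , l) = Supp-nonzero (supp , deg) nz in ne (sym (one-letter w p l)))))

labelsUpTo : ℕ → List Label
labelsUpTo n = concatMap (λ i → (i , white) ∷ (i , black) ∷ []) (range 1 n)

∑-labels-δ : ∀ n l (G : Label → ℚ) → 1 ≤ proj₁ l → proj₁ l ≤ n → ∑ (labelsUpTo n) (λ l′ → 𝟙 (does (l′ ≟ˡ l)) * G l′) ≡ G l
∑-labels-δ n (j , α) G 1≤j j≤n = begin
  ∑ (labelsUpTo n) (λ l′ → 𝟙 (does (l′ ≟ˡ (j , α))) * G l′)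
    ≡⟨ ∑-concatMap _ (range 1 n) _ ⟩
  ∑ (range 1 n) (λ i → 𝟙 (does ((i , white) ≟ˡ (j , α))) * G (i , white) + (𝟙 (does ((i , black) ≟ˡ (j , α))) * G (i , black) + 0ℚ))
    ≡⟨ ∑-cong (range 1 n) (λ i → term i α) ⟩
  ∑ (range 1 n) (λ i → 𝟙 (i ℕ.≡ᵇ j) * G (i , α))
    ≡⟨ ∑-range-δ 1 n j (λ i → G (i , α)) ⟩
  𝟙 ((1 ≤ᵇ j) ∧ (j ≤ᵇ n)) * G (j , α)
    ≡⟨ 𝟙-true (G (j , α)) (∧-true⁺ (≤ᵇ-true 1≤j) (≤ᵇ-true j≤n)) ⟩
  G (j , α) ∎
  where
  same : ∀ i α → 𝟙 (does ((i , α) ≟ˡ (j , α))) ≡ 𝟙 (i ℕ.≡ᵇ j)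
  same i α = cases (i ℕ.≟ j)
    where
    cases : Dec (i ≡ j) → 𝟙 (does ((i , α) ≟ˡ (j , α))) ≡ 𝟙 (i ℕ.≡ᵇ j)
    cases (yes refl) = trans (Labels.δ-refl (i , α)) (cong 𝟙 (sym (≡ᵇ-refl i)))
    cases (no ne)    = trans (Labels.δ-≢ {i , α} {j , α} (λ e → ne (cong proj₁ e))) (cong 𝟙 (sym (≡ᵇ-false ne)))
  term : ∀ i α → 𝟙 (does ((i , white) ≟ˡ (j , α))) * G (i , white) + (𝟙 (does ((i , black) ≟ˡ (j , α))) * G (i , black) + 0ℚ)
       ≡ 𝟙 (i ℕ.≡ᵇ j) * G (i , α)
  term i white = trans (cong₂ _+_ (cong (_* G (i , white)) (same i white))
      (trans (ℚ.+-identityʳ _) (*-zeroˡ-≡ (G (i , black)) (Labels.δ-≢ {i , black} {j , white} (λ ()))))) (ℚ.+-identityʳ _)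
  term i black = trans (cong₂ _+_ (*-zeroˡ-≡ (G (i , white)) (Labels.δ-≢ {i , white} {j , black} (λ ())))
      (trans (ℚ.+-identityʳ _) (cong (_* G (i , black)) (same i black)))) (ℚ.+-identityˡ _)

module _ {n} (f : V) (suppf : Supp (suc n) f) (vl : Vanishes left f) (vr : Vanishes right f) where

  private
    supp = proj₁ suppf
    deg  = proj₂ suppf

    leaf-packed : Packed (1 ∷ [])
    leaf-packed = (s≤s z≤n ∷ []) , λ { (suc zero) _ _ → here refl ; (suc (suc j)) _ (s≤s ()) }

  -- The cut-off at `maxW w` mirrors the root condition. The valid labels it drops are the white
  -- ones with letter `suc (maxW w)`, and there `f` vanishes at nonempty words by `ψ-last-zero`.
  strip : Label → V
  strip l w = 𝟙 (isPacked w ∧ (proj₁ l ≤ᵇ maxW w)) * f (ψ l w)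

  strip-≤ : ∀ l {w} → Packed w → proj₁ l ≤ maxW w → strip l w ≡ f (ψ l w)
  strip-≤ l {w} pw le = 𝟙-true (f (ψ l w)) (∧-true⁺ (isPacked-complete w pw) (≤ᵇ-true le))

  strip-> : ∀ l {w} → maxW w < proj₁ l → strip l w ≡ 0ℚ
  strip-> l {w} lt′ = 𝟙-false (f (ψ l w)) (≢true⇒false (λ h → ℕ.<⇒≱ lt′ (≤ᵇ-sound {proj₁ l} {maxW w} (∧-true⁻ʳ {isPacked w} h))))

  strip-Supp : ∀ l → Supp n (strip l)
  strip-Supp l = (λ {w} np → 𝟙-false (f (ψ l w)) (≢true⇒false (λ h → np (isPacked-sound w (∧-true⁻ˡ h))))) ,
    (λ {w} ne → *-zeroʳ-≡ (𝟙 (isPacked w ∧ (proj₁ l ≤ᵇ maxW w))) (deg (λ e → ne (ℕ.suc-injective (trans (sym (length-ψ l w)) e)))))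

  private
    low-cut : ∀ l → 1 ≤ proj₁ l → ∀ {a b} → Packed a → Packed b → b ≢ [] → proj₁ l ≤ maxW a →
              ∑sh a (shift (maxW a) b) (f ∘ ψ l) ≡ 0ℚ
    low-cut l 1≤l {a} {b} pa pb nb le = trans (sym (Δ-left-ψ l f pa pb val)) (vl (ψ-packed l pa val) pb (ψ-≢[] l a) nb)
      where val = Valid-≤ l 1≤l le

    high-cut : ∀ l → ∀ {a b} → Packed a → Packed b → a ≢ [] → maxW a < proj₁ l → proj₁ l ≤ maxW a ℕ.+ maxW b →
               ∑sh a (shift (maxW a) b) (f ∘ ψ l) ≡ 0ℚ
    high-cut (i , α) {a} {b} pa pb na l le = trans
      (cong (λ j → ∑sh a (shift (maxW a) b) (f ∘ ψ (j , α))) (sym (ℕ.m+[n∸m]≡n (ℕ.<⇒≤ l))))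
      (trans (sym (Δ-right-ψ (i ∸ maxW a , α) f pa pb val)) (vr pa (ψ-packed _ pb val) na (ψ-≢[] (i ∸ maxW a , α) b)))
      where
      val : Valid (i ∸ maxW a , α) (maxW b)
      val = Valid-≤ (i ∸ maxW a , α) (ℕ.m<n⇒0<n∸m l) (ℕ.m≤n+o⇒m∸n≤o i (maxW a) le)

  -- The letter of `l` belongs either to the low letters of a shuffle of `a` and `b` or to the high
  -- ones. In the first case it can be attached to `a`, which gives a value of Δ≺ of `f`; in the
  -- second to `b`, which gives a value of Δ≻.
  strip-primitive : ∀ l → 1 ≤ proj₁ l → Vanishes all (strip l)
  strip-primitive l 1≤l {a} {b} pa pb na nb = trans (Δ-all (strip l) pa pb) (cases (proj₁ l ℕ.≤? maxW a ℕ.+ maxW b) (proj₁ l ℕ.≤? maxW a))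
    where
    expand : proj₁ l ≤ maxW a ℕ.+ maxW b → ∑sh a (shift (maxW a) b) (strip l) ≡ ∑sh a (shift (maxW a) b) (f ∘ ψ l)
    expand le = ∑sh-cong a (shift (maxW a) b) (λ u i → strip-≤ l (shuffle-packed pa pb i) (subst (proj₁ l ≤_) (sym (maxW-shuffle a b i)) le))
    cases : Dec (proj₁ l ≤ maxW a ℕ.+ maxW b) → Dec (proj₁ l ≤ maxW a) → ∑sh a (shift (maxW a) b) (strip l) ≡ 0ℚ
    cases (no ¬le) _ = ∑sh-zero a (shift (maxW a) b) (λ u i → strip-> l {u} (subst (_< proj₁ l) (sym (maxW-shuffle a b i)) (ℕ.≰⇒> ¬le)))
    cases (yes le) (yes le′) = trans (expand le) (low-cut l 1≤l pa pb nb le′)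
    cases (yes le) (no ¬le′) = trans (expand le) (high-cut l pa pb na (ℕ.≰⇒> ¬le′) le)

  -- The final 1 is the only letter 1 of the word, so the cut at level 1 splits it off as left
  -- factor, which is a cut counted by Δ≺.
  ψ-first-zero : ∀ {v} → Packed v → v ≢ [] → f (ψ (1 , white) v) ≡ 0ℚ
  ψ-first-zero {v} pv nv = begin
    f (ψ (1 , white) v)                            ≡⟨ cong (f ∘ ψ (1 , white)) (List.map-id v) ⟨
    f (ψ (1 , white) (shift 0 v))                  ≡⟨ ∑sh-[]ˡ (shift 0 v) _ ⟨
    ∑sh [] (shift 0 v) (f ∘ ψ (1 , white))         ≡⟨ Δ-left-ψ (1 , white) f []-packed pv (ℕ.≤-refl , ℕ.≤-refl) ⟨
    Δ left f (1 ∷ []) v                            ≡⟨ vl leaf-packed pv (λ ()) nv ⟩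
    0ℚ                                             ∎

  -- The final letter is the only occurrence of the maximum, so the top cut splits it off as right
  -- factor, which is a cut counted by Δ≻.
  ψ-last-zero : ∀ {v} → Packed v → v ≢ [] → f (ψ (suc (maxW v) , white) v) ≡ 0ℚ
  ψ-last-zero {v} pv nv = begin
    f (ψ (suc (maxW v) , white) v)                                   ≡⟨ cong (λ j → f (ψ (j , white) v)) (ℕ.+-comm (maxW v) 1) ⟨
    f (ψ (maxW v ℕ.+ 1 , white) v)                                   ≡⟨ ∑sh-[]ʳ v _ ⟨
    ∑sh v [] (f ∘ ψ (maxW v ℕ.+ 1 , white))                          ≡⟨ Δ-right-ψ (1 , white) f pv []-packed (ℕ.≤-refl , ℕ.≤-refl) ⟨
    Δ right f v (1 ∷ [])                                             ≡⟨ vr pv leaf-packed nv (λ ()) ⟩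
    0ℚ                                                               ∎

  strip-complete : ∀ l {v} → Packed v → v ≢ [] → Valid l (maxW v) → strip l v ≡ f (ψ l v)
  strip-complete l {v} pv nv val = cases l val (proj₁ l ℕ.≤? maxW v)
    where
    cases : ∀ l → Valid l (maxW v) → Dec (proj₁ l ≤ maxW v) → strip l v ≡ f (ψ l v)
    cases l val (yes le) = strip-≤ l pv le
    cases (i , black) (_ , le) (no ¬le) = ⊥-elim (¬le le)
    cases (i , white) (_ , le) (no ¬le) = trans (strip-> (i , white) {v} (ℕ.≰⇒> ¬le))
      (sym (trans (cong (λ j → f (ψ (j , white) v)) (ℕ.≤-antisym le (ℕ.≰⇒> ¬le))) (ψ-last-zero pv nv)))

-- Each part of `f` under an admissible label is primitive of degree `n`, hence a combination of
-- trees `t`, and every such `t` is put as right child under a root with that label. The label 1° is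
-- left out, since `f` vanishes at the words ending in it.
span₃-step : ∀ n → 1 ≤ n → Span₂ n → Span₃ (suc n)
span₃-step n 1≤n span₂ f suppf vl vr = cs , good , value
  where
  Admissible : Label → Set
  Admissible l = 1 ≤ proj₁ l × l ≢ (1 , white)

  admissible? : ∀ l → Dec (Admissible l)
  admissible? l with 1 ℕ.≤? proj₁ l | l ≟ˡ (1 , white)
  ... | no n  | _     = no (n ∘ proj₁)
  ... | yes _ | yes e = no (λ h → proj₂ h e)
  ... | yes p | no n  = yes (p , n)

  y : Label → V
  y = strip f suppf vl vr

  raw : ∀ l → Admissible l → Span (TreeOf n) Oᵗ (y l)
  raw l (1≤l , _) = span₂ (y l) (strip-Supp f suppf vl vr l) (λ {a} {b} → strip-primitive f suppf vl vr l 1≤l {a} {b})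

  -- A tree of weight below the letter of `l` is not allowed under this root. Discarding it changes
  -- nothing: its element lives on words with maximum equal to the weight, and `strip` vanishes at
  -- words with maximum below the letter.
  heavy : Label → ℚ × Tree → Bool
  heavy l (_ , t) = proj₁ l ≤ᵇ weight t

  piece : ∀ l → Dec (Admissible l) → List (ℚ × Tree)
  piece l (no _)  = []
  piece l (yes g) = map (λ (c , t) → c , node l [] (t ∷ [])) (filterᵇ (heavy l) (proj₁ (raw l g)))

  cs : List (ℚ × Tree)
  -- A packed word of length `n` has maximum at most `n`, so valid labels carry letters up to
  -- `suc n`.
  cs = concatMap (λ l → piece l (admissible? l)) (labelsUpTo (suc n))

  heavy-good : ∀ l g → All (λ p → TreeOf n (proj₂ p) × proj₁ l ≤ weight (proj₂ p)) (filterᵇ (heavy l) (proj₁ (raw l g)))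
  heavy-good l g = All.tabulate λ {p} p∈ → case ∈.∈-filter⁻ (T? ∘ heavy l) {xs = proj₁ (raw l g)} p∈ of λ
    { (p∈cs , t) → All.lookup (proj₁ (proj₂ (raw l g))) p∈cs , ≤ᵇ-sound {proj₁ l} {weight (proj₂ p)} (Equivalence.to T-≡ t) }

  piece-good : ∀ l d → All (CoreOf (suc n) ∘ proj₂) (piece l d)
  piece-good l (no _)  = []
  piece-good l (yes g@(1≤l , l≢)) = All.map⁺ (All.map
    (λ {(_ , t)} ((b , s) , le) → (tt , (b , tt) , l≢ , 1≤l , le) , cong suc (trans (ℕ.+-identityʳ (size t)) s) , refl) (heavy-good l g))

  good : All (CoreOf (suc n) ∘ proj₂) cs
  good = All.concat⁺ (All.map⁺ (All.tabulate {xs = labelsUpTo (suc n)} (λ {l} _ → piece-good l (admissible? l))))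

  lc-heavy : ∀ l g w → lc Oᵗ (filterᵇ (heavy l) (proj₁ (raw l g))) w ≡ y l w
  lc-heavy l g w = begin
    ∑ (filterᵇ (heavy l) ds) (λ (c , t) → c * Oᵗ t w)   ≡⟨ ∑-filterᵇ (heavy l) ds _ ⟩
    ∑ ds (λ p → 𝟙 (heavy l p) * (proj₁ p * Oᵗ (proj₂ p) w)) ≡⟨ cases (proj₁ l ℕ.≤? maxW w) ⟩
    y l w                                               ∎
    where
    ds = proj₁ (raw l g)
    trees = proj₁ (proj₂ (raw l g))
    total = proj₂ (proj₂ (raw l g))
    max≡ : ∀ {p} → p ∈ ds → Oᵗ (proj₂ p) w ≢ 0ℚ → maxW w ≡ weight (proj₂ p)
    max≡ {p} p∈ nz = proj₂ (proj₂ (TreeFacts.hom (treeFacts (proj₂ p) (proj₁ (All.lookup trees p∈))) nz))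
    cases : Dec (proj₁ l ≤ maxW w) → ∑ ds (λ p → 𝟙 (heavy l p) * (proj₁ p * Oᵗ (proj₂ p) w)) ≡ y l w
    cases (yes le) = trans (∑-cong-∈ ds (λ p p∈ → keep p p∈ (Oᵗ (proj₂ p) w ℚ.≟ 0ℚ))) (total w)
      where
      keep : ∀ p → p ∈ ds → Dec (Oᵗ (proj₂ p) w ≡ 0ℚ) → 𝟙 (heavy l p) * (proj₁ p * Oᵗ (proj₂ p) w) ≡ proj₁ p * Oᵗ (proj₂ p) w
      keep p p∈ (yes z) = trans (*-zeroʳ-≡ (𝟙 (heavy l p)) (*-zeroʳ-≡ (proj₁ p) z)) (sym (*-zeroʳ-≡ (proj₁ p) z))
      keep p p∈ (no nz) = 𝟙-true (proj₁ p * Oᵗ (proj₂ p) w) (≤ᵇ-true (subst (proj₁ l ≤_) (max≡ p∈ nz) le))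
    cases (no ¬le) = trans (∑-zero-∈ ds (λ p p∈ → stable-0 (λ nz → drop-heavy p p∈ nz))) (sym (strip-> f suppf vl vr l {w} (ℕ.≰⇒> ¬le)))
      where
      drop-heavy : ∀ p → p ∈ ds → 𝟙 (heavy l p) * (proj₁ p * Oᵗ (proj₂ p) w) ≢ 0ℚ → ⊥
      drop-heavy p p∈ nz = ¬le (subst (proj₁ l ≤_) (sym (max≡ p∈ (*-nonzeroʳ (proj₁ p) _ (*-nonzeroʳ (𝟙 (heavy l p)) _ nz))))
        (≤ᵇ-sound {proj₁ l} {weight (proj₂ p)} (𝟙-nonzero (heavy l p) (*-nonzeroˡ _ _ nz))))

  O-node : ∀ l t → TreeOf n t → ∀ l′ {v} → Packed v → Valid l′ (maxW v) → Oᵗ (node l [] (t ∷ [])) (ψ l′ v) ≡ 𝟙 (does (l ≟ˡ l′)) * Oᵗ t v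
  O-node l t g l′ pv val = coeff-Ψ (OT t) (proj₁ (tree-Supp g)) l l′ pv val

  lc-piece : ∀ l d l′ {v} → Packed v → Valid l′ (maxW v) → (Admissible l′ → 𝟙 (does (l ≟ˡ l′)) * y l v ≡ lc Oᵗ (piece l d) (ψ l′ v))
  lc-piece l (no ng) l′ {v} pv val g′ = *-zeroˡ-≡ (y l v) (Labels.δ-≢ {l} {l′} (λ e → ng (subst Admissible (sym e) g′)))
  lc-piece l (yes g) l′ {v} pv val g′ = sym (begin
    lc Oᵗ (map (λ (c , t) → c , node l [] (t ∷ [])) hs) (ψ l′ v)
      ≡⟨ ∑-map _ hs _ ⟩
    ∑ hs (λ (c , t) → c * Oᵗ (node l [] (t ∷ [])) (ψ l′ v))
      ≡⟨ ∑-cong-∈ hs (λ (c , t) p∈ → trans (cong (c *_) (O-node l t (proj₁ (All.lookup (heavy-good l g) p∈)) l′ pv val))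
           (*-shift c (𝟙 (does (l ≟ˡ l′))) (Oᵗ t v))) ⟩
    ∑ hs (λ (c , t) → 𝟙 (does (l ≟ˡ l′)) * (c * Oᵗ t v))
      ≡⟨ ∑-*ˡ hs (𝟙 (does (l ≟ˡ l′))) _ ⟩
    𝟙 (does (l ≟ˡ l′)) * lc Oᵗ hs v
      ≡⟨ cong (𝟙 (does (l ≟ˡ l′)) *_) (lc-heavy l g v) ⟩
    𝟙 (does (l ≟ˡ l′)) * y l v ∎)
    where hs = filterᵇ (heavy l) (proj₁ (raw l g))

  lc-piece-first : ∀ l d {v} → Packed v → Valid (1 , white) (maxW v) → lc Oᵗ (piece l d) (ψ (1 , white) v) ≡ 0ℚ
  lc-piece-first l (no _) pv val = refl
  lc-piece-first l (yes g) {v} pv val = trans (∑-map _ hs _) (∑-zero-∈ hs (λ (c , t) p∈ → *-zeroʳ-≡ c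
    (trans (O-node l t (proj₁ (All.lookup (heavy-good l g) p∈)) (1 , white) pv val)
           (*-zeroˡ-≡ (Oᵗ t v) (Labels.δ-≢ {l} {1 , white} (proj₂ g))))))
    where hs = filterᵇ (heavy l) (proj₁ (raw l g))

  cs-Supp : Supp (suc n) (lc Oᵗ cs)
  cs-Supp = Supp-lc Oᵗ (All.map (λ (b , s , _) → tree-Supp (b , s)) good)

  at-ψ : ∀ l′ {v} → Packed v → length v ≡ n → Valid l′ (maxW v) → Dec (Admissible l′) → lc Oᵗ cs (ψ l′ v) ≡ f (ψ l′ v)
  at-ψ l′ {v} pv lv val (yes g′) = begin
    lc Oᵗ cs (ψ l′ v)
      ≡⟨ ∑-concatMap (λ l → piece l (admissible? l)) (labelsUpTo (suc n)) _ ⟩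
    ∑ (labelsUpTo (suc n)) (λ l → lc Oᵗ (piece l (admissible? l)) (ψ l′ v))
      ≡⟨ ∑-cong (labelsUpTo (suc n)) (λ l → sym (lc-piece l (admissible? l) l′ pv val g′)) ⟩
    ∑ (labelsUpTo (suc n)) (λ l → 𝟙 (does (l ≟ˡ l′)) * y l v)
      ≡⟨ ∑-labels-δ (suc n) l′ (λ l → y l v) (proj₁ g′) (bound l′ val) ⟩
    y l′ v
      ≡⟨ strip-complete f suppf vl vr l′ pv v≢[] val ⟩
    f (ψ l′ v) ∎
    where
    v≢[] : v ≢ []
    v≢[] refl = ℕ.<⇒≱ 1≤n (ℕ.≤-reflexive (sym lv))
    max≤n : maxW v ≤ n
    max≤n = subst (maxW v ≤_) lv (maxW-≤-length pv)
    bound : ∀ l → Valid l (maxW v) → proj₁ l ≤ suc n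
    bound (i , white) (_ , le) = ℕ.≤-trans le (s≤s max≤n)
    bound (i , black) (_ , le) = ℕ.≤-trans le (ℕ.m≤n⇒m≤1+n max≤n)
  at-ψ l′ {v} pv lv val (no ng) = trans (cong (λ l → lc Oᵗ cs (ψ l v)) l′≡) (trans
    (trans (∑-concatMap (λ l → piece l (admissible? l)) (labelsUpTo (suc n)) _)
           (∑-zero (labelsUpTo (suc n)) (λ l → lc-piece-first l (admissible? l) pv (subst (λ l → Valid l (maxW v)) l′≡ val))))
    (sym (trans (cong (λ l → f (ψ l v)) l′≡) (ψ-first-zero f suppf vl vr pv v≢[]))))
    where
    v≢[] : v ≢ []
    v≢[] refl = ℕ.<⇒≱ 1≤n (ℕ.≤-reflexive (sym lv))
    valid-≥1 : ∀ l {m} → Valid l m → 1 ≤ proj₁ l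
    valid-≥1 (_ , white) = proj₁
    valid-≥1 (_ , black) = proj₁
    l′≡ : l′ ≡ (1 , white)
    l′≡ with l′ ≟ˡ (1 , white)
    ... | yes e = e
    ... | no ne = ⊥-elim (ng (valid-≥1 l′ val , ne))

  value : ∀ w → lc Oᵗ cs w ≡ f w
  value w = cases (packed? w) (length w ℕ.≟ suc n)
    where
    at-last : length w ≡ suc n → LastLetter w → lc Oᵗ cs w ≡ f w
    at-last lw (mkLast l′ v val pv e) = trans (cong (lc Oᵗ cs) e) (trans
      (at-ψ l′ pv (ℕ.suc-injective (trans (sym (length-ψ l′ v)) (trans (cong length (sym e)) lw))) val (admissible? l′)) (cong f (sym e)))
    cases : Dec (Packed w) → Dec (length w ≡ suc n) → lc Oᵗ cs w ≡ f w
    cases (no np) _ = trans (proj₁ cs-Supp np) (sym (proj₁ suppf np))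
    cases (yes _) (no nl) = trans (proj₂ cs-Supp nl) (sym (proj₂ suppf nl))
    cases (yes p) (yes lw) = at-last lw (lastLetter p (λ { refl → case lw of λ () }))

-- Simultaneous induction for the three spanning statements

record Spans (n : ℕ) : Set where
  field
    span₁ : Span₁ n
    span₂ : Span₂ n
    span₃ : Span₃ n

-- The order within one degree is `Span₃`, `Span₂`, `Span₁`. The circle closes because beyond degree
-- 1 `Span₃` uses `Span₂` one degree lower.
spans : ∀ n → 1 ≤ n → Spans n
spans = <-rec (λ n → 1 ≤ n → Spans n) step
  where
  step : ∀ n → (∀ {m} → m < n → 1 ≤ m → Spans m) → 1 ≤ n → Spans n
  step n rec 1≤n = record { span₁ = s₁ ; span₂ = s₂ ; span₃ = s₃ }
    where
    three : ∀ n → (∀ {m} → m < n → 1 ≤ m → Spans m) → 1 ≤ n → Span₃ n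
    three (suc zero)    rec _ = span₃-one
    three (suc (suc n)) rec _ = span₃-step (suc n) (s≤s z≤n) (Spans.span₂ (rec ℕ.≤-refl (s≤s z≤n)))
    s₃ = three n rec 1≤n
    s₂ = span₂-step n 1≤n (λ m 1≤m m<n → Spans.span₁ (rec m<n 1≤m) , Spans.span₃ (rec m<n 1≤m)) s₃
    s₁ = span₁-step n 1≤n (λ m 1≤m m<n → Spans.span₁ (rec m<n 1≤m) , Spans.span₂ (rec m<n 1≤m)) s₂

-- Linear independence by triangular families of functionals

𝟙-does-× : ∀ {P Q R : Set} (d : Dec P) (d′ : Dec Q) (e : Dec R) → (P → Q → R) → (R → P × Q) →
           𝟙 (does d) * 𝟙 (does d′) ≡ 𝟙 (does e)
𝟙-does-× (yes p) (yes q) (yes r) f g = refl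
𝟙-does-× (yes p) (yes q) (no ¬r) f g = ⊥-elim (¬r (f p q))
𝟙-does-× (no ¬p) d′      (yes r) f g = ⊥-elim (¬p (proj₁ (g r)))
𝟙-does-× (no ¬p) d′      (no ¬r) f g = ℚ.*-zeroˡ (𝟙 (does d′))
𝟙-does-× (yes p) (no ¬q) (yes r) f g = ⊥-elim (¬q (proj₂ (g r)))
𝟙-does-× (yes p) (no ¬q) (no ¬r) f g = refl

-- The functional of `a` is prescribed on elements of rank at least that of `a` only. Elements of
-- smaller rank do no harm: their coefficients have already been shown to vanish, by induction on
-- the rank.
module Triangular {A : Set} (_≟_ : DecidableEquality A) {Good : A → Set} {O : A → V} (rank : A → ℕ) {P : Word → Set}
  (functional : ∀ a → Good a → Σ (V → ℚ) λ θ → Linear P θ × (∀ b → Good b → rank a ≤ rank b → θ (O b) ≡ 𝟙 (does (b ≟ a)))) where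

  open FormalSum _≟_

  independent : ∀ cs → All (Good ∘ proj₂) cs → (∀ w → lc O cs w ≡ 0ℚ) → ∀ a → Good a → coef cs a ≡ 0ℚ
  independent cs good zero-lc a = <-rec (λ r → ∀ a → rank a ≡ r → Good a → coef cs a ≡ 0ℚ) step (rank a) a refl
    where
    present : ∀ b → coef cs b ≢ 0ℚ → Good b
    present b nz with ∑-nonzero cs nz
    ... | (c , b′) , b′∈ , nz′ = subst Good (δ-nonzero (*-nonzeroˡ (𝟙 (does (b′ ≟ b))) c nz′)) (All.lookup good b′∈)
    step : ∀ r → (∀ {s} → s < r → ∀ b → rank b ≡ s → Good b → coef cs b ≡ 0ℚ) → ∀ a → rank a ≡ r → Good a → coef cs a ≡ 0ℚ
    step r rec a refl ga = begin
      coef cs a                                    ≡⟨ ∑-cong cs (λ (c , b) → ℚ.*-comm (𝟙 (does (b ≟ a))) c) ⟩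
      ∑ cs (λ (c , b) → c * 𝟙 (does (b ≟ a)))      ≡⟨ eval-cong cs _ _ agree ⟨
      ∑ cs (λ (c , b) → c * θ (O b))               ≡⟨ lc-linear lin O cs ⟨
      θ (lc O cs)                                  ≡⟨ linear-zero lin (lc O cs) (λ {w} _ → zero-lc w) ⟩
      0ℚ                                           ∎
      where
      θ   = proj₁ (functional a ga)
      lin = proj₁ (proj₂ (functional a ga))
      agree : ∀ b → coef cs b ≢ 0ℚ → θ (O b) ≡ 𝟙 (does (b ≟ a))
      agree b nz with rank b ℕ.<? rank a
      ... | yes l = ⊥-elim (nz (rec l b refl (present b nz)))
      ... | no nl = proj₂ (proj₂ (functional a ga)) b (present b nz) (ℕ.≮⇒≥ nl)

mutual
  tree-≟ : DecidableEquality Tree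
  tree-≟ (node l ls rs) (node l′ ls′ rs′) with l ≟ˡ l′ | forest-≟ ls ls′ | forest-≟ rs rs′
  ... | yes refl | yes refl | yes refl = yes refl
  ... | no ne    | _        | _        = no (λ { refl → ne refl })
  ... | yes _    | no ne    | _        = no (λ { refl → ne refl })
  ... | yes _    | yes _    | no ne    = no (λ { refl → ne refl })

  forest-≟ : DecidableEquality Forest
  forest-≟ []      []      = yes refl
  forest-≟ []      (_ ∷ _) = no (λ ())
  forest-≟ (_ ∷ _) []      = no (λ ())
  forest-≟ (t ∷ f) (u ∷ g) with tree-≟ t u | forest-≟ f g
  ... | yes refl | yes refl = yes refl
  ... | no ne    | _        = no (λ { refl → ne refl })
  ... | yes _    | no ne    = no (λ { refl → ne refl })

opaque

  -- Opaque, so that the Kronecker symbols of forests do not unfold into comparisons of labels and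
  -- subtrees.
  _≟ᶠ_ : DecidableEquality Forest
  _≟ᶠ_ = forest-≟

module Forests = FormalSum _≟ᶠ_

-- Dual functionals from spanning and independence

PackedOf : ℕ → Word → Set
PackedOf n w = Packed w × length w ≡ n

record Dual (n : ℕ) (f : Forest) : Set₁ where
  field
    φ      : V → ℚ
    linear : Linear (PackedOf n) φ
    dual   : ∀ g → ForestOf n g → φ (Oᶠ g) ≡ 𝟙 (does (g ≟ᶠ f))

Independent : ℕ → Set
Independent n = ∀ cs → All (ForestOf n ∘ proj₂) cs → (∀ w → lc Oᶠ cs w ≡ 0ℚ) → ∀ f → ForestOf n f → Forests.coef cs f ≡ 0ℚ

-- `E a` is a chosen expansion of the indicator of `a`, and `φ x` is the coefficient of `f` after
-- expanding every word of `x` in this way. Spanning provides the expansions; independence makes the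
-- result correct on the family itself.
module MakeDual (n : ℕ) (span₁ : Span₁ n) (indep : Independent n) (f : Forest) (gf : ForestOf n f) where

  private
    expansion : ∀ a → Dec (Packed a) → Dec (length a ≡ n) → List (ℚ × Forest)
    expansion a (yes pa) (yes la) = proj₁ (span₁ _ (δ-Supp pa la))
    expansion a _        _        = []

    E : Word → List (ℚ × Forest)
    E a = expansion a (packed? a) (length a ℕ.≟ n)

    E-good : ∀ a pa? la? → All (ForestOf n ∘ proj₂) (expansion a pa? la?)
    E-good a (yes pa) (yes la) = proj₁ (proj₂ (span₁ _ (δ-Supp pa la)))
    E-good a (yes pa) (no _)   = []
    E-good a (no _)   _        = []

    E-≡ : ∀ a pa? la? {w} → PackedOf n w → lc Oᶠ (expansion a pa? la?) w ≡ 𝟙 (eqW a w)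
    E-≡ a (yes pa) (yes la) {w} _ = proj₂ (proj₂ (span₁ _ (δ-Supp pa la))) w
    E-≡ a (yes pa) (no nl) {w} (pw , lw) = sym (cong 𝟙 (eqW-false {a} {w} (λ { refl → nl lw })))
    E-≡ a (no np)  _       {w} (pw , lw) = sym (cong 𝟙 (eqW-false {a} {w} (λ { refl → np pw })))

    E-coef : ∀ a pa? la? (x y : V) → (PackedOf n a → x a ≡ y a) →
             x a * Forests.coef (expansion a pa? la?) f ≡ y a * Forests.coef (expansion a pa? la?) f
    E-coef a (yes pa) (yes la) x y h = cong (_* Forests.coef (expansion a (yes pa) (yes la)) f) (h (pa , la))
    E-coef a (yes pa) (no _)   x y h = trans (ℚ.*-zeroʳ (x a)) (sym (ℚ.*-zeroʳ (y a)))
    E-coef a (no _)   _        x y h = trans (ℚ.*-zeroʳ (x a)) (sym (ℚ.*-zeroʳ (y a)))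

    W = packedWords n

    φ : V → ℚ
    φ x = ∑ W (λ a → x a * Forests.coef (E a) f)

    φ-linear : Linear (PackedOf n) φ
    φ-linear xs k F x h = begin
      ∑ W (λ a → x a * Forests.coef (E a) f)
        ≡⟨ ∑-cong W (λ a → E-coef a (packed? a) (length a ℕ.≟ n) x (λ w → ∑ xs (λ i → k i * F i w)) h) ⟩
      ∑ W (λ a → ∑ xs (λ i → k i * F i a) * Forests.coef (E a) f)
        ≡⟨ ∑-cong W (λ a → trans (sym (∑-*ʳ xs (Forests.coef (E a) f) _)) (∑-cong xs (λ i → ℚ.*-assoc (k i) (F i a) _))) ⟩
      ∑ W (λ a → ∑ xs (λ i → k i * (F i a * Forests.coef (E a) f)))
        ≡⟨ ∑-swap W xs _ ⟩
      ∑ xs (λ i → ∑ W (λ a → k i * (F i a * Forests.coef (E a) f)))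
        ≡⟨ ∑-cong xs (λ i → ∑-*ˡ W (k i) _) ⟩
      ∑ xs (λ i → k i * φ (F i)) ∎

    module _ (g : Forest) (gg : ForestOf n g) where

      scaled : Word → List (ℚ × Forest)
      scaled a = map (λ (c , h) → Oᶠ g a * c , h) (E a)

      relation : List (ℚ × Forest)
      -- Re-expanding `Oᶠ g` word by word gives `Oᶠ g` again, so this combination is zero. Its
      -- coefficient at `f` is `φ (Oᶠ g)` minus the Kronecker symbol.
      relation = (- 1ℚ , g) ∷ concatMap scaled W

      relation-good : All (ForestOf n ∘ proj₂) relation
      relation-good = gg ∷ All.concat⁺ (All.map⁺ (All.tabulate {xs = W} (λ {a} _ → All.map⁺ (E-good a (packed? a) (length a ℕ.≟ n)))))

      lc-scaled : ∀ w → PackedOf n w → lc Oᶠ (concatMap scaled W) w ≡ Oᶠ g w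
      lc-scaled w pw = begin
        lc Oᶠ (concatMap scaled W) w
          ≡⟨ ∑-concatMap scaled W _ ⟩
        ∑ W (λ a → lc Oᶠ (scaled a) w)
          ≡⟨ ∑-cong W (λ a → trans (∑-map _ (E a) _) (trans (∑-cong (E a) (λ (c , h) → ℚ.*-assoc (Oᶠ g a) c (Oᶠ h w))) (∑-*ˡ (E a) (Oᶠ g a) _))) ⟩
        ∑ W (λ a → Oᶠ g a * lc Oᶠ (E a) w)
          ≡⟨ ∑-cong W (λ a → trans (cong (Oᶠ g a *_) (E-≡ a (packed? a) (length a ℕ.≟ n) pw)) (ℚ.*-comm (Oᶠ g a) (𝟙 (eqW a w)))) ⟩
        ∑ W (λ a → 𝟙 (eqW a w) * Oᶠ g a)
          ≡⟨ ∑-packedWords-δ n (proj₁ pw) (proj₂ pw) (Oᶠ g) ⟩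
        Oᶠ g w ∎

      relation-zero : ∀ w → lc Oᶠ relation w ≡ 0ℚ
      relation-zero w = stable-0 λ nz → let pw = Supp-nonzero (Supp-lc Oᶠ (All.map forest-Supp relation-good)) nz in
        nz (trans (cong (- 1ℚ * Oᶠ g w +_) (lc-scaled w pw)) (solve 1 (λ x → :- con 1ℚ :* x :+ x := con 0ℚ) refl (Oᶠ g w)))
        where open +-*-Solver

      coef-scaled : Forests.coef (concatMap scaled W) f ≡ φ (Oᶠ g)
      coef-scaled = begin
        Forests.coef (concatMap scaled W) f
          ≡⟨ ∑-concatMap scaled W _ ⟩
        ∑ W (λ a → Forests.coef (scaled a) f)
          ≡⟨ ∑-cong W (λ a → trans (∑-map _ (E a) _) (trans (∑-cong (E a) (λ (c , h) → *-shift (𝟙 (does (h ≟ᶠ f))) (Oᶠ g a) c)) (∑-*ˡ (E a) (Oᶠ g a) _))) ⟩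
        φ (Oᶠ g) ∎

      φ-dual : φ (Oᶠ g) ≡ 𝟙 (does (g ≟ᶠ f))
      φ-dual = begin
        φ (Oᶠ g)
          ≡⟨ solve 2 (λ x d → x := d :+ (d :* (:- con 1ℚ) :+ x)) refl (φ (Oᶠ g)) (𝟙 (does (g ≟ᶠ f))) ⟩
        𝟙 (does (g ≟ᶠ f)) + (𝟙 (does (g ≟ᶠ f)) * - 1ℚ + φ (Oᶠ g))
          ≡⟨ cong (λ z → 𝟙 (does (g ≟ᶠ f)) + (𝟙 (does (g ≟ᶠ f)) * - 1ℚ + z)) coef-scaled ⟨
        𝟙 (does (g ≟ᶠ f)) + Forests.coef relation f
          ≡⟨ cong (𝟙 (does (g ≟ᶠ f)) +_) (indep relation relation-good relation-zero f gf) ⟩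
        𝟙 (does (g ≟ᶠ f)) + 0ℚ
          ≡⟨ ℚ.+-identityʳ _ ⟩
        𝟙 (does (g ≟ᶠ f)) ∎
        where open +-*-Solver

  makeDual : Dual n f
  makeDual = record { φ = φ ; linear = φ-linear ; dual = φ-dual }

-- This is `φ ⊗ χ` composed with the coproduct: `χ` evaluates the right factor of every slice and
-- `φ` the resulting function of the left factor. Only the component of bidegree `(j , k)` matters.
module TensorFunctional {j k} {φ χ : V → ℚ} (φ-linear : Linear (PackedOf j) φ) (χ-linear : Linear (PackedOf k) χ) (c : Side) where

  ⟨φ⊗χ⟩ : V → ℚ
  ⟨φ⊗χ⟩ x = φ (λ p → χ (Δ c x p))

  ⊗-linear : Linear Packed ⟨φ⊗χ⟩
  ⊗-linear xs m F x h = φ-linear xs m (λ i p → χ (Δ c (F i) p)) (λ p → χ (Δ c x p))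
    (λ {p} _ → χ-linear xs m (λ i → Δ c (F i) p) (Δ c x p) (λ {q} _ → Δ-linear c p q xs m F x h))

  ⊗-zero : ∀ x → (∀ {p q} → PackedOf j p → PackedOf k q → Δ c x p q ≡ 0ℚ) → ⟨φ⊗χ⟩ x ≡ 0ℚ
  ⊗-zero x h = linear-zero φ-linear _ (λ {p} pp → linear-zero χ-linear (Δ c x p) (λ pq → h pp pq))

  ⊗-product : ∀ x y z → (∀ {p q} → PackedOf j p → PackedOf k q → Δ c x p q ≡ y p * z q) → ⟨φ⊗χ⟩ x ≡ φ y * χ z
  ⊗-product x y z h = trans (linear-scale φ-linear (χ z) _ y (λ {p} pp →
      trans (linear-scale χ-linear (y p) (Δ c x p) z (λ pq → h pp pq)) (ℚ.*-comm (y p) (χ z))))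
    (ℚ.*-comm (χ z) (φ y))

PackedOf-≢[] : ∀ {n w} → 1 ≤ n → PackedOf n w → w ≢ []
PackedOf-≢[] 1≤n (_ , l) refl = ℕ.<⇒≱ 1≤n (ℕ.≤-reflexive (sym l))

-- Triangular functionals for forests

coreSize : Tree → ℕ
coreSize (node l _ rs) = size (node l [] rs)

-- The functionals constructed below are unitriangular with respect to this rank.
forestRank : Forest → ℕ
forestRank []          = 0
forestRank (t ∷ [])    = size t ℕ.+ coreSize t
forestRank (_ ∷ t ∷ f) = lastSize t f
  where
  lastSize : Tree → Forest → ℕ
  lastSize t []      = size t
  lastSize _ (u ∷ f) = lastSize u f

data ForestView : Forest → Set where
  empty  : ForestView []
  single : ∀ l ls rs → ForestView (node l ls rs ∷ [])
  many   : ∀ s f t → ForestView ((s ∷ f) ∷ʳ t)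

forestView : ∀ f → ForestView f
forestView f with initLast f
... | []                     = empty
... | [] ∷ʳ′ node l ls rs    = single l ls rs
... | (s ∷ f) ∷ʳ′ t          = many s f t

forestRank-many : ∀ s f t → forestRank ((s ∷ f) ∷ʳ t) ≡ size t
forestRank-many s []          t = refl
forestRank-many s (u ∷ [])    t = refl
forestRank-many s (u ∷ v ∷ f) t = forestRank-many u (v ∷ f) t

size-node : ∀ l ls rs → size (node l ls rs) ≡ sizeF ls ℕ.+ coreSize (node l ls rs)
size-node l ls rs = sym (ℕ.+-suc (sizeF ls) (sizeF rs))

sizeF≥1 : ∀ f → f ≢ [] → 1 ≤ sizeF f
sizeF≥1 []      ne = ⊥-elim (ne refl)
sizeF≥1 (t ∷ f) ne = ℕ.≤-trans (size≥1 t) (ℕ.m≤m+n _ _)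

-- A forest of size `n` with several trees has the size of its last tree as rank, which is less than
-- `n`; a single tree has rank `n` plus the size of its core. So functionals of longer forests must
-- also be controlled on single trees, where primitivity makes them vanish, while those of single
-- trees are compared with single trees only.
module Functionals (n : ℕ) (duals : ∀ m → 1 ≤ m → m < n → ∀ f → ForestOf m f → Dual m f) where

  Functional : Forest → Set₁
  Functional a = Σ (V → ℚ) λ θ → Linear Packed θ ×
    (∀ b → ForestOf n b → forestRank a ≤ forestRank b → θ (Oᶠ b) ≡ 𝟙 (does (b ≟ᶠ a)))

  private
    not-equal : ∀ {a b} → b ≢ a → 0ℚ ≡ 𝟙 (does (b ≟ᶠ a))
    not-equal {a} {b} ne = sym (Forests.δ-≢ {b} {a} ne)

    rank-many-< : ∀ s f t → ForestOf n ((s ∷ f) ∷ʳ t) → size t < n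
    rank-many-< s f t (_ , e) = subst (size t <_) (trans (sym (sizeF-∷ʳ (s ∷ f) t)) e) (ℕ.m<n+m (size t) (sizeF≥1 (s ∷ f) (λ ())))

    -- The duals of the front forest and of the last tree are applied to the two tensor factors. A
    -- forest with a larger last tree has no component in this bidegree, and one with a last tree of
    -- equal size has a single tensor there.
    module Many (s : Tree) (f : Forest) (t : Tree) (g : ForestOf n ((s ∷ f) ∷ʳ t)) where
      a : Forest
      a = (s ∷ f) ∷ʳ t
      j = sizeF (s ∷ f)
      k = size t
      j+k : j ℕ.+ k ≡ n
      j+k = trans (sym (sizeF-∷ʳ (s ∷ f) t)) (proj₂ g)
      bluepacked = BluePackedF-++⁻ (s ∷ f) (t ∷ []) (proj₁ g)
      1≤j = sizeF≥1 (s ∷ f) (λ ())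
      1≤k = size≥1 t
      module φ = Dual (duals j 1≤j (subst (j <_) j+k (ℕ.m<m+n j 1≤k)) (s ∷ f) (proj₁ bluepacked , refl))
      module χ = Dual (duals k 1≤k (subst (k <_) j+k (ℕ.m<n+m k 1≤j)) (t ∷ []) (proj₂ bluepacked , ℕ.+-identityʳ (size t)))
      open TensorFunctional φ.linear χ.linear all

      on-many : ∀ s′ f′ t′ → ForestOf n ((s′ ∷ f′) ∷ʳ t′) → k ≤ size t′ →
                ⟨φ⊗χ⟩ (Oᶠ ((s′ ∷ f′) ∷ʳ t′)) ≡ 𝟙 (does (((s′ ∷ f′) ∷ʳ t′) ≟ᶠ a))
      on-many s′ f′ t′ g′ le = cases (ℕ.m≤n⇒m<n∨m≡n le)
        where
        b : Forest
        b = (s′ ∷ f′) ∷ʳ t′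
        bp = BluePackedF-++⁻ (s′ ∷ f′) (t′ ∷ []) (proj₁ g′)
        gt′ : TreeOf (size t′) t′
        gt′ = proj₁ (proj₂ bp) , refl
        cases : k < size t′ ⊎ k ≡ size t′ → ⟨φ⊗χ⟩ (Oᶠ b) ≡ 𝟙 (does (b ≟ᶠ a))
        cases (inj₁ l) = trans
          (⊗-zero (Oᶠ b) (λ pp pq → ForestLeading.forest-short (proj₁ bp) gt′ (proj₁ pp) (proj₁ pq)
             (PackedOf-≢[] 1≤j pp) (PackedOf-≢[] 1≤k pq) (subst (_< size t′) (sym (proj₂ pq)) l)))
          (not-equal {a} {b} (λ e → ℕ.<⇒≢ l (cong size (sym (proj₂ (List.∷ʳ-injective (s′ ∷ f′) (s ∷ f) e))))))
        cases (inj₂ e) = begin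
          ⟨φ⊗χ⟩ (Oᶠ b)
            ≡⟨ ⊗-product (Oᶠ b) (Oᶠ (s′ ∷ f′)) (Oᵗ t′) (λ pp pq → ForestLeading.forest-leading (proj₁ bp) gt′ (proj₁ pp) (proj₁ pq)
                 (PackedOf-≢[] 1≤k pq) (trans (proj₂ pq) e)) ⟩
          φ.φ (Oᶠ (s′ ∷ f′)) * χ.φ (Oᵗ t′)
            ≡⟨ cong₂ _*_ (φ.dual (s′ ∷ f′) (proj₁ bp , size-f′)) (χ.dual (t′ ∷ []) (proj₂ bp , trans (ℕ.+-identityʳ (size t′)) (sym e))) ⟩
          𝟙 (does ((s′ ∷ f′) ≟ᶠ (s ∷ f))) * 𝟙 (does ((t′ ∷ []) ≟ᶠ (t ∷ [])))
            ≡⟨ 𝟙-does-× ((s′ ∷ f′) ≟ᶠ (s ∷ f)) ((t′ ∷ []) ≟ᶠ (t ∷ [])) (b ≟ᶠ a) (λ p q → cong₂ _++_ p q)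
                 (λ r → let (p , q) = List.∷ʳ-injective (s′ ∷ f′) (s ∷ f) r in p , cong (_∷ []) q) ⟩
          𝟙 (does (b ≟ᶠ a)) ∎
          where
          size-f′ : sizeF (s′ ∷ f′) ≡ j
          size-f′ = ℕ.+-cancelʳ-≡ (size t′) _ _ (trans (sym (sizeF-∷ʳ (s′ ∷ f′) t′)) (trans (proj₂ g′) (trans (sym j+k) (cong (j ℕ.+_) e))))

      functional : Functional a
      functional = ⟨φ⊗χ⟩ , ⊗-linear , triangular
        where
        triangular : ∀ b → ForestOf n b → forestRank a ≤ forestRank b → ⟨φ⊗χ⟩ (Oᶠ b) ≡ 𝟙 (does (b ≟ᶠ a))
        triangular b g′ le with forestView b
        ... | empty = ⊥-elim (ℕ.<⇒≢ (ℕ.≤-trans 1≤j (subst (j ≤_) j+k (ℕ.m≤m+n j k))) (proj₂ g′))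
        ... | single l ls rs = trans
              (⊗-zero (Oᵗ (node l ls rs)) (λ pp pq → tree-primitive (proj₁ (proj₁ g′) , refl) (proj₁ pp) (proj₁ pq) (PackedOf-≢[] 1≤j pp) (PackedOf-≢[] 1≤k pq)))
              (not-equal {a} {node l ls rs ∷ []} (λ e → case List.∷-injectiveʳ e of λ e′ → ∷ʳ-≢[] f (sym e′)))
        ... | many s′ f′ t′ = on-many s′ f′ t′ g′ (subst₂ _≤_ (forestRank-many s f t) (forestRank-many s′ f′ t′) le)

    single-rank : ∀ l ls rs → ForestOf n (node l ls rs ∷ []) → size (node l ls rs) ≡ n
    single-rank l ls rs (_ , e) = trans (sym (ℕ.+-identityʳ _)) e

    -- A forest of rank at least n is a single tree.
    on-single : ∀ {r} (θ : V → ℚ) a → n ℕ.+ r ≡ forestRank a →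
                (∀ l ls rs → BluePacked (node l ls rs) → size (node l ls rs) ≡ n → r ≤ coreSize (node l ls rs) →
                   θ (Oᵗ (node l ls rs)) ≡ 𝟙 (does ((node l ls rs ∷ []) ≟ᶠ a))) →
                1 ≤ n → ∀ b → ForestOf n b → forestRank a ≤ forestRank b → θ (Oᶠ b) ≡ 𝟙 (does (b ≟ᶠ a))
    on-single {r} θ a ra h 1≤n b g le with forestView b
    ... | empty = ⊥-elim (ℕ.<⇒≢ 1≤n (proj₂ g))
    ... | single l ls rs = h l ls rs (proj₁ (proj₁ g)) sz
            (ℕ.+-cancelˡ-≤ n r _ (subst₂ _≤_ (sym ra) (cong (ℕ._+ coreSize (node l ls rs)) sz) le))
      where sz = single-rank l ls rs g
    ... | many s f t = ⊥-elim (ℕ.<⇒≱ (rank-many-< s f t g)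
            (ℕ.≤-trans (ℕ.m≤m+n n r) (subst₂ _≤_ (sym ra) (forestRank-many s f t) le)))

    -- The analogue with Δ≻: the leading tensor of a tree consists of its left forest, reversed, and
    -- of its core, so the two duals recover both. A larger core gives zero.
    module Grafted (l : Label) (ls rs : Forest) (ls≢[] : ls ≢ []) (g : ForestOf n (node l ls rs ∷ [])) where
      a : Forest
      a = node l ls rs ∷ []
      j = sizeF (reverse ls)
      core = node l [] rs
      k = size core
      bt = proj₁ (proj₁ g)
      sz = single-rank l ls rs g
      j+k : j ℕ.+ k ≡ n
      j+k = trans (cong (ℕ._+ k) (sizeF-reverse ls)) (trans (sym (size-node l ls rs)) sz)
      1≤j : 1 ≤ j
      1≤j = subst (1 ≤_) (sym (sizeF-reverse ls)) (sizeF≥1 ls ls≢[])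
      1≤k = size≥1 core
      core-good : ForestOf k (core ∷ [])
      core-good = ((tt , proj₂ bt) , tt) , ℕ.+-identityʳ k
      module φ = Dual (duals j 1≤j (subst (j <_) j+k (ℕ.m<m+n j 1≤k)) (reverse ls) (BluePackedF-reverse ls (proj₁ bt) , refl))
      module χ = Dual (duals k 1≤k (subst (k <_) j+k (ℕ.m<n+m k 1≤j)) (core ∷ []) core-good)
      open TensorFunctional φ.linear χ.linear right

      on-tree : ∀ l′ ls′ rs′ → BluePacked (node l′ ls′ rs′) → size (node l′ ls′ rs′) ≡ n → k ≤ coreSize (node l′ ls′ rs′) →
                ⟨φ⊗χ⟩ (Oᵗ (node l′ ls′ rs′)) ≡ 𝟙 (does ((node l′ ls′ rs′ ∷ []) ≟ᶠ a))
      on-tree l′ ls′ rs′ b sz′ le = cases (ℕ.m≤n⇒m<n∨m≡n le)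
        where
        k′ = coreSize (node l′ ls′ rs′)
        cases : k < k′ ⊎ k ≡ k′ → ⟨φ⊗χ⟩ (Oᵗ (node l′ ls′ rs′)) ≡ 𝟙 (does ((node l′ ls′ rs′ ∷ []) ≟ᶠ a))
        cases (inj₁ l<) = trans
          (⊗-zero (Oᵗ (node l′ ls′ rs′)) (λ pp pq → TreeLeading.tree-short {ls = ls′} b refl (proj₁ pp) (proj₁ pq)
             (PackedOf-≢[] 1≤j pp) (PackedOf-≢[] 1≤k pq) (subst (_< k′) (sym (proj₂ pq)) l<)))
          (not-equal {a} {node l′ ls′ rs′ ∷ []} (λ { refl → ℕ.<-irrefl refl l< }))
        cases (inj₂ e) = begin
          ⟨φ⊗χ⟩ (Oᵗ (node l′ ls′ rs′))
            ≡⟨ ⊗-product (Oᵗ (node l′ ls′ rs′)) (Oᶠ (reverse ls′)) (Oᵗ (node l′ [] rs′))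
                 (λ pp pq → TreeLeading.tree-leading {ls = ls′} b refl (proj₁ pp) (proj₁ pq) (PackedOf-≢[] 1≤k pq) (trans (proj₂ pq) e)) ⟩
          φ.φ (Oᶠ (reverse ls′)) * χ.φ (Oᵗ (node l′ [] rs′))
            ≡⟨ cong₂ _*_ (φ.dual (reverse ls′) (BluePackedF-reverse ls′ (proj₁ b) , size-ls′))
                         (χ.dual (node l′ [] rs′ ∷ []) (((tt , proj₂ b) , tt) , trans (ℕ.+-identityʳ k′) (sym e))) ⟩
          𝟙 (does (reverse ls′ ≟ᶠ reverse ls)) * 𝟙 (does ((node l′ [] rs′ ∷ []) ≟ᶠ (core ∷ [])))
            ≡⟨ 𝟙-does-× (reverse ls′ ≟ᶠ reverse ls) ((node l′ [] rs′ ∷ []) ≟ᶠ (core ∷ [])) ((node l′ ls′ rs′ ∷ []) ≟ᶠ a)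
                 (λ p q → assemble (List.reverse-injective p) q) (λ { refl → refl , refl }) ⟩
          𝟙 (does ((node l′ ls′ rs′ ∷ []) ≟ᶠ a)) ∎
          where
          size-ls′ : sizeF (reverse ls′) ≡ j
          size-ls′ = ℕ.+-cancelʳ-≡ k′ _ _ (trans (cong (ℕ._+ k′) (sizeF-reverse ls′))
            (trans (sym (size-node l′ ls′ rs′)) (trans sz′ (trans (sym j+k) (cong (j ℕ.+_) e)))))
          assemble : ls′ ≡ ls → node l′ [] rs′ ∷ [] ≡ core ∷ [] → node l′ ls′ rs′ ∷ [] ≡ a
          assemble refl refl = refl

      functional : 1 ≤ n → Functional a
      functional 1≤n = ⟨φ⊗χ⟩ , ⊗-linear , on-single {k} ⟨φ⊗χ⟩ a (cong (ℕ._+ k) (sym sz)) on-tree 1≤n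

    no-left : ∀ l ls rs → size (node l ls rs) ≡ n → n ≤ coreSize (node l ls rs) → ls ≡ []
    no-left l []       rs e le = refl
    no-left l (t ∷ ls) rs e le = ⊥-elim (ℕ.<⇒≱ (ℕ.m<n+m (coreSize (node l (t ∷ ls) rs)) (sizeF≥1 (t ∷ ls) (λ ())))
      (subst (_≤ coreSize (node l (t ∷ ls) rs)) (trans (sym e) (size-node l (t ∷ ls) rs)) le))

    -- No coproduct is available for a totally primitive element. The functional strips the last
    -- letter with label `l` and applies the dual of the child `r`, which lives in degree `n - 1`.
    module Core (l : Label) (r : Tree) (g : ForestOf n (node l [] (r ∷ []) ∷ [])) where
      a : Forest
      a = node l [] (r ∷ []) ∷ []
      m = size r
      br = proj₁ (proj₁ (proj₂ (proj₁ (proj₁ g))))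
      sz = single-rank l [] (r ∷ []) g
      1≤m = size≥1 r
      n≡ : suc m ≡ n
      n≡ = trans (cong suc (sym (ℕ.+-identityʳ m))) sz
      module φ = Dual (duals m 1≤m (ℕ.≤-reflexive n≡) (r ∷ []) ((br , tt) , ℕ.+-identityʳ m))
      1≤l : 1 ≤ proj₁ l
      1≤l = proj₁ (proj₂ (proj₂ (proj₂ (proj₁ (proj₁ g)))))

      -- Words w with max w < i may have ψ l w packed with another label; the indicator discards them.
      strip′ : V → V
      strip′ x w = 𝟙 (proj₁ l ≤ᵇ maxW w) * x (ψ l w)

      θ : V → ℚ
      θ x = φ.φ (strip′ x)

      θ-linear : Linear Packed θ
      θ-linear xs k F x h = φ.linear xs k (λ i → strip′ (F i)) (strip′ x) (λ {w} pw → expand w (proj₁ pw))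
        where
        expand : ∀ w → Packed w → strip′ x w ≡ ∑ xs (λ i → k i * strip′ (F i) w)
        expand w pw = begin
          𝟙 (proj₁ l ≤ᵇ maxW w) * x (ψ l w)
            ≡⟨ 𝟙-cong-* (proj₁ l ≤ᵇ maxW w) (λ e → h (ψ-packed l pw (Valid-≤ l 1≤l (≤ᵇ-sound {proj₁ l} {maxW w} e)))) ⟩
          𝟙 (proj₁ l ≤ᵇ maxW w) * ∑ xs (λ i → k i * F i (ψ l w))
            ≡⟨ ∑-*ˡ xs (𝟙 (proj₁ l ≤ᵇ maxW w)) _ ⟨
          ∑ xs (λ i → 𝟙 (proj₁ l ≤ᵇ maxW w) * (k i * F i (ψ l w)))
            ≡⟨ ∑-cong xs (λ i → *-shift (𝟙 (proj₁ l ≤ᵇ maxW w)) (k i) (F i (ψ l w))) ⟩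
          ∑ xs (λ i → k i * strip′ (F i) w) ∎

      on-core : ∀ l′ r′ → BluePacked (node l′ [] (r′ ∷ [])) → size (node l′ [] (r′ ∷ [])) ≡ n →
                θ (Oᵗ (node l′ [] (r′ ∷ []))) ≡ 𝟙 (does ((node l′ [] (r′ ∷ []) ∷ []) ≟ᶠ a))
      on-core l′ r′ (_ , (br′ , _) , _ , _ , l′≤) sz′ = begin
        θ (Oᵗ (node l′ [] (r′ ∷ [])))
          ≡⟨ linear-scale φ.linear (𝟙 (does (l′ ≟ˡ l))) (strip′ (Oᵗ (node l′ [] (r′ ∷ [])))) (Oᵗ r′) (λ {w} pw → at w (proj₁ pw) (proj₁ l ℕ.≤? maxW w)) ⟩
        𝟙 (does (l′ ≟ˡ l)) * φ.φ (Oᵗ r′)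
          ≡⟨ cong (𝟙 (does (l′ ≟ˡ l)) *_) (φ.dual (r′ ∷ []) ((br′ , tt) , ℕ.suc-injective (trans sz′ (sym n≡)))) ⟩
        𝟙 (does (l′ ≟ˡ l)) * 𝟙 (does ((r′ ∷ []) ≟ᶠ (r ∷ [])))
          ≡⟨ 𝟙-does-× (l′ ≟ˡ l) ((r′ ∷ []) ≟ᶠ (r ∷ [])) ((node l′ [] (r′ ∷ []) ∷ []) ≟ᶠ a) (λ { refl refl → refl }) (λ { refl → refl , refl }) ⟩
        𝟙 (does ((node l′ [] (r′ ∷ []) ∷ []) ≟ᶠ a)) ∎
        where
        hom = TreeFacts.hom (treeFacts r′ br′)
        at : ∀ w → Packed w → Dec (proj₁ l ≤ maxW w) →
             strip′ (Oᵗ (node l′ [] (r′ ∷ []))) w ≡ 𝟙 (does (l′ ≟ˡ l)) * Oᵗ r′ w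
        at w pw (yes le) = trans (𝟙-true (Oᵗ (node l′ [] (r′ ∷ [])) (ψ l w)) (≤ᵇ-true le))
          (coeff-Ψ (OT r′) (Hom-packedSupport hom) l′ l pw (Valid-≤ l 1≤l le))
        -- A nonzero right side would mean equal labels and `maxW w` equal to the weight of `r′`;
        -- the root condition of the second tree would then bound the letter of `l` by `maxW w`.
        at w pw (no ¬le) = trans (𝟙-false (Oᵗ (node l′ [] (r′ ∷ [])) (ψ l w)) (≤ᵇ-false (ℕ.≰⇒> ¬le)))
          (sym (stable-0 (λ nz → ¬le (subst₂ _≤_ (cong proj₁ (Labels.δ-nonzero {l′} {l} (*-nonzeroˡ (𝟙 (does (l′ ≟ˡ l))) (Oᵗ r′ w) nz)))
            (sym (proj₂ (proj₂ (hom (*-nonzeroʳ (𝟙 (does (l′ ≟ˡ l))) (Oᵗ r′ w) nz))))) l′≤))))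

      on-tree : ∀ l′ ls′ rs′ → BluePacked (node l′ ls′ rs′) → size (node l′ ls′ rs′) ≡ n → n ≤ coreSize (node l′ ls′ rs′) →
                θ (Oᵗ (node l′ ls′ rs′)) ≡ 𝟙 (does ((node l′ ls′ rs′ ∷ []) ≟ᶠ a))
      on-tree l′ ls′ rs′ b sz′ le = cases ls′ rs′ (no-left l′ ls′ rs′ sz′ le) b sz′
        where
        cases : ∀ ls′ rs′ → ls′ ≡ [] → BluePacked (node l′ ls′ rs′) → size (node l′ ls′ rs′) ≡ n →
                θ (Oᵗ (node l′ ls′ rs′)) ≡ 𝟙 (does ((node l′ ls′ rs′ ∷ []) ≟ᶠ a))
        cases [] []         _ b e = ⊥-elim (ℕ.<⇒≢ (s≤s 1≤m) (trans e (sym n≡)))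
        cases [] (r′ ∷ [])  _ b e = on-core l′ r′ b e
        cases [] (_ ∷ _ ∷ _) _ (_ , _ , ()) e

      functional : 1 ≤ n → Functional a
      functional 1≤n = θ , θ-linear , on-single {n} θ a (cong₂ ℕ._+_ (sym sz) (sym sz)) on-tree 1≤n

    module Leaf (g : ForestOf n (leaf ∷ [])) where
      θ : V → ℚ
      θ x = x (1 ∷ [])

      θ-linear : Linear Packed θ
      θ-linear xs k F x h = h ((s≤s z≤n ∷ []) , λ { (suc zero) _ _ → here refl ; (suc (suc j)) _ (s≤s ()) })

      on-tree : ∀ l ls rs → BluePacked (node l ls rs) → size (node l ls rs) ≡ n → n ≤ coreSize (node l ls rs) →
                θ (Oᵗ (node l ls rs)) ≡ 𝟙 (does ((node l ls rs ∷ []) ≟ᶠ (leaf ∷ [])))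
      on-tree l ls rs b sz le = cases ls rs (no-left l ls rs sz le) b (trans sz (sym (proj₂ g)))
        where
        cases : ∀ ls rs → ls ≡ [] → BluePacked (node l ls rs) → size (node l ls rs) ≡ 1 →
                θ (Oᵗ (node l ls rs)) ≡ 𝟙 (does ((node l ls rs ∷ []) ≟ᶠ (leaf ∷ [])))
        cases [] []      _ (_ , _ , refl) _ = trans (Oᵗ-leaf (1 ∷ [])) (sym (Forests.δ-refl (leaf ∷ [])))
        cases [] (r ∷ _) _ _ e = ⊥-elim (ℕ.<⇒≢ (ℕ.≤-trans (size≥1 r) (ℕ.m≤m+n _ _)) (sym (ℕ.suc-injective e)))

      functional : 1 ≤ n → Functional (leaf ∷ [])
      functional 1≤n = θ , θ-linear , on-single {n} θ (leaf ∷ []) (cong₂ ℕ._+_ (sym (proj₂ g)) (sym (proj₂ g))) on-tree 1≤n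

  functional : 1 ≤ n → ∀ a → ForestOf n a → Functional a
  functional 1≤n a g with forestView a
  ... | empty = ⊥-elim (ℕ.<⇒≢ 1≤n (proj₂ g))
  ... | many s f t = Many.functional s f t g
  ... | single l (u ∷ ls) rs = Grafted.functional l (u ∷ ls) rs (λ ()) g 1≤n
  ... | single l [] (r ∷ []) = Core.functional l r g 1≤n
  functional 1≤n a ((( _ , _ , ()) , _) , _) | single l [] (_ ∷ _ ∷ _)
  functional 1≤n a g@(((_ , _ , refl) , _) , _) | single _ [] [] = Leaf.functional g 1≤n

record Independence (n : ℕ) : Set₁ where
  field
    independent : Independent n
    dual        : ∀ f → ForestOf n f → Dual n f

-- Independence in degree `n` consumes duals of smaller degrees only; spanning in degree `n` then
-- turns it into duals of that degree for the next steps.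
independence : ∀ n → 1 ≤ n → Independence n
independence = <-rec (λ n → 1 ≤ n → Independence n) step
  where
  step : ∀ n → (∀ {m} → m < n → 1 ≤ m → Independence m) → 1 ≤ n → Independence n
  step n rec 1≤n = record { independent = indep ; dual = MakeDual.makeDual n (Spans.span₁ (spans n 1≤n)) indep }
    where
    indep : Independent n
    indep = Triangular.independent _≟ᶠ_ forestRank
      (Functionals.functional n (λ m 1≤m m<n → Independence.dual (rec m<n 1≤m)) 1≤n)

-- The three bases

InWQSym⇒Supp : ∀ {n} x → InWQSym n x → Supp n (coeff x)
InWQSym⇒Supp x h = (λ {w} np → stable-0 (λ nz → np (proj₁ (h w nz)))) , (λ {w} nl → stable-0 (λ nz → nl (proj₂ (h w nz))))

Span⇒lincomb : ∀ {A : Set} {Good : A → Set} (O : A → LC) x → Span Good (λ a → coeff (O a)) (coeff x) →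
               Σ (List (ℚ × A)) λ cs → All (λ p → Good (proj₂ p)) cs × lincomb O cs ≈ x
Span⇒lincomb O x (cs , good , e) = cs , good , λ w → trans (coeff-lincomb O cs w) (e w)

forest-independent : ∀ n → 1 ≤ n → ∀ (cs : List (ℚ × Forest)) → All (λ p → ForestOf n (proj₂ p)) cs → Unique (map proj₂ cs) →
                     lincomb OF cs ≈ [] → All (λ p → proj₁ p ≡ 0ℚ) cs
forest-independent n 1≤n cs good uniq e = Forests.coef-Unique cs uniq λ f f∈ → case ∈.∈-map⁻ proj₂ f∈ of λ
  { (p , p∈ , refl) → Independence.independent (independence n 1≤n) cs good
      (λ w → trans (sym (coeff-lincomb OF cs w)) (e w)) (proj₂ p) (All.lookup good p∈) }

-- A forest with one tree has the same element as the tree, so the trees form a subfamily of the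
-- independent family of forests.
tree-independent : ∀ n → 1 ≤ n → ∀ (cs : List (ℚ × Tree)) → All (λ p → TreeOf n (proj₂ p)) cs → Unique (map proj₂ cs) →
                   lincomb OT cs ≈ [] → All (λ p → proj₁ p ≡ 0ℚ) cs
tree-independent n 1≤n cs good uniq e = All.map⁻ (forest-independent n 1≤n (map plant cs)
  (All.map⁺ (All.map (λ {(_ , t)} (b , s) → (b , tt) , trans (ℕ.+-identityʳ (size t)) s) good))
  (subst Unique (trans (sym (List.map-∘ cs)) (List.map-∘ cs)) (Unique.map⁺ List.∷-injectiveˡ uniq))
  (λ w → trans (coeff-lincomb OF (map plant cs) w) (trans (∑-map plant cs _) (trans (sym (coeff-lincomb OT cs w)) (e w)))))
  where
  plant : ℚ × Tree → ℚ × Forest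
  plant (c , t) = c , t ∷ []

forestBasis : ∀ n → 1 ≤ n → IsBasisOf (ForestOf n) OF (InWQSym n)
forestBasis n 1≤n = (λ f g w nz → Supp-nonzero (forest-Supp g) nz) , forest-independent n 1≤n ,
  λ x h → Span⇒lincomb OF x (Spans.span₁ (spans n 1≤n) (coeff x) (InWQSym⇒Supp x h))

tree-InWQSym : ∀ {n t} → TreeOf n t → InWQSym n (OT t)
tree-InWQSym g w nz = Supp-nonzero (tree-Supp g) nz

treeBasis : ∀ n → 1 ≤ n → IsBasisOf (TreeOf n) OT (Prim n)
treeBasis n 1≤n =
  (λ t g → tree-InWQSym g , primitive⇒IsZero2 (OT t) (proj₁ (tree-Supp g)) (tree-primitive g)) ,
  tree-independent n 1≤n ,
  λ x (h , z) → let s = InWQSym⇒Supp x h in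
    Span⇒lincomb OT x (Spans.span₂ (spans n 1≤n) (coeff x) s (IsZero2⇒primitive x (proj₁ s) z))

coreBasis : ∀ n → 1 ≤ n → IsBasisOf (CoreOf n) OT (TPrim n)
coreBasis n 1≤n =
  member ,
  (λ cs good → tree-independent n 1≤n cs (All.map (λ (b , s , _) → b , s) good)) ,
  λ x (h , zl , zr) → let s = InWQSym⇒Supp x h in
    Span⇒lincomb OT x (Spans.span₃ (spans n 1≤n) (coeff x) s
      (IsZero2⇒Vanishes x (proj₁ s) left (λ ()) zl) (IsZero2⇒Vanishes x (proj₁ s) right (λ ()) zr))
  where
  member : ∀ t → CoreOf n t → TPrim n (OT t)
  member (node l [] rs) (b , s , refl) = tree-InWQSym g ,
      Vanishes⇒IsZero2 (OT t) supp left (λ ()) (CoreFacts.vanishes-left core) ,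
      Vanishes⇒IsZero2 (OT t) supp right (λ ()) (CoreFacts.vanishes-right core)
    where
    t = node l [] rs
    g : TreeOf n t
    g = b , s
    supp = proj₁ (tree-Supp g)
    core = coreFacts-node l [] rs b

mainTheorem4 : ∀ (n : ℕ) → 1 ≤ n →
    IsBasisOf (λ f → BluePackedF f × sizeF f ≡ n) OF (InWQSym n)
    × IsBasisOf (λ t → BluePacked t × size t ≡ n) OT (Prim n)
    × IsBasisOf (λ t → BluePacked t × size t ≡ n × leftForest t ≡ []) OT (TPrim n)
mainTheorem4 n 1≤n = forestBasis n 1≤n , treeBasis n 1≤n , coreBasis n 1≤n
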